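{- Let $k,\ell\ge1$, $\mu\in\mathrm{Par}^k_\ell$ and $m=\max(|\mu|-k,0)$. Then $$s^{(k)}_\mu=\sum_{T\in\mathrm{VSMT}^{k+m}_{(\ell^m)}(\mu+m^\ell)}t^{\mathrm{spin}(T)}\,s_{\mathrm{inside}(T)},$$ where $\ell^m=(\ell,\dots,\ell)$ ($m$ entries), $m^\ell=(m,\dots,m)\in\mathbb Z^\ell$, and $s_\nu$ is the Schur function.
   Context: $\mathrm{Par}^k_\ell=\{\mu\in\mathbb Z^\ell:k\ge\mu_1\ge\dots\ge\mu_\ell\ge0\}$; $\mathrm{Par}^k$ is the set of partitions with largest part $\le k$; partitions are identified with themselves padded by zeros. Hook length of a box (English notation): number of boxes below it in its column plus those weakly to its right in its row. For $K\ge1$, a $(K+1)$-core is a partition with no box of hook length $K+1$; $\mathfrak p(\kappa)$ has $r$-th part equal to the number of boxes in row $r$ of $\kappa$ with hook length $\le K$, a bijection from $(K+1)$-cores to $\mathrm{Par}^K$. A strong cover $\tau\Rightarrow\kappa$: $(K+1)$-cores with $\tau\subset\kappa$, $|\mathfrak p(\tau)|+1=|\mathfrak p(\kappa)|$; a strong marked cover $\tau\xRightarrow{r}\kappa$ adds a positive integer $r$ equal to the smallest row index of some connected component of $\kappa/\tau$; its spin is $c(h-1)+N$ with $c$ the number of components of $\kappa/\tau$, $h$ the common number of rows of each component, $N$ the number of components entirely in rows $>r$. For $\eta\in\mathbb Z^\infty_{\ge0}$, $M=|\eta|<\infty$, a strong marked tableau (resp. vertical strong marked tableau) of weight $\eta$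 is a chain $T=(\kappa^{(0)}\xRightarrow{r_1}\cdots\xRightarrow{r_M}\kappa^{(M)})$ of strong marked covers with $r_{v_i+1}\ge\dots\ge r_{v_i+\eta_i}$ (resp. $r_{v_i+1}<\dots<r_{v_i+\eta_i}$) for all $i$, where $v_i=\eta_1+\dots+\eta_{i-1}$; $\mathrm{spin}(T)$ is the sum of spins, $\mathrm{inside}(T)=\mathfrak p(\kappa^{(0)})$; $\mathrm{SMT}^K_\eta(\mu)$ (resp. $\mathrm{VSMT}^K_\eta(\mu)$) is the set of those with $\mathfrak p(\kappa^{(M)})=\mu$. The $k$-Schur function is $s^{(k)}_\mu(x;t)=\sum_{\eta\in\mathbb Z^\infty_{\ge0},\,|\eta|=|\mu|}\sum_{T\in\mathrm{SMT}^k_\eta(\mu)}t^{\mathrm{spin}(T)}x^\eta$. -}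

module Defs where

open import Data.Nat using (ℕ; zero; suc; _+_; _*_; _∸_; _≤_; _<_; _≥_; _≤?_; _<?_; _≟_)
open import Data.Nat.ListAction using (sum)
open import Data.List using (List; []; _∷_; length; map; filter; upTo; applyUpTo; take; drop; replicate)
open import Data.List.Relation.Unary.All using (All)
open import Data.List.Relation.Unary.Linked using (Linked)
open import Data.List.Relation.Unary.Unique.Propositional using (Unique)
open import Data.List.Membership.Propositional using (_∈_)
open import Data.Product using (Σ; ∃; _×_; _,_; proj₁; proj₂)
open import Data.Sum using (_⊎_)
open import Relation.Binary.PropositionalEquality using (_≡_; _≢_)
open import Relation.Binary.Construct.Closure.ReflexiveTransitive using (Star)

record Count {A : Set} (P : A → Set) (n : ℕ) : Set where
  field
    elems    : List A
    sound    : All P elems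
    complete : ∀ a → P a → a ∈ elems
    unique   : Unique elems
    size     : length elems ≡ n

-- Partitions as lists of parts; `part λ i` is the (i+1)-st part
-- (rows are 0-based internally), 0 beyond the end (padding by zeros).

part : List ℕ → ℕ → ℕ
part []       _       = 0
part (x ∷ _)  zero    = x
part (_ ∷ xs) (suc i) = part xs i

-- remove trailing zeros: identifies a partition with its zero paddings
trim : List ℕ → List ℕ
trim []       = []
trim (x ∷ xs) = cons x (trim xs)
  where
  cons : ℕ → List ℕ → List ℕ
  cons zero [] = []
  cons y    ys = y ∷ ys

IsPartition : List ℕ → Set
IsPartition λ' = (∀ i → part λ' (suc i) ≤ part λ' i) × All (1 ≤_) λ'

ParKL : ℕ → ℕ → List ℕ → Set
ParKL k ℓ μ = (length μ ≡ ℓ) × (∀ i → part μ (suc i) ≤ part μ i) × All (_≤ k) μ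

-- Boxes (i , j): row i, column j, both 0-based, English notation.

Box : Set
Box = ℕ × ℕ

colLen : List ℕ → ℕ → ℕ
colLen λ' j = length (filter (j <?_) λ')

hook : List ℕ → ℕ → ℕ → ℕ
hook λ' i j = (colLen λ' j ∸ suc i) + (part λ' i ∸ j)

IsCore : ℕ → List ℕ → Set
IsCore K κ = IsPartition κ × (∀ i j → j < part κ i → hook κ i j ≢ suc K)

pmap : ℕ → List ℕ → List ℕ
pmap K κ = applyUpTo (λ i → length (filter (λ j → hook κ i j ≤? K) (upTo (part κ i)))) (length κ)

StrongCover : ℕ → List ℕ → List ℕ → Set
StrongCover K τ κ =
  IsCore K τ × IsCore K κ × (∀ i → part τ i ≤ part κ i) × (sum (pmap K τ) + 1 ≡ sum (pmap K κ))

Skew : List ℕ → List ℕ → Box → Set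
Skew τ κ (i , j) = (part τ i ≤ j) × (j < part κ i)

Adj : Box → Box → Set
Adj (i , j) (i' , j') =
  ((i ≡ i') × ((suc j ≡ j') ⊎ (j ≡ suc j'))) ⊎ ((j ≡ j') × ((suc i ≡ i') ⊎ (i ≡ suc i')))

SAdj : List ℕ → List ℕ → Box → Box → Set
SAdj τ κ a b = Skew τ κ a × Skew τ κ b × Adj a b

Conn : List ℕ → List ℕ → Box → Box → Set
Conn τ κ = Star (SAdj τ κ)

_≤lex_ : Box → Box → Set
(i , j) ≤lex (i' , j') = (i < i') ⊎ ((i ≡ i') × (j ≤ j'))

-- b is the (lexicographically least) representative of its component;
-- components of κ/τ correspond bijectively to such b, and the smallest
-- row index of the component is that of b.
Rep : List ℕ → List ℕ → Box → Set
Rep τ κ b = Skew τ κ b × (∀ a → Skew τ κ a → Conn τ κ a b → b ≤lex a)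

RowsOf : List ℕ → List ℕ → Box → ℕ → Set
RowsOf τ κ b i = ∃ λ j → Skew τ κ (i , j) × Conn τ κ (i , j) b

-- strong marked cover τ =r=> κ (r a positive, 1-based row index) with spin s
record MarkedCoverSpin (K : ℕ) (τ : List ℕ) (r : ℕ) (κ : List ℕ) (s : ℕ) : Set where
  field
    cover  : StrongCover K τ κ
    mark   : ∃ λ b → Rep τ κ b × (r ≡ suc (proj₁ b))
    c h N  : ℕ
    #comp  : Count (Rep τ κ) c
    #rows  : ∀ b → Rep τ κ b → Count (RowsOf τ κ b) h
    #below : Count (λ b → Rep τ κ b × (r < suc (proj₁ b))) N
    spinEq : s ≡ c * (h ∸ 1) + N

-- T = (κ⁽⁰⁾ =r₁=> κ⁽¹⁾ ⋯ =r_M=> κ⁽ᴹ⁾) is stored as κ⁽⁰⁾ and the list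
-- of pairs (r_i , κ⁽ⁱ⁾)
record Tab : Set where
  constructor tab
  field
    start : List ℕ
    steps : List (ℕ × List ℕ)

data Chain (K : ℕ) : List ℕ → List (ℕ × List ℕ) → List ℕ → ℕ → Set where
  done : ∀ {κ} → IsCore K κ → Chain K κ [] κ 0
  step : ∀ {τ r κ rest end s s'} → MarkedCoverSpin K τ r κ s →
         Chain K κ rest end s' → Chain K τ ((r , κ) ∷ rest) end (s + s')

Blocks : (ℕ → ℕ → Set) → List ℕ → List ℕ → Set
Blocks R []       rs = rs ≡ []
Blocks R (e ∷ es) rs = (e ≤ length rs) × Linked R (take e rs) × Blocks R es (drop e rs)

_≥'_ : ℕ → ℕ → Set
a ≥' b = b ≤ a

SMT : ℕ → List ℕ → List ℕ → Tab → ℕ → Set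
SMT K η μ (tab κ₀ st) d =
  ∃ λ κM → Chain K κ₀ st κM d × Blocks _≥'_ η (map proj₁ st) × (trim (pmap K κM) ≡ trim μ)

VSMT : ℕ → List ℕ → List ℕ → Tab → ℕ → Set
VSMT K η μ (tab κ₀ st) d =
  ∃ λ κM → Chain K κ₀ st κM d × Blocks _<_ η (map proj₁ st) × (trim (pmap K κM) ≡ trim μ)

inside : ℕ → Tab → List ℕ
inside K T = pmap K (Tab.start T)

-- Semistandard Young tableaux (coefficient of x^η in the Schur function
-- s_ν is the number of SSYT of shape ν and content η)

entry : List (List ℕ) → ℕ → ℕ → ℕ
entry []       _       _ = 0
entry (r ∷ _)  zero    j = part r j
entry (_ ∷ rs) (suc i) j = entry rs i j

SSYT : List ℕ → List ℕ → List (List ℕ) → Set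
SSYT ν η F =
  (map length F ≡ trim ν) ×
  All (All (1 ≤_)) F ×
  All (Linked _≤_) F ×
  (∀ i j → j < part (map length F) (suc i) →
     entry F i j < entry F (suc i) j) ×
  (∀ v → sum (map (λ row → length (filter (λ x → x ≟ suc v) row)) F) ≡ part η v)

-- To weights γ ∈ ℤ^ℓ, a functional f on weights with values in ℤ[t] and a set of roots (i , j), i < j, attach the
-- value at γ of ∏ (1 − t R_ij)⁻¹ f, where R_ij raises γ_i and lowers γ_j. For a (K+1)-core κ with 𝔭(κ) = μ take
-- γ = μ and the roots with j ≥ D i = i + K + 1 − μ_i; in terms of the beads κ_i − i, row D i holds the bead of
-- row i moved down by K + 1. If f is antisymmetric under the dot action and vanishes where some tail sum of γ is
-- negative, then lowering γ_p by one and straightening along the beads turns the value into a sum over the strong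
-- covers of κ marked in row p, weighted by t^spin. Iterated over rows this is a Pieri rule: horizontal (vertical)
-- strong strips are adjoint to multiplication by h_d (by e_d). Starting from the alternant, the coefficient of x^η in
-- s_μ^(k) is therefore the value at μ of the functional f_η adjoint to h_η. On the other side, vertical strips of
-- full height ℓ are adjoint to e_ℓ = x₁ ⋯ x_ℓ, that is, they shift all weights by one, while D is unchanged when K
-- and all μ_i grow by m; so Σ t^spin over VSMT has the same value. The inner cores have size |μ| ≤ k + m, for them
-- the roots act trivially, and f_η at a partition ν counts the semistandard tableaux of shape ν and content η.

module Submission where

open import Data.Nat as ℕ using (ℕ; zero; suc; s≤s; z≤n; _≤_; _<_; _∸_; _≤?_; _<?_; _≟_)
import Data.Nat.Properties as ℕP
open import Data.Integer as ℤ using (ℤ; +_; -[1+_]; 0ℤ; 1ℤ; +≤+)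
import Data.Integer.Properties as ℤP
open import Data.Integer.Tactic.RingSolver using (solve-∀)
open import Data.Bool as Bool using (Bool; true; false; _∧_)
open import Data.List using (List; []; _∷_; map; _++_; concatMap; length; filter; upTo; cartesianProduct; applyUpTo; take; drop; _ʳ++_; reverse; replicate)
open import Data.List.Relation.Unary.All as All using (All; []; _∷_)
open import Data.List.Relation.Unary.All.Properties using (++⁺; ++⁻ˡ)
open import Data.Sum using (_⊎_; inj₁; inj₂)
open import Data.Product using (_×_; _,_; proj₁; proj₂; Σ; ∃)
open import Data.Unit using (⊤; tt)
open import Data.Empty using (⊥; ⊥-elim)
open import Relation.Nullary using (yes; no; ¬_; Dec)
open import Relation.Binary.PropositionalEquality as ≡ using (_≡_; _≢_; refl; sym; cong; cong₂; subst; subst₂)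
open import Data.List.Membership.Propositional using (_∈_)
open import Data.List.Membership.Propositional.Properties using (∈-filter⁺; ∈-filter⁻; ∈-map⁺; ∈-map⁻; ∈-upTo⁺; ∈-upTo⁻; ∈-cartesianProduct⁺; ∈-cartesianProduct⁻; ∈-++⁺ˡ; ∈-++⁺ʳ; ∈-++⁻)
open import Data.List.Relation.Unary.Any using (here; there)
open import Data.List.Relation.Unary.Unique.Propositional using (Unique)
import Data.List.Relation.Unary.Unique.Propositional.Properties as Uniq
open import Data.List.Relation.Unary.AllPairs using ([]; _∷_)
open import Data.List.Relation.Binary.Permutation.Propositional using (_↭_; refl; prep; swap; trans)
open import Data.List.Relation.Binary.BagAndSetEquality using (∼bag⇒↭)
open import Data.List.Membership.Propositional.Properties.WithK using (unique∧set⇒bag)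
open import Function using (_∘_)
open import Function.Bundles using (mk⇔)
open import Data.Fin using (Fin; toℕ; fromℕ<)
import Data.Fin.Properties as FinP
import Relation.Binary.Definitions
open import Defs
open import Data.List.Properties using (filter-accept; filter-reject; length-map; length-upTo; ʳ++-defn; length-reverse; ++-identityʳ; length-++; filter-++)
open import Data.Nat.ListAction using (sum)
open import Relation.Binary.Construct.Closure.ReflexiveTransitive using (Star; ε; _◅_; _◅◅_)
open import Data.List.Relation.Binary.Permutation.Propositional.Properties using (↭-length)
import Data.List.Properties
open import Data.List.Relation.Unary.Linked as Linked using (Linked; []; [-]; _∷_)

-- A strip is peeled box by box, and between two boxes the functional is only partially symmetric:
-- once the peeling has reached row `p`, antisymmetry can fail for the swap of rows `p - 1` and `p`.
-- `Class ℓ p` records exactly this loss. It does no harm, because straightening a cover marked in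
-- row `p` never swaps that pair: the lower row of each swapped pair carries a bead on another
-- runner of the abacus than row `p` or, in one degenerate case, a bead further down the same
-- runner. A swap either kills the value or yields one factor t. An exchange on c levels needs h - 1
-- swaps per level, whence t^(c(h-1)); the remaining t^N comes from expanding roots, each expansion
-- passing the lowered row from `p` to `D p`. Straightening only produces covers that exchange beads
-- along two runners. That there are no others is a separate combinatorial fact: every core properly
-- inside κ lies inside such an exchange of κ, so |𝔭| is strictly monotone under containment.
-- Identities of series in t and x are stated coefficient by coefficient, finally as equal lengths
-- of two lists without repetitions.

module LinearArithmetic where
  -- Linear arithmetic over ℕ and ℤ, by Fourier–Motzkin refutation of the hypotheses together with the negated goal.

  record Form : Set where
    constructor _⊹_
    field
      const : ℤ
      coefs : List ℤ
  open Form

  dot : List ℤ → List ℤ → ℤ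
  dot [] _ = 0ℤ
  dot (_ ∷ _) [] = 0ℤ
  dot (a ∷ as) (v ∷ vs) = a ℤ.* v ℤ.+ dot as vs

  eval : List ℤ → Form → ℤ
  eval vs (c ⊹ as) = c ℤ.+ dot as vs

  combs : ℤ → List ℤ → ℤ → List ℤ → List ℤ
  combs p [] q bs = map (q ℤ.*_) bs
  combs p (a ∷ as) q [] = map (p ℤ.*_) (a ∷ as)
  combs p (a ∷ as) q (b ∷ bs) = (p ℤ.* a ℤ.+ q ℤ.* b) ∷ combs p as q bs

  comb : ℤ → Form → ℤ → Form → Form
  comb p (c ⊹ as) q (d ⊹ bs) = (p ℤ.* c ℤ.+ q ℤ.* d) ⊹ combs p as q bs

  dot-scale : ∀ q bs vs → dot (map (q ℤ.*_) bs) vs ≡ q ℤ.* dot bs vs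
  dot-scale q [] vs = sym (ℤP.*-zeroʳ q)
  dot-scale q (b ∷ bs) [] = sym (ℤP.*-zeroʳ q)
  dot-scale q (b ∷ bs) (v ∷ vs) rewrite dot-scale q bs vs = lem q b v (dot bs vs)
    where lem : ∀ q b v d → (q ℤ.* b) ℤ.* v ℤ.+ q ℤ.* d ≡ q ℤ.* (b ℤ.* v ℤ.+ d)
          lem = solve-∀

  dot-combs : ∀ p as q bs vs → dot (combs p as q bs) vs ≡ p ℤ.* dot as vs ℤ.+ q ℤ.* dot bs vs
  dot-combs p [] q bs vs = ≡.trans (dot-scale q bs vs) (lem p _)
    where lem : ∀ p x → x ≡ p ℤ.* 0ℤ ℤ.+ x
          lem = solve-∀
  dot-combs p (a ∷ as) q [] vs = ≡.trans (dot-scale p (a ∷ as) vs) (lem _ q)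
    where lem : ∀ x q → x ≡ x ℤ.+ q ℤ.* 0ℤ
          lem = solve-∀
  dot-combs p (a ∷ as) q (b ∷ bs) [] = lem p q
    where lem : ∀ p q → 0ℤ ≡ p ℤ.* 0ℤ ℤ.+ q ℤ.* 0ℤ
          lem = solve-∀
  dot-combs p (a ∷ as) q (b ∷ bs) (v ∷ vs) rewrite dot-combs p as q bs vs = lem p q a b v (dot as vs) (dot bs vs)
    where lem : ∀ p q a b v x y → (p ℤ.* a ℤ.+ q ℤ.* b) ℤ.* v ℤ.+ (p ℤ.* x ℤ.+ q ℤ.* y)
                  ≡ p ℤ.* (a ℤ.* v ℤ.+ x) ℤ.+ q ℤ.* (b ℤ.* v ℤ.+ y)
          lem = solve-∀

  eval-comb : ∀ p l q m vs → eval vs (comb p l q m) ≡ p ℤ.* eval vs l ℤ.+ q ℤ.* eval vs m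
  eval-comb p (c ⊹ as) q (d ⊹ bs) vs rewrite dot-combs p as q bs vs = lem p q c d (dot as vs) (dot bs vs)
    where lem : ∀ p q c d x y → (p ℤ.* c ℤ.+ q ℤ.* d) ℤ.+ (p ℤ.* x ℤ.+ q ℤ.* y) ≡ p ℤ.* (c ℤ.+ x) ℤ.+ q ℤ.* (d ℤ.+ y)
          lem = solve-∀

  lead : Form → ℤ
  lead (c ⊹ []) = 0ℤ
  lead (c ⊹ (a ∷ as)) = a

  tail : Form → Form
  tail (c ⊹ []) = c ⊹ []
  tail (c ⊹ (a ∷ as)) = c ⊹ as

  eval-split : ∀ v vs l → eval (v ∷ vs) l ≡ lead l ℤ.* v ℤ.+ eval vs (tail l)
  eval-split v vs (c ⊹ []) = lem c v
    where lem : ∀ c v → c ℤ.+ 0ℤ ≡ 0ℤ ℤ.* v ℤ.+ (c ℤ.+ 0ℤ)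
          lem = solve-∀
  eval-split v vs (c ⊹ (a ∷ as)) = lem c a v (dot as vs)
    where lem : ∀ c a v d → c ℤ.+ (a ℤ.* v ℤ.+ d) ≡ a ℤ.* v ℤ.+ (c ℤ.+ d)
          lem = solve-∀

  elim : ∀ p l q m v vs → p ℤ.* lead l ℤ.+ q ℤ.* lead m ≡ 0ℤ →
    eval vs (comb p (tail l) q (tail m)) ≡ p ℤ.* eval (v ∷ vs) l ℤ.+ q ℤ.* eval (v ∷ vs) m
  elim p l q m v vs h = ≡.trans (eval-comb p (tail l) q (tail m) vs)
    (≡.trans (lem₀ p q (eval vs (tail l)) (eval vs (tail m)) v)
    (≡.trans (cong (λ z → z ℤ.* v ℤ.+ (p ℤ.* eval vs (tail l) ℤ.+ q ℤ.* eval vs (tail m))) (sym h))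
    (≡.trans (lem p q (lead l) (lead m) (eval vs (tail l)) (eval vs (tail m)) v)
      (sym (cong₂ (λ x y → p ℤ.* x ℤ.+ q ℤ.* y) (eval-split v vs l) (eval-split v vs m))))))
    where
    lem₀ : ∀ p q x y v → p ℤ.* x ℤ.+ q ℤ.* y ≡ 0ℤ ℤ.* v ℤ.+ (p ℤ.* x ℤ.+ q ℤ.* y)
    lem₀ = solve-∀
    lem : ∀ p q a b x y v → (p ℤ.* a ℤ.+ q ℤ.* b) ℤ.* v ℤ.+ (p ℤ.* x ℤ.+ q ℤ.* y)
          ≡ p ℤ.* (a ℤ.* v ℤ.+ x) ℤ.+ q ℤ.* (b ℤ.* v ℤ.+ y)
    lem = solve-∀

  data Sign : Set where
    negS nulS posS : Sign

  sign : ℤ → Sign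
  sign (+ 0) = nulS
  sign (+ suc _) = posS
  sign -[1+ _ ] = negS

  -- q·m − (±b)·e with q = |lead e|, which cancels the leading variable
  cancel : Form → Form → Form
  cancel e m with sign (lead e)
  ... | negS = comb (lead m) (tail e) (ℤ.- lead e) (tail m)
  ... | _   = comb (ℤ.- lead m) (tail e) (lead e) (tail m)

  pairUp : Form → Form → Form
  pairUp u l = comb (ℤ.- lead l) (tail u) (lead u) (tail l)

  pick : List Form → List Form → List Form × (⊤ ⊎ Form)
  pick seen [] = seen , inj₁ tt
  pick seen (e ∷ es) with sign (lead e)
  ... | nulS = pick (e ∷ seen) es
  ... | _   = seen ++ es , inj₂ e

  bySign : List Form → List Form × List Form × List Form
  bySign [] = [] , [] , []
  bySign (l ∷ ls) with sign (lead l) | bySign ls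
  ... | negS | (N , Z , P) = l ∷ N , Z , P
  ... | nulS | (N , Z , P) = N , l ∷ Z , P
  ... | posS | (N , Z , P) = N , Z , l ∷ P

  someNonzero : List Form → Bool
  someNonzero [] = false
  someNonzero (((+ 0) ⊹ _) ∷ es) = someNonzero es
  someNonzero (((+ suc _) ⊹ []) ∷ es) = true
  someNonzero ((-[1+ _ ] ⊹ []) ∷ es) = true
  someNonzero ((_ ⊹ (_ ∷ _)) ∷ es) = someNonzero es

  -- Equations are spent first, since substituting one does not increase the number of inequalities.
  -- Only when no equation involves the leading variable are its lower and upper bounds combined in
  -- pairs. The number counts the variables left; at 0 a contradiction is a nonzero constant equal
  -- to 0 or a negative constant claimed to be nonnegative.
  refutes : ℕ → List Form → List Form → Bool
  refutes zero es [] = someNonzero es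
  refutes zero es ((-[1+ _ ] ⊹ []) ∷ ls) = true
  refutes zero es (_ ∷ ls) = refutes zero es ls
  refutes (suc k) es ls with pick [] es
  ... | (es' , inj₂ e) = refutes k (map (cancel e) es') (map (cancel e) ls)
  ... | (es' , inj₁ _) with bySign ls
  ...   | (N , Z , P) = refutes k (map tail es') (map tail Z ++ concatMap (λ u → map (pairUp u) N) P)

  Zero Pos : List ℤ → Form → Set
  Zero vs l = eval vs l ≡ 0ℤ
  Pos vs l = 0ℤ ℤ.≤ eval vs l

  *-nonneg : ∀ {a b} → 0ℤ ℤ.≤ a → 0ℤ ℤ.≤ b → 0ℤ ℤ.≤ a ℤ.* b
  *-nonneg {+ a} {+ b} _ _ = subst (0ℤ ℤ.≤_) (ℤP.pos-* a b) (+≤+ z≤n)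

  lead-zero : ∀ l v vs → sign (lead l) ≡ nulS → eval (v ∷ vs) l ≡ eval vs (tail l)
  lead-zero l v vs h with lead l | eval-split v vs l | h
  ... | + 0 | e | _ = ≡.trans e (lem v (eval vs (tail l)))
    where lem : ∀ v x → 0ℤ ℤ.* v ℤ.+ x ≡ x
          lem = solve-∀

  cancel-sound : ∀ p q e m v vs → p ℤ.* lead e ℤ.+ q ℤ.* lead m ≡ 0ℤ → 0ℤ ℤ.≤ q → Zero (v ∷ vs) e →
    (Pos (v ∷ vs) m → Pos vs (comb p (tail e) q (tail m))) × (Zero (v ∷ vs) m → Zero vs (comb p (tail e) q (tail m)))
  cancel-sound p q e m v vs h q≥0 ze =
    (λ m≥0 → subst (0ℤ ℤ.≤_) (sym val) (*-nonneg q≥0 m≥0)) ,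
    λ m≡0 → ≡.trans val (≡.trans (cong (q ℤ.*_) m≡0) (ℤP.*-zeroʳ q))
    where
    lem : ∀ p y → p ℤ.* 0ℤ ℤ.+ y ≡ y
    lem = solve-∀
    val : eval vs (comb p (tail e) q (tail m)) ≡ q ℤ.* eval (v ∷ vs) m
    val = ≡.trans (elim p e q m v vs h) (≡.trans (cong (λ z → p ℤ.* z ℤ.+ _) ze) (lem p _))

  sign-nonneg : ∀ a → sign a ≢ negS → 0ℤ ℤ.≤ a
  sign-nonneg (+ _) _ = +≤+ z≤n
  sign-nonneg -[1+ _ ] h = ⊥-elim (h refl)

  sign-nonpos : ∀ a → sign a ≡ negS → 0ℤ ℤ.≤ ℤ.- a
  sign-nonpos (+ 0) ()
  sign-nonpos (+ suc _) ()
  sign-nonpos -[1+ _ ] _ = +≤+ z≤n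

  cross₁ : ∀ b a → b ℤ.* a ℤ.+ (ℤ.- a) ℤ.* b ≡ 0ℤ
  cross₁ = solve-∀

  cross₂ : ∀ b a → (ℤ.- b) ℤ.* a ℤ.+ a ℤ.* b ≡ 0ℤ
  cross₂ = solve-∀

  cancel-eval : ∀ e m v vs → Zero (v ∷ vs) e →
    (Pos (v ∷ vs) m → Pos vs (cancel e m)) × (Zero (v ∷ vs) m → Zero vs (cancel e m))
  cancel-eval e m v vs ze with sign (lead e) in sg
  ... | negS = cancel-sound (lead m) (ℤ.- lead e) e m v vs (cross₁ (lead m) (lead e)) (sign-nonpos _ sg) ze
  ... | nulS = cancel-sound (ℤ.- lead m) (lead e) e m v vs (cross₂ (lead m) (lead e))
                (sign-nonneg (lead e) (λ h → case-neg (≡.trans (sym sg) h))) ze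
    where case-neg : nulS ≢ negS
          case-neg ()
  ... | posS = cancel-sound (ℤ.- lead m) (lead e) e m v vs (cross₂ (lead m) (lead e))
                (sign-nonneg (lead e) (λ h → case-neg (≡.trans (sym sg) h))) ze
    where case-neg : posS ≢ negS
          case-neg ()

  pairUp-sound : ∀ u l v vs → sign (lead u) ≡ posS → sign (lead l) ≡ negS → Pos (v ∷ vs) u → Pos (v ∷ vs) l → Pos vs (pairUp u l)
  pairUp-sound u l v vs su sl hu hl =
    subst (0ℤ ℤ.≤_) (sym (elim (ℤ.- lead l) u (lead u) l v vs (cross₂ (lead l) (lead u))))
      (ℤP.+-mono-≤ (*-nonneg (sign-nonpos _ sl) hu)
                   (*-nonneg (sign-nonneg (lead u) (λ h → case-neg (≡.trans (sym su) h))) hl))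
    where case-neg : posS ≢ negS
          case-neg ()

  pick-sound : ∀ {P : Form → Set} seen es → All P seen → All P es →
    All P (proj₁ (pick seen es)) × (∀ e → proj₂ (pick seen es) ≡ inj₂ e → P e)
  pick-sound seen [] hs _ = hs , λ _ ()
  pick-sound seen (e ∷ es) hs (h ∷ he) with sign (lead e)
  ... | nulS = pick-sound (e ∷ seen) es (h ∷ hs) he
  ... | negS = ++⁺ hs he , λ { _ refl → h }
  ... | posS = ++⁺ hs he , λ { _ refl → h }

  pick-none : ∀ seen es → All (λ l → sign (lead l) ≡ nulS) seen → proj₂ (pick seen es) ≡ inj₁ tt →
    All (λ l → sign (lead l) ≡ nulS) (proj₁ (pick seen es))
  pick-none seen [] hs _ = hs
  pick-none seen (e ∷ es) hs h with sign (lead e) in sg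
  ... | nulS = pick-none (e ∷ seen) es (sg ∷ hs) h

  bySign-sound : ∀ {P : Form → Set} ls → All P ls →
    All (λ l → P l × sign (lead l) ≡ negS) (proj₁ (bySign ls)) ×
    All (λ l → P l × sign (lead l) ≡ nulS) (proj₁ (proj₂ (bySign ls))) ×
    All (λ l → P l × sign (lead l) ≡ posS) (proj₂ (proj₂ (bySign ls)))
  bySign-sound [] [] = [] , [] , []
  bySign-sound (l ∷ ls) (p ∷ ps) with sign (lead l) in sg | bySign-sound ls ps
  ... | negS | (N , Z , P) = (p , sg) ∷ N , Z , P
  ... | nulS | (N , Z , P) = N , (p , sg) ∷ Z , P
  ... | posS | (N , Z , P) = N , Z , (p , sg) ∷ P

  All-map : ∀ {P Q : Form → Set} {f : Form → Form} → (∀ l → P l → Q (f l)) → ∀ {ls} → All P ls → All Q (map f ls)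
  All-map h [] = []
  All-map h (p ∷ ps) = h _ p ∷ All-map h ps

  All-concatMap : ∀ {P Q : Form → Set} {f : Form → List Form} → (∀ l → P l → All Q (f l)) → ∀ {ls} → All P ls → All Q (concatMap f ls)
  All-concatMap h [] = []
  All-concatMap h (p ∷ ps) = ++⁺ (h _ p) (All-concatMap h ps)

  someNonzero-sound : ∀ es → Bool.T (someNonzero es) → All (Zero []) es → ⊥
  someNonzero-sound (((+ 0) ⊹ _) ∷ es) r (_ ∷ he) = someNonzero-sound es r he
  someNonzero-sound (((+ suc _) ⊹ []) ∷ es) r (() ∷ _)
  someNonzero-sound ((-[1+ _ ] ⊹ []) ∷ es) r (() ∷ _)
  someNonzero-sound (((+ suc _) ⊹ (_ ∷ _)) ∷ es) r (_ ∷ he) = someNonzero-sound es r he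
  someNonzero-sound ((-[1+ _ ] ⊹ (_ ∷ _)) ∷ es) r (_ ∷ he) = someNonzero-sound es r he

  refutes-sound : ∀ k es ls → Bool.T (refutes k es ls) → ∀ vs → length vs ≡ k → All (Zero vs) es → All (Pos vs) ls → ⊥
  refutes-sound zero es [] r [] _ he [] = someNonzero-sound es r he
  refutes-sound zero es ((-[1+ _ ] ⊹ []) ∷ ls) r [] _ he (() ∷ _)
  refutes-sound zero es (((+ _) ⊹ []) ∷ ls) r [] _ he (_ ∷ hl) = refutes-sound zero es ls r [] refl he hl
  refutes-sound zero es (((+ _) ⊹ (_ ∷ _)) ∷ ls) r [] _ he (_ ∷ hl) = refutes-sound zero es ls r [] refl he hl
  refutes-sound zero es ((-[1+ _ ] ⊹ (_ ∷ _)) ∷ ls) r [] _ he (_ ∷ hl) = refutes-sound zero es ls r [] refl he hl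
  refutes-sound (suc k) es ls r (v ∷ vs) eq he hl
    with pick [] es | pick-sound [] es [] he | pick-none [] es []
  ... | (es' , inj₂ e) | (hs , hp) | _ =
    refutes-sound k (map (cancel e) es') (map (cancel e) ls) r vs (ℕP.suc-injective eq)
      (All-map (λ l → proj₂ (cancel-eval e l v vs (hp e refl))) hs)
      (All-map (λ l → proj₁ (cancel-eval e l v vs (hp e refl))) hl)
  ... | (es' , inj₁ _) | (hs , _) | hn with bySign ls | bySign-sound ls hl
  ...   | (N , Z , P) | (hN , hZ , hP) =
    refutes-sound k (map tail es') (map tail Z ++ concatMap (λ u → map (pairUp u) N) P) r vs (ℕP.suc-injective eq)
      (All-map (λ l p → ≡.trans (sym (lead-zero l v vs (proj₂ p))) (proj₁ p)) (All.zip (hs , hn refl)))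
      (++⁺ (All-map (λ l p → subst (0ℤ ℤ.≤_) (lead-zero l v vs (proj₂ p)) (proj₁ p)) hZ)
           (All-concatMap (λ u hu → All-map (λ l hl' → pairUp-sound u l v vs (proj₂ hu) (proj₂ hl') (proj₁ hu) (proj₁ hl')) hN) hP))

  infixr 9 ↑_ ⊝_ 1+_
  infixl 7 _⊕_ _⊖_
  infixl 8 _⊛_
  infix 10 #_
  infix 6 _≤ⁿ_ _<ⁿ_ _≈ⁿ_ _≤ᶻ_ _<ᶻ_ _≈ᶻ_

  data NExp : Set where
    #_ : ℕ → NExp
    lit : ℕ → NExp
    1+_ : NExp → NExp
    _⊕_ : NExp → NExp → NExp
    _⊛_ : ℕ → NExp → NExp

  data ZExp : Set where
    #_ : ℕ → ZExp
    lit : ℤ → ZExp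
    ↑_ : NExp → ZExp
    _⊕_ _⊖_ : ZExp → ZExp → ZExp
    ⊝_ : ZExp → ZExp

  data Rel : Set where
    _≤ⁿ_ _<ⁿ_ _≈ⁿ_ : NExp → NExp → Rel
    _≤ᶻ_ _<ᶻ_ _≈ᶻ_ : ZExp → ZExp → Rel
    absurd : Rel

  Env : Set
  Env = List ℕ × List ℤ

  at : {A : Set} → A → List A → ℕ → A
  at d [] _ = d
  at d (x ∷ _) zero = x
  at d (_ ∷ xs) (suc i) = at d xs i

  ⟦_⟧ⁿ : NExp → Env → ℕ
  ⟦ # i ⟧ⁿ ρ = at 0 (proj₁ ρ) i
  ⟦ lit k ⟧ⁿ ρ = k
  ⟦ 1+ e ⟧ⁿ ρ = suc (⟦ e ⟧ⁿ ρ)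
  ⟦ e ⊕ f ⟧ⁿ ρ = ⟦ e ⟧ⁿ ρ ℕ.+ ⟦ f ⟧ⁿ ρ
  ⟦ k ⊛ e ⟧ⁿ ρ = k ℕ.* ⟦ e ⟧ⁿ ρ

  ⟦_⟧ᶻ : ZExp → Env → ℤ
  ⟦ # i ⟧ᶻ ρ = at 0ℤ (proj₂ ρ) i
  ⟦ lit k ⟧ᶻ ρ = k
  ⟦ ↑ e ⟧ᶻ ρ = + ⟦ e ⟧ⁿ ρ
  ⟦ e ⊕ f ⟧ᶻ ρ = ⟦ e ⟧ᶻ ρ ℤ.+ ⟦ f ⟧ᶻ ρ
  ⟦ e ⊖ f ⟧ᶻ ρ = ⟦ e ⟧ᶻ ρ ℤ.- ⟦ f ⟧ᶻ ρ
  ⟦ ⊝ e ⟧ᶻ ρ = ℤ.- ⟦ e ⟧ᶻ ρ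

  ⟦_⟧ : Rel → Env → Set
  ⟦ e ≤ⁿ f ⟧ ρ = ⟦ e ⟧ⁿ ρ ℕ.≤ ⟦ f ⟧ⁿ ρ
  ⟦ e <ⁿ f ⟧ ρ = ⟦ e ⟧ⁿ ρ ℕ.< ⟦ f ⟧ⁿ ρ
  ⟦ e ≈ⁿ f ⟧ ρ = ⟦ e ⟧ⁿ ρ ≡ ⟦ f ⟧ⁿ ρ
  ⟦ e ≤ᶻ f ⟧ ρ = ⟦ e ⟧ᶻ ρ ℤ.≤ ⟦ f ⟧ᶻ ρ
  ⟦ e <ᶻ f ⟧ ρ = ⟦ e ⟧ᶻ ρ ℤ.< ⟦ f ⟧ᶻ ρ
  ⟦ e ≈ᶻ f ⟧ ρ = ⟦ e ⟧ᶻ ρ ≡ ⟦ f ⟧ᶻ ρ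
  ⟦ absurd ⟧ ρ = ⊥

  -- The variables of a form are the natural atoms (cast to ℤ) followed by the integer atoms.
  unit : ℕ → List ℤ
  unit zero = 1ℤ ∷ []
  unit (suc i) = 0ℤ ∷ unit i

  natAtom : ℕ → ℕ → List ℤ
  natAtom zero i = []
  natAtom (suc n) zero = 1ℤ ∷ []
  natAtom (suc n) (suc i) = 0ℤ ∷ natAtom n i

  values : Env → List ℤ
  values (ns , zs) = map +_ ns ++ zs

  formⁿ : ℕ → NExp → Form
  formⁿ n (# i) = 0ℤ ⊹ natAtom n i
  formⁿ n (lit k) = (+ k) ⊹ []
  formⁿ n (1+ e) = comb 1ℤ (1ℤ ⊹ []) 1ℤ (formⁿ n e)
  formⁿ n (e ⊕ f) = comb 1ℤ (formⁿ n e) 1ℤ (formⁿ n f)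
  formⁿ n (k ⊛ e) = comb (+ k) (formⁿ n e) 0ℤ (0ℤ ⊹ [])

  formᶻ : ℕ → ZExp → Form
  formᶻ n (# i) = 0ℤ ⊹ unit (n ℕ.+ i)
  formᶻ n (lit k) = k ⊹ []
  formᶻ n (↑ e) = formⁿ n e
  formᶻ n (e ⊕ f) = comb 1ℤ (formᶻ n e) 1ℤ (formᶻ n f)
  formᶻ n (e ⊖ f) = comb 1ℤ (formᶻ n e) (ℤ.- 1ℤ) (formᶻ n f)
  formᶻ n (⊝ e) = comb (ℤ.- 1ℤ) (formᶻ n e) 0ℤ (0ℤ ⊹ [])

  dot-natAtom : ∀ ns zs i → dot (natAtom (length ns) i) (map +_ ns ++ zs) ≡ + at 0 ns i
  dot-natAtom [] zs i = refl
  dot-natAtom (x ∷ ns) zs zero = lem (+ x)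
    where lem : ∀ x → 1ℤ ℤ.* x ℤ.+ 0ℤ ≡ x
          lem = solve-∀
  dot-natAtom (x ∷ ns) zs (suc i) = ≡.trans (lem (+ x) _) (dot-natAtom ns zs i)
    where lem : ∀ x d → 0ℤ ℤ.* x ℤ.+ d ≡ d
          lem = solve-∀

  dot-unit : ∀ ns zs i → dot (unit (length ns ℕ.+ i)) (map +_ ns ++ zs) ≡ at 0ℤ zs i
  dot-unit [] [] zero = refl
  dot-unit [] [] (suc i) = refl
  dot-unit [] (z ∷ zs) zero = lem z
    where lem : ∀ x → 1ℤ ℤ.* x ℤ.+ 0ℤ ≡ x
          lem = solve-∀
  dot-unit [] (z ∷ zs) (suc i) = ≡.trans (lem z _) (dot-unit [] zs i)
    where lem : ∀ x d → 0ℤ ℤ.* x ℤ.+ d ≡ d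
          lem = solve-∀
  dot-unit (x ∷ ns) zs i = ≡.trans (lem (+ x) _) (dot-unit ns zs i)
    where lem : ∀ x d → 0ℤ ℤ.* x ℤ.+ d ≡ d
          lem = solve-∀

  formⁿ-eval : ∀ ρ e → eval (values ρ) (formⁿ (length (proj₁ ρ)) e) ≡ + ⟦ e ⟧ⁿ ρ
  formⁿ-eval ρ (# i) = ≡.trans (ℤP.+-identityˡ _) (dot-natAtom (proj₁ ρ) (proj₂ ρ) i)
  formⁿ-eval ρ (lit k) = ℤP.+-identityʳ (+ k)
  formⁿ-eval ρ (1+ e) = ≡.trans (eval-comb 1ℤ (1ℤ ⊹ []) 1ℤ (formⁿ _ e) (values ρ))
    (≡.trans (cong (λ z → 1ℤ ℤ.* 1ℤ ℤ.+ 1ℤ ℤ.* z) (formⁿ-eval ρ e)) (lem (+ ⟦ e ⟧ⁿ ρ)))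
    where lem : ∀ x → 1ℤ ℤ.* 1ℤ ℤ.+ 1ℤ ℤ.* x ≡ 1ℤ ℤ.+ x
          lem = solve-∀
  formⁿ-eval ρ (e ⊕ f) = ≡.trans (eval-comb 1ℤ (formⁿ _ e) 1ℤ (formⁿ _ f) (values ρ))
    (≡.trans (cong₂ (λ y z → 1ℤ ℤ.* y ℤ.+ 1ℤ ℤ.* z) (formⁿ-eval ρ e) (formⁿ-eval ρ f)) (lem (+ ⟦ e ⟧ⁿ ρ) (+ ⟦ f ⟧ⁿ ρ)))
    where lem : ∀ x y → 1ℤ ℤ.* x ℤ.+ 1ℤ ℤ.* y ≡ x ℤ.+ y
          lem = solve-∀
  formⁿ-eval ρ (k ⊛ e) = ≡.trans (eval-comb (+ k) (formⁿ _ e) 0ℤ (0ℤ ⊹ []) (values ρ))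
    (≡.trans (cong (λ z → + k ℤ.* z ℤ.+ 0ℤ) (formⁿ-eval ρ e))
      (≡.trans (ℤP.+-identityʳ _) (sym (ℤP.pos-* k (⟦ e ⟧ⁿ ρ)))))

  formᶻ-eval : ∀ ρ e → eval (values ρ) (formᶻ (length (proj₁ ρ)) e) ≡ ⟦ e ⟧ᶻ ρ
  formᶻ-eval ρ (# i) = ≡.trans (ℤP.+-identityˡ _) (dot-unit (proj₁ ρ) (proj₂ ρ) i)
  formᶻ-eval ρ (lit k) = ℤP.+-identityʳ k
  formᶻ-eval ρ (↑ e) = formⁿ-eval ρ e
  formᶻ-eval ρ (e ⊕ f) = ≡.trans (eval-comb 1ℤ (formᶻ _ e) 1ℤ (formᶻ _ f) (values ρ))
    (≡.trans (cong₂ (λ y z → 1ℤ ℤ.* y ℤ.+ 1ℤ ℤ.* z) (formᶻ-eval ρ e) (formᶻ-eval ρ f)) (lem (⟦ e ⟧ᶻ ρ) (⟦ f ⟧ᶻ ρ)))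
    where lem : ∀ x y → 1ℤ ℤ.* x ℤ.+ 1ℤ ℤ.* y ≡ x ℤ.+ y
          lem = solve-∀
  formᶻ-eval ρ (e ⊖ f) = ≡.trans (eval-comb 1ℤ (formᶻ _ e) (ℤ.- 1ℤ) (formᶻ _ f) (values ρ))
    (≡.trans (cong₂ (λ y z → 1ℤ ℤ.* y ℤ.+ (ℤ.- 1ℤ) ℤ.* z) (formᶻ-eval ρ e) (formᶻ-eval ρ f)) (lem (⟦ e ⟧ᶻ ρ) (⟦ f ⟧ᶻ ρ)))
    where lem : ∀ x y → 1ℤ ℤ.* x ℤ.+ (ℤ.- 1ℤ) ℤ.* y ≡ x ℤ.- y
          lem = solve-∀
  formᶻ-eval ρ (⊝ e) = ≡.trans (eval-comb (ℤ.- 1ℤ) (formᶻ _ e) 0ℤ (0ℤ ⊹ []) (values ρ))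
    (≡.trans (cong (λ y → (ℤ.- 1ℤ) ℤ.* y ℤ.+ 0ℤ) (formᶻ-eval ρ e)) (lem (⟦ e ⟧ᶻ ρ)))
    where lem : ∀ x → (ℤ.- 1ℤ) ℤ.* x ℤ.+ 0ℤ ≡ ℤ.- x
          lem = solve-∀

  minus : Form → Form → Form
  minus l m = comb 1ℤ l (ℤ.- 1ℤ) m

  -- Strict inequalities enter as `0 ≤ y - x - 1`, which is sound because all values are integers.
  shiftDown : Form → Form
  shiftDown l = comb 1ℤ l 1ℤ ((ℤ.- 1ℤ) ⊹ [])

  equations inequalities : ℕ → Rel → List Form
  equations n (e ≈ⁿ f) = minus (formⁿ n e) (formⁿ n f) ∷ []
  equations n (e ≈ᶻ f) = minus (formᶻ n e) (formᶻ n f) ∷ []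
  equations n _ = []
  inequalities n (e ≤ⁿ f) = minus (formⁿ n f) (formⁿ n e) ∷ []
  inequalities n (e <ⁿ f) = shiftDown (minus (formⁿ n f) (formⁿ n e)) ∷ []
  inequalities n (e ≤ᶻ f) = minus (formᶻ n f) (formᶻ n e) ∷ []
  inequalities n (e <ᶻ f) = shiftDown (minus (formᶻ n f) (formᶻ n e)) ∷ []
  inequalities n _ = []

  minus-eval : ∀ vs l m {x y} → eval vs l ≡ x → eval vs m ≡ y → eval vs (minus l m) ≡ x ℤ.- y
  minus-eval vs l m refl refl = ≡.trans (eval-comb 1ℤ l (ℤ.- 1ℤ) m vs) (lem (eval vs l) (eval vs m))
    where lem : ∀ x y → 1ℤ ℤ.* x ℤ.+ (ℤ.- 1ℤ) ℤ.* y ≡ x ℤ.- y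
          lem = solve-∀

  shiftDown-eval : ∀ vs l {x} → eval vs l ≡ x → eval vs (shiftDown l) ≡ x ℤ.- 1ℤ
  shiftDown-eval vs l refl = ≡.trans (eval-comb 1ℤ l 1ℤ ((ℤ.- 1ℤ) ⊹ []) vs) (lem (eval vs l))
    where lem : ∀ x → 1ℤ ℤ.* x ℤ.+ 1ℤ ℤ.* (ℤ.- 1ℤ ℤ.+ 0ℤ) ≡ x ℤ.- 1ℤ
          lem = solve-∀

  <⇒0≤-1 : ∀ {x y} → x ℤ.< y → 0ℤ ℤ.≤ (y ℤ.- x) ℤ.- 1ℤ
  <⇒0≤-1 {x} {y} h = subst (0ℤ ℤ.≤_) (lem x y) (ℤP.i≤j⇒0≤j-i (ℤP.i<j⇒suc[i]≤j h))
    where lem : ∀ x y → y ℤ.- (1ℤ ℤ.+ x) ≡ (y ℤ.- x) ℤ.- 1ℤ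
          lem = solve-∀

  equations-sound : ∀ ρ r → ⟦ r ⟧ ρ → All (Zero (values ρ)) (equations (length (proj₁ ρ)) r)
  equations-sound ρ (e ≈ⁿ f) h = ≡.trans (minus-eval (values ρ) (formⁿ _ e) (formⁿ _ f) (formⁿ-eval ρ e) (formⁿ-eval ρ f)) (ℤP.i≡j⇒i-j≡0 (cong +_ h)) ∷ []
  equations-sound ρ (e ≈ᶻ f) h = ≡.trans (minus-eval (values ρ) (formᶻ _ e) (formᶻ _ f) (formᶻ-eval ρ e) (formᶻ-eval ρ f)) (ℤP.i≡j⇒i-j≡0 h) ∷ []
  equations-sound ρ (_ ≤ⁿ _) h = []
  equations-sound ρ (_ <ⁿ _) h = []
  equations-sound ρ (_ ≤ᶻ _) h = []
  equations-sound ρ (_ <ᶻ _) h = []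

  inequalities-sound : ∀ ρ r → ⟦ r ⟧ ρ → All (Pos (values ρ)) (inequalities (length (proj₁ ρ)) r)
  inequalities-sound ρ (e ≤ⁿ f) h = subst (0ℤ ℤ.≤_) (sym (minus-eval (values ρ) (formⁿ _ f) (formⁿ _ e) (formⁿ-eval ρ f) (formⁿ-eval ρ e))) (ℤP.i≤j⇒0≤j-i (+≤+ h)) ∷ []
  inequalities-sound ρ (e <ⁿ f) h = subst (0ℤ ℤ.≤_) (sym (shiftDown-eval (values ρ) (minus (formⁿ _ f) (formⁿ _ e)) (minus-eval (values ρ) (formⁿ _ f) (formⁿ _ e) (formⁿ-eval ρ f) (formⁿ-eval ρ e)))) (<⇒0≤-1 (ℤ.+<+ h)) ∷ []
  inequalities-sound ρ (e ≤ᶻ f) h = subst (0ℤ ℤ.≤_) (sym (minus-eval (values ρ) (formᶻ _ f) (formᶻ _ e) (formᶻ-eval ρ f) (formᶻ-eval ρ e))) (ℤP.i≤j⇒0≤j-i h) ∷ []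
  inequalities-sound ρ (e <ᶻ f) h = subst (0ℤ ℤ.≤_) (sym (shiftDown-eval (values ρ) (minus (formᶻ _ f) (formᶻ _ e)) (minus-eval (values ρ) (formᶻ _ f) (formᶻ _ e) (formᶻ-eval ρ f) (formᶻ-eval ρ e)))) (<⇒0≤-1 h) ∷ []
  inequalities-sound ρ (_ ≈ⁿ _) h = []
  inequalities-sound ρ (_ ≈ᶻ _) h = []

  nonnegs : ℕ → List Form
  nonnegs zero = []
  nonnegs (suc n) = (0ℤ ⊹ unit n) ∷ nonnegs n

  nonnegs-sound : ∀ ns zs k → k ℕ.≤ length ns → All (Pos (map +_ ns ++ zs)) (nonnegs k)
  nonnegs-sound ns zs zero _ = []
  nonnegs-sound ns zs (suc k) h = subst (0ℤ ℤ.≤_) (sym (ℤP.+-identityˡ _)) (one ns k h) ∷ nonnegs-sound ns zs k (ℕP.<⇒≤ h)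
    where
    lem₀ : ∀ x → x ≡ 1ℤ ℤ.* x ℤ.+ 0ℤ
    lem₀ = solve-∀
    lem : ∀ x d → d ≡ 0ℤ ℤ.* x ℤ.+ d
    lem = solve-∀
    one : ∀ ns k → k ℕ.< length ns → 0ℤ ℤ.≤ dot (unit k) (map +_ ns ++ zs)
    one (x ∷ ns) zero _ = subst (0ℤ ℤ.≤_) (lem₀ (+ x)) (+≤+ z≤n)
    one (x ∷ ns) (suc k) (s≤s h) = subst (0ℤ ℤ.≤_) (lem (+ x) _) (one ns k h)

  -- Without a final unit component, so that a single hypothesis is passed as it stands and several
  -- as a plain tuple.
  Given : List Rel → Env → Set
  Given [] ρ = ⊤
  Given (r ∷ []) ρ = ⟦ r ⟧ ρ
  Given (r ∷ rs@(_ ∷ _)) ρ = ⟦ r ⟧ ρ × Given rs ρ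

  given : ∀ rs ρ → Given rs ρ → All (λ r → ⟦ r ⟧ ρ) rs
  given [] ρ _ = []
  given (r ∷ []) ρ h = h ∷ []
  given (r ∷ rs@(_ ∷ _)) ρ (h , hs) = h ∷ given rs ρ hs

  contradictory : Env → List Rel → Bool
  contradictory ρ rs = refutes (n ℕ.+ length (proj₂ ρ)) (concatMap (equations n) rs) (nonnegs n ++ concatMap (inequalities n) rs)
    where n = length (proj₁ ρ)

  contradictory-sound : ∀ ρ rs → Bool.T (contradictory ρ rs) → All (λ r → ⟦ r ⟧ ρ) rs → ⊥
  contradictory-sound ρ@(ns , zs) rs ok hs = refutes-sound _ _ _ ok (values ρ) (len ns)
    (gather (equations-sound ρ) hs) (++⁺ (nonnegs-sound ns zs (length ns) ℕP.≤-refl) (gather (inequalities-sound ρ) hs))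
    where
    len : ∀ ns → length (map +_ ns ++ zs) ≡ length ns ℕ.+ length zs
    len [] = refl
    len (x ∷ ns) = cong suc (len ns)
    gather : ∀ {P : Form → Set} {F : Rel → List Form} → (∀ r → ⟦ r ⟧ ρ → All P (F r)) → ∀ {rs} → All (λ r → ⟦ r ⟧ ρ) rs → All P (concatMap F rs)
    gather f [] = []
    gather f (h ∷ hs) = ++⁺ (f _ h) (gather f hs)

  negations : Rel → List Rel
  negations (e ≤ⁿ f) = (f <ⁿ e) ∷ []
  negations (e <ⁿ f) = (f ≤ⁿ e) ∷ []
  negations (e ≈ⁿ f) = (e <ⁿ f) ∷ (f <ⁿ e) ∷ []
  negations (e ≤ᶻ f) = (f <ᶻ e) ∷ []
  negations (e <ᶻ f) = (f ≤ᶻ e) ∷ []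
  negations (e ≈ᶻ f) = (e <ᶻ f) ∷ (f <ᶻ e) ∷ []
  -- A true relation: refuting it together with the hypotheses means that the hypotheses contradict
  -- each other.
  negations absurd = (lit 0 ≤ⁿ lit 0) ∷ []

  by-negation : ∀ ρ g → All (λ r → ¬ ⟦ r ⟧ ρ) (negations g) → ⟦ g ⟧ ρ
  by-negation ρ (e ≤ⁿ f) (h ∷ []) = ℕP.≮⇒≥ h
  by-negation ρ (e <ⁿ f) (h ∷ []) = ℕP.≰⇒> h
  by-negation ρ (e ≈ⁿ f) (h ∷ h' ∷ []) = ℕP.≤-antisym (ℕP.≮⇒≥ h') (ℕP.≮⇒≥ h)
  by-negation ρ (e ≤ᶻ f) (h ∷ []) = ℤP.≮⇒≥ h
  by-negation ρ (e <ᶻ f) (h ∷ []) = ℤP.≰⇒> h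
  by-negation ρ (e ≈ᶻ f) (h ∷ h' ∷ []) = ℤP.≤-antisym (ℤP.≮⇒≥ h') (ℤP.≮⇒≥ h)
  by-negation ρ absurd (h ∷ []) = h z≤n

  entails : Env → List Rel → List Rel → Bool
  entails ρ rs [] = true
  entails ρ rs (g ∷ gs) = contradictory ρ (g ∷ rs) ∧ entails ρ rs gs

  infix 3 _⊢_
  record Sequent : Set where
    constructor _⊢_
    field
      hypotheses : List Rel
      conclusion : Rel

  -- # i stands for the i-th entry of ns in an expression over ℕ, of zs in one over ℤ; ↑ casts from ℕ to ℤ.
  linear : ∀ ns zs → ((rs ⊢ g) : Sequent) → {Bool.T (entails (ns , zs) rs (negations g))} → Given rs (ns , zs) → ⟦ g ⟧ (ns , zs)
  linear ns zs (rs ⊢ g) {ok} hs = by-negation _ g (go (negations g) ok)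
    where
    go : ∀ gs → Bool.T (entails (ns , zs) rs gs) → All (λ r → ¬ ⟦ r ⟧ (ns , zs)) gs
    go [] _ = []
    go (g ∷ gs) ok with contradictory (ns , zs) (g ∷ rs) in eq
    ... | true = (λ h → contradictory-sound _ (g ∷ rs) (subst Bool.T (sym eq) tt) (h ∷ given rs _ hs)) ∷ go gs ok

open LinearArithmetic using (linear; _⊢_; #_; lit; 1+_; ↑_; ⊝_; _⊕_; _⊖_; _⊛_; _≤ⁿ_; _<ⁿ_; _≈ⁿ_; _≤ᶻ_; _<ᶻ_; _≈ᶻ_; absurd)

-- Functionals on weights and products of (1 − t R_ij)⁻¹

same-members⇒↭ : ∀ {A : Set} {xs ys : List A} → Unique xs → Unique ys → (∀ x → x ∈ xs → x ∈ ys) → (∀ x → x ∈ ys → x ∈ xs) → xs ↭ ys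
same-members⇒↭ u v f g = ∼bag⇒↭ (unique∧set⇒bag u v (mk⇔ (f _) (g _)))

Wt Fn : Set
Wt = ℕ → ℤ
Fn = Wt → ℕ → ℤ

δ : ℕ → ℕ → ℤ
δ zero zero = 1ℤ
δ zero (suc _) = 0ℤ
δ (suc _) zero = 0ℤ
δ (suc i) (suc k) = δ i k

δ-refl : ∀ i → δ i i ≡ 1ℤ
δ-refl zero = refl
δ-refl (suc i) = δ-refl i

δ-≢ : ∀ i k → i ≢ k → δ i k ≡ 0ℤ
δ-≢ zero zero h = ⊥-elim (h refl)
δ-≢ zero (suc k) h = refl
δ-≢ (suc i) zero h = refl
δ-≢ (suc i) (suc k) h = δ-≢ i k (h ∘ cong suc)

infix 4 _≈_
_≈_ : Fn → Fn → Set
f ≈ g = ∀ γ d → f γ d ≡ g γ d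

-- Weights are functions and are compared pointwise, so respecting pointwise equality is a property
-- that every functional has to carry along.
Ext : Fn → Set
Ext f = ∀ {γ γ'} → (∀ i → γ i ≡ γ' i) → ∀ d → f γ d ≡ f γ' d

raise : ℕ → ℕ → Wt → Wt
raise i j γ k = γ k ℤ.+ (δ i k ℤ.- δ j k)

-- (1 − t R_ij)⁻¹, where f γ d is the coefficient of t^d in the value at the weight γ
inv : ℕ → ℕ → Fn → Fn
inv i j f γ zero = f γ zero
inv i j f γ (suc d) = f γ (suc d) ℤ.+ inv i j f (raise i j γ) d

raise-cong : ∀ i j {γ γ' : Wt} → (∀ k → γ k ≡ γ' k) → ∀ k → raise i j γ k ≡ raise i j γ' k
raise-cong i j h k = cong (λ x → x ℤ.+ (δ i k ℤ.- δ j k)) (h k)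

inv-ext : ∀ i j {f} → Ext f → Ext (inv i j f)
inv-ext i j ef h zero = ef h zero
inv-ext i j ef h (suc d) = cong₂ ℤ._+_ (ef h (suc d)) (inv-ext i j ef (raise-cong i j h) d)

inv-cong : ∀ i j {f g} → f ≈ g → inv i j f ≈ inv i j g
inv-cong i j h γ zero = h γ zero
inv-cong i j h γ (suc d) = cong₂ ℤ._+_ (h γ (suc d)) (inv-cong i j h (raise i j γ) d)

-- Both sides are the double series of the terms t^(a+b) f(R_ij^a R_kl^b γ). Unfolding one factor on
-- each side leaves the same single series and two double series at raised weights, which are
-- compared in lower degree; the raisings commute because each adds a fixed vector.
inv-comm : ∀ i j k l {f} → Ext f → inv i j (inv k l f) ≈ inv k l (inv i j f)
inv-comm i j k l {f} ef γ zero = refl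
inv-comm i j k l {f} ef γ (suc zero) = lem (f γ 1) (f (raise k l γ) 0) (f (raise i j γ) 0)
  where lem : ∀ x y z → x ℤ.+ y ℤ.+ z ≡ x ℤ.+ z ℤ.+ y
        lem = solve-∀
inv-comm i j k l {f} ef γ (suc (suc d)) = ≡.trans
  (cong₂ (λ x y → f γ (suc (suc d)) ℤ.+ x ℤ.+ y) refl (inv-comm i j k l ef (raise i j γ) (suc d)))
  (≡.trans (cong (λ z → f γ (suc (suc d)) ℤ.+ B ℤ.+ (A ℤ.+ z)) C≡)
  (≡.trans (lem (f γ (suc (suc d))) A B _)
    (cong (λ z → f γ (suc (suc d)) ℤ.+ A ℤ.+ z) (inv-comm i j k l ef (raise k l γ) (suc d)))))
  where
  A = inv i j f (raise i j γ) (suc d)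
  B = inv k l f (raise k l γ) (suc d)
  C≡ : inv k l (inv i j f) (raise k l (raise i j γ)) d ≡ inv i j (inv k l f) (raise i j (raise k l γ)) d
  C≡ = ≡.trans (sym (inv-comm i j k l ef (raise k l (raise i j γ)) d))
    (inv-ext i j (inv-ext k l ef) (λ m → lem' (γ m) (δ i m ℤ.- δ j m) (δ k m ℤ.- δ l m)) d)
    where lem' : ∀ x y z → x ℤ.+ y ℤ.+ z ≡ x ℤ.+ z ℤ.+ y
          lem' = solve-∀
  lem : ∀ x a b c → x ℤ.+ b ℤ.+ (a ℤ.+ c) ≡ x ℤ.+ a ℤ.+ (b ℤ.+ c)
  lem = solve-∀

cat : List (ℕ × ℕ) → Fn → Fn
cat [] f = f
cat ((i , j) ∷ Ψ) f = inv i j (cat Ψ f)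

cat-ext : ∀ Ψ {f} → Ext f → Ext (cat Ψ f)
cat-ext [] ef = ef
cat-ext ((i , j) ∷ Ψ) ef = inv-ext i j (cat-ext Ψ ef)

cat-↭ : ∀ {Ψ Ψ'} {f} → Ext f → Ψ ↭ Ψ' → cat Ψ f ≈ cat Ψ' f
cat-↭ ef refl γ d = refl
cat-↭ ef (prep (i , j) p) γ d = inv-cong i j (cat-↭ ef p) γ d
cat-↭ {Ψ' = _ ∷ _ ∷ Ψ'} ef (swap (i , j) (k , l) p) γ d =
  ≡.trans (inv-cong i j (inv-cong k l (cat-↭ ef p)) γ d) (inv-comm i j k l (cat-ext Ψ' ef) γ d)
cat-↭ ef (trans p q) γ d = ≡.trans (cat-↭ ef p γ d) (cat-↭ ef q γ d)

_⊞_ : Wt → Wt → Wt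
(γ ⊞ v) k = γ k ℤ.+ v k

cat-cong : ∀ Ψ {f g} → f ≈ g → cat Ψ f ≈ cat Ψ g
cat-cong [] h = h
cat-cong ((i , j) ∷ Ψ) h = inv-cong i j (cat-cong Ψ h)

inv-translate : ∀ i j {f} → Ext f → ∀ v γ d → inv i j (λ γ → f (γ ⊞ v)) γ d ≡ inv i j f (γ ⊞ v) d
inv-translate i j ef v γ zero = refl
inv-translate i j {f} ef v γ (suc d) = cong (λ z → f (γ ⊞ v) (suc d) ℤ.+ z)
  (≡.trans (inv-translate i j ef v (raise i j γ) d) (inv-ext i j ef (λ k → lem (γ k) (δ i k ℤ.- δ j k) (v k)) d))
  where lem : ∀ x y z → x ℤ.+ y ℤ.+ z ≡ x ℤ.+ z ℤ.+ y
        lem = solve-∀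

cat-translate : ∀ Ψ {f} → Ext f → ∀ v γ d → cat Ψ (λ γ → f (γ ⊞ v)) γ d ≡ cat Ψ f (γ ⊞ v) d
cat-translate [] ef v γ d = refl
cat-translate ((i , j) ∷ Ψ) ef v γ d =
  ≡.trans (inv-cong i j (cat-translate Ψ ef v) γ d) (inv-translate i j (cat-ext Ψ ef) v γ d)

cat-+ : ∀ Ψ f g γ d → cat Ψ (λ γ d → f γ d ℤ.+ g γ d) γ d ≡ cat Ψ f γ d ℤ.+ cat Ψ g γ d
cat-+ [] f g γ d = refl
cat-+ ((i , j) ∷ Ψ) f g γ d = ≡.trans (inv-cong i j (cat-+ Ψ f g) γ d) (go γ d)
  where
  lem : ∀ a b c d → a ℤ.+ b ℤ.+ (c ℤ.+ d) ≡ a ℤ.+ c ℤ.+ (b ℤ.+ d)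
  lem = solve-∀
  go : ∀ γ d → inv i j (λ γ d → cat Ψ f γ d ℤ.+ cat Ψ g γ d) γ d ≡ inv i j (cat Ψ f) γ d ℤ.+ inv i j (cat Ψ g) γ d
  go γ zero = refl
  go γ (suc d) = ≡.trans (cong (λ z → cat Ψ f γ (suc d) ℤ.+ cat Ψ g γ (suc d) ℤ.+ z) (go (raise i j γ) d))
    (lem (cat Ψ f γ (suc d)) (cat Ψ g γ (suc d)) _ _)

-- The dot action of adjacent transpositions

sw : ℕ → ℕ → ℕ
sw z k with k ≟ z | k ≟ suc z
... | yes _ | _ = suc z
... | no _ | yes _ = z
... | no _ | no _ = k

sw-l : ∀ z → sw z z ≡ suc z
sw-l z with z ≟ z | z ≟ suc z
... | yes _ | _ = refl
... | no h | _ = ⊥-elim (h refl)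

sw-r : ∀ z → sw z (suc z) ≡ z
sw-r z with suc z ≟ z | suc z ≟ suc z
... | yes h | _ = ⊥-elim (ℕP.1+n≢n h)
... | no _ | yes _ = refl
... | no _ | no h = ⊥-elim (h refl)

sw-o : ∀ z k → k ≢ z → k ≢ suc z → sw z k ≡ k
sw-o z k h h' with k ≟ z | k ≟ suc z
... | yes e | _ = ⊥-elim (h e)
... | no _ | yes e = ⊥-elim (h' e)
... | no _ | no _ = refl

data Place (z : ℕ) : ℕ → Set where
  left : Place z z
  right : Place z (suc z)
  other : ∀ {k} → k ≢ z → k ≢ suc z → Place z k

place : ∀ z k → Place z k
place z k with k ≟ z | k ≟ suc z
... | yes refl | _ = left
... | no _ | yes refl = right
... | no h | no h' = other h h'

sw-invol : ∀ z k → sw z (sw z k) ≡ k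
sw-invol z k with place z k
... | left = ≡.trans (cong (sw z) (sw-l z)) (sw-r z)
... | right = ≡.trans (cong (sw z) (sw-r z)) (sw-l z)
... | other h h' = ≡.trans (cong (sw z) (sw-o z k h h')) (sw-o z k h h')

sw-inj : ∀ z {i k} → sw z i ≡ sw z k → i ≡ k
sw-inj z {i} {k} e = ≡.trans (sym (sw-invol z i)) (≡.trans (cong (sw z) e) (sw-invol z k))

δ-sw : ∀ z i k → δ i (sw z k) ≡ δ (sw z i) k
δ-sw z i k with i ≟ sw z k
... | yes refl = ≡.trans (δ-refl (sw z k)) (sym (≡.trans (cong (λ x → δ x k) (sw-invol z k)) (δ-refl k)))
... | no h = ≡.trans (δ-≢ _ _ h) (sym (δ-≢ _ _ (λ e → h (sw-inj z (≡.trans e (sym (sw-invol z k)))))))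

-- This is s_z(γ + ρ) - ρ with ρ_i = -i. In terms of the beads γ_i - i it simply exchanges rows `z`
-- and `z + 1`.
dotSwap : ℕ → Wt → Wt
dotSwap z γ k = γ (sw z k) ℤ.+ (δ (suc z) k ℤ.- δ z k)

Anti : ℕ → Fn → Fn → Set
Anti z f g = ∀ γ d → f (dotSwap z γ) d ≡ ℤ.- g γ d

-- The dot action is affine with linear part the swap, so it turns adding the root (i, j) into
-- adding the swapped root.
inv-anti : ∀ z i j {f g} → Ext f → Anti z f g → Anti z (inv i j f) (inv (sw z i) (sw z j) g)
inv-anti z i j ef h γ zero = h γ zero
inv-anti z i j {f} {g} ef h γ (suc d) = ≡.trans
  (cong₂ ℤ._+_ (h γ (suc d)) (≡.trans (inv-ext i j ef eq d) (inv-anti z i j ef h (raise (sw z i) (sw z j) γ) d)))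
  (sym (ℤP.neg-distrib-+ (g γ (suc d)) _))
  where
  lem : ∀ x y z → x ℤ.+ y ℤ.+ z ≡ x ℤ.+ z ℤ.+ y
  lem = solve-∀
  eq : ∀ k → raise i j (dotSwap z γ) k ≡ dotSwap z (raise (sw z i) (sw z j) γ) k
  eq k = ≡.trans (lem (γ (sw z k)) _ (δ i k ℤ.- δ j k))
    (cong₂ (λ x y → γ (sw z k) ℤ.+ (x ℤ.- y) ℤ.+ (δ (suc z) k ℤ.- δ z k)) (adj i) (adj j))
    where
    adj : ∀ i → δ i k ≡ δ (sw z i) (sw z k)
    adj i = sym (≡.trans (δ-sw z (sw z i) k) (cong (λ x → δ x k) (sw-invol z i)))

swap₂ : ℕ → ℕ × ℕ → ℕ × ℕ
swap₂ z (i , j) = sw z i , sw z j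

cat-anti : ∀ z Ψ {f g} → Ext f → Anti z f g → Anti z (cat Ψ f) (cat (map (swap₂ z) Ψ) g)
cat-anti z [] ef h = h
cat-anti z ((i , j) ∷ Ψ) ef h = inv-anti z i j (cat-ext Ψ ef) (cat-anti z Ψ ef h)

self-negative : ∀ x → x ≡ ℤ.- x → x ≡ 0ℤ
self-negative (+ 0) _ = refl
self-negative (+ suc _) ()
self-negative -[1+ _ ] ()

-- The condition on γ says that the beads of rows `z` and `z + 1` collide, so γ is fixed by the dot
-- action. With a swap-stable root set the value is then its own negative.
mirror : ∀ z Ψ {f} → Ext f → Anti z f f → map (swap₂ z) Ψ ↭ Ψ → ∀ γ → γ (suc z) ≡ γ z ℤ.+ 1ℤ → ∀ d → cat Ψ f γ d ≡ 0ℤ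
mirror z Ψ {f} ef h p γ eq d = self-negative _
  (≡.trans (cat-ext Ψ ef (λ k → sym (fixed k)) d)
  (≡.trans (cat-anti z Ψ ef h γ d) (cong ℤ.-_ (cat-↭ ef p γ d))))
  where
  fixed : ∀ k → dotSwap z γ k ≡ γ k
  fixed k with place z k
  ... | left rewrite sw-l z | eq | δ-≢ (suc z) z ℕP.1+n≢n | δ-refl z = lem (γ z)
    where lem : ∀ x → x ℤ.+ 1ℤ ℤ.+ (0ℤ ℤ.- 1ℤ) ≡ x
          lem = solve-∀
  ... | right rewrite sw-r z | eq | δ-≢ z (suc z) (λ e → ℕP.1+n≢n (sym e)) | δ-refl z = lem (γ z)
    where lem : ∀ x → x ℤ.+ (1ℤ ℤ.- 0ℤ) ≡ x ℤ.+ 1ℤ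
          lem = solve-∀
  ... | other h₁ h₂ rewrite sw-o z k h₁ h₂ | δ-≢ z k (λ e → h₁ (sym e)) | δ-≢ (suc z) k (λ e → h₂ (sym e)) = ℤP.+-identityʳ _

sh : (ℕ → ℤ) → ℕ → ℤ
sh g zero = 0ℤ
sh g (suc d) = g d

sh-cong : ∀ {g h : ℕ → ℤ} → (∀ d → g d ≡ h d) → ∀ d → sh g d ≡ sh h d
sh-cong e zero = refl
sh-cong e (suc d) = e d

sh-zero : ∀ {g : ℕ → ℤ} → (∀ d → g d ≡ 0ℤ) → ∀ d → sh g d ≡ 0ℤ
sh-zero e zero = refl
sh-zero e (suc d) = e d

upd : (ℕ → ℕ) → ℕ → ℕ → ℕ → ℕ
upd E r v k with k ≟ r
... | yes _ = v
... | no _ = E k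

upd-same : ∀ E r v → upd E r v r ≡ v
upd-same E r v with r ≟ r
... | yes _ = refl
... | no h = ⊥-elim (h refl)

upd-other : ∀ E r v k → k ≢ r → upd E r v k ≡ E k
upd-other E r v k h with k ≟ r
... | yes e = ⊥-elim (h e)
... | no _ = refl

inv-sh : ∀ i j f γ d → inv i j f γ d ≡ f γ d ℤ.+ sh (inv i j f (raise i j γ)) d
inv-sh i j f γ zero = sym (ℤP.+-identityʳ _)
inv-sh i j f γ (suc d) = refl

sub : ℕ → Wt → Wt
sub p γ k = γ k ℤ.- δ p k

wt-shift : ∀ (a e e' : ℕ) (x y u v : ℤ) → x ≡ u → y ≡ v → + e' ≡ + e ℤ.- (u ℤ.- v) → + a ℤ.- + e ℤ.+ (x ℤ.- y) ≡ + a ℤ.- + e'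
wt-shift a e e' x y u v p q r = linear (_ ∷ e ∷ a ∷ []) (_ ∷ _ ∷ _ ∷ _ ∷ []) (# 0 ≈ᶻ # 1 ∷ # 2 ≈ᶻ # 3 ∷ ↑ # 0 ≈ᶻ ↑ # 1 ⊖ (# 1 ⊖ # 3) ∷ [] ⊢ ↑ # 2 ⊖ ↑ # 1 ⊕ (# 0 ⊖ # 2) ≈ᶻ ↑ # 2 ⊖ ↑ # 0) (p , q , r)

wt-sub : ∀ (a e e' : ℕ) (x u : ℤ) → x ≡ u → + e' ≡ + e ℤ.+ u → + a ℤ.- + e ℤ.- x ≡ + a ℤ.- + e'
wt-sub a e e' x u p r = linear (_ ∷ e ∷ a ∷ []) (_ ∷ _ ∷ []) (# 0 ≈ᶻ # 1 ∷ ↑ # 0 ≈ᶻ ↑ # 1 ⊕ # 1 ∷ [] ⊢ ↑ # 2 ⊖ ↑ # 1 ⊖ # 0 ≈ᶻ ↑ # 2 ⊖ ↑ # 0) (p , r)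

wt : ℕ → (ℕ → ℕ) → Wt
wt n E k = + (k ℕ.+ n) ℤ.- + E k

-- Root sets given by the first column of each row

module Catalan (ℓ : ℕ) where

  allPairs : List (ℕ × ℕ)
  allPairs = cartesianProduct (upTo ℓ) (upTo ℓ)

  roots : (ℕ → ℕ) → List (ℕ × ℕ)
  roots E = filter (λ x → E (proj₁ x) ≤? proj₂ x) allPairs

  roots-unique : ∀ E → Unique (roots E)
  roots-unique E = Uniq.filter⁺ (λ x → E (proj₁ x) ≤? proj₂ x) (Uniq.cartesianProduct⁺ (Uniq.upTo⁺ ℓ) (Uniq.upTo⁺ ℓ))

  ∈-roots⁺ : ∀ E {i j} → i < ℓ → j < ℓ → E i ≤ j → (i , j) ∈ roots E
  ∈-roots⁺ E a b c = ∈-filter⁺ (λ x → E (proj₁ x) ≤? proj₂ x) (∈-cartesianProduct⁺ (∈-upTo⁺ a) (∈-upTo⁺ b)) c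

  ∈-roots⁻ : ∀ E {i j} → (i , j) ∈ roots E → i < ℓ × j < ℓ × E i ≤ j
  ∈-roots⁻ E m with ∈-filter⁻ (λ x → E (proj₁ x) ≤? proj₂ x) {xs = allPairs} m
  ... | m' , c with ∈-cartesianProduct⁻ (upTo ℓ) (upTo ℓ) m'
  ...   | a , b = ∈-upTo⁻ a , ∈-upTo⁻ b , c

  H : (ℕ → ℕ) → Fn → Fn
  H E f = cat (roots E) f

  roots-same : ∀ E E' → (∀ i j → i < ℓ → j < ℓ → E i ≤ j → E' i ≤ j) → ∀ x → x ∈ roots E → x ∈ roots E'
  roots-same E E' h (i , j) m = let (a , b , c) = ∈-roots⁻ E m in ∈-roots⁺ E' a b (h i j a b c)

  H-same : ∀ {f} → Ext f → ∀ E E' → (∀ i j → i < ℓ → j < ℓ → E i ≤ j → E' i ≤ j) →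
    (∀ i j → i < ℓ → j < ℓ → E' i ≤ j → E i ≤ j) → H E f ≈ H E' f
  H-same ef E E' h h' = cat-↭ ef (same-members⇒↭ (roots-unique E) (roots-unique E') (roots-same E E' h) (roots-same E' E h'))

  H-cong : ∀ {f} → Ext f → ∀ E E' → (∀ i → i < ℓ → E i ≡ E' i) → H E f ≈ H E' f
  H-cong ef E E' h = H-same ef E E' (λ i j a b c → subst (_≤ j) (h i a) c) (λ i j a b c → subst (_≤ j) (sym (h i a)) c)

  -- The identity 1/(1 - tR) = 1 + tR/(1 - tR), applied to the first root of row `r`.
  remove : ∀ {f} → Ext f → ∀ E E' r → r < ℓ → E r < ℓ → E' r ≡ suc (E r) → (∀ k → k ≢ r → E' k ≡ E k) →
    ∀ γ d → H E f γ d ≡ H E' f γ d ℤ.+ sh (H E f (raise r (E r) γ)) d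
  remove {f} ef E E' r r<ℓ c<ℓ e₁ e₂ γ d = ≡.trans (p≈ γ d) (≡.trans (inv-sh r (E r) (H E' f) γ d)
      (cong (λ x → H E' f γ d ℤ.+ x) (sh-cong (λ d → sym (p≈ (raise r (E r) γ) d)) d)))
    where
    fwd : ∀ x → x ∈ roots E → x ∈ (r , E r) ∷ roots E'
    fwd (i , j) m with ∈-roots⁻ E m | i ≟ r | j ≟ E r
    ... | a , b , c | yes refl | yes refl = here refl
    ... | a , b , c | yes refl | no h = there (∈-roots⁺ E' a b (subst (_≤ j) (sym e₁) (ℕP.≤∧≢⇒< c (h ∘ sym))))
    ... | a , b , c | no h | _ = there (∈-roots⁺ E' a b (subst (_≤ j) (sym (e₂ i h)) c))
    bwd : ∀ x → x ∈ (r , E r) ∷ roots E' → x ∈ roots E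
    bwd x (here refl) = ∈-roots⁺ E r<ℓ c<ℓ ℕP.≤-refl
    bwd (i , j) (there m) with ∈-roots⁻ E' m | i ≟ r
    ... | a , b , c | yes refl = ∈-roots⁺ E a b (ℕP.<⇒≤ (subst (_≤ j) e₁ c))
    ... | a , b , c | no h = ∈-roots⁺ E a b (subst (_≤ j) (e₂ i h) c)
    fresh : All ((r , E r) ≢_) (roots E')
    fresh = All.tabulate (λ m e → ℕP.<-irrefl refl (subst (_≤ E r) e₁ (proj₂ (proj₂ (∈-roots⁻ E' (subst (_∈ roots E') (sym e) m))))))
    p≈ : H E f ≈ inv r (E r) (H E' f)
    p≈ = cat-↭ ef (same-members⇒↭ (roots-unique E) (fresh ∷ roots-unique E') fwd bwd)

  -- Rows `z` and `z + 1` of the root set agree because their starts do. Columns `z` and `z + 1`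
  -- agree because only a row starting in column `z + 1` could meet one of them without the other.
  -- So the root set is stable under the swap.
  mirrorH : ∀ {f} z → Ext f → Anti z f f → suc z < ℓ → ∀ E → E z ≡ E (suc z) → (∀ r → r < ℓ → E r ≢ suc z) →
    ∀ γ → γ (suc z) ≡ γ z ℤ.+ 1ℤ → ∀ d → H E f γ d ≡ 0ℤ
  mirrorH {f} z ef af z<ℓ E e no-r γ eq d = mirror z (roots E) ef af
    (same-members⇒↭ (Uniq.map⁺ inj (roots-unique E)) (roots-unique E) fwd bwd) γ eq d
    where
    inj : ∀ {x y} → swap₂ z x ≡ swap₂ z y → x ≡ y
    inj h = cong₂ _,_ (sw-inj z (cong proj₁ h)) (sw-inj z (cong proj₂ h))
    sw-< : ∀ i → i < ℓ → sw z i < ℓ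
    sw-< i h with place z i
    ... | left = subst (_< ℓ) (sym (sw-l z)) z<ℓ
    ... | right = subst (_< ℓ) (sym (sw-r z)) (ℕP.<-trans (ℕP.n<1+n z) z<ℓ)
    ... | other a b = subst (_< ℓ) (sym (sw-o z i a b)) h
    E-sw : ∀ i → E (sw z i) ≡ E i
    E-sw i with place z i
    ... | left = ≡.trans (cong E (sw-l z)) (sym e)
    ... | right = ≡.trans (cong E (sw-r z)) e
    ... | other a b = cong E (sw-o z i a b)
    col : ∀ i j → i < ℓ → E i ≤ j → E i ≤ sw z j
    col i j a c with place z j
    ... | left = subst (E i ≤_) (sym (sw-l z)) (ℕP.m≤n⇒m≤1+n c)
    ... | right = subst (E i ≤_) (sym (sw-r z)) (ℕP.≤-pred (ℕP.≤∧≢⇒< c (no-r i a)))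
    ... | other p q = subst (E i ≤_) (sym (sw-o z j p q)) c
    closed : ∀ x → x ∈ roots E → swap₂ z x ∈ roots E
    closed (i , j) m = let (a , b , c) = ∈-roots⁻ E m in
      ∈-roots⁺ E (sw-< i a) (sw-< j b) (subst (_≤ sw z j) (sym (E-sw i)) (col i j a c))
    fwd : ∀ x → x ∈ map (swap₂ z) (roots E) → x ∈ roots E
    fwd x m with ∈-map⁻ (swap₂ z) m
    ... | y , m' , refl = closed y m'
    bwd : ∀ x → x ∈ roots E → x ∈ map (swap₂ z) (roots E)
    bwd (i , j) m = subst (_∈ map (swap₂ z) (roots E)) (cong₂ _,_ (sw-invol z i) (sw-invol z j)) (∈-map⁺ (swap₂ z) (closed (i , j) m))

  -- Three changes of a single root. Without (r, z+1) the root set is swap-stable and its value at γ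
  -- vanishes, so only the raised term survives. At the raised weight the entries `z` and `z + 1`
  -- are equal. Adding the root (r, z), and then deleting the first root of row `z + 1`, each cost a
  -- term with the swap-stable root set `E₂` at a weight fixed by the dot action, hence nothing.
  slide : ∀ {f} z r → Ext f → Anti z f f → suc z < ℓ → r < ℓ → ∀ E E' →
    E z ≡ E (suc z) → suc z < E z → E r ≡ suc z → (∀ k → k < ℓ → E k ≡ suc z → k ≡ r) →
    E' r ≡ z → E' (suc z) ≡ suc (E z) → (∀ k → k ≢ r → k ≢ suc z → E' k ≡ E k) →
    ∀ γ → γ (suc z) ≡ γ z ℤ.+ 1ℤ → ∀ d → H E f γ d ≡ sh (H E' f (raise r (suc z) γ)) d
  slide {f} z r ef af z<ℓ r<ℓ E E' e gt er uniq e'r e'z e'o γ γe d =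
    ≡.trans (remove ef E E₁ r r<ℓ (subst (_< ℓ) (sym er) z<ℓ) (upd-same E r _) (upd-other E r _) γ d)
    (≡.trans (cong (λ x → x ℤ.+ sh (H E f (raise r (E r) γ)) d) (mirrorH z ef af z<ℓ E₁ E₁z E₁no γ γe d))
    (≡.trans (ℤP.+-identityˡ _) (sh-cong (λ d → ≡.trans (cat-ext (roots E) ef (λ k → cong (λ x → raise r x γ k) er) d) (≡.trans (step₂ d) (step₄ d))) d)))
    where
    z≢sz : z ≢ suc z
    z≢sz h = ℕP.1+n≢n (sym h)
    z≢r : z ≢ r
    z≢r refl = ℕP.<-irrefl (sym er) gt
    sz≢r : suc z ≢ r
    sz≢r refl = ℕP.<-irrefl (≡.trans (sym er) (sym e)) gt
    E₁ E₂ : ℕ → ℕ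
    E₁ = upd E r (suc (E r))
    E₂ = upd E r z
    E₁z : E₁ z ≡ E₁ (suc z)
    E₁z = ≡.trans (upd-other E r _ z z≢r) (≡.trans e (sym (upd-other E r _ (suc z) sz≢r)))
    E₁no : ∀ k → k < ℓ → E₁ k ≢ suc z
    E₁no k k<ℓ h with k ≟ r
    ... | yes refl = ℕP.1+n≢n (≡.trans h (sym er))
    ... | no k≢r = k≢r (uniq k k<ℓ h)
    E₂z : E₂ z ≡ E₂ (suc z)
    E₂z = ≡.trans (upd-other E r _ z z≢r) (≡.trans e (sym (upd-other E r _ (suc z) sz≢r)))
    E₂no : ∀ k → k < ℓ → E₂ k ≢ suc z
    E₂no k k<ℓ h with k ≟ r
    ... | yes refl = z≢sz h
    ... | no k≢r = k≢r (uniq k k<ℓ h)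
    γ' : Wt
    γ' = raise r (suc z) γ
    δrz = δ-≢ r z (z≢r ∘ sym)
    δrsz = δ-≢ r (suc z) (sz≢r ∘ sym)
    δszz = δ-≢ (suc z) z (z≢sz ∘ sym)
    δzsz = δ-≢ z (suc z) z≢sz
    γ'z : γ' z ≡ γ z
    γ'z rewrite δrz | δszz = ℤP.+-identityʳ _
    γ'sz : γ' (suc z) ≡ γ z
    γ'sz rewrite δrsz | δ-refl z | γe = lem (γ z)
      where lem : ∀ x → x ℤ.+ 1ℤ ℤ.+ (0ℤ ℤ.- 1ℤ) ≡ x
            lem = solve-∀
    step₂ : ∀ d → H E f γ' d ≡ H E₂ f γ' d
    step₂ d = sym (≡.trans (remove ef E₂ E r r<ℓ (subst (_< ℓ) (sym e₂r) (ℕP.<-trans (ℕP.n<1+n z) z<ℓ))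
        (≡.trans er (cong suc (sym e₂r))) (λ k h → sym (upd-other E r z k h)) γ' d)
      (≡.trans (cong (λ x → H E f γ' d ℤ.+ x) (sh-zero (mirrorH z ef af z<ℓ E₂ E₂z E₂no _ defect) d)) (ℤP.+-identityʳ _)))
      where
      e₂r = upd-same E r z
      defect : raise r (E₂ r) γ' (suc z) ≡ raise r (E₂ r) γ' z ℤ.+ 1ℤ
      defect rewrite e₂r | γ'z | γ'sz | δrz | δrsz | δ-refl z | δzsz = lem (γ z)
        where lem : ∀ x → x ℤ.+ (0ℤ ℤ.- 0ℤ) ≡ x ℤ.+ (0ℤ ℤ.- 1ℤ) ℤ.+ 1ℤ
              lem = solve-∀
    c≡ : E₂ (suc z) ≡ E z
    c≡ = ≡.trans (upd-other E r z (suc z) sz≢r) (sym e)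
    E'≡ : ∀ k → k ≢ suc z → E' k ≡ E₂ k
    E'≡ k h with k ≟ r
    ... | yes refl = e'r
    ... | no h' = e'o k h' h
    step₄ : ∀ d → H E₂ f γ' d ≡ H E' f γ' d
    step₄ d with E₂ (suc z) <? ℓ
    ... | yes c<ℓ = ≡.trans (remove ef E₂ E' (suc z) z<ℓ c<ℓ (≡.trans e'z (cong suc (sym c≡))) E'≡ γ' d)
      (≡.trans (cong (λ x → H E' f γ' d ℤ.+ x) (sh-zero (mirrorH z ef af z<ℓ E₂ E₂z E₂no _ defect) d)) (ℤP.+-identityʳ _))
      where
      c≢z : E₂ (suc z) ≢ z
      c≢z h = ℕP.<-irrefl (≡.trans (sym h) c≡) (ℕP.<-trans (ℕP.n<1+n z) gt)
      c≢sz : E₂ (suc z) ≢ suc z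
      c≢sz h = ℕP.<-irrefl (≡.trans (sym h) c≡) gt
      defect : raise (suc z) (E₂ (suc z)) γ' (suc z) ≡ raise (suc z) (E₂ (suc z)) γ' z ℤ.+ 1ℤ
      defect rewrite γ'z | γ'sz | δ-refl z | δszz | δ-≢ _ _ c≢z | δ-≢ _ _ c≢sz = lem (γ z)
        where lem : ∀ x → x ℤ.+ (1ℤ ℤ.- 0ℤ) ≡ x ℤ.+ (0ℤ ℤ.- 0ℤ) ℤ.+ 1ℤ
              lem = solve-∀
    -- Row `z + 1` starts beyond the last column, so it has no root to delete and moving its start
    -- further changes nothing.
    ... | no c≮ℓ = H-same ef E₂ E' one two γ' d
      where
      one : ∀ i j → i < ℓ → j < ℓ → E₂ i ≤ j → E' i ≤ j
      one i j a b c with i ≟ suc z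
      ... | yes refl = ⊥-elim (c≮ℓ (ℕP.≤-<-trans c b))
      ... | no h = subst (_≤ j) (sym (E'≡ i h)) c
      two : ∀ i j → i < ℓ → j < ℓ → E' i ≤ j → E₂ i ≤ j
      two i j a b c with i ≟ suc z
      ... | yes refl = ⊥-elim (c≮ℓ (ℕP.≤-<-trans (ℕP.≤-trans (ℕP.≤-reflexive c≡) (ℕP.≤-trans (ℕP.n≤1+n _) (subst (_≤ j) e'z c))) b))
      ... | no h = subst (_≤ j) (E'≡ i h) c

  -- Weight and roots are read off from the same start function, as for a core with `E = D`. A whole
  -- straightening can thus be followed on start functions alone.
  Φ : ℕ → Fn → (ℕ → ℕ) → ℕ → ℤ
  Φ n f E d = H E f (wt n E) d

  Φ-cong : ∀ n {f} → Ext f → ∀ E E' → (∀ i → E i ≡ E' i) → ∀ d → Φ n f E d ≡ Φ n f E' d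
  Φ-cong n ef E E' h d = ≡.trans (H-cong ef E E' (λ i _ → h i) _ d)
    (cat-ext (roots E') ef (λ i → cong (λ x → + (i ℕ.+ n) ℤ.- + x) (h i)) d)

  wt-defect : ∀ n E z → E z ≡ E (suc z) → wt n E (suc z) ≡ wt n E z ℤ.+ 1ℤ
  wt-defect n E z e = lem (z ℕ.+ n) (E z) (E (suc z)) e
    where lem : ∀ a x y → x ≡ y → + suc a ℤ.- + y ≡ + a ℤ.- + x ℤ.+ 1ℤ
          lem a x y h = linear (_ ∷ _ ∷ a ∷ []) [] (# 0 ≈ⁿ # 1 ∷ [] ⊢ ↑ 1+ # 2 ⊖ ↑ # 1 ≈ᶻ ↑ # 2 ⊖ ↑ # 0 ⊕ lit 1ℤ) h

  Φ-zero : ∀ n {f} z → Ext f → Anti z f f → suc z < ℓ → ∀ E → E z ≡ E (suc z) → (∀ r → r < ℓ → E r ≢ suc z) → ∀ d → Φ n f E d ≡ 0ℤ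
  Φ-zero n z ef af z<ℓ E e no-r = mirrorH z ef af z<ℓ E e no-r (wt n E) (wt-defect n E z e)

  -- The root added to the weight by `slide` is exactly the change of `wt` from `E` to `E'`, so the
  -- value keeps the form `Φ`.
  Φ-slide : ∀ n {f} z r → Ext f → Anti z f f → suc z < ℓ → r < ℓ → ∀ E E' →
    E z ≡ E (suc z) → suc z < E z → E r ≡ suc z → (∀ k → k < ℓ → E k ≡ suc z → k ≡ r) →
    E' r ≡ z → E' (suc z) ≡ suc (E z) → (∀ k → k ≢ r → k ≢ suc z → E' k ≡ E k) →
    ∀ d → Φ n f E d ≡ sh (Φ n f E') d
  Φ-slide n {f} z r ef af z<ℓ r<ℓ E E' e gt er uniq e'r e'z e'o d =
    ≡.trans (slide z r ef af z<ℓ r<ℓ E E' e gt er uniq e'r e'z e'o (wt n E) (wt-defect n E z e) d)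
      (sh-cong (cat-ext (roots E') ef same) d)
    where
    r≢sz : r ≢ suc z
    r≢sz refl = ℕP.<-irrefl (≡.trans (sym er) (sym e)) gt
    same : ∀ k → raise r (suc z) (wt n E) k ≡ wt n E' k
    same k with k ≟ r | k ≟ suc z
    ... | yes refl | _ = wt-shift (k ℕ.+ n) (E k) (E' k) _ _ 1ℤ 0ℤ (δ-refl r) (δ-≢ (suc z) r (r≢sz ∘ sym)) (linear (_ ∷ _ ∷ _ ∷ []) [] (# 0 ≈ⁿ 1+ # 1 ∷ # 2 ≈ⁿ # 1 ∷ [] ⊢ ↑ # 2 ≈ᶻ ↑ # 0 ⊖ (lit 1ℤ ⊖ lit 0ℤ)) (er , e'r))
    ... | no h | yes refl = wt-shift (k ℕ.+ n) (E k) (E' k) _ _ 0ℤ 1ℤ (δ-≢ r k (h ∘ sym)) (δ-refl z) (linear (_ ∷ _ ∷ _ ∷ []) [] (# 0 ≈ⁿ 1+ # 1 ∷ # 1 ≈ⁿ # 2 ∷ [] ⊢ ↑ # 0 ≈ᶻ ↑ # 2 ⊖ (lit 0ℤ ⊖ lit 1ℤ)) (e'z , e))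
    ... | no h | no h' = wt-shift (k ℕ.+ n) (E k) (E' k) _ _ 0ℤ 0ℤ (δ-≢ r k (h ∘ sym)) (δ-≢ (suc z) k (h' ∘ sym)) (linear (_ ∷ _ ∷ []) [] (# 0 ≈ⁿ # 1 ∷ [] ⊢ ↑ # 0 ≈ᶻ ↑ # 1 ⊖ (lit 0ℤ ⊖ lit 0ℤ)) (e'o k h h'))

  -- Expanding the first root of row p: the term divisible by t moves the lowered row from p to E p.
  lower-row : ∀ n {f} → Ext f → ∀ E E' p → p < ℓ → E p < ℓ → E' p ≡ suc (E p) → (∀ k → k ≢ p → E' k ≡ E k) →
    ∀ d → H E f (sub p (wt n E)) d ≡ Φ n f E' d ℤ.+ sh (H E f (sub (E p) (wt n E))) d
  lower-row n {f} ef E E' p p<ℓ c<ℓ e₁ e₂ d = ≡.trans (remove ef E E' p p<ℓ c<ℓ e₁ e₂ _ d)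
    (cong₂ ℤ._+_ (cat-ext (roots E') ef same d) (sh-cong (cat-ext (roots E) ef (λ k → lem (wt n E k) (δ p k) (δ (E p) k))) d))
    where
    lem : ∀ x a b → x ℤ.- a ℤ.+ (a ℤ.- b) ≡ x ℤ.- b
    lem = solve-∀
    same : ∀ k → sub p (wt n E) k ≡ wt n E' k
    same k with k ≟ p
    ... | yes refl = wt-sub (k ℕ.+ n) (E k) (E' k) _ 1ℤ (δ-refl p) (linear (_ ∷ _ ∷ []) [] (# 0 ≈ⁿ 1+ # 1 ∷ [] ⊢ ↑ # 0 ≈ᶻ ↑ # 1 ⊕ lit 1ℤ) e₁)
    ... | no h = wt-sub (k ℕ.+ n) (E k) (E' k) _ 0ℤ (δ-≢ p k (h ∘ sym)) (linear (_ ∷ _ ∷ []) [] (# 0 ≈ⁿ # 1 ∷ [] ⊢ ↑ # 0 ≈ᶻ ↑ # 1 ⊕ lit 0ℤ) (e₂ k h))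

  lower-last-row : ∀ n {f} → Ext f → ∀ E E' p → ℓ ≤ E p → E' p ≡ suc (E p) → (∀ k → k ≢ p → E' k ≡ E k) →
    ∀ d → H E f (sub p (wt n E)) d ≡ Φ n f E' d
  lower-last-row n {f} ef E E' p ℓ≤c e₁ e₂ d = ≡.trans (H-same ef E E' one two _ d) (cat-ext (roots E') ef same d)
    where
    one : ∀ i j → i < ℓ → j < ℓ → E i ≤ j → E' i ≤ j
    one i j a b c with i ≟ p
    ... | yes refl = ⊥-elim (ℕP.<-irrefl refl (ℕP.<-≤-trans b (ℕP.≤-trans ℓ≤c c)))
    ... | no h = subst (_≤ j) (sym (e₂ i h)) c
    two : ∀ i j → i < ℓ → j < ℓ → E' i ≤ j → E i ≤ j
    two i j a b c with i ≟ p
    ... | yes refl = ℕP.<⇒≤ (subst (_≤ j) e₁ c)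
    ... | no h = subst (_≤ j) (e₂ i h) c
    same : ∀ k → sub p (wt n E) k ≡ wt n E' k
    same k with k ≟ p
    ... | yes refl = wt-sub (k ℕ.+ n) (E k) (E' k) _ 1ℤ (δ-refl p) (linear (_ ∷ _ ∷ []) [] (# 0 ≈ⁿ 1+ # 1 ∷ [] ⊢ ↑ # 0 ≈ᶻ ↑ # 1 ⊕ lit 1ℤ) e₁)
    ... | no h = wt-sub (k ℕ.+ n) (E k) (E' k) _ 0ℤ (δ-≢ p k (h ∘ sym)) (linear (_ ∷ _ ∷ []) [] (# 0 ≈ⁿ # 1 ∷ [] ⊢ ↑ # 0 ≈ᶻ ↑ # 1 ⊕ lit 0ℤ) (e₂ k h))

-- Finite sums and tail sums of weights

Σ< : ℕ → (ℕ → ℤ) → ℤ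
Σ< zero g = 0ℤ
Σ< (suc m) g = Σ< m g ℤ.+ g m

Σ<-cong : ∀ m {g h : ℕ → ℤ} → (∀ i → i < m → g i ≡ h i) → Σ< m g ≡ Σ< m h
Σ<-cong zero e = refl
Σ<-cong (suc m) e = cong₂ ℤ._+_ (Σ<-cong m (λ i h → e i (ℕP.m<n⇒m<1+n h))) (e m ℕP.≤-refl)

Σ<-lin : ∀ m (g h k : ℕ → ℤ) → Σ< m (λ i → g i ℤ.+ (h i ℤ.- k i)) ≡ Σ< m g ℤ.+ (Σ< m h ℤ.- Σ< m k)
Σ<-lin zero g h k = refl
Σ<-lin (suc m) g h k = linear [] (_ ∷ Σ< m g ∷ Σ< m h ∷ Σ< m k ∷ g m ∷ h m ∷ k m ∷ []) (# 0 ≈ᶻ # 1 ⊕ (# 2 ⊖ # 3) ∷ [] ⊢ # 0 ⊕ (# 4 ⊕ (# 5 ⊖ # 6)) ≈ᶻ # 1 ⊕ # 4 ⊕ (# 2 ⊕ # 5 ⊖ (# 3 ⊕ # 6))) (Σ<-lin m g h k)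

Σ<-sub : ∀ m (g h : ℕ → ℤ) → Σ< m (λ i → g i ℤ.- h i) ≡ Σ< m g ℤ.- Σ< m h
Σ<-sub zero g h = refl
Σ<-sub (suc m) g h = linear [] (_ ∷ Σ< m g ∷ Σ< m h ∷ g m ∷ h m ∷ []) (# 0 ≈ᶻ # 1 ⊖ # 2 ∷ [] ⊢ # 0 ⊕ (# 3 ⊖ # 4) ≈ᶻ # 1 ⊕ # 3 ⊖ (# 2 ⊕ # 4)) (Σ<-sub m g h)

Σ<-mono : ∀ m {g h : ℕ → ℤ} → (∀ i → i < m → g i ℤ.≤ h i) → Σ< m g ℤ.≤ Σ< m h
Σ<-mono zero e = ℤP.≤-refl
Σ<-mono (suc m) e = ℤP.+-mono-≤ (Σ<-mono m (λ i h → e i (ℕP.m<n⇒m<1+n h))) (e m ℕP.≤-refl)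

Σ<-zero : ∀ m → Σ< m (λ _ → 0ℤ) ≡ 0ℤ
Σ<-zero zero = refl
Σ<-zero (suc m) rewrite Σ<-zero m = refl

Σ<-δ-out : ∀ m i → m ≤ i → Σ< m (δ i) ≡ 0ℤ
Σ<-δ-out m i h = ≡.trans (Σ<-cong m (λ k k<m → δ-≢ i k (λ { refl → ℕP.<-irrefl refl (ℕP.<-≤-trans k<m h) }))) (Σ<-zero m)

Σ<-δ-in : ∀ m i → i < m → Σ< m (δ i) ≡ 1ℤ
Σ<-δ-in (suc m) i h with i ≟ m
... | yes refl rewrite Σ<-δ-out m m ℕP.≤-refl | δ-refl m = refl
... | no i≢m rewrite Σ<-δ-in m i (ℕP.≤∧≢⇒< (ℕP.≤-pred h) i≢m) | δ-≢ i m i≢m = refl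

tailSum : ℕ → ℕ → Wt → ℤ
tailSum ℓ z γ = Σ< (ℓ ∸ z) (λ i → γ (z ℕ.+ i))

tailδ-below : ∀ ℓ z i → i < z → tailSum ℓ z (δ i) ≡ 0ℤ
tailδ-below ℓ z i h = ≡.trans (Σ<-cong (ℓ ∸ z) (λ k _ → δ-≢ i (z ℕ.+ k) (λ e → linear (_ ∷ _ ∷ k ∷ []) [] (# 0 <ⁿ # 1 ∷ # 0 ≈ⁿ # 1 ⊕ # 2 ∷ [] ⊢ absurd) (h , e)))) (Σ<-zero (ℓ ∸ z))

δ-shift : ∀ z i k → δ (z ℕ.+ i) (z ℕ.+ k) ≡ δ i k
δ-shift zero i k = refl
δ-shift (suc z) i k = δ-shift z i k

tailδ-in : ∀ ℓ z i → z ≤ i → i < ℓ → tailSum ℓ z (δ i) ≡ 1ℤ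
tailδ-in ℓ z i h h' = ≡.trans (Σ<-cong (ℓ ∸ z) (λ k _ → ≡.trans (cong (λ x → δ x (z ℕ.+ k)) (sym (ℕP.m+[n∸m]≡n h))) (δ-shift z (i ∸ z) k)))
  (Σ<-δ-in (ℓ ∸ z) (i ∸ z) (ℕP.∸-monoˡ-< h' h))

tailδ-nonneg : ∀ ℓ z i → 0ℤ ℤ.≤ tailSum ℓ z (δ i)
tailδ-nonneg ℓ z i = subst (ℤ._≤ tailSum ℓ z (δ i)) (Σ<-zero (ℓ ∸ z)) (Σ<-mono (ℓ ∸ z) (λ k _ → nn i (z ℕ.+ k)))
  where
  nn : ∀ i k → 0ℤ ℤ.≤ δ i k
  nn zero zero = ℤ.+≤+ z≤n
  nn zero (suc k) = ℤ.+≤+ z≤n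
  nn (suc i) zero = ℤ.+≤+ z≤n
  nn (suc i) (suc k) = nn i k

tailδ-mono : ∀ ℓ z i j → i ≤ j → j < ℓ → tailSum ℓ z (δ i) ℤ.≤ tailSum ℓ z (δ j)
tailδ-mono ℓ z i j h h' with z ≤? i
... | yes z≤i = ℤP.≤-reflexive (≡.trans (tailδ-in ℓ z i z≤i (ℕP.≤-<-trans h h')) (sym (tailδ-in ℓ z j (ℕP.≤-trans z≤i h) h')))
... | no z≰i = subst (ℤ._≤ tailSum ℓ z (δ j)) (sym (tailδ-below ℓ z i (ℕP.≰⇒> z≰i))) (tailδ-nonneg ℓ z j)

-- Raising moves weight to higher rows and lowering removes it, so neither can repair a negative
-- tail sum; the condition survives all operators in use. It serves twice: lowering an empty row
-- gives 0, and roots ending in empty rows act trivially.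
Tail : ℕ → Fn → Set
Tail ℓ f = ∀ z γ → tailSum ℓ z γ ℤ.< 0ℤ → ∀ d → f γ d ≡ 0ℤ

tailSum-raise : ∀ ℓ z i j γ → tailSum ℓ z (raise i j γ) ≡ tailSum ℓ z γ ℤ.+ (tailSum ℓ z (δ i) ℤ.- tailSum ℓ z (δ j))
tailSum-raise ℓ z i j γ = Σ<-lin (ℓ ∸ z) _ _ _

tailSum-sub : ∀ ℓ z p γ → tailSum ℓ z (sub p γ) ≡ tailSum ℓ z γ ℤ.- tailSum ℓ z (δ p)
tailSum-sub ℓ z p γ = Σ<-sub (ℓ ∸ z) _ _

Descending : ℕ → ℕ × ℕ → Set
Descending ℓ (i , j) = i < j × j < ℓ

inv-tail : ∀ ℓ i j {f} → Descending ℓ (i , j) → Tail ℓ f → Tail ℓ (inv i j f)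
inv-tail ℓ i j h tf z γ neg zero = tf z γ neg zero
inv-tail ℓ i j {f} h tf z γ neg (suc d) = ≡.trans (cong₂ ℤ._+_ (tf z γ neg (suc d)) (inv-tail ℓ i j h tf z (raise i j γ) neg' d)) refl
  where neg' : tailSum ℓ z (raise i j γ) ℤ.< 0ℤ
        neg' = linear [] (_ ∷ _ ∷ _ ∷ _ ∷ []) (# 0 ≈ᶻ # 1 ⊕ (# 2 ⊖ # 3) ∷ # 2 ≤ᶻ # 3 ∷ # 1 <ᶻ lit 0ℤ ∷ [] ⊢ # 0 <ᶻ lit 0ℤ) (tailSum-raise ℓ z i j γ , tailδ-mono ℓ z i j (ℕP.<⇒≤ (proj₁ h)) (proj₂ h) , neg)

cat-tail : ∀ ℓ Ψ {f} → All (Descending ℓ) Ψ → Tail ℓ f → Tail ℓ (cat Ψ f)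
cat-tail ℓ [] [] tf = tf
cat-tail ℓ ((i , j) ∷ Ψ) (h ∷ hs) tf = inv-tail ℓ i j h (cat-tail ℓ Ψ hs tf)

-- Raising along (i , j) makes the sum from row j on negative, which Tail functionals do not see.
cat-trivial : ∀ ℓ Ψ {f} → All (Descending ℓ) Ψ → Tail ℓ f → ∀ γ → All (λ x → tailSum ℓ (proj₂ x) γ ℤ.≤ 0ℤ) Ψ → ∀ d → cat Ψ f γ d ≡ f γ d
cat-trivial ℓ [] [] tf γ [] d = refl
cat-trivial ℓ ((i , j) ∷ Ψ) {f} (h ∷ hs) tf γ (t ∷ ts) d = ≡.trans (inv-sh i j (cat Ψ f) γ d)
  (≡.trans (cong₂ ℤ._+_ (cat-trivial ℓ Ψ hs tf γ ts d)
      (sh-zero (inv-tail ℓ i j h (cat-tail ℓ Ψ hs tf) j (raise i j γ) neg) d)) (ℤP.+-identityʳ _))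
  where neg : tailSum ℓ j (raise i j γ) ℤ.< 0ℤ
        neg = linear [] (_ ∷ _ ∷ _ ∷ _ ∷ []) (# 0 ≈ᶻ # 1 ⊕ (# 2 ⊖ # 3) ∷ # 2 ≈ᶻ lit 0ℤ ∷ # 3 ≈ᶻ lit 1ℤ ∷ # 1 ≤ᶻ lit 0ℤ ∷ [] ⊢ # 0 <ᶻ lit 0ℤ) (tailSum-raise ℓ j i j γ , tailδ-below ℓ j i (proj₁ h) , tailδ-in ℓ j j ℕP.≤-refl (proj₂ h) , t)

-- Adding up m distinct naturals: move the value of an index q with x q ≥ m into the last place and recurse.
distinct-sum : ∀ m (x : ℕ → ℕ) → (∀ i j → i < j → j < m → x i ≢ x j) → Σ< m (λ i → + i) ℤ.≤ Σ< m (λ i → + x i)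
distinct-sum zero x inj = ℤP.≤-refl
distinct-sum (suc m) x inj with ℕP.anyUpTo? (λ q → m ≤? x q) (suc m)
... | no none = ⊥-elim (inj _ _ i<j (FinP.toℕ<n j) (≡.trans (sym (val i)) (≡.trans (cong toℕ fe) (val j))))
  where
  small : ∀ q → q < suc m → x q < m
  small q h = ℕP.≰⇒> (λ k → none (q , h , k))
  f : Fin (suc m) → Fin m
  f k = fromℕ< (small (toℕ k) (FinP.toℕ<n k))
  val : ∀ k → toℕ (f k) ≡ x (toℕ k)
  val k = FinP.toℕ-fromℕ< _
  ph = FinP.pigeonhole ℕP.≤-refl f
  i = proj₁ ph
  j = proj₁ (proj₂ ph)
  i<j = proj₁ (proj₂ (proj₂ ph))
  fe = proj₂ (proj₂ (proj₂ ph))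
... | yes (q , q<sm , m≤xq) = linear (_ ∷ _ ∷ _ ∷ x' m ∷ []) (_ ∷ _ ∷ Σ< m (λ i → + x i) ∷ []) (# 0 ≤ᶻ # 1 ∷ # 1 ⊕ ↑ # 0 ≈ᶻ # 2 ⊕ ↑ # 1 ∷ # 2 ≤ⁿ # 0 ∷ ↑ # 3 ⊕ lit 0ℤ ≈ᶻ ↑ # 1 ∷ [] ⊢ # 0 ⊕ ↑ # 2 ≤ᶻ # 2 ⊕ ↑ # 1) (distinct-sum m x' inj' , upd-sum m (q<m) , m≤xq , top)
  where
  x' : ℕ → ℕ
  x' = upd x q (x m)
  top : + x' m ℤ.+ 0ℤ ≡ + x m
  top with m ≟ q
  ... | yes _ = ℤP.+-identityʳ _
  ... | no _ = ℤP.+-identityʳ _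
  q<m : q ≤ m
  q<m = ℕP.≤-pred q<sm
  upd-sum : ∀ k → q ≤ m → Σ< m (λ i → + x' i) ℤ.+ + x q ≡ Σ< m (λ i → + x i) ℤ.+ + x m
  upd-sum k h with q ≟ m
  ... | yes refl = cong (ℤ._+ + x q) (Σ<-cong q (λ i i<q → cong +_ (upd-other x q (x q) i (ℕP.<⇒≢ i<q))))
  ... | no q≢m = go m (ℕP.≤∧≢⇒< h q≢m)
    where
    go : ∀ k → q < k → Σ< k (λ i → + x' i) ℤ.+ + x q ≡ Σ< k (λ i → + x i) ℤ.+ + x m
    go (suc k) h' with q ≟ k
    ... | yes refl = lem _ _ _ _ _ (Σ<-cong q (λ i i<q → cong +_ (upd-other x q (x m) i (ℕP.<⇒≢ i<q)))) (cong +_ (upd-same x q (x m)))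
      where lem : ∀ (s t u v w : ℤ) → s ≡ t → u ≡ v → s ℤ.+ u ℤ.+ w ≡ t ℤ.+ w ℤ.+ v
            lem s t u v w h k = linear [] (_ ∷ _ ∷ _ ∷ _ ∷ w ∷ []) (# 0 ≈ᶻ # 1 ∷ # 2 ≈ᶻ # 3 ∷ [] ⊢ # 0 ⊕ # 2 ⊕ # 4 ≈ᶻ # 1 ⊕ # 4 ⊕ # 3) (h , k)
    ... | no q≢k = lem (Σ< k (λ i → + x' i)) (Σ< k (λ i → + x i)) (+ x' k) (+ x k) (+ x q) (+ x m) (go k (ℕP.≤∧≢⇒< (ℕP.≤-pred h') q≢k)) (cong +_ (upd-other x q (x m) k (λ e → q≢k (sym e))))
      where lem : ∀ (s t u v w w' : ℤ) → s ℤ.+ w ≡ t ℤ.+ w' → u ≡ v → s ℤ.+ u ℤ.+ w ≡ t ℤ.+ v ℤ.+ w'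
            lem s t u v w w' h k = linear [] (s ∷ w ∷ t ∷ w' ∷ _ ∷ _ ∷ []) (# 0 ⊕ # 1 ≈ᶻ # 2 ⊕ # 3 ∷ # 4 ≈ᶻ # 5 ∷ [] ⊢ # 0 ⊕ # 4 ⊕ # 1 ≈ᶻ # 2 ⊕ # 5 ⊕ # 3) (h , k)
  inj' : ∀ i j → i < j → j < m → x' i ≢ x' j
  inj' i j i<j j<m e with i ≟ q | j ≟ q
  ... | yes refl | yes refl = ℕP.<-irrefl refl i<j
  ... | yes refl | no _ = inj j m j<m ℕP.≤-refl (sym e)
  ... | no _ | yes refl = inj i m (ℕP.<-trans i<j j<m) ℕP.≤-refl e
  ... | no _ | no _ = inj i j i<j (ℕP.m<n⇒m<1+n j<m) e

-- Adjoints of multiplication by e_d and h_d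

sub-cong : ∀ p {γ γ' : Wt} → (∀ k → γ k ≡ γ' k) → ∀ k → sub p γ k ≡ sub p γ' k
sub-cong p h k = cong (λ x → x ℤ.- δ p k) (h k)

sub-comm : ∀ p q γ k → sub p (sub q γ) k ≡ sub q (sub p γ) k
sub-comm p q γ k = lem (γ k) (δ p k) (δ q k)
  where lem : ∀ x a b → x ℤ.- b ℤ.- a ≡ x ℤ.- a ℤ.- b
        lem = solve-∀

sub-dotSwap : ∀ z p γ k → sub p (dotSwap z γ) k ≡ dotSwap z (sub (sw z p) γ) k
sub-dotSwap z p γ k = ≡.trans (lem (γ (sw z k)) (δ (suc z) k ℤ.- δ z k) (δ p k))
  (cong (λ x → γ (sw z k) ℤ.- x ℤ.+ (δ (suc z) k ℤ.- δ z k)) (≡.trans (cong (λ q → δ q k) (sym (sw-invol z p))) (sym (δ-sw z (sw z p) k))))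
  where lem : ∀ x y a → x ℤ.+ y ℤ.- a ≡ x ℤ.- a ℤ.+ y
        lem = solve-∀

-- The excluded swap is the one across the boundary between rows before `p` and rows from `p` on.
-- For `p = 0` nothing is excluded.
record Class (ℓ p : ℕ) (f : Fn) : Set where
  field
    ext : Ext f
    vanish : Tail ℓ f
    anti : ∀ z → suc z < ℓ → suc z ≢ p → Anti z f f
open Class public

zeroFn : Fn
zeroFn _ _ = 0ℤ

-- es p d and hs p c d are adjoint to multiplication by e_d in the first p variables,
-- resp. by h_d in the c variables from the p-th on, acting on weights.
es : ℕ → ℕ → Fn → Fn
es p zero f = f
es zero (suc d) f = zeroFn
es (suc p) (suc d) f γ t = es p (suc d) f γ t ℤ.+ es p d f (sub p γ) t

hs : ℕ → ℕ → ℕ → Fn → Fn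
hs p c zero f = f
hs p zero (suc d) f = zeroFn
hs p (suc c) (suc d) f γ t = hs (suc p) c (suc d) f γ t ℤ.+ hs p (suc c) d f (sub p γ) t

es-ext : ∀ p d {f} → Ext f → Ext (es p d f)
es-ext p zero ef = ef
es-ext zero (suc d) ef = λ _ _ → refl
es-ext (suc p) (suc d) ef h t = cong₂ ℤ._+_ (es-ext p (suc d) ef h t) (es-ext p d ef (sub-cong p h) t)

hs-ext : ∀ p c d {f} → Ext f → Ext (hs p c d f)
hs-ext p c zero ef = ef
hs-ext p zero (suc d) ef = λ _ _ → refl
hs-ext p (suc c) (suc d) ef h t = cong₂ ℤ._+_ (hs-ext (suc p) c (suc d) ef h t) (hs-ext p (suc c) d ef (sub-cong p h) t)

sub-tail : ∀ ℓ z p γ → tailSum ℓ z γ ℤ.< 0ℤ → tailSum ℓ z (sub p γ) ℤ.< 0ℤ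
sub-tail ℓ z p γ h = linear [] (_ ∷ _ ∷ _ ∷ []) (# 0 ≈ᶻ # 1 ⊖ # 2 ∷ lit 0ℤ ≤ᶻ # 2 ∷ # 1 <ᶻ lit 0ℤ ∷ [] ⊢ # 0 <ᶻ lit 0ℤ) (tailSum-sub ℓ z p γ , tailδ-nonneg ℓ z p , h)

es-tail : ∀ ℓ p d {f} → Tail ℓ f → Tail ℓ (es p d f)
es-tail ℓ p zero tf = tf
es-tail ℓ zero (suc d) tf = λ _ _ _ _ → refl
es-tail ℓ (suc p) (suc d) tf z γ h t = cong₂ ℤ._+_ (es-tail ℓ p (suc d) tf z γ h t) (es-tail ℓ p d tf z (sub p γ) (sub-tail ℓ z p γ h) t)

hs-tail : ∀ ℓ p c d {f} → Tail ℓ f → Tail ℓ (hs p c d f)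
hs-tail ℓ p c zero tf = tf
hs-tail ℓ p zero (suc d) tf = λ _ _ _ _ → refl
hs-tail ℓ p (suc c) (suc d) tf z γ h t = cong₂ ℤ._+_ (hs-tail ℓ (suc p) c (suc d) tf z γ h t) (hs-tail ℓ p (suc c) d tf z (sub p γ) (sub-tail ℓ z p γ h) t)

neg-+ : ∀ {a b c d} → a ≡ ℤ.- c → b ≡ ℤ.- d → a ℤ.+ b ≡ ℤ.- (c ℤ.+ d)
neg-+ {c = c} {d} h k = linear [] (_ ∷ c ∷ _ ∷ d ∷ []) (# 0 ≈ᶻ ⊝ # 1 ∷ # 2 ≈ᶻ ⊝ # 3 ∷ [] ⊢ # 0 ⊕ # 2 ≈ᶻ ⊝ (# 1 ⊕ # 3)) (h , k)

sub-fixed : ∀ {z p f} → Ext f → Anti z f f → p ≢ z → p ≢ suc z → ∀ γ t → f (sub p (dotSwap z γ)) t ≡ ℤ.- f (sub p γ) t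
sub-fixed {z} {p} {f} ef af h h' γ t = ≡.trans (ef (λ k → ≡.trans (sub-dotSwap z p γ k) (cong (λ q → dotSwap z (sub q γ) k) (sw-o z p h h'))) t) (af (sub p γ) t)

sub-left : ∀ {z f g} → Ext f → Anti z f g → ∀ γ t → f (sub z (dotSwap z γ)) t ≡ ℤ.- g (sub (suc z) γ) t
sub-left {z} ef af γ t = ≡.trans (ef (λ k → ≡.trans (sub-dotSwap z z γ k) (cong (λ q → dotSwap z (sub q γ) k) (sw-l z))) t) (af (sub (suc z) γ) t)

sub-right : ∀ {z f g} → Ext f → Anti z f g → ∀ γ t → f (sub (suc z) (dotSwap z γ)) t ≡ ℤ.- g (sub z γ) t
sub-right {z} ef af γ t = ≡.trans (ef (λ k → ≡.trans (sub-dotSwap z (suc z) γ k) (cong (λ q → dotSwap z (sub q γ) k) (sw-r z))) t) (af (sub z γ) t)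

es-anti-above : ∀ z p d {f} → Ext f → Anti z f f → p ≤ z → Anti z (es p d f) (es p d f)
es-anti-above z p zero ef af h = af
es-anti-above z zero (suc d) ef af h = λ _ _ → refl
es-anti-above z (suc p) (suc d) ef af h γ t = neg-+ (es-anti-above z p (suc d) ef af (ℕP.<⇒≤ h) γ t)
  (sub-fixed {p = p} (es-ext p d ef) (es-anti-above z p d ef af (ℕP.<⇒≤ h)) (λ e → linear (_ ∷ _ ∷ []) [] (# 0 ≈ⁿ # 1 ∷ # 0 <ⁿ # 1 ∷ [] ⊢ absurd) (e , h)) (λ e → linear (_ ∷ _ ∷ []) [] (# 0 ≈ⁿ 1+ # 1 ∷ # 0 <ⁿ # 1 ∷ [] ⊢ absurd) (e , h)) γ t)

-- Sort the terms of e_d by whether they use the variables `z` and `z + 1`: the terms using neither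
-- and those using both are carried to themselves, while those using one are exchanged with those
-- using the other.
es-anti-pair : ∀ z d {f} → Ext f → Anti z f f → Anti z (es (suc (suc z)) d f) (es (suc (suc z)) d f)
es-anti-pair z zero ef af = af
es-anti-pair z (suc zero) {f} ef af γ t =
  lem (es-anti-above z z 1 ef af ℕP.≤-refl γ t) (sub-left ef af γ t) (sub-right ef af γ t)
  where lem : ∀ {a a' b b' c c' : ℤ} → a ≡ ℤ.- a' → b ≡ ℤ.- c' → c ≡ ℤ.- b' → a ℤ.+ b ℤ.+ c ≡ ℤ.- (a' ℤ.+ b' ℤ.+ c')
        lem {a' = a'} {b' = b'} {c' = c'} h k l = linear [] (_ ∷ a' ∷ _ ∷ c' ∷ _ ∷ b' ∷ []) (# 0 ≈ᶻ ⊝ # 1 ∷ # 2 ≈ᶻ ⊝ # 3 ∷ # 4 ≈ᶻ ⊝ # 5 ∷ [] ⊢ # 0 ⊕ # 2 ⊕ # 4 ≈ᶻ ⊝ (# 1 ⊕ # 5 ⊕ # 3)) (h , k , l)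
es-anti-pair z (suc (suc d)) {f} ef af γ t =
  lem (A (suc (suc d)) γ t) (sub-left (es-ext z (suc d) ef) (A (suc d)) γ t)
      (sub-right (es-ext z (suc d) ef) (A (suc d)) γ t) both
  where
  A : ∀ d → Anti z (es z d f) (es z d f)
  A d = es-anti-above z z d ef af ℕP.≤-refl
  both : es z d f (sub z (sub (suc z) (dotSwap z γ))) t ≡ ℤ.- es z d f (sub z (sub (suc z) γ)) t
  both = ≡.trans (es-ext z d ef (sub-cong z (λ k → ≡.trans (sub-dotSwap z (suc z) γ k) (cong (λ q → dotSwap z (sub q γ) k) (sw-r z)))) t)
    (≡.trans (sub-left (es-ext z d ef) (A d) (sub z γ) t) (cong ℤ.-_ (es-ext z d ef (sub-comm (suc z) z γ) t)))
  lem : ∀ {a a' b b' c c' e e' : ℤ} → a ≡ ℤ.- a' → b ≡ ℤ.- c' → c ≡ ℤ.- b' → e ≡ ℤ.- e' → a ℤ.+ b ℤ.+ (c ℤ.+ e) ≡ ℤ.- (a' ℤ.+ b' ℤ.+ (c' ℤ.+ e'))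
  lem {a' = a'} {b' = b'} {c' = c'} {e' = e'} h k l m = linear [] (_ ∷ a' ∷ _ ∷ c' ∷ _ ∷ b' ∷ _ ∷ e' ∷ []) (# 0 ≈ᶻ ⊝ # 1 ∷ # 2 ≈ᶻ ⊝ # 3 ∷ # 4 ≈ᶻ ⊝ # 5 ∷ # 6 ≈ᶻ ⊝ # 7 ∷ [] ⊢ # 0 ⊕ # 2 ⊕ (# 4 ⊕ # 6) ≈ᶻ ⊝ (# 1 ⊕ # 5 ⊕ (# 3 ⊕ # 7))) (h , k , l , m)

es-anti-below : ∀ z p d {f} → Ext f → Anti z f f → suc z < p → Anti z (es p d f) (es p d f)
es-anti-below z p zero ef af h = af
es-anti-below z (suc p) (suc d) {f} ef af h with suc z ≟ p
... | yes refl = es-anti-pair z (suc d) ef af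
... | no ne = λ γ t → neg-+ (es-anti-below z p (suc d) ef af lt γ t)
    (sub-fixed {p = p} (es-ext p d ef) (es-anti-below z p d ef af lt) (λ e → linear (_ ∷ _ ∷ []) [] (1+ # 0 <ⁿ # 1 ∷ # 1 ≈ⁿ # 0 ∷ [] ⊢ absurd) (lt , e)) (λ e → linear (_ ∷ _ ∷ []) [] (1+ # 0 <ⁿ # 1 ∷ # 1 ≈ⁿ 1+ # 0 ∷ [] ⊢ absurd) (lt , e)) γ t)
  where lt : suc z < p
        lt = ℕP.≤∧≢⇒< (ℕP.≤-pred h) ne

es-class : ∀ {ℓ} p d {f} → Class ℓ 0 f → Class ℓ p (es p d f)
es-class {ℓ} p d {f} C .ext = es-ext p d (C .ext)
es-class {ℓ} p d {f} C .vanish = es-tail ℓ p d (C .vanish)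
es-class {ℓ} p d {f} C .anti z h ne with p ≤? z
... | yes p≤z = es-anti-above z p d (C .ext) (C .anti z h (λ ())) p≤z
... | no p≰z = es-anti-below z p d (C .ext) (C .anti z h (λ ())) (ℕP.≤∧≢⇒< (ℕP.≰⇒> p≰z) ne)

hs-anti-below : ∀ z p c d {f} → Ext f → Anti z f f → suc z < p → Anti z (hs p c d f) (hs p c d f)
hs-anti-below z p c zero ef af h = af
hs-anti-below z p zero (suc d) ef af h = λ _ _ → refl
hs-anti-below z p (suc c) (suc d) ef af h γ t = neg-+ (hs-anti-below z (suc p) c (suc d) ef af (ℕP.m<n⇒m<1+n h) γ t)
  (sub-fixed {p = p} (hs-ext p (suc c) d ef) (hs-anti-below z p (suc c) d ef af h) (λ e → linear (_ ∷ _ ∷ []) [] (1+ # 0 <ⁿ # 1 ∷ # 1 ≈ⁿ # 0 ∷ [] ⊢ absurd) (h , e)) (λ e → linear (_ ∷ _ ∷ []) [] (1+ # 0 <ⁿ # 1 ∷ # 1 ≈ⁿ 1+ # 0 ∷ [] ⊢ absurd) (h , e)) γ t)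

module _ (z c : ℕ) {f : Fn} (ef : Ext f) (af : Anti z f f) where
  private
    A B B' C : ℕ → Fn
    A d = hs z (suc (suc c)) d f
    B d = hs (suc z) (suc c) d f
    C d = hs (suc (suc z)) c d f
    B' zero = f
    B' (suc d) γ t = C (suc d) γ t ℤ.+ B' d (sub z γ) t

    C-anti : ∀ d → Anti z (C d) (C d)
    C-anti d = above (suc (suc z)) c d ℕP.≤-refl
      where
      above : ∀ p c d → suc z < p → Anti z (hs p c d f) (hs p c d f)
      above p c d h = hs-anti-below z p c d ef af h

    B-anti : ∀ d → Anti z (B d) (B' d)
    B-anti zero = af
    B-anti (suc d) γ t = neg-+ (C-anti (suc d) γ t) (sub-right (hs-ext (suc z) (suc c) d ef) (B-anti d) γ t)

    -- Two expansions of h_(d+1) in the c + 2 variables from `z` on: along the variable `z` on the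
    -- left, along `z + 1` on the right. `B` omits the variable `z`, `B'` omits `z + 1` and `C`
    -- omits both.
    exchange : ∀ d γ t → B (suc d) γ t ℤ.+ A d (sub z γ) t ≡ B' (suc d) γ t ℤ.+ A d (sub (suc z) γ) t
    exchange zero γ t = lem (C 1 γ t) (f (sub (suc z) γ) t) (f (sub z γ) t)
      where lem : ∀ x y w → x ℤ.+ y ℤ.+ w ≡ x ℤ.+ w ℤ.+ y
            lem = solve-∀
    exchange (suc d) γ t = lem (C (suc (suc d)) γ t) (B (suc d) (sub (suc z) γ) t) (A (suc d) (sub z γ) t)
      (B' (suc d) (sub z γ) t) (A d (sub (suc z) (sub z γ)) t) (A d (sub z (sub (suc z) γ)) t)
      (exchange d (sub z γ) t) (hs-ext z (suc (suc c)) d ef (sub-comm (suc z) z γ) t)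
      where lem : ∀ x b a b' u v → a ≡ b' ℤ.+ u → u ≡ v → x ℤ.+ b ℤ.+ a ≡ x ℤ.+ b' ℤ.+ (b ℤ.+ v)
            lem x b a b' u v h k = linear [] (_ ∷ b' ∷ _ ∷ _ ∷ x ∷ b ∷ []) (# 0 ≈ᶻ # 1 ⊕ # 2 ∷ # 2 ≈ᶻ # 3 ∷ [] ⊢ # 4 ⊕ # 5 ⊕ # 0 ≈ᶻ # 4 ⊕ # 1 ⊕ (# 5 ⊕ # 3)) (h , k)

  hs-anti-pair : ∀ d → Anti z (A d) (A d)
  hs-anti-pair zero = af
  hs-anti-pair (suc d) γ t = ≡.trans (neg-+ (B-anti (suc d) γ t) (sub-left (hs-ext z (suc (suc c)) d ef) (hs-anti-pair d) γ t))
    (cong ℤ.-_ (sym (exchange d γ t)))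

hs-anti-above : ∀ z p c d {f} → Ext f → Anti z f f → p ≤ z → suc z < p ℕ.+ c → Anti z (hs p c d f) (hs p c d f)
hs-anti-above z p c zero ef af h h' = af
hs-anti-above z p zero (suc d) ef af h h' = λ _ _ → refl
hs-anti-above z p (suc c) (suc d) {f} ef af h h' with p ≟ z
hs-anti-above z p (suc zero) (suc d) {f} ef af h h' | yes refl = ⊥-elim (linear (_ ∷ []) [] (1+ # 0 <ⁿ # 0 ⊕ 1+ lit 0 ∷ [] ⊢ absurd) h')
hs-anti-above z p (suc (suc c)) (suc d) {f} ef af h h' | yes refl = hs-anti-pair z c ef af (suc d)
... | no ne = λ γ t → neg-+ (hs-anti-above z (suc p) c (suc d) ef af p<z (linear (_ ∷ p ∷ c ∷ []) [] (1+ # 0 <ⁿ # 1 ⊕ 1+ # 2 ∷ [] ⊢ 1+ # 0 <ⁿ 1+ # 1 ⊕ # 2) h') γ t)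
    (sub-fixed {p = p} (hs-ext p (suc c) d ef) (hs-anti-above z p (suc c) d ef af h h') ne (λ e → linear (_ ∷ _ ∷ []) [] (# 0 ≤ⁿ # 1 ∷ # 0 ≈ⁿ 1+ # 1 ∷ [] ⊢ absurd) (h , e)) γ t)
  where p<z : p < z
        p<z = ℕP.≤∧≢⇒< h ne

hs-class : ∀ {ℓ} p c d {f} → p ℕ.+ c ≡ ℓ → Class ℓ 0 f → Class ℓ p (hs p c d f)
hs-class {ℓ} p c d {f} e C .ext = hs-ext p c d (C .ext)
hs-class {ℓ} p c d {f} e C .vanish = hs-tail ℓ p c d (C .vanish)
hs-class {ℓ} p c d {f} e C .anti z h ne with p ≤? z
... | yes p≤z = hs-anti-above z p c d (C .ext) (C .anti z h (λ ())) p≤z (subst (suc z <_) (sym e) h)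
... | no p≰z = hs-anti-below z p c d (C .ext) (C .anti z h (λ ())) (ℕP.≤∧≢⇒< (ℕP.≰⇒> p≰z) ne)

es-full : ∀ {ℓ} d {f} → Class ℓ 0 f → Class ℓ 0 (es ℓ d f)
es-full {ℓ} d C .ext = es-ext ℓ d (C .ext)
es-full {ℓ} d C .vanish = es-tail ℓ ℓ d (C .vanish)
es-full {ℓ} d C .anti z h _ = es-anti-below z ℓ d (C .ext) (C .anti z h (λ ())) h

hs-full : ∀ {ℓ} d {f} → Class ℓ 0 f → Class ℓ 0 (hs 0 ℓ d f)
hs-full d C = hs-class 0 _ d refl C

es-excess : ∀ p d f γ t → p < d → es p d f γ t ≡ 0ℤ
es-excess zero (suc d) f γ t h = refl
es-excess (suc p) (suc d) f γ t h = cong₂ ℤ._+_ (es-excess p (suc d) f γ t (ℕP.m<n⇒m<1+n (ℕP.≤-pred h))) (es-excess p d f (sub p γ) t (ℕP.≤-pred h))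

initial : ℕ → ℕ → ℤ
initial zero k = 0ℤ
initial (suc p) k = initial p k ℤ.+ δ p k

-- There is one way to choose `p` of `p` rows, so e_p is the product of the variables and lowers
-- each of them once.
es-top : ∀ p {f} → Ext f → ∀ γ t → es p p f γ t ≡ f (λ k → γ k ℤ.- initial p k) t
es-top zero ef γ t = ef (λ k → sym (ℤP.+-identityʳ (γ k))) t
es-top (suc p) {f} ef γ t = ≡.trans (cong₂ ℤ._+_ (es-excess p (suc p) f γ t ℕP.≤-refl) (es-top p ef (sub p γ) t))
  (≡.trans (ℤP.+-identityˡ _) (ef (λ k → lem (γ k) (initial p k) (δ p k)) t))
  where lem : ∀ x a b → x ℤ.- b ℤ.- a ≡ x ℤ.- (a ℤ.+ b)
        lem = solve-∀

initial-out : ∀ p k → p ≤ k → initial p k ≡ 0ℤ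
initial-out zero k h = refl
initial-out (suc p) k h = cong₂ ℤ._+_ (initial-out p k (ℕP.<⇒≤ h)) (δ-≢ p k (ℕP.<⇒≢ h))

initial-in : ∀ p k → k < p → initial p k ≡ 1ℤ
initial-in (suc p) k h with k ≟ p
... | yes refl = ≡.trans (cong₂ ℤ._+_ (initial-out p p ℕP.≤-refl) (δ-refl p)) refl
... | no ne = ≡.trans (cong₂ ℤ._+_ (initial-in p k (ℕP.≤∧≢⇒< (ℕP.≤-pred h) ne)) (δ-≢ p k (ne ∘ sym))) refl

-- The alternant

prod : {A : Set} → (A → ℤ) → List A → ℤ
prod F [] = 1ℤ
prod F (x ∷ xs) = F x ℤ.* prod F xs

prod-↭ : {A : Set} (F : A → ℤ) {xs ys : List A} → xs ↭ ys → prod F xs ≡ prod F ys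
prod-↭ F refl = refl
prod-↭ F (prep x p) = cong (λ z → F x ℤ.* z) (prod-↭ F p)
prod-↭ F (swap {xs} x y p) = ≡.trans (cong (λ z → F x ℤ.* (F y ℤ.* z)) (prod-↭ F p)) (lem (F x) (F y) _)
  where lem : ∀ a b c → a ℤ.* (b ℤ.* c) ≡ b ℤ.* (a ℤ.* c)
        lem = solve-∀
prod-↭ F (trans p q) = ≡.trans (prod-↭ F p) (prod-↭ F q)

prod-cong : {A : Set} {F G : A → ℤ} (xs : List A) → (∀ x → x ∈ xs → F x ≡ G x) → prod F xs ≡ prod G xs
prod-cong [] h = refl
prod-cong (x ∷ xs) h = cong₂ ℤ._*_ (h x (here refl)) (prod-cong xs (λ y m → h y (there m)))

prod-map : {A B : Set} (F : B → ℤ) (g : A → B) (xs : List A) → prod F (map g xs) ≡ prod (F ∘ g) xs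
prod-map F g [] = refl
prod-map F g (x ∷ xs) = cong (λ z → F (g x) ℤ.* z) (prod-map F g xs)

prod-zero : {A : Set} (F : A → ℤ) {xs : List A} {x : A} → x ∈ xs → F x ≡ 0ℤ → prod F xs ≡ 0ℤ
prod-zero F {x ∷ xs} (here refl) h rewrite h = refl
prod-zero F {y ∷ xs} (there m) h rewrite prod-zero F m h = ℤP.*-zeroʳ (F y)

prod-one : {A : Set} (F : A → ℤ) {xs : List A} → (∀ x → x ∈ xs → F x ≡ 1ℤ) → prod F xs ≡ 1ℤ
prod-one F {[]} h = refl
prod-one F {x ∷ xs} h rewrite h x (here refl) | prod-one F {xs} (λ y m → h y (there m)) = refl

sgn : ℤ → ℤ
sgn (+ 0) = 0ℤ
sgn (+ suc _) = 1ℤ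
sgn -[1+ _ ] = -[1+ 0 ]

sgn-neg : ∀ x → sgn (ℤ.- x) ≡ ℤ.- sgn x
sgn-neg (+ 0) = refl
sgn-neg (+ suc _) = refl
sgn-neg -[1+ _ ] = refl

sgn-indicator : ∀ x → 0ℤ ℤ.< x → sgn x ≡ 1ℤ
sgn-indicator (+ suc _) _ = refl
sgn-indicator (+ 0) (ℤ.+<+ ())

indicator : ℤ → ℤ
indicator (+ suc _) = 1ℤ
indicator _ = 0ℤ

indicator-one : ∀ x → 0ℤ ℤ.< x → indicator x ≡ 1ℤ
indicator-one (+ suc _) _ = refl
indicator-one (+ 0) (ℤ.+<+ ())

indicator-zero : ∀ x → x ℤ.≤ 0ℤ → indicator x ≡ 0ℤ
indicator-zero (+ 0) _ = refl
indicator-zero (+ suc _) (ℤ.+≤+ ())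
indicator-zero -[1+ _ ] _ = refl

bead : Wt → ℕ → ℤ
bead γ i = γ i ℤ.- + i

bead-dotSwap : ∀ z γ i → bead (dotSwap z γ) i ≡ bead γ (sw z i)
bead-dotSwap z γ i with place z i
... | left rewrite sw-l z | δ-≢ (suc z) z ℕP.1+n≢n | δ-refl z = linear (z ∷ []) (γ (suc z) ∷ []) ([] ⊢ # 0 ⊕ (↑ lit 0 ⊕ ⊝ ↑ lit 1) ⊕ ⊝ ↑ # 0 ≈ᶻ # 0 ⊕ ⊝ ↑ 1+ # 0) tt
... | right rewrite sw-r z | δ-≢ z (suc z) (λ e → ℕP.1+n≢n (sym e)) | δ-refl z = lem (γ z) z
  where lem : ∀ x z → x ℤ.+ (1ℤ ℤ.- 0ℤ) ℤ.- + suc z ≡ x ℤ.- + z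
        lem x z = linear (z ∷ []) (x ∷ []) ([] ⊢ # 0 ⊕ (lit 1ℤ ⊖ lit 0ℤ) ⊖ ↑ 1+ # 0 ≈ᶻ # 0 ⊖ ↑ # 0) tt
... | other h h' rewrite sw-o z i h h' | δ-≢ z i (λ e → h (sym e)) | δ-≢ (suc z) i (λ e → h' (sym e)) = linear (i ∷ []) (γ i ∷ []) ([] ⊢ # 0 ⊕ (↑ lit 0 ⊕ ↑ lit 0) ⊕ ⊝ ↑ # 0 ≈ᶻ # 0 ⊕ ⊝ ↑ # 0) tt

module Sign (ℓ : ℕ) where
  open Catalan ℓ using (allPairs)

  pairs : List (ℕ × ℕ)
  pairs = filter (λ x → proj₁ x <? proj₂ x) allPairs

  order : Wt → ℕ × ℕ → ℤ
  order γ (i , j) = sgn (bead γ i ℤ.- bead γ j)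

  lower : Wt → ℕ → ℤ
  lower γ i = indicator (bead γ i ℤ.+ + ℓ)

  -- The sign of the permutation sorting the beads, 0 if two beads collide or a bead is below −(ℓ−1).
  alternant : Wt → ℤ
  alternant γ = prod (order γ) pairs ℤ.* prod (lower γ) (upTo ℓ)

  -- On a partition the value is 1 whatever its size. What is finally read off is the value at the
  -- zero weight, when the content has used up all boxes.
  unit-functional : Fn
  unit-functional γ zero = alternant γ
  unit-functional γ (suc d) = 0ℤ

  pairs-unique : Unique pairs
  pairs-unique = Uniq.filter⁺ (λ x → proj₁ x <? proj₂ x) (Uniq.cartesianProduct⁺ (Uniq.upTo⁺ ℓ) (Uniq.upTo⁺ ℓ))

  ∈-pairs⁺ : ∀ {i j} → i < j → j < ℓ → (i , j) ∈ pairs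
  ∈-pairs⁺ h h' = ∈-filter⁺ (λ x → proj₁ x <? proj₂ x) (∈-cartesianProduct⁺ (∈-upTo⁺ (ℕP.<-trans h h')) (∈-upTo⁺ h')) h

  ∈-pairs⁻ : ∀ {i j} → (i , j) ∈ pairs → i < j × j < ℓ
  ∈-pairs⁻ m with ∈-filter⁻ (λ x → proj₁ x <? proj₂ x) {xs = allPairs} m
  ... | m' , lt = lt , ∈-upTo⁻ (proj₂ (∈-cartesianProduct⁻ (upTo ℓ) (upTo ℓ) m'))

  module _ (z : ℕ) (z<ℓ : suc z < ℓ) where
    private
      sw-< : ∀ i → i < ℓ → sw z i < ℓ
      sw-< i h with place z i
      ... | left = subst (_< ℓ) (sym (sw-l z)) z<ℓ
      ... | right = subst (_< ℓ) (sym (sw-r z)) (ℕP.<-trans (ℕP.n<1+n z) z<ℓ)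
      ... | other a b = subst (_< ℓ) (sym (sw-o z i a b)) h

      notz? : (x : ℕ × ℕ) → Dec (¬ (proj₁ x ≡ z × proj₂ x ≡ suc z))
      notz? (i , j) with i ≟ z | j ≟ suc z
      ... | yes a | yes b = no (λ k → k (a , b))
      ... | no a | _ = yes (λ k → a (proj₁ k))
      ... | yes _ | no b = yes (λ k → b (proj₂ k))

      rest : List (ℕ × ℕ)
      rest = filter notz? pairs

      rest-unique : Unique rest
      rest-unique = Uniq.filter⁺ notz? pairs-unique

      rest⁻ : ∀ {i j} → (i , j) ∈ rest → i < j × j < ℓ × ¬ (i ≡ z × j ≡ suc z)
      rest⁻ m with ∈-filter⁻ notz? {xs = pairs} m
      ... | m' , k = proj₁ (∈-pairs⁻ m') , proj₂ (∈-pairs⁻ m') , k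

      split : pairs ↭ (z , suc z) ∷ rest
      split = same-members⇒↭ pairs-unique
        (All.tabulate (λ m e → proj₂ (∈-filter⁻ notz? {xs = pairs} m) (sym (cong proj₁ e) , sym (cong proj₂ e))) ∷ rest-unique) fwd bwd
        where
        fwd : ∀ x → x ∈ pairs → x ∈ (z , suc z) ∷ rest
        fwd (i , j) m with i ≟ z | j ≟ suc z
        ... | yes refl | yes refl = here refl
        ... | no a | _ = there (∈-filter⁺ notz? m (λ k → a (proj₁ k)))
        ... | yes _ | no b = there (∈-filter⁺ notz? m (λ k → b (proj₂ k)))
        bwd : ∀ x → x ∈ (z , suc z) ∷ rest → x ∈ pairs
        bwd x (here refl) = ∈-pairs⁺ (ℕP.n<1+n z) z<ℓ
        bwd x (there m) = proj₁ (∈-filter⁻ notz? {xs = pairs} m)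

      sw-mono : ∀ i j → i < j → ¬ (i ≡ z × j ≡ suc z) → sw z i < sw z j
      sw-mono i j h k with place z i | place z j
      ... | left | left = ⊥-elim (ℕP.<-irrefl refl h)
      ... | left | right = ⊥-elim (k (refl , refl))
      ... | left | other a b = subst₂ _<_ (sym (sw-l z)) (sym (sw-o z j a b)) (ℕP.≤∧≢⇒< h (b ∘ sym))
      ... | right | left = ⊥-elim (linear (_ ∷ []) [] (1+ # 0 <ⁿ # 0 ∷ [] ⊢ absurd) h)
      ... | right | right = ⊥-elim (ℕP.<-irrefl refl h)
      ... | right | other a b = subst₂ _<_ (sym (sw-r z)) (sym (sw-o z j a b)) (linear (_ ∷ _ ∷ []) [] (1+ # 0 <ⁿ # 1 ∷ [] ⊢ # 0 <ⁿ # 1) h)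
      ... | other a b | left = subst₂ _<_ (sym (sw-o z i a b)) (sym (sw-l z)) (linear (_ ∷ _ ∷ []) [] (# 0 <ⁿ # 1 ∷ [] ⊢ # 0 <ⁿ 1+ # 1) h)
      ... | other a b | right = subst₂ _<_ (sym (sw-o z i a b)) (sym (sw-r z)) (ℕP.≤∧≢⇒< (ℕP.≤-pred h) a)
      ... | other a b | other c d = subst₂ _<_ (sym (sw-o z i a b)) (sym (sw-o z j c d)) h

      sw₂-inj : ∀ {x y} → swap₂ z x ≡ swap₂ z y → x ≡ y
      sw₂-inj h = cong₂ _,_ (sw-inj z (cong proj₁ h)) (sw-inj z (cong proj₂ h))

      rest-closed : ∀ x → x ∈ rest → swap₂ z x ∈ rest
      rest-closed (i , j) m = let (a , b , k) = rest⁻ m in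
        ∈-filter⁺ notz? (∈-pairs⁺ (sw-mono i j a k) (sw-< j b)) (λ { (p , q) → ℕP.<-asym a (subst₂ _<_ (back j z (≡.trans q (sym (sw-l z)))) (back i (suc z) (≡.trans p (sym (sw-r z)))) (ℕP.n<1+n z)) })
        where
        back : ∀ i k → sw z i ≡ sw z k → k ≡ i
        back i k e = sym (sw-inj z e)

      rest-swap : map (swap₂ z) rest ↭ rest
      rest-swap = same-members⇒↭ (Uniq.map⁺ sw₂-inj rest-unique) rest-unique fwd bwd
        where
        fwd : ∀ x → x ∈ map (swap₂ z) rest → x ∈ rest
        fwd x m with ∈-map⁻ (swap₂ z) m
        ... | y , m' , refl = rest-closed y m'
        bwd : ∀ x → x ∈ rest → x ∈ map (swap₂ z) rest
        bwd (i , j) m = subst (_∈ map (swap₂ z) rest) (cong₂ _,_ (sw-invol z i) (sw-invol z j)) (∈-map⁺ (swap₂ z) (rest-closed (i , j) m))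

      upTo-swap : map (sw z) (upTo ℓ) ↭ upTo ℓ
      upTo-swap = same-members⇒↭ (Uniq.map⁺ (sw-inj z) (Uniq.upTo⁺ ℓ)) (Uniq.upTo⁺ ℓ) fwd bwd
        where
        fwd : ∀ x → x ∈ map (sw z) (upTo ℓ) → x ∈ upTo ℓ
        fwd x m with ∈-map⁻ (sw z) m
        ... | y , m' , refl = ∈-upTo⁺ (sw-< y (∈-upTo⁻ m'))
        bwd : ∀ x → x ∈ upTo ℓ → x ∈ map (sw z) (upTo ℓ)
        bwd i m = subst (_∈ map (sw z) (upTo ℓ)) (sw-invol z i) (∈-map⁺ (sw z) (∈-upTo⁺ (sw-< i (∈-upTo⁻ m))))

    -- The dot action permutes the beads, so it permutes the factors, except that the factor of the
    -- pair (z, z+1) changes sign.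
    alternant-anti : ∀ γ → alternant (dotSwap z γ) ≡ ℤ.- alternant γ
    alternant-anti γ = ≡.trans (cong₂ ℤ._*_ orders lowers) (sym (ℤP.neg-distribˡ-* (prod (order γ) pairs) _))
      where
      γ' = dotSwap z γ
      order' : ∀ x → order γ' x ≡ order γ (swap₂ z x)
      order' (i , j) = cong₂ (λ a b → sgn (a ℤ.- b)) (bead-dotSwap z γ i) (bead-dotSwap z γ j)
      flip : order γ (swap₂ z (z , suc z)) ≡ ℤ.- order γ (z , suc z)
      flip rewrite sw-l z | sw-r z = ≡.trans (cong sgn (lem (bead γ (suc z)) (bead γ z))) (sgn-neg _)
        where lem : ∀ x y → x ℤ.- y ≡ ℤ.- (y ℤ.- x)
              lem = solve-∀
      orders : prod (order γ') pairs ≡ ℤ.- prod (order γ) pairs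
      orders = ≡.trans (prod-cong pairs (λ x _ → order' x)) (≡.trans (prod-↭ _ split)
        (≡.trans (cong₂ ℤ._*_ flip (≡.trans (sym (prod-map (order γ) (swap₂ z) rest)) (prod-↭ (order γ) rest-swap)))
        (≡.trans (sym (ℤP.neg-distribˡ-* (order γ (z , suc z)) _)) (cong ℤ.-_ (sym (prod-↭ (order γ) split))))))
      lowers : prod (lower γ') (upTo ℓ) ≡ prod (lower γ) (upTo ℓ)
      lowers = ≡.trans (prod-cong (upTo ℓ) (λ i _ → cong (λ a → indicator (a ℤ.+ + ℓ)) (bead-dotSwap z γ i)))
        (≡.trans (sym (prod-map (lower γ) (sw z) (upTo ℓ))) (prod-↭ (lower γ) upTo-swap))

  alternant-ext : ∀ {γ γ' : Wt} → (∀ i → γ i ≡ γ' i) → alternant γ ≡ alternant γ'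
  alternant-ext h = cong₂ ℤ._*_
    (prod-cong pairs (λ { (i , j) _ → cong₂ (λ a b → sgn (a ℤ.- + i ℤ.- (b ℤ.- + j))) (h i) (h j) }))
    (prod-cong (upTo ℓ) (λ i _ → cong (λ a → indicator (a ℤ.- + i ℤ.+ + ℓ)) (h i)))

  alternant-collision : ∀ γ i j → i < j → j < ℓ → bead γ i ≡ bead γ j → alternant γ ≡ 0ℤ
  alternant-collision γ i j h h' e rewrite prod-zero (order γ) (∈-pairs⁺ h h') (cong sgn (ℤP.i≡j⇒i-j≡0 e)) = refl

  alternant-low : ∀ γ i → i < ℓ → bead γ i ℤ.+ + ℓ ℤ.≤ 0ℤ → alternant γ ≡ 0ℤ
  alternant-low γ i h e rewrite prod-zero (lower γ) (∈-upTo⁺ h) (indicator-zero _ e) = ℤP.*-zeroʳ (prod (order γ) pairs)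

  -- Unless a factor vanishes, the beads from row `z` on, raised by ℓ - 1, are distinct natural
  -- numbers. Their sum is then at least 0 + 1 + ... + (m - 1), which is the sum for the weight 0,
  -- so the tail sum of γ is not negative.
  alternant-tail : ∀ z γ → tailSum ℓ z γ ℤ.< 0ℤ → alternant γ ≡ 0ℤ
  alternant-tail z γ neg with ℕP.anyUpTo? (λ i → bead γ i ℤ.+ + ℓ ℤ.≤? 0ℤ) ℓ
  ... | yes (i , h , e) = alternant-low γ i h e
  ... | no ok with ℕP.anyUpTo? (λ j → ℕP.anyUpTo? (λ i → bead γ i ℤ.≟ bead γ j) j) ℓ
  ...   | yes (j , h' , i , h , e) = alternant-collision γ i j h h' e
  ...   | no inj = ⊥-elim (linear [] (_ ∷ _ ∷ _ ∷ []) (# 0 ≤ᶻ # 1 ∷ # 1 ≈ᶻ # 2 ⊕ # 0 ∷ # 2 <ᶻ lit 0ℤ ∷ [] ⊢ absurd) (total , sums , neg'))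
    where
    neg' : tailSum ℓ z γ ℤ.< 0ℤ
    neg' = neg
    m = ℓ ∸ z
    in-range : ∀ {i} → i < m → z ℕ.+ i < ℓ
    in-range {i} h = ℕP.≤-trans (ℕP.≤-reflexive (sym (ℕP.+-suc z i)))
      (ℕP.≤-trans (ℕP.+-monoʳ-≤ z {suc i} {m} h) (ℕP.≤-reflexive (ℕP.m+[n∸m]≡n {z} {ℓ} (ℕP.<⇒≤ (ℕP.≰⇒> (λ k → ℕP.<⇒≱ h (ℕP.≤-trans (ℕP.≤-reflexive (ℕP.m≤n⇒m∸n≡0 k)) z≤n)))))))
    x : ℕ → ℕ
    x i = ℤ.∣ bead γ (z ℕ.+ i) ℤ.+ + ℓ ℤ.- 1ℤ ∣
    x≡ : ∀ i → i < m → + x i ≡ bead γ (z ℕ.+ i) ℤ.+ + ℓ ℤ.- 1ℤ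
    x≡ i h = ℤP.0≤i⇒+∣i∣≡i (lem (bead γ (z ℕ.+ i) ℤ.+ + ℓ) (ℤP.≰⇒> (λ k → ok (z ℕ.+ i , in-range h , k))))
      where lem : ∀ a → 0ℤ ℤ.< a → 0ℤ ℤ.≤ a ℤ.- 1ℤ
            lem a h = linear [] (_ ∷ []) (lit 0ℤ <ᶻ # 0 ∷ [] ⊢ lit 0ℤ ≤ᶻ # 0 ⊖ lit 1ℤ) h
    total : Σ< m (λ i → + i) ℤ.≤ Σ< m (λ i → + x i)
    total = distinct-sum m x (λ i j h h' e → inj (z ℕ.+ j , in-range h' , z ℕ.+ i , ℕP.+-monoʳ-< z h ,
      lem _ _ (+ ℓ) (≡.trans (sym (x≡ i (ℕP.<-trans h h'))) (≡.trans (cong +_ e) (x≡ j h')))))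
      where lem : ∀ a b c → a ℤ.+ c ℤ.- 1ℤ ≡ b ℤ.+ c ℤ.- 1ℤ → a ≡ b
            lem a b c h = linear [] (_ ∷ c ∷ _ ∷ []) (# 0 ⊕ # 1 ⊖ lit 1ℤ ≈ᶻ # 2 ⊕ # 1 ⊖ lit 1ℤ ∷ [] ⊢ # 0 ≈ᶻ # 2) h
    x-sum : ∀ m → m ≤ ℓ ∸ z → Σ< m (λ i → + x i) ≡ Σ< m (λ i → γ (z ℕ.+ i)) ℤ.+ Σ< m (λ i → + (m ∸ suc i)) ℤ.+ Σ< m (λ i → + (ℓ ∸ z ∸ m))
    x-sum m h = ≡.trans (Σ<-cong m (λ i i<m → ≡.trans (x≡ i (ℕP.<-≤-trans i<m h)) (eq i i<m))) (sum3 m _ _ _)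
      where
      sum3 : ∀ m (f g h : ℕ → ℤ) → Σ< m (λ i → f i ℤ.+ g i ℤ.+ h i) ≡ Σ< m f ℤ.+ Σ< m g ℤ.+ Σ< m h
      sum3 zero f g h = refl
      sum3 (suc m) f g h = linear [] (_ ∷ Σ< m f ∷ Σ< m g ∷ Σ< m h ∷ f m ∷ g m ∷ h m ∷ []) (# 0 ≈ᶻ # 1 ⊕ # 2 ⊕ # 3 ∷ [] ⊢ # 0 ⊕ (# 4 ⊕ # 5 ⊕ # 6) ≈ᶻ # 1 ⊕ # 4 ⊕ (# 2 ⊕ # 5) ⊕ (# 3 ⊕ # 6)) (sum3 m f g h)
      eq : ∀ i → i < m → bead γ (z ℕ.+ i) ℤ.+ + ℓ ℤ.- 1ℤ ≡ γ (z ℕ.+ i) ℤ.+ + (m ∸ suc i) ℤ.+ + (ℓ ∸ z ∸ m)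
      eq i i<m = linear (m ∸ suc i ∷ i ∷ _ ∷ ℓ ∸ z ∸ m ∷ _ ∷ z ∷ _ ∷ []) (γ (z ℕ.+ i) ∷ []) (# 0 ⊕ 1+ # 1 ≈ⁿ # 2 ∷ # 3 ⊕ # 2 ≈ⁿ # 4 ∷ # 4 ⊕ # 5 ≈ⁿ # 6 ∷ [] ⊢ # 0 ⊕ ⊝ ↑ (# 5 ⊕ # 1) ⊕ ↑ # 6 ⊖ lit 1ℤ ≈ᶻ # 0 ⊕ ↑ # 0 ⊕ ↑ # 3) (ℕP.m∸n+n≡m i<m , ℕP.m∸n+n≡m h , ℕP.m∸n+n≡m {ℓ} {z} (ℕP.<⇒≤ (ℕP.≤-<-trans (ℕP.m≤m+n z i) (in-range (ℕP.<-≤-trans i<m h)))))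
    flipped : ∀ m → Σ< m (λ i → + (m ∸ suc i)) ≡ Σ< m (λ i → + i)
    flipped m = go m
      where
      front : ∀ m (g : ℕ → ℤ) → Σ< (suc m) g ≡ g 0 ℤ.+ Σ< m (g ∘ suc)
      front zero g = ≡.trans (ℤP.+-identityˡ (g 0)) (sym (ℤP.+-identityʳ (g 0)))
      front (suc m) g = ≡.trans (cong (λ s → s ℤ.+ g (suc m)) (front m g)) (ℤP.+-assoc (g 0) _ _)
      go : ∀ m → Σ< m (λ i → + (m ∸ suc i)) ≡ Σ< m (λ i → + i)
      go zero = refl
      go (suc m) = ≡.trans (front m _) (≡.trans (ℤP.+-comm (+ m) (Σ< m (λ i → + (m ∸ suc i)))) (cong (λ s → s ℤ.+ + m) (go m)))
    sums : Σ< m (λ i → + x i) ≡ tailSum ℓ z γ ℤ.+ Σ< m (λ i → + i)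
    sums = ≡.trans (x-sum m ℕP.≤-refl) (≡.trans (cong₂ ℤ._+_ (cong (λ s → tailSum ℓ z γ ℤ.+ s) (flipped m))
      (≡.trans (Σ<-cong m (λ i _ → cong +_ (ℕP.n∸n≡0 m))) (Σ<-zero m))) (ℤP.+-identityʳ _))

  alternant-zero : ∀ γ → (∀ i → i < ℓ → γ i ≡ 0ℤ) → alternant γ ≡ 1ℤ
  alternant-zero γ h = cong₂ ℤ._*_
    (prod-one (order γ) (λ { (i , j) m → sgn-indicator _ (linear (_ ∷ _ ∷ []) (_ ∷ _ ∷ []) (# 0 ≈ᶻ lit 0ℤ ∷ # 1 ≈ᶻ lit 0ℤ ∷ # 0 <ⁿ # 1 ∷ [] ⊢ lit 0ℤ <ᶻ # 0 ⊕ ⊝ ↑ # 0 ⊕ ⊝ (# 1 ⊕ ⊝ ↑ # 1)) (h i (ℕP.<-trans (proj₁ (∈-pairs⁻ m)) (proj₂ (∈-pairs⁻ m))) , h j (proj₂ (∈-pairs⁻ m)) , proj₁ (∈-pairs⁻ m))) }))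
    (prod-one (lower γ) (λ i m → indicator-one _ (linear (_ ∷ _ ∷ []) (_ ∷ []) (# 0 ≈ᶻ lit 0ℤ ∷ # 0 <ⁿ # 1 ∷ [] ⊢ lit 0ℤ <ᶻ # 0 ⊕ ⊝ ↑ # 0 ⊕ ↑ # 1) (h i (∈-upTo⁻ m) , ∈-upTo⁻ m))))

  unit-class : Class ℓ 0 unit-functional
  unit-class .ext h zero = alternant-ext h
  unit-class .ext h (suc d) = refl
  unit-class .vanish z γ neg zero = alternant-tail z γ neg
  unit-class .vanish z γ neg (suc d) = refl
  unit-class .anti z h _ γ zero = alternant-anti z h γ
  unit-class .anti z h _ γ (suc d) = refl

-- Beads of cores

infixl 6 _⇧[_]_
_⇧[_]_ : ℤ → ℕ → ℕ → ℤ
v ⇧[ n ] j = v ℤ.+ + (j ℕ.* n)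

-- A partition with rows κ_i is stored by its beads b i = κ_i − i; it is an n-core iff b i − n is again a bead, in row D i say.
record Beads (n : ℕ) : Set where
  field
    b : ℕ → ℤ
    D : ℕ → ℕ
    L : ℕ
    b-dec : ∀ i → b (suc i) ℤ.< b i
    b-D : ∀ i → b (D i) ≡ b i ℤ.- + n
    b-end : ∀ i → L ≤ i → b i ≡ ℤ.- + i

≤ᵇ⇒+ : ∀ {i j} → i ≤ j → ∃ λ k → j ≡ i ℕ.+ k
≤ᵇ⇒+ {i} {j} h = j ∸ i , sym (ℕP.m+[n∸m]≡n h)

module Seq (b : ℕ → ℤ) (L : ℕ) (b-dec : ∀ i → b (suc i) ℤ.< b i) (b-end : ∀ i → L ≤ i → b i ≡ ℤ.- + i) where
  mono+ : ∀ i k → b (i ℕ.+ suc k) ℤ.< b i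
  mono+ i zero = subst (λ m → b m ℤ.< b i) (ℕP.+-comm 1 i) (b-dec i)
  mono+ i (suc k) = subst (λ m → b m ℤ.< b i) (sym (ℕP.+-suc i (suc k))) (ℤP.<-trans (b-dec (i ℕ.+ suc k)) (mono+ i k))

  mono< : ∀ {i j} → i < j → b j ℤ.< b i
  mono< {i} {j} h with ≤ᵇ⇒+ h
  ... | k , refl = subst (λ m → b m ℤ.< b i) (ℕP.+-suc i k) (mono+ i k)

  mono≤ : ∀ {i j} → i ≤ j → b j ℤ.≤ b i
  mono≤ {i} {j} h with i ≟ j
  ... | yes refl = ℤP.≤-refl
  ... | no ne = ℤP.<⇒≤ (mono< (ℕP.≤∧≢⇒< h ne))

  cmp< : ∀ {i j} → b j ℤ.< b i → i < j
  cmp< {i} {j} h with i <? j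
  ... | yes p = p
  ... | no p = ⊥-elim (ℤP.<-irrefl refl (ℤP.<-≤-trans h (mono≤ (ℕP.≮⇒≥ p))))

  cmp≤ : ∀ {i j} → b j ℤ.≤ b i → i ≤ j
  cmp≤ {i} {j} h with i ≤? j
  ... | yes p = p
  ... | no p = ⊥-elim (ℤP.<-irrefl refl (ℤP.≤-<-trans h (mono< (ℕP.≰⇒> p))))

  b-inj : ∀ {i j} → b i ≡ b j → i ≡ j
  b-inj e = ℕP.≤-antisym (cmp≤ (ℤP.≤-reflexive (sym e))) (cmp≤ (ℤP.≤-reflexive e))

  b-≥ : ∀ i → ℤ.- + i ℤ.≤ b i
  b-≥ i with L ≤? i
  ... | yes h = ℤP.≤-reflexive (sym (b-end i h))
  ... | no h = go (L ∸ i) (ℕP.m+[n∸m]≡n (ℕP.<⇒≤ (ℕP.≰⇒> h)))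
    where
    go : ∀ k {i} → i ℕ.+ k ≡ L → ℤ.- + i ℤ.≤ b i
    go zero {i} e = ℤP.≤-reflexive (sym (b-end i (linear (_ ∷ _ ∷ []) [] (# 0 ⊕ lit 0 ≈ⁿ # 1 ∷ [] ⊢ # 1 ≤ⁿ # 0) e)))
    go (suc k) {i} e = linear (i ∷ []) (_ ∷ _ ∷ []) (⊝ ↑ 1+ # 0 ≤ᶻ # 0 ∷ # 0 <ᶻ # 1 ∷ [] ⊢ ⊝ ↑ # 0 ≤ᶻ # 1) (go k {suc i} (linear (i ∷ k ∷ _ ∷ []) [] (# 0 ⊕ 1+ # 1 ≈ⁿ # 2 ∷ [] ⊢ 1+ # 0 ⊕ # 1 ≈ⁿ # 2) e) , b-dec i)

  opaque
    first : ∀ v → ∃ λ i → b i ℤ.≤ v × (∀ j → j < i → v ℤ.< b j)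
    first v = go (L ℕ.+ ℤ.∣ v ∣) 0 base (λ _ ())
      where
      base : b (0 ℕ.+ (L ℕ.+ ℤ.∣ v ∣)) ℤ.≤ v
      base = subst (ℤ._≤ v) (sym (b-end _ (ℕP.m≤m+n L _))) (abs-low v)
        where
        abs-low : ∀ v → ℤ.- + (L ℕ.+ ℤ.∣ v ∣) ℤ.≤ v
        abs-low (+ m) = linear (L ∷ _ ∷ []) [] ([] ⊢ ⊝ ↑ (# 0 ⊕ # 1) ≤ᶻ ↑ # 1) tt
        abs-low -[1+ m ] = linear (L ∷ m ∷ []) [] ([] ⊢ ⊝ ↑ (# 0 ⊕ 1+ # 1) ≤ᶻ ⊝ ↑ 1+ # 1) tt
      go : ∀ k i → b (i ℕ.+ k) ℤ.≤ v → (∀ j → j < i → v ℤ.< b j) → ∃ λ i → b i ℤ.≤ v × (∀ j → j < i → v ℤ.< b j)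
      go zero i h hs = i , subst (λ m → b m ℤ.≤ v) (ℕP.+-identityʳ i) h , hs
      go (suc k) i h hs with b i ℤ.≤? v
      ... | yes p = i , p , hs
      ... | no p = go k (suc i) (subst (λ m → b m ℤ.≤ v) (ℕP.+-suc i k) h) hs'
        where
        hs' : ∀ j → j < suc i → v ℤ.< b j
        hs' j h' with j ≟ i
        ... | yes refl = ℤP.≰⇒> p
        ... | no ne = hs j (ℕP.≤∧≢⇒< (ℕP.≤-pred h') ne)

  mem : ℤ → Set
  mem v = ∃ λ i → b i ≡ v

  opaque
    mem? : ∀ v → Dec (mem v)
    mem? v with first v
    ... | i , h , hs with b i ℤ.≟ v
    ...   | yes e = yes (i , e)
    ...   | no ne = no contra
      where
      contra : mem v → ⊥
      contra (j , e) with j <? i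
      ... | yes j<i = ℤP.<-irrefl (sym e) (hs j j<i)
      ... | no j≮i = ne (ℤP.≤-antisym h (subst (ℤ._≤ b i) e (mono≤ (ℕP.≮⇒≥ j≮i))))

module Rows {n : ℕ} (1≤n : 1 ≤ n) (κ : Beads n) where
  open Beads κ public
  open Seq b L b-dec b-end public

  D-mono : ∀ {i j} → i < j → D i < D j
  D-mono {i} {j} h = cmp< {D i} {D j} (linear (n ∷ []) (_ ∷ _ ∷ _ ∷ _ ∷ []) (# 0 <ᶻ # 1 ∷ # 2 ≈ᶻ # 1 ⊖ ↑ # 0 ∷ # 3 ≈ᶻ # 0 ⊖ ↑ # 0 ∷ [] ⊢ # 3 <ᶻ # 2) (mono< h , b-D i , b-D j))

  D-> : ∀ i → i < D i
  D-> i = cmp< {i} {D i} (linear (_ ∷ []) (_ ∷ _ ∷ []) (# 0 ≈ᶻ # 1 ⊖ ↑ # 0 ∷ lit 1 ≤ⁿ # 0 ∷ [] ⊢ # 0 <ᶻ # 1) (b-D i , 1≤n))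

  mem-pred : ∀ {v} → mem v → mem (v ℤ.- + n)
  mem-pred (i , e) = D i , ≡.trans (b-D i) (cong (λ x → x ℤ.- + n) e)

  mem-≡ : ∀ {v w} → v ≡ w → mem v → mem w
  mem-≡ e = subst mem e

  mem-down : ∀ {v} k j → mem (v ⇧[ n ] (k ℕ.+ j)) → mem (v ⇧[ n ] j)
  mem-down zero j h = h
  mem-down {v} (suc k) j h = mem-down {v} k j (mem-≡ (lem v (+ ((k ℕ.+ j) ℕ.* n)) (+ n)) (mem-pred h))
    where lem : ∀ v x m → v ℤ.+ (m ℤ.+ x) ℤ.- m ≡ v ℤ.+ x
          lem = solve-∀

  mem-le : ∀ {v i j} → i ≤ j → mem (v ⇧[ n ] j) → mem (v ⇧[ n ] i)
  mem-le {v} {i} {j} h m = mem-down {v} (j ∸ i) i (mem-≡ (cong (λ k → v ⇧[ n ] k) (sym (ℕP.m∸n+n≡m h))) m)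

  mem-base : ∀ {v} j → mem (v ⇧[ n ] j) → mem v
  mem-base {v} j m = mem-≡ (ℤP.+-identityʳ v) (mem-le {v} {0} {j} z≤n m)

  -- From row `L` on the rows are empty and their beads fill everything up to `- L`.
  nonmember-high : ∀ {x} → ¬ mem x → ℤ.- + L ℤ.< x
  nonmember-high {x} x∉ with x ℤ.≤? ℤ.- + L
  ... | no p = ℤP.≰⇒> p
  ... | yes p = ⊥-elim (x∉ (ℤ.∣ x ∣ , ≡.trans (b-end ℤ.∣ x ∣ (proj₁ ab)) (proj₂ ab)))
    where
    abs : ∀ v → v ℤ.≤ ℤ.- + L → L ≤ ℤ.∣ v ∣ × ℤ.- + ℤ.∣ v ∣ ≡ v
    abs (+ zero) h = linear (_ ∷ []) [] (↑ lit 0 ≤ᶻ ⊝ ↑ # 0 ∷ [] ⊢ # 0 ≤ⁿ lit 0) h , refl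
    abs (+ suc m) h = ⊥-elim (linear (_ ∷ L ∷ []) [] (↑ 1+ # 0 ≤ᶻ ⊝ ↑ # 1 ∷ [] ⊢ absurd) h)
    abs -[1+ m ] h = linear (_ ∷ _ ∷ []) [] (⊝ ↑ 1+ # 0 ≤ᶻ ⊝ ↑ # 1 ∷ [] ⊢ # 1 ≤ⁿ 1+ # 0) h , refl
    ab = abs x p

  no-between : ∀ s {v} → b (suc s) ℤ.< v → v ℤ.< b s → ¬ mem v
  no-between s h h' (i , refl) = ℕP.<-irrefl refl (ℕP.<-≤-trans (cmp< h') (ℕP.≤-pred (cmp< h)))

  window-beads : ℤ → ℕ → List ℤ
  window-beads x zero = []
  window-beads x (suc i) with mem? (x ℤ.+ 1ℤ ℤ.+ + i)
  ... | yes _ = (x ℤ.+ 1ℤ ℤ.+ + i) ∷ window-beads x i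
  ... | no _ = window-beads x i

  -- Window x y j: every bead of the window (x , y) is present on levels 0 … j, and level −1 has no further ones.
  record Window (x y : ℤ) (j : ℕ) : Set where
    field
      base : ∀ w → x ℤ.< w → w ℤ.< y → mem (w ℤ.- + n) → mem w
      rise : ∀ w → x ℤ.< w → w ℤ.< y → mem w → mem (w ⇧[ n ] j)

  window-≤ : ∀ {x y i j} → i ≤ j → Window x y j → Window x y i
  window-≤ h W = record { base = base ; rise = λ w a c m → mem-le {w} h (rise w a c m) }
    where open Window W

  -- Above level 0, a bead at `v - n` forces one at level 0 of the same runner, since runners are
  -- filled from below, and `rise` brings it up to the level of `v`.
  lift : ∀ {x y j} → Window x y j → ∀ v → x ⇧[ n ] j ℤ.< v → v ℤ.< y ⇧[ n ] j → mem (v ℤ.- + n) → mem v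
  lift {x} {y} {zero} W v h h' m = Window.base W v (linear [] (_ ∷ _ ∷ []) (# 0 ⊕ ↑ lit 0 <ᶻ # 1 ∷ [] ⊢ # 0 <ᶻ # 1) h) (linear [] (_ ∷ _ ∷ []) (# 0 <ᶻ # 1 ⊕ ↑ lit 0 ∷ [] ⊢ # 0 <ᶻ # 1) h') m
  lift {x} {y} {suc j} W v h h' m = mem-≡ (lem v (+ (suc j ℕ.* n))) (Window.rise W (v ℤ.- + (suc j ℕ.* n)) (linear (n ∷ j ℕ.* n ∷ []) (_ ∷ _ ∷ []) (# 0 ⊕ ↑ (# 0 ⊕ # 1) <ᶻ # 1 ∷ [] ⊢ # 0 <ᶻ # 1 ⊖ ↑ (# 0 ⊕ # 1)) h) (linear (n ∷ j ℕ.* n ∷ []) (_ ∷ _ ∷ []) (# 0 <ᶻ # 1 ⊕ ↑ (# 0 ⊕ # 1) ∷ [] ⊢ # 0 ⊖ ↑ (# 0 ⊕ # 1) <ᶻ # 1) h')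
      (mem-base {v ℤ.- + (suc j ℕ.* n)} j (mem-≡ (lem' v (+ n) (+ (j ℕ.* n))) m)))
    where
    lem : ∀ v x → v ℤ.- x ℤ.+ x ≡ v
    lem = solve-∀
    lem' : ∀ v m x → v ℤ.- m ≡ v ℤ.- (m ℤ.+ x) ℤ.+ x
    lem' = solve-∀

  -- A bead between the partners of rows `s` and `s + 1`, one level down, would lift to a bead
  -- between these two rows.
  D-consecutive : ∀ {x y j} → Window x y j → ∀ s → x ⇧[ n ] j ℤ.≤ b (suc s) → b s ℤ.≤ y ⇧[ n ] j → D (suc s) ≡ suc (D s)
  D-consecutive {x} {y} {j} W s h h' with D (suc s) ≟ suc (D s)
  ... | yes e = e
  ... | no ne = ⊥-elim (no-between s {v} lo hi (lift {x} {y} {j} W v (ℤP.≤-<-trans h lo) (ℤP.<-≤-trans hi h') (suc (D s) , lem (b (suc (D s))) (+ n))))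
    where
    v = b (suc (D s)) ℤ.+ + n
    lem : ∀ v x → v ≡ v ℤ.+ x ℤ.- x
    lem = solve-∀
    lo : b (suc s) ℤ.< v
    lo = linear (n ∷ []) (_ ∷ _ ∷ _ ∷ []) (# 0 ≈ᶻ # 1 ⊖ ↑ # 0 ∷ # 0 <ᶻ # 2 ∷ [] ⊢ # 1 <ᶻ # 2 ⊕ ↑ # 0) (b-D (suc s) , mono< (ℕP.≤∧≢⇒< (D-mono (ℕP.n<1+n s)) (ne ∘ sym)))
    hi : v ℤ.< b s
    hi = linear (n ∷ []) (_ ∷ _ ∷ _ ∷ []) (# 0 ≈ᶻ # 1 ⊖ ↑ # 0 ∷ # 2 <ᶻ # 0 ∷ [] ⊢ # 2 ⊕ ↑ # 0 <ᶻ # 1) (b-D s , b-dec (D s))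

  D-last : ∀ {x y j} → Window x y j → ∀ s → b (suc s) ℤ.≤ x ⇧[ n ] j → b s ℤ.≤ y ⇧[ n ] j → b (suc (D s)) ℤ.≤ x ⇧[ n ] j ℤ.- + n
  D-last {x} {y} {j} W s h h' with b (suc (D s)) ℤ.≤? x ⇧[ n ] j ℤ.- + n
  ... | yes p = p
  ... | no p = ⊥-elim (no-between s {v} (ℤP.≤-<-trans h lo) hi (lift {x} {y} {j} W v lo (ℤP.<-≤-trans hi h') (suc (D s) , lem (b (suc (D s))) (+ n))))
    where
    v = b (suc (D s)) ℤ.+ + n
    lem : ∀ v x → v ≡ v ℤ.+ x ℤ.- x
    lem = solve-∀
    lo : x ⇧[ n ] j ℤ.< v
    lo = linear (j ℕ.* n ∷ n ∷ []) (x ∷ _ ∷ []) (# 0 ⊕ ↑ # 0 ⊕ ⊝ ↑ # 1 <ᶻ # 1 ∷ [] ⊢ # 0 ⊕ ↑ # 0 <ᶻ # 1 ⊕ ↑ # 1) (ℤP.≰⇒> p)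
    hi : v ℤ.< b s
    hi = linear (n ∷ []) (_ ∷ _ ∷ _ ∷ []) (# 0 ≈ᶻ # 1 ⊖ ↑ # 0 ∷ # 2 <ᶻ # 0 ∷ [] ⊢ # 2 ⊕ ↑ # 0 <ᶻ # 1) (b-D s , b-dec (D s))

  -- The beads y, y + n, …, y + J n can be exchanged for x, x + n, …, x + J n in a strong cover.
  record Exchange (x y : ℤ) (J : ℕ) : Set where
    field
      x<y : x ℤ.< y
      y<x+n : y ℤ.< x ℤ.+ + n
      x∉ : ¬ mem x
      x-n∈ : mem (x ℤ.- + n)
      top∈ : mem (y ⇧[ n ] J)
      top∉ : ¬ mem (y ⇧[ n ] suc J)
      gap : ∀ w → x ℤ.< w → w ℤ.< y → mem (w ℤ.- + n) → mem (w ⇧[ n ] suc J)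

  -- The condition `gap` sorts the runners strictly between those of x and y into two kinds: either
  -- the topmost bead lies below level -1, or it lies at level J + 1 or higher. Hence all exchanged
  -- levels show the same pattern of beads between the two runners.
  exchange-window : ∀ {x y J} → Exchange x y J → Window x y (suc J)
  exchange-window {J = J} X = record
    { base = λ w a c m → mem-base {w} (suc J) (gap w a c m)
    ; rise = λ w a c m → gap w a c (mem-pred m) }
    where open Exchange X

module Swap {n : ℕ} (1≤n : 1 ≤ n) (κ : Beads n) {x y : ℤ} {J : ℕ} (X : Rows.Exchange 1≤n κ x y J) where
  open Rows 1≤n κ
  open Exchange X

  W : ∀ {j} → j ≤ suc J → Window x y j
  W h = window-≤ h (exchange-window X)

  record Inside (j : ℕ) (v : ℤ) : Set where
    constructor _,_
    field
      lo : x ⇧[ n ] j ℤ.< v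
      hi : v ℤ.≤ y ⇧[ n ] j
  open Inside public

  opaque
    inside? : ∀ v → Dec (∃ λ j → j < suc J × Inside j v)
    inside? v = ℕP.anyUpTo? at?  (suc J)
      where
      at? : ∀ j → Dec (Inside j v)
      at? j with x ⇧[ n ] j ℤ.<? v | v ℤ.≤? y ⇧[ n ] j
      ... | yes p | yes q = yes (p , q)
      ... | no p | _ = no (p ∘ lo)
      ... | yes _ | no q = no (q ∘ hi)

  gap-n : ∀ {i j} → i < j → i ℕ.* n ℕ.+ n ≤ j ℕ.* n
  gap-n {i} {j} h = subst (_≤ j ℕ.* n) (ℕP.+-comm n (i ℕ.* n)) (ℕP.*-monoˡ-≤ n h)

  inside-unique : ∀ {i j v} → Inside i v → Inside j v → i ≡ j
  inside-unique {i} {j} (a , c) (a' , c') with ℕP.<-cmp i j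
  ... | Relation.Binary.Definitions.tri< h _ _ = ⊥-elim (linear (i ℕ.* n ∷ n ∷ _ ∷ []) (_ ∷ _ ∷ x ∷ []) (# 0 ⊕ # 1 ≤ⁿ # 2 ∷ # 0 ≤ᶻ # 1 ⊕ ↑ # 0 ∷ # 2 ⊕ ↑ # 2 <ᶻ # 0 ∷ # 1 <ᶻ # 2 ⊕ ↑ # 1 ∷ [] ⊢ absurd) (gap-n h , c , a' , y<x+n))
  ... | Relation.Binary.Definitions.tri≈ _ e _ = e
  ... | Relation.Binary.Definitions.tri> _ _ h = ⊥-elim (linear (j ℕ.* n ∷ n ∷ _ ∷ []) (_ ∷ _ ∷ x ∷ []) (# 0 ⊕ # 1 ≤ⁿ # 2 ∷ # 0 ≤ᶻ # 1 ⊕ ↑ # 0 ∷ # 2 ⊕ ↑ # 2 <ᶻ # 0 ∷ # 1 <ᶻ # 2 ⊕ ↑ # 1 ∷ [] ⊢ absurd) (gap-n h , c' , a , y<x+n))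

  y∈ : ∀ {j} → j ≤ J → mem (y ⇧[ n ] j)
  y∈ h = mem-le {y} h top∈

  x∉⇧ : ∀ j → ¬ mem (x ⇧[ n ] j)
  x∉⇧ j m = x∉ (mem-base {x} j m)

  opaque
    -- In the window of each level the beads move down by one place, the lowest of them to x + jn;
    -- the maximum tells whether the next bead still lies in the window. As a set, the beads lose y
    -- + jn and gain x + jn for j ≤ J.
    bσ : ℕ → ℤ
    bσ r with inside? (b r)
    ... | yes (j , _) = b (suc r) ℤ.⊔ (x ⇧[ n ] j)
    ... | no _ = b r

    bσ-yes : ∀ r j → j ≤ J → Inside j (b r) → bσ r ≡ b (suc r) ℤ.⊔ (x ⇧[ n ] j)
    bσ-yes r j h i with inside? (b r)
    ... | yes (j' , _ , i') = cong (λ j → b (suc r) ℤ.⊔ (x ⇧[ n ] j)) (inside-unique i' i)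
    ... | no none = ⊥-elim (none (j , s≤s h , i))

    bσ-no : ∀ r → (∀ j → j ≤ J → ¬ Inside j (b r)) → bσ r ≡ b r
    bσ-no r none with inside? (b r)
    ... | yes (j , h , i) = ⊥-elim (none j (ℕP.≤-pred h) i)
    ... | no _ = refl

  data View (r : ℕ) : Set where
    step : ∀ j → j ≤ J → Inside j (b r) → x ⇧[ n ] j ℤ.< b (suc r) → bσ r ≡ b (suc r) → View r
    last : ∀ j → j ≤ J → Inside j (b r) → b (suc r) ℤ.< x ⇧[ n ] j → bσ r ≡ x ⇧[ n ] j → View r
    outside : (∀ j → j ≤ J → ¬ Inside j (b r)) → bσ r ≡ b r → View r

  bσ-step : ∀ r j → j ≤ J → Inside j (b r) → x ⇧[ n ] j ℤ.< b (suc r) → bσ r ≡ b (suc r)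
  bσ-step r j h i lt = ≡.trans (bσ-yes r j h i) (ℤP.i≥j⇒i⊔j≡i (ℤP.<⇒≤ lt))

  bσ-last : ∀ r j → j ≤ J → Inside j (b r) → b (suc r) ℤ.≤ x ⇧[ n ] j → bσ r ≡ x ⇧[ n ] j
  bσ-last r j h i le = ≡.trans (bσ-yes r j h i) (ℤP.i≤j⇒i⊔j≡j le)

  view : ∀ r → View r
  view r with inside? (b r)
  ... | no none = outside (λ j h i → none (j , s≤s h , i)) (bσ-no r (λ j h i → none (j , s≤s h , i)))
  ... | yes (j , h , i) with x ⇧[ n ] j ℤ.<? b (suc r)
  ...   | yes lt = step j (ℕP.≤-pred h) i lt (bσ-step r j (ℕP.≤-pred h) i lt)
  ...   | no nl = last j (ℕP.≤-pred h) i (ℤP.≤∧≢⇒< (ℤP.≮⇒≥ nl) (λ e → x∉⇧ j (suc r , e))) (bσ-last r j (ℕP.≤-pred h) i (ℤP.≮⇒≥ nl))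

  bσ-≤ : ∀ r → bσ r ℤ.≤ b r
  bσ-≤ r with view r
  ... | step j _ _ _ e = subst (ℤ._≤ b r) (sym e) (ℤP.<⇒≤ (b-dec r))
  ... | last j _ i _ e = subst (ℤ._≤ b r) (sym e) (ℤP.<⇒≤ (lo i))
  ... | outside _ e = ℤP.≤-reflexive e

  bσ-< : ∀ r j → j ≤ J → Inside j (b r) → bσ r ℤ.< b r
  bσ-< r j h i with view r
  ... | step _ _ _ _ e = subst (ℤ._< b r) (sym e) (b-dec r)
  ... | last _ _ i _ e = subst (ℤ._< b r) (sym e) (lo i)
  ... | outside none e = ⊥-elim (none j h i)

  next-inside : ∀ {r j} → Inside j (b r) → x ⇧[ n ] j ℤ.< b (suc r) → Inside j (b (suc r))
  next-inside {r} i lt = lt , ℤP.<⇒≤ (ℤP.<-≤-trans (b-dec r) (hi i))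

  bσ-dec : ∀ r → bσ (suc r) ℤ.< bσ r
  bσ-dec r with view r
  ... | step j h i lt e = subst (bσ (suc r) ℤ.<_) (sym e) (bσ-< (suc r) j h (next-inside i lt))
  ... | last j h i lt e = subst (bσ (suc r) ℤ.<_) (sym e) (ℤP.≤-<-trans (bσ-≤ (suc r)) lt)
  ... | outside _ e = subst (bσ (suc r) ℤ.<_) (sym e) (ℤP.≤-<-trans (bσ-≤ (suc r)) (b-dec r))

  x-high : ℤ.- + L ℤ.< x
  x-high = nonmember-high x∉

  bσ-end : ∀ r → L ≤ r → bσ r ≡ ℤ.- + r
  bσ-end r h = ≡.trans (bσ-no r (λ j _ i → linear (j ℕ.* n ∷ _ ∷ _ ∷ []) (_ ∷ _ ∷ []) (# 0 ⊕ ↑ # 0 <ᶻ # 1 ∷ ⊝ ↑ # 1 <ᶻ # 0 ∷ # 1 ≈ᶻ ⊝ ↑ # 2 ∷ # 1 ≤ⁿ # 2 ∷ [] ⊢ absurd) (lo i , x-high , b-end r h , h))) (b-end r h)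

  Low High : ℤ → Set
  Low v = x ℤ.< v × v ℤ.≤ y
  High v = x ⇧[ n ] suc J ℤ.< v × v ℤ.< y ⇧[ n ] suc J

  low? : ∀ v → Dec (Low v)
  low? v with x ℤ.<? v | v ℤ.≤? y
  ... | yes p | yes q = yes (p , q)
  ... | no p | _ = no (p ∘ proj₁)
  ... | yes _ | no q = no (q ∘ proj₂)

  high? : ∀ v → Dec (High v)
  high? v with x ⇧[ n ] suc J ℤ.<? v | v ℤ.<? y ⇧[ n ] suc J
  ... | yes p | yes q = yes (p , q)
  ... | no p | _ = no (p ∘ proj₁)
  ... | yes _ | no q = no (q ∘ proj₂)

  low⇒inside : ∀ {v} → Low v → Inside 0 v
  low⇒inside (p , q) = linear (n ∷ []) (_ ∷ _ ∷ []) (# 0 <ᶻ # 1 ∷ [] ⊢ # 0 ⊕ ↑ (0 ⊛ # 0) <ᶻ # 1) p , linear (n ∷ []) (_ ∷ _ ∷ []) (# 0 ≤ᶻ # 1 ∷ [] ⊢ # 0 ≤ᶻ # 1 ⊕ ↑ (0 ⊛ # 0)) q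

  inside⇒low : ∀ {v} → Inside 0 v → Low v
  inside⇒low (p , q) = linear (n ∷ []) (_ ∷ _ ∷ []) (# 0 ⊕ ↑ (0 ⊛ # 0) <ᶻ # 1 ∷ [] ⊢ # 0 <ᶻ # 1) p , linear (n ∷ []) (_ ∷ _ ∷ []) (# 0 ≤ᶻ # 1 ⊕ ↑ (0 ⊛ # 0) ∷ [] ⊢ # 0 ≤ᶻ # 1) q

  high⇒outside : ∀ {v} → High v → ∀ j → j ≤ J → ¬ Inside j v
  high⇒outside (p , q) j h (a , c) = linear (j ℕ.* n ∷ n ∷ J ℕ.* n ∷ []) (_ ∷ _ ∷ x ∷ []) (# 0 ⊕ # 1 ≤ⁿ # 1 ⊕ # 2 ∷ # 0 ≤ᶻ # 1 ⊕ ↑ # 0 ∷ # 2 ⊕ ↑ (# 1 ⊕ # 2) <ᶻ # 0 ∷ # 1 <ᶻ # 2 ⊕ ↑ # 1 ∷ [] ⊢ absurd) (gap-n {j} {suc J} (s≤s h) , c , p , y<x+n)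

  opaque
    -- On level 0 the beads have moved while their partners, one level lower, have not: the partner
    -- comes one row later. In the window above level J it is the partners that have moved: one row
    -- earlier. On the levels between, beads and partners shift together.
    Dσ : ℕ → ℕ
    Dσ r with low? (b r) | high? (b r)
    ... | yes _ | _ = suc (D r)
    ... | no _ | yes _ = ℕ.pred (D r)
    ... | no _ | no _ = D r

    Dσ-low : ∀ r → Low (b r) → Dσ r ≡ suc (D r)
    Dσ-low r l with low? (b r) | high? (b r)
    ... | yes _ | _ = refl
    ... | no p | _ = ⊥-elim (p l)

    Dσ-high : ∀ r → High (b r) → suc (Dσ r) ≡ D r
    Dσ-high r l with low? (b r) | high? (b r)
    ... | yes p | _ = ⊥-elim (high⇒outside l 0 z≤n (low⇒inside p))
    ... | no _ | yes _ = ℕP.suc-pred (D r) ⦃ ℕ.>-nonZero (ℕP.≤-<-trans z≤n (D-> r)) ⦄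
    ... | no _ | no p = ⊥-elim (p l)

    Dσ-else : ∀ r → ¬ Low (b r) → ¬ High (b r) → Dσ r ≡ D r
    Dσ-else r l h with low? (b r) | high? (b r)
    ... | yes p | _ = ⊥-elim (l p)
    ... | no _ | yes p = ⊥-elim (h p)
    ... | no _ | no _ = refl

  below-outside : ∀ {v} → v ℤ.≤ x → ∀ j → j ≤ J → ¬ Inside j v
  below-outside h j _ (a , _) = linear (j ℕ.* n ∷ []) (_ ∷ _ ∷ []) (# 0 ≤ᶻ # 1 ∷ # 1 ⊕ ↑ # 0 <ᶻ # 0 ∷ [] ⊢ absurd) (h , a)

  row-above : ∀ {q j} → j ≤ J → b q ℤ.< y ⇧[ n ] j → ∃ λ s → q ≡ suc s × b s ℤ.≤ y ⇧[ n ] j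
  row-above {zero} h lt with y∈ h
  ... | i , e = ⊥-elim (ℕP.<⇒≱ (cmp< (subst (b 0 ℤ.<_) (sym e) lt)) z≤n)
  row-above {suc q} h lt with y∈ h
  ... | i , e = q , refl , subst (b q ℤ.≤_) e (mono≤ (ℕP.≤-pred (cmp< (subst (b (suc q) ℤ.<_) (sym e) lt))))

  pred-inside : ∀ {j v w} → w ≡ v ℤ.- + n → Inside (suc j) v → Inside j w
  pred-inside {j} e (a , c) = linear (n ∷ j ℕ.* n ∷ []) (_ ∷ _ ∷ x ∷ []) (# 0 ≈ᶻ # 1 ⊖ ↑ # 0 ∷ # 2 ⊕ ↑ (# 0 ⊕ # 1) <ᶻ # 1 ∷ [] ⊢ # 2 ⊕ ↑ # 1 <ᶻ # 0) (e , a) , linear (n ∷ j ℕ.* n ∷ []) (_ ∷ _ ∷ y ∷ []) (# 0 ≈ᶻ # 1 ⊖ ↑ # 0 ∷ # 1 ≤ᶻ # 2 ⊕ ↑ (# 0 ⊕ # 1) ∷ [] ⊢ # 0 ≤ᶻ # 2 ⊕ ↑ # 1) (e , c)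

  succ-inside : ∀ {j v w} → w ≡ v ℤ.- + n → Inside j w → Inside (suc j) v
  succ-inside {j} e (a , c) = linear (n ∷ j ℕ.* n ∷ []) (_ ∷ _ ∷ x ∷ []) (# 0 ≈ᶻ # 1 ⊖ ↑ # 0 ∷ # 2 ⊕ ↑ # 1 <ᶻ # 0 ∷ [] ⊢ # 2 ⊕ ↑ (# 0 ⊕ # 1) <ᶻ # 1) (e , a) , linear (n ∷ j ℕ.* n ∷ []) (_ ∷ _ ∷ y ∷ []) (# 0 ≈ᶻ # 1 ⊖ ↑ # 0 ∷ # 0 ≤ᶻ # 2 ⊕ ↑ # 1 ∷ [] ⊢ # 1 ≤ᶻ # 2 ⊕ ↑ (# 0 ⊕ # 1)) (e , c)

  bσ-Dσ : ∀ r → bσ (Dσ r) ≡ bσ r ℤ.- + n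
  bσ-Dσ r with view r
  bσ-Dσ r | step zero h i lt e = ≡.trans (cong bσ (≡.trans (Dσ-low r (inside⇒low i)) (sym dc)))
      (≡.trans (bσ-no (D (suc r)) (below-outside (linear (n ∷ []) (_ ∷ _ ∷ _ ∷ _ ∷ _ ∷ []) (# 0 ≈ᶻ # 1 ⊖ ↑ # 0 ∷ # 1 <ᶻ # 2 ∷ # 2 ≤ᶻ # 3 ⊕ ↑ lit 0 ∷ # 3 <ᶻ # 4 ⊕ ↑ # 0 ∷ [] ⊢ # 0 ≤ᶻ # 4) (b-D (suc r) , b-dec r , hi i , y<x+n))))
      (≡.trans (b-D (suc r)) (cong (λ v → v ℤ.- + n) (sym e))))
    where dc = D-consecutive {x} {y} {0} (W z≤n) r (ℤP.<⇒≤ lt) (hi i)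
  bσ-Dσ r | step (suc j) h i lt e = ≡.trans (cong bσ (Dσ-else r no-low no-high))
      (≡.trans (bσ-step (D r) j (ℕP.<⇒≤ h) (pred-inside (b-D r) i) (linear (n ∷ j ℕ.* n ∷ []) (_ ∷ _ ∷ _ ∷ x ∷ []) (# 0 ≈ᶻ # 1 ∷ # 0 ≈ᶻ # 2 ⊖ ↑ # 0 ∷ # 3 ⊕ ↑ (# 0 ⊕ # 1) <ᶻ # 2 ∷ [] ⊢ # 3 ⊕ ↑ # 1 <ᶻ # 1) (cong b dc , b-D (suc r) , lt)))
      (≡.trans (cong b (sym dc)) (≡.trans (b-D (suc r)) (cong (λ v → v ℤ.- + n) (sym e)))))
    where
    dc = D-consecutive {x} {y} {suc j} (W (ℕP.m≤n⇒m≤1+n h)) r (ℤP.<⇒≤ lt) (hi i)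
    no-low : ¬ Low (b r)
    no-low l = ℕP.0≢1+n (inside-unique (low⇒inside l) i)
    no-high : ¬ High (b r)
    no-high l = high⇒outside l (suc j) h i
  -- The moved bead is now x itself. Its partner x - n is a bead by assumption, and it is the first
  -- one after the old partner `D r`.
  bσ-Dσ r | last zero h i lt e = ≡.trans (cong bσ (Dσ-low r (inside⇒low i)))
      (≡.trans (bσ-no (suc (D r)) (below-outside (linear (n ∷ []) (_ ∷ _ ∷ []) (# 0 ≤ᶻ # 1 ⊕ ↑ (0 ⊛ # 0) ⊖ ↑ # 0 ∷ [] ⊢ # 0 ≤ᶻ # 1) dl))) (≡.trans is-x (lem (bσ r) e)))
    where
    lem : ∀ v → v ≡ x ⇧[ n ] 0 → x ℤ.- + n ≡ v ℤ.- + n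
    lem v e = linear (n ∷ []) (_ ∷ x ∷ []) (# 0 ≈ᶻ # 1 ⊕ ↑ (0 ⊛ # 0) ∷ [] ⊢ # 1 ⊖ ↑ # 0 ≈ᶻ # 0 ⊖ ↑ # 0) e
    dl = D-last {x} {y} {0} (W z≤n) r (ℤP.<⇒≤ lt) (hi i)
    is-x : b (suc (D r)) ≡ x ℤ.- + n
    is-x with x-n∈
    ... | q , qe = ℤP.≤-antisym (linear (n ∷ []) (_ ∷ x ∷ []) (# 0 ≤ᶻ # 1 ⊕ ↑ (0 ⊛ # 0) ⊖ ↑ # 0 ∷ [] ⊢ # 0 ≤ᶻ # 1 ⊕ ⊝ ↑ # 0) dl) (subst (ℤ._≤ b (suc (D r))) qe (mono≤ (cmp< {D r} {q} (linear (n ∷ []) (_ ∷ x ∷ _ ∷ _ ∷ []) (# 0 ≈ᶻ # 1 ⊕ ⊝ ↑ # 0 ∷ # 2 ≈ᶻ # 3 ⊖ ↑ # 0 ∷ # 1 ⊕ ↑ (0 ⊛ # 0) <ᶻ # 3 ∷ [] ⊢ # 0 <ᶻ # 2) (qe , b-D r , lo i)))))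
  bσ-Dσ r | last (suc j) h i lt e = ≡.trans (cong bσ (Dσ-else r no-low no-high))
      (≡.trans (bσ-last (D r) j (ℕP.<⇒≤ h) (pred-inside (b-D r) i) (linear (n ∷ j ℕ.* n ∷ []) (_ ∷ x ∷ []) (# 0 ≤ᶻ # 1 ⊕ ↑ (# 0 ⊕ # 1) ⊖ ↑ # 0 ∷ [] ⊢ # 0 ≤ᶻ # 1 ⊕ ↑ # 1) dl)) (lem (bσ r) e))
    where
    lem : ∀ v → v ≡ x ⇧[ n ] suc j → x ⇧[ n ] j ≡ v ℤ.- + n
    lem v e = linear (n ∷ j ℕ.* n ∷ []) (_ ∷ x ∷ []) (# 0 ≈ᶻ # 1 ⊕ ↑ (# 0 ⊕ # 1) ∷ [] ⊢ # 1 ⊕ ↑ # 1 ≈ᶻ # 0 ⊖ ↑ # 0) e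
    dl = D-last {x} {y} {suc j} (W (ℕP.m≤n⇒m≤1+n h)) r (ℤP.<⇒≤ lt) (hi i)
    no-low : ¬ Low (b r)
    no-low l = ℕP.0≢1+n (inside-unique (low⇒inside l) i)
    no-high : ¬ High (b r)
    no-high l = high⇒outside l (suc j) h i
  bσ-Dσ r | outside none e with high? (b r)
  ... | yes hi = at-top (row-above {D r} {J} ℕP.≤-refl (linear (n ∷ J ℕ.* n ∷ []) (_ ∷ _ ∷ y ∷ []) (# 0 ≈ᶻ # 1 ⊖ ↑ # 0 ∷ # 1 <ᶻ # 2 ⊕ ↑ (# 0 ⊕ # 1) ∷ [] ⊢ # 0 <ᶻ # 2 ⊕ ↑ # 1) (b-D r , proj₂ hi)))
    where
    at-top : (∃ λ s → D r ≡ suc s × b s ℤ.≤ y ⇧[ n ] J) → bσ (Dσ r) ≡ bσ r ℤ.- + n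
    at-top (s , eq , le) = ≡.trans (cong bσ (ℕP.suc-injective (≡.trans (Dσ-high r hi) eq)))
      (≡.trans (bσ-step s J ℕP.≤-refl (linear (n ∷ J ℕ.* n ∷ []) (_ ∷ _ ∷ _ ∷ _ ∷ x ∷ []) (# 0 <ᶻ # 1 ∷ # 2 ≈ᶻ # 0 ∷ # 2 ≈ᶻ # 3 ⊖ ↑ # 0 ∷ # 4 ⊕ ↑ (# 0 ⊕ # 1) <ᶻ # 3 ∷ [] ⊢ # 4 ⊕ ↑ # 1 <ᶻ # 1) (b-dec s , cong b eq , b-D r , proj₁ hi) , le) (linear (n ∷ J ℕ.* n ∷ []) (_ ∷ _ ∷ _ ∷ x ∷ []) (# 0 ≈ᶻ # 1 ∷ # 0 ≈ᶻ # 2 ⊖ ↑ # 0 ∷ # 3 ⊕ ↑ (# 0 ⊕ # 1) <ᶻ # 2 ∷ [] ⊢ # 3 ⊕ ↑ # 1 <ᶻ # 1) (cong b eq , b-D r , proj₁ hi)))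
      (≡.trans (cong b (sym eq)) (≡.trans (b-D r) (cong (λ v → v ℤ.- + n) (sym e)))))
  ... | no nh = ≡.trans (cong bσ (Dσ-else r (λ l → none 0 z≤n (low⇒inside l)) nh))
      (≡.trans (bσ-no (D r) none') (≡.trans (b-D r) (cong (λ v → v ℤ.- + n) (sym e))))
    where
    none' : ∀ j → j ≤ J → ¬ Inside j (b (D r))
    none' j h i with j ≟ J
    -- One level above J the window can only be missed at its upper end, and y + (J+1)n is not a
    -- bead.
    ... | yes refl = nh (lo i' , ℤP.≤∧≢⇒< (hi i') (λ eq → top∉ (r , eq)))
      where i' = succ-inside (b-D r) i
    ... | no ne = none (suc j) (ℕP.≤∧≢⇒< h ne) (succ-inside (b-D r) i)

  σ : Beads n
  σ = record { b = bσ ; D = Dσ ; L = L ; b-dec = bσ-dec ; b-D = bσ-Dσ ; b-end = bσ-end }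

-- Straightening along the beads

shk : ℕ → (ℕ → ℤ) → ℕ → ℤ
shk zero g = g
shk (suc k) g = sh (shk k g)

shk-cong : ∀ k {g h : ℕ → ℤ} → (∀ d → g d ≡ h d) → ∀ d → shk k g d ≡ shk k h d
shk-cong zero e = e
shk-cong (suc k) e = sh-cong (shk-cong k e)

shk-zero : ∀ k {g : ℕ → ℤ} → (∀ d → g d ≡ 0ℤ) → ∀ d → shk k g d ≡ 0ℤ
shk-zero zero e = e
shk-zero (suc k) e = sh-zero (shk-zero k e)

shk-+ : ∀ k m (g : ℕ → ℤ) d → shk k (shk m g) d ≡ shk (k ℕ.+ m) g d
shk-+ zero m g d = refl
shk-+ (suc k) m g d = sh-cong (shk-+ k m g) d

data Position (a c v : ℤ) : ℤ → Set where
  within : a ℤ.≤ v → v ℤ.< c → Position a c v 1ℤ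
  beyond : v ℤ.< a ⊎ c ℤ.≤ v → Position a c v 0ℤ

opaque
  iv : ℤ → ℤ → ℤ → ℤ
  iv a c v with a ℤ.≤? v | v ℤ.<? c
  ... | yes _ | yes _ = 1ℤ
  ... | yes _ | no _ = 0ℤ
  ... | no _ | _ = 0ℤ

  position : ∀ a c v → Position a c v (iv a c v)
  position a c v with a ℤ.≤? v | v ℤ.<? c
  ... | yes p | yes q = within p q
  ... | yes p | no q = beyond (inj₂ (ℤP.≮⇒≥ q))
  ... | no p | _ = beyond (inj₁ (ℤP.≰⇒> p))

beyond-absurd : ∀ {a c v} → v ℤ.< a ⊎ c ℤ.≤ v → a ℤ.≤ v → v ℤ.< c → ⊥
beyond-absurd (inj₁ p) h k = ℤP.<⇒≱ p h
beyond-absurd (inj₂ p) h k = ℤP.<⇒≱ k p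

iv-in : ∀ {a c v} → a ℤ.≤ v → v ℤ.< c → iv a c v ≡ 1ℤ
iv-in {a} {c} {v} h k with iv a c v | position a c v
... | _ | within _ _ = refl
... | _ | beyond p = ⊥-elim (beyond-absurd p h k)

iv-out : ∀ {a c v} → (a ℤ.≤ v → v ℤ.< c → ⊥) → iv a c v ≡ 0ℤ
iv-out {a} {c} {v} h with iv a c v | position a c v
... | _ | within p q = ⊥-elim (h p q)
... | _ | beyond _ = refl

iv-same : ∀ {a c a' c' v} → (a ℤ.≤ v → v ℤ.< c → a' ℤ.≤ v × v ℤ.< c') → (a' ℤ.≤ v → v ℤ.< c' → a ℤ.≤ v × v ℤ.< c) → iv a c v ≡ iv a' c' v
iv-same {a} {c} {a'} {c'} {v} f g with iv a c v | position a c v | iv a' c' v | position a' c' v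
... | _ | within _ _ | _ | within _ _ = refl
... | _ | within p q | _ | beyond r = ⊥-elim (beyond-absurd r (proj₁ (f p q)) (proj₂ (f p q)))
... | _ | beyond r | _ | within p q = ⊥-elim (beyond-absurd r (proj₁ (g p q)) (proj₂ (g p q)))
... | _ | beyond _ | _ | beyond _ = refl

module Straighten {n : ℕ} (1≤n : 1 ≤ n) (κ : Beads n) (x y : ℤ) (x<y : x ℤ.< y) (y≤x+n : y ℤ.≤ x ℤ.+ + n) where
  open Rows 1≤n κ

  -- The start function in the middle of the straightening: the window has been processed on the levels below j and,
  -- on level j, from the top down to θ.
  stateℤ : ℕ → ℤ → ℕ → ℤ
  stateℤ j θ r = + D r ℤ.+ iv (x ℤ.+ 1ℤ) (y ℤ.+ 1ℤ) (b r)
    ℤ.- iv ((x ℤ.+ 1ℤ) ⇧[ n ] j) (θ ⇧[ n ] j) (b r)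
    ℤ.- iv (θ ⇧[ n ] suc j) (y ⇧[ n ] suc j) (b r)

  opaque
    state : ℕ → ℤ → ℕ → ℕ
    state j θ r = ℤ.∣ stateℤ j θ r ∣

    -- The two subtracted intervals are disjoint and `D r` is positive, so taking the absolute value
    -- alters nothing.
    state-spec : ∀ j θ r → θ ℤ.≤ y → + state j θ r ≡ stateℤ j θ r
    state-spec j θ r h = ℤP.0≤i⇒+∣i∣≡i nonneg
      where
      nonneg : 0ℤ ℤ.≤ stateℤ j θ r
      nonneg with iv (x ℤ.+ 1ℤ) (y ℤ.+ 1ℤ) (b r) | position (x ℤ.+ 1ℤ) (y ℤ.+ 1ℤ) (b r)
                | iv ((x ℤ.+ 1ℤ) ⇧[ n ] j) (θ ⇧[ n ] j) (b r) | position ((x ℤ.+ 1ℤ) ⇧[ n ] j) (θ ⇧[ n ] j) (b r)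
                | iv (θ ⇧[ n ] suc j) (y ⇧[ n ] suc j) (b r) | position (θ ⇧[ n ] suc j) (y ⇧[ n ] suc j) (b r)
      ... | _ | _ | _ | within _ p | _ | within q _ = ⊥-elim (linear (j ℕ.* n ∷ _ ∷ []) (_ ∷ θ ∷ []) (# 0 <ᶻ # 1 ⊕ ↑ # 0 ∷ # 1 ⊕ ↑ (# 1 ⊕ # 0) ≤ᶻ # 0 ∷ lit 1 ≤ⁿ # 1 ∷ [] ⊢ absurd) (p , q , 1≤n))
      ... | _ | within _ _ | _ | within _ _ | _ | beyond _ = linear (D r ∷ []) [] ([] ⊢ ↑ lit 0 ≤ᶻ ↑ # 0 ⊕ lit 1ℤ ⊕ ⊝ lit 1ℤ ⊕ ⊝ lit 0ℤ) tt
      ... | _ | within _ _ | _ | beyond _ | _ | within _ _ = linear (D r ∷ []) [] ([] ⊢ ↑ lit 0 ≤ᶻ ↑ # 0 ⊕ lit 1ℤ ⊕ ⊝ lit 0ℤ ⊕ ⊝ lit 1ℤ) tt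
      ... | _ | within _ _ | _ | beyond _ | _ | beyond _ = linear (D r ∷ []) [] ([] ⊢ ↑ lit 0 ≤ᶻ ↑ # 0 ⊕ lit 1ℤ ⊕ ⊝ lit 0ℤ ⊕ ⊝ lit 0ℤ) tt
      ... | _ | beyond _ | _ | within _ _ | _ | beyond _ = linear (_ ∷ _ ∷ []) [] (# 0 <ⁿ # 1 ∷ [] ⊢ ↑ lit 0 ≤ᶻ ↑ # 1 ⊕ lit 0ℤ ⊕ ⊝ lit 1ℤ ⊕ ⊝ lit 0ℤ) (D-> r)
      ... | _ | beyond _ | _ | beyond _ | _ | within _ _ = linear (_ ∷ _ ∷ []) [] (# 0 <ⁿ # 1 ∷ [] ⊢ ↑ lit 0 ≤ᶻ ↑ # 1 ⊕ lit 0ℤ ⊕ ⊝ lit 0ℤ ⊕ ⊝ lit 1ℤ) (D-> r)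
      ... | _ | beyond _ | _ | beyond _ | _ | beyond _ = linear (D r ∷ []) [] ([] ⊢ ↑ lit 0 ≤ᶻ ↑ # 0 ⊕ lit 0ℤ ⊕ ⊝ lit 0ℤ ⊕ ⊝ lit 0ℤ) tt

  spec : ∀ j θ r → θ ℤ.≤ y → ∀ {u v w} → iv (x ℤ.+ 1ℤ) (y ℤ.+ 1ℤ) (b r) ≡ u →
    iv ((x ℤ.+ 1ℤ) ⇧[ n ] j) (θ ⇧[ n ] j) (b r) ≡ v → iv (θ ⇧[ n ] suc j) (y ⇧[ n ] suc j) (b r) ≡ w →
    + state j θ r ≡ + D r ℤ.+ u ℤ.- v ℤ.- w
  spec j θ r h refl refl refl = state-spec j θ r h

  state-cong : ∀ j θ j' θ' r → θ ℤ.≤ y → θ' ℤ.≤ y →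
    iv ((x ℤ.+ 1ℤ) ⇧[ n ] j) (θ ⇧[ n ] j) (b r) ℤ.+ iv (θ ⇧[ n ] suc j) (y ⇧[ n ] suc j) (b r)
      ≡ iv ((x ℤ.+ 1ℤ) ⇧[ n ] j') (θ' ⇧[ n ] j') (b r) ℤ.+ iv (θ' ⇧[ n ] suc j') (y ⇧[ n ] suc j') (b r) →
    state j θ r ≡ state j' θ' r
  state-cong j θ j' θ' r h h' e = ℤP.+-injective (linear (_ ∷ D r ∷ _ ∷ []) (iv (x ℤ.+ 1ℤ) (y ℤ.+ 1ℤ) (b r) ∷ iv (x ℤ.+ 1ℤ ⇧[ n ] j) (θ ⇧[ n ] j) (b r) ∷ iv (θ ⇧[ n ] suc j) (y ⇧[ n ] suc j) (b r) ∷ iv (x ℤ.+ 1ℤ ⇧[ n ] j') (θ' ⇧[ n ] j') (b r) ∷ iv (θ' ⇧[ n ] suc j') (y ⇧[ n ] suc j') (b r) ∷ []) (↑ # 0 ≈ᶻ ↑ # 1 ⊕ # 0 ⊖ # 1 ⊖ # 2 ∷ ↑ # 2 ≈ᶻ ↑ # 1 ⊕ # 0 ⊖ # 3 ⊖ # 4 ∷ # 1 ⊕ # 2 ≈ᶻ # 3 ⊕ # 4 ∷ [] ⊢ ↑ # 0 ≈ᶻ ↑ # 2) (spec j θ r h refl refl refl , spec j' θ' r h' refl refl refl , e))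

  -- At the end of level `j` the second interval is empty, at the start of level `j + 1` the third
  -- one is, and the remaining interval is the same in both: no straightening takes place between
  -- levels.
  next-level : ∀ j r → state j (x ℤ.+ 1ℤ) r ≡ state (suc j) y r
  next-level j r = state-cong j (x ℤ.+ 1ℤ) (suc j) y r (linear [] (_ ∷ _ ∷ []) (# 0 <ᶻ # 1 ∷ [] ⊢ # 0 ⊕ lit 1ℤ ≤ᶻ # 1) x<y) ℤP.≤-refl
    (lem (iv-out (λ p q → linear (j ℕ.* n ∷ []) (x ∷ _ ∷ []) (# 0 ⊕ lit 1ℤ ⊕ ↑ # 0 ≤ᶻ # 1 ∷ # 1 <ᶻ # 0 ⊕ lit 1ℤ ⊕ ↑ # 0 ∷ [] ⊢ absurd) (p , q))) (iv-out (λ p q → linear (n ∷ j ℕ.* n ∷ []) (y ∷ _ ∷ []) (# 0 ⊕ ↑ (# 0 ⊕ (# 0 ⊕ # 1)) ≤ᶻ # 1 ∷ # 1 <ᶻ # 0 ⊕ ↑ (# 0 ⊕ (# 0 ⊕ # 1)) ∷ [] ⊢ absurd) (p , q))))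
    where
    lem : ∀ {s t u} → s ≡ 0ℤ → u ≡ 0ℤ → s ℤ.+ t ≡ t ℤ.+ u
    lem {t = t} h k = linear [] (_ ∷ _ ∷ t ∷ []) (# 0 ≈ᶻ lit 0ℤ ∷ # 1 ≈ᶻ lit 0ℤ ∷ [] ⊢ # 0 ⊕ # 2 ≈ᶻ # 2 ⊕ # 1) (h , k)

  -- For `j = 0` and `θ = y` the first two indicators cancel except at y itself, so the scan starts
  -- from `D` with the row of y increased by one.
  start-at : ∀ z → b z ≡ y → state 0 y z ≡ suc (D z)
  start-at z e = ℤP.+-injective (linear (_ ∷ _ ∷ []) [] (↑ # 0 ≈ᶻ ↑ # 1 ⊕ lit 1ℤ ⊖ lit 0ℤ ⊖ lit 0ℤ ∷ [] ⊢ ↑ # 0 ≈ᶻ ↑ 1+ # 1) (spec 0 y z ℤP.≤-refl (iv-in (linear [] (_ ∷ _ ∷ _ ∷ []) (# 0 ≈ᶻ # 1 ∷ # 2 <ᶻ # 1 ∷ [] ⊢ # 2 ⊕ lit 1ℤ ≤ᶻ # 0) (e , x<y)) (linear [] (_ ∷ _ ∷ []) (# 0 ≈ᶻ # 1 ∷ [] ⊢ # 0 <ᶻ # 1 ⊕ lit 1ℤ) e)) (iv-out (λ p q → linear (n ∷ []) (_ ∷ _ ∷ []) (# 0 ≈ᶻ # 1 ∷ # 0 <ᶻ # 1 ⊕ ↑ (0 ⊛ # 0) ∷ [] ⊢ absurd) (e , q))) (iv-out (λ p q → linear (_ ∷ []) (_ ∷ _ ∷ []) (# 0 ≈ᶻ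 # 1 ∷ # 1 ⊕ ↑ (# 0 ⊕ 0 ⊛ # 0) ≤ᶻ # 0 ∷ lit 1 ≤ⁿ # 0 ∷ [] ⊢ absurd) (e , p , 1≤n)))))

  start-off : ∀ r → b r ≢ y → state 0 y r ≡ D r
  start-off r ne = ℤP.+-injective (lem {i = iv (x ℤ.+ 1ℤ) (y ℤ.+ 1ℤ) (b r)} (spec 0 y r ℤP.≤-refl refl
     (iv-same {a' = x ℤ.+ 1ℤ} {c' = y ℤ.+ 1ℤ} (λ p q → linear (n ∷ []) (x ∷ _ ∷ []) (# 0 ⊕ lit 1ℤ ⊕ ↑ (0 ⊛ # 0) ≤ᶻ # 1 ∷ [] ⊢ # 0 ⊕ lit 1ℤ ≤ᶻ # 1) p , linear (n ∷ []) (_ ∷ y ∷ []) (# 0 <ᶻ # 1 ⊕ ↑ (0 ⊛ # 0) ∷ [] ⊢ # 0 <ᶻ # 1 ⊕ lit 1ℤ) q) (λ p q → linear (n ∷ []) (x ∷ _ ∷ []) (# 0 ⊕ lit 1ℤ ≤ᶻ # 1 ∷ [] ⊢ # 0 ⊕ lit 1ℤ ⊕ ↑ (0 ⊛ # 0) ≤ᶻ # 1) p , linear (n ∷ []) (_ ∷ _ ∷ []) (# 0 <ᶻ # 1 ∷ [] ⊢ # 0 <ᶻ # 1 ⊕ ↑ (0 ⊛ # 0)) (ℤP.≤∧≢⇒< (lem' q) ne))) (iv-out (λ p q → linear (n ∷ []) (y ∷ _ ∷ []) (# 0 ⊕ ↑ (# 0 ⊕ 0 ⊛ # 0) ≤ᶻ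 # 1 ∷ # 1 <ᶻ # 0 ⊕ ↑ (# 0 ⊕ 0 ⊛ # 0) ∷ [] ⊢ absurd) (p , q)))))
    where
    lem : ∀ {s d i} → s ≡ d ℤ.+ i ℤ.- i ℤ.- 0ℤ → s ≡ d
    lem {i = i} h = linear [] (_ ∷ _ ∷ i ∷ []) (# 0 ≈ᶻ # 1 ⊕ # 2 ⊖ # 2 ⊖ lit 0ℤ ∷ [] ⊢ # 0 ≈ᶻ # 1) h
    lem' : b r ℤ.< y ℤ.+ 1ℤ → b r ℤ.≤ y
    lem' h = linear [] (_ ∷ _ ∷ []) (# 0 <ᶻ # 1 ⊕ lit 1ℤ ∷ [] ⊢ # 0 ≤ᶻ # 1) h

  -- One step of the scan, at the bead w + jn in row `s + 1`; the rows to be swapped are `s` and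
  -- `s + 1`. The strict inequalities are demanded only above level 0, so that level 0 also covers
  -- the degenerate window with y = x + n and w = x.
  module Level (j : ℕ) (W : Window x y j) (top : mem (y ⇧[ n ] j)) (strict : 1 ≤ j → y ℤ.< x ℤ.+ + n)
    (w : ℤ) (x≤w : x ℤ.≤ w) (w<y : w ℤ.< y) (x<w : 1 ≤ j → x ℤ.< w) (s : ℕ) (bq : b (suc s) ≡ w ⇧[ n ] j) where

    θ : ℤ
    θ = w ℤ.+ 1ℤ
    θ≤y : θ ℤ.≤ y
    θ≤y = linear [] (_ ∷ _ ∷ []) (# 0 <ᶻ # 1 ∷ [] ⊢ # 0 ⊕ lit 1ℤ ≤ᶻ # 1) w<y

    bs≤ : b s ℤ.≤ y ⇧[ n ] j
    bs≤ = subst (b s ℤ.≤_) (proj₂ top) (mono≤ (ℕP.≤-pred (cmp< {proj₁ top} {suc s} (linear (j ℕ.* n ∷ []) (_ ∷ _ ∷ _ ∷ _ ∷ []) (# 0 ≈ᶻ # 1 ⊕ ↑ # 0 ∷ # 2 ≈ᶻ # 3 ⊕ ↑ # 0 ∷ # 3 <ᶻ # 1 ∷ [] ⊢ # 2 <ᶻ # 0) (proj₂ top , bq , w<y)))))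

    bs> : w ⇧[ n ] j ℤ.< b s
    bs> = subst (ℤ._< b s) bq (b-dec s)

    Dq : D (suc s) ≡ suc (D s)
    Dq = D-consecutive W s (linear (j ℕ.* n ∷ []) (_ ∷ _ ∷ _ ∷ []) (# 0 ≈ᶻ # 1 ⊕ ↑ # 0 ∷ # 2 ≤ᶻ # 1 ∷ [] ⊢ # 2 ⊕ ↑ # 0 ≤ᶻ # 0) (bq , x≤w)) bs≤

    level : (j ≡ 0 × j ℕ.* n ≡ 0) ⊎ (1 ≤ j × ℕ.pred j ℕ.* n ℕ.+ n ≡ j ℕ.* n)
    level = go j
      where
      go : ∀ j → (j ≡ 0 × j ℕ.* n ≡ 0) ⊎ (1 ≤ j × ℕ.pred j ℕ.* n ℕ.+ n ≡ j ℕ.* n)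
      go zero = inj₁ (refl , refl)
      go (suc j) = inj₂ (s≤s z≤n , ℕP.+-comm (j ℕ.* n) n)

    at-s : (state j θ s ≡ suc (D s) × j ≡ 0) ⊎ (state j θ s ≡ D s × 1 ≤ j)
    at-s with level
    ... | inj₁ (z , e) = inj₁ (linear (_ ∷ _ ∷ []) [] (↑ # 0 ≈ᶻ ↑ # 1 ⊕ lit 1ℤ ⊖ lit 0ℤ ⊖ lit 0ℤ ∷ [] ⊢ # 0 ≈ⁿ 1+ # 1) (spec j θ s θ≤y (iv-in (linear (_ ∷ []) (_ ∷ _ ∷ _ ∷ []) (# 0 ⊕ ↑ # 0 <ᶻ # 1 ∷ # 2 ≤ᶻ # 0 ∷ # 0 ≈ⁿ lit 0 ∷ [] ⊢ # 2 ⊕ lit 1ℤ ≤ᶻ # 1) (bs> , x≤w , e)) (linear (_ ∷ []) (_ ∷ y ∷ []) (# 0 ≤ᶻ # 1 ⊕ ↑ # 0 ∷ # 0 ≈ⁿ lit 0 ∷ [] ⊢ # 0 <ᶻ # 1 ⊕ lit 1ℤ) (bs≤ , e)))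
        (iv-out (λ p q → linear (j ℕ.* n ∷ []) (_ ∷ w ∷ []) (# 0 <ᶻ # 1 ⊕ lit 1ℤ ⊕ ↑ # 0 ∷ # 1 ⊕ ↑ # 0 <ᶻ # 0 ∷ [] ⊢ absurd) (q , bs>))) (iv-out (λ p q → linear (n ∷ j ℕ.* n ∷ []) (_ ∷ _ ∷ _ ∷ _ ∷ []) (# 0 ⊕ lit 1ℤ ⊕ ↑ (# 0 ⊕ # 1) ≤ᶻ # 1 ∷ # 1 ≤ᶻ # 2 ⊕ ↑ # 1 ∷ # 3 ≤ᶻ # 0 ∷ # 2 ≤ᶻ # 3 ⊕ ↑ # 0 ∷ [] ⊢ absurd) (p , bs≤ , x≤w , y≤x+n)))) , z)
    ... | inj₂ (z , e) = inj₂ (linear (_ ∷ _ ∷ []) [] (↑ # 0 ≈ᶻ ↑ # 1 ⊕ lit 0ℤ ⊖ lit 0ℤ ⊖ lit 0ℤ ∷ [] ⊢ # 0 ≈ⁿ # 1) (spec j θ s θ≤y (iv-out (λ p q → linear ((j ∸ 1) ℕ.* n ∷ n ∷ _ ∷ []) (_ ∷ _ ∷ _ ∷ _ ∷ []) (# 0 <ᶻ # 1 ⊕ lit 1ℤ ∷ # 0 ⊕ # 1 ≈ⁿ # 2 ∷ # 2 ⊕ ↑ # 2 <ᶻ # 0 ∷ # 3 ≤ᶻ # 2 ∷ # 1 ≤ᶻ # 3 ⊕ ↑ # 1 ∷ [] ⊢ absurd) (q , e , bs> , x≤w , y≤x+n)))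
        (iv-out (λ p q → linear (j ℕ.* n ∷ []) (_ ∷ w ∷ []) (# 0 <ᶻ # 1 ⊕ lit 1ℤ ⊕ ↑ # 0 ∷ # 1 ⊕ ↑ # 0 <ᶻ # 0 ∷ [] ⊢ absurd) (q , bs>))) (iv-out (λ p q → linear (n ∷ j ℕ.* n ∷ []) (_ ∷ _ ∷ _ ∷ _ ∷ []) (# 0 ⊕ lit 1ℤ ⊕ ↑ (# 0 ⊕ # 1) ≤ᶻ # 1 ∷ # 1 ≤ᶻ # 2 ⊕ ↑ # 1 ∷ # 3 ≤ᶻ # 0 ∷ # 2 ≤ᶻ # 3 ⊕ ↑ # 0 ∷ [] ⊢ absurd) (p , bs≤ , x≤w , y≤x+n)))) , z)

    at-q : (j ≡ 0 → state j θ (suc s) ≡ D (suc s)) × (1 ≤ j → suc (state j θ (suc s)) ≡ D (suc s))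
    at-q with level
    ... | inj₁ (z , e) = (λ _ → linear (_ ∷ _ ∷ []) (iv (x ℤ.+ 1ℤ) (y ℤ.+ 1ℤ) (b (suc s)) ∷ []) (↑ # 0 ≈ᶻ ↑ # 1 ⊕ # 0 ⊖ # 0 ⊖ lit 0ℤ ∷ [] ⊢ # 0 ≈ⁿ # 1) (spec j θ (suc s) θ≤y refl (iv-same {a' = x ℤ.+ 1ℤ} {c' = y ℤ.+ 1ℤ}
        (λ p q → linear (_ ∷ []) (x ∷ _ ∷ []) (# 0 ⊕ lit 1ℤ ⊕ ↑ # 0 ≤ᶻ # 1 ∷ # 0 ≈ⁿ lit 0 ∷ [] ⊢ # 0 ⊕ lit 1ℤ ≤ᶻ # 1) (p , e) , linear (_ ∷ []) (_ ∷ _ ∷ _ ∷ []) (# 0 <ᶻ # 1 ⊕ lit 1ℤ ⊕ ↑ # 0 ∷ # 1 <ᶻ # 2 ∷ # 0 ≈ⁿ lit 0 ∷ [] ⊢ # 0 <ᶻ # 2 ⊕ lit 1ℤ) (q , w<y , e)) (λ p q → linear (_ ∷ []) (x ∷ _ ∷ []) (# 0 ⊕ lit 1ℤ ≤ᶻ # 1 ∷ # 0 ≈ⁿ lit 0 ∷ [] ⊢ # 0 ⊕ lit 1ℤ ⊕ ↑ # 0 ≤ᶻ # 1) (p , e) , linear (j ℕ.* n ∷ []) (_ ∷ w ∷ []) (# 0 ≈ᶻ # 1 ⊕ ↑ # 0 ∷ [] ⊢ # 0 <ᶻ # 1 ⊕ lit 1ℤ ⊕ ↑ # 0) bq)) (iv-out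 (λ p q → linear (_ ∷ j ℕ.* n ∷ []) (w ∷ _ ∷ []) (# 0 ⊕ lit 1ℤ ⊕ ↑ (# 0 ⊕ # 1) ≤ᶻ # 1 ∷ # 1 ≈ᶻ # 0 ⊕ ↑ # 1 ∷ lit 1 ≤ⁿ # 0 ∷ [] ⊢ absurd) (p , bq , 1≤n))))) , λ o → ⊥-elim (linear (_ ∷ []) [] (# 0 ≈ⁿ lit 0 ∷ lit 1 ≤ⁿ # 0 ∷ [] ⊢ absurd) (z , o))
    ... | inj₂ (z , e) = (λ o → ⊥-elim (linear (_ ∷ []) [] (lit 1 ≤ⁿ # 0 ∷ # 0 ≈ⁿ lit 0 ∷ [] ⊢ absurd) (z , o))) , λ _ → linear (_ ∷ _ ∷ []) [] (↑ # 0 ≈ᶻ ↑ # 1 ⊕ lit 0ℤ ⊖ lit 1ℤ ⊖ lit 0ℤ ∷ [] ⊢ 1+ # 0 ≈ⁿ # 1) (spec j θ (suc s) θ≤y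
        (iv-out (λ p q → linear (_ ∷ (j ∸ 1) ℕ.* n ∷ n ∷ []) (_ ∷ _ ∷ _ ∷ _ ∷ []) (# 0 <ᶻ # 1 ⊕ lit 1ℤ ∷ # 0 ≈ᶻ # 2 ⊕ ↑ # 0 ∷ # 3 <ᶻ # 2 ∷ # 1 ⊕ # 2 ≈ⁿ # 0 ∷ # 1 ≤ᶻ # 3 ⊕ ↑ # 2 ∷ [] ⊢ absurd) (q , bq , x<w z , e , y≤x+n))) (iv-in (linear (j ℕ.* n ∷ []) (_ ∷ _ ∷ _ ∷ []) (# 0 ≈ᶻ # 1 ⊕ ↑ # 0 ∷ # 2 <ᶻ # 1 ∷ [] ⊢ # 2 ⊕ lit 1ℤ ⊕ ↑ # 0 ≤ᶻ # 0) (bq , x<w z)) (linear (j ℕ.* n ∷ []) (_ ∷ w ∷ []) (# 0 ≈ᶻ # 1 ⊕ ↑ # 0 ∷ [] ⊢ # 0 <ᶻ # 1 ⊕ lit 1ℤ ⊕ ↑ # 0) bq)) (iv-out (λ p q → linear (_ ∷ j ℕ.* n ∷ []) (w ∷ _ ∷ []) (# 0 ⊕ lit 1ℤ ⊕ ↑ (# 0 ⊕ # 1) ≤ᶻ # 1 ∷ # 1 ≈ᶻ # 0 ⊕ ↑ # 1 ∷ lit 1 ≤ⁿ # 0 ∷ [] ⊢ absurd) (p , bq , 1≤n))))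

    equal : state j θ s ≡ state j θ (suc s)
    equal with at-s
    ... | inj₁ (e , z) = linear (_ ∷ _ ∷ _ ∷ _ ∷ []) [] (# 0 ≈ⁿ 1+ # 1 ∷ # 2 ≈ⁿ # 3 ∷ # 3 ≈ⁿ 1+ # 1 ∷ [] ⊢ # 0 ≈ⁿ # 2) (e , proj₁ at-q z , Dq)
    ... | inj₂ (e , z) = linear (_ ∷ _ ∷ _ ∷ _ ∷ []) [] (# 0 ≈ⁿ # 1 ∷ 1+ # 2 ≈ⁿ # 3 ∷ # 3 ≈ⁿ 1+ # 1 ∷ [] ⊢ # 0 ≈ⁿ # 2) (e , proj₂ at-q z , Dq)

    above : suc s < state j θ s
    above with at-s
    ... | inj₁ (e , z) = linear (_ ∷ _ ∷ _ ∷ []) [] (# 0 ≈ⁿ 1+ # 1 ∷ # 2 <ⁿ # 1 ∷ [] ⊢ 1+ # 2 <ⁿ # 0) (e , D-> s)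
    ... | inj₂ (e , z) = linear (_ ∷ _ ∷ _ ∷ []) [] (# 0 ≈ⁿ # 1 ∷ 1+ # 2 <ⁿ # 1 ∷ [] ⊢ 1+ # 2 <ⁿ # 0) (e , cmp< {suc s} {D s} (linear (j ℕ.* n ∷ n ∷ []) (_ ∷ _ ∷ _ ∷ _ ∷ _ ∷ _ ∷ []) (# 0 ≈ᶻ # 1 ⊕ ↑ # 0 ∷ # 2 ≈ᶻ # 3 ⊖ ↑ # 1 ∷ # 3 ≤ᶻ # 4 ⊕ ↑ # 0 ∷ # 4 <ᶻ # 5 ⊕ ↑ # 1 ∷ # 5 ≤ᶻ # 1 ∷ [] ⊢ # 2 <ᶻ # 0) (bq , b-D s , bs≤ , strict z , x≤w)))

    -- A row starting in column `s + 1` is what breaks the symmetry of the columns `s` and `s + 1`.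
    -- Only the bead one level above w + jn can provide such a row; so it is unique, as a slide
    -- requires, and if it is missing the value is 0.
    preimage : ∀ r → state j θ r ≡ suc s → b r ≡ w ⇧[ n ] suc j × state j θ r ≡ D r
    preimage r e = go (spec j θ r θ≤y refl refl refl)
      where
      I₁ = iv (x ℤ.+ 1ℤ) (y ℤ.+ 1ℤ) (b r)
      I₂ = iv ((x ℤ.+ 1ℤ) ⇧[ n ] j) (θ ⇧[ n ] j) (b r)
      I₃ = iv (θ ⇧[ n ] suc j) (y ⇧[ n ] suc j) (b r)
      zero-case : D r ≡ suc s → b r ≡ w ⇧[ n ] suc j × state j θ r ≡ D r
      zero-case d = linear (n ∷ j ℕ.* n ∷ []) (_ ∷ _ ∷ _ ∷ w ∷ []) (# 0 ≈ᶻ # 1 ⊖ ↑ # 0 ∷ # 0 ≈ᶻ # 2 ∷ # 2 ≈ᶻ # 3 ⊕ ↑ # 1 ∷ [] ⊢ # 1 ≈ᶻ # 3 ⊕ ↑ (# 0 ⊕ # 1)) (b-D r , cong b d , bq) , ≡.trans e (sym d)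
      plus-case : suc (D r) ≡ suc s → b r ℤ.≤ y → ⊥
      plus-case d h = linear (n ∷ j ℕ.* n ∷ []) (_ ∷ _ ∷ _ ∷ _ ∷ _ ∷ _ ∷ []) (# 0 ≈ᶻ # 1 ∷ # 0 ≈ᶻ # 2 ⊖ ↑ # 0 ∷ # 3 ⊕ ↑ # 1 <ᶻ # 1 ∷ # 2 ≤ᶻ # 4 ∷ # 5 ≤ᶻ # 3 ∷ # 4 ≤ᶻ # 5 ⊕ ↑ # 0 ∷ [] ⊢ absurd) (cong b (ℕP.suc-injective d) , b-D r , bs> , h , x≤w , y≤x+n)
      minus-case : D r ≡ suc (suc s) → (x ℤ.+ 1ℤ) ⇧[ n ] j ℤ.≤ b r → b r ℤ.< θ ⇧[ n ] j → b r ℤ.< x ℤ.+ 1ℤ ⊎ y ℤ.+ 1ℤ ℤ.≤ b r → ⊥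
      minus-case d lo hi out with r ≟ suc s
      ... | no ne = no-between (suc s) {b r} (linear (_ ∷ []) (_ ∷ _ ∷ _ ∷ []) (# 0 ≈ᶻ # 1 ∷ # 0 ≈ᶻ # 2 ⊖ ↑ # 0 ∷ lit 1 ≤ⁿ # 0 ∷ [] ⊢ # 1 <ᶻ # 2) (cong b d , b-D r , 1≤n)) (ℤP.≤∧≢⇒< (linear (j ℕ.* n ∷ []) (_ ∷ w ∷ _ ∷ []) (# 0 <ᶻ # 1 ⊕ ↑ lit 1 ⊕ ↑ # 0 ∷ # 2 ≈ᶻ # 1 ⊕ ↑ # 0 ∷ [] ⊢ # 0 ≤ᶻ # 2) (hi , bq)) (λ q → ne (b-inj q))) (r , refl)
      ... | yes refl with level | out
      ...   | inj₁ (z , e) | inj₁ o = linear (_ ∷ []) (x ∷ _ ∷ []) (# 0 ⊕ ↑ lit 1 ⊕ ↑ # 0 ≤ᶻ # 1 ∷ # 1 <ᶻ # 0 ⊕ ↑ lit 1 ∷ # 0 ≈ⁿ lit 0 ∷ [] ⊢ absurd) (lo , o , e)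
      ...   | inj₁ (z , e) | inj₂ o = linear (_ ∷ []) (_ ∷ _ ∷ _ ∷ []) (# 0 ≈ᶻ # 1 ⊕ ↑ # 0 ∷ # 1 <ᶻ # 2 ∷ # 2 ⊕ ↑ lit 1 ≤ᶻ # 0 ∷ # 0 ≈ⁿ lit 0 ∷ [] ⊢ absurd) (bq , w<y , o , e)
      ...   | inj₂ (z , e) | _ = no-between (suc s) {y ⇧[ n ] ℕ.pred j} (linear (n ∷ _ ∷ (j ∸ 1) ℕ.* n ∷ []) (_ ∷ _ ∷ _ ∷ _ ∷ _ ∷ []) (# 0 ≈ᶻ # 1 ∷ # 0 ≈ᶻ # 2 ⊖ ↑ # 0 ∷ # 2 ≈ᶻ # 3 ⊕ ↑ # 1 ∷ # 3 <ᶻ # 4 ∷ # 2 ⊕ # 0 ≈ⁿ # 1 ∷ [] ⊢ # 1 <ᶻ # 4 ⊕ ↑ # 2) (cong b d , b-D (suc s) , bq , w<y , e)) (linear (_ ∷ n ∷ (j ∸ 1) ℕ.* n ∷ []) (_ ∷ _ ∷ _ ∷ _ ∷ []) (# 0 ≈ᶻ # 1 ⊕ ↑ # 0 ∷ # 2 <ᶻ # 3 ⊕ ↑ # 1 ∷ # 3 ≤ᶻ # 1 ∷ # 2 ⊕ # 1 ≈ⁿ # 0 ∷ [] ⊢ # 2 ⊕ ↑ # 2 <ᶻ # 0) (bq , strict z , x≤w , e)) (mem-le {y} {ℕ.pred j} {j} ℕP.pred[n]≤n top)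
      high-case : D r ≡ suc (suc s) → θ ⇧[ n ] suc j ℤ.≤ b r → ⊥
      high-case d h = linear (n ∷ j ℕ.* n ∷ []) (_ ∷ _ ∷ _ ∷ w ∷ _ ∷ []) (# 0 ≈ᶻ # 1 ∷ # 0 ≈ᶻ # 2 ⊖ ↑ # 0 ∷ # 3 ⊕ lit 1ℤ ⊕ ↑ (# 0 ⊕ # 1) ≤ᶻ # 2 ∷ # 1 <ᶻ # 4 ∷ # 4 ≈ᶻ # 3 ⊕ ↑ # 1 ∷ [] ⊢ absurd) (cong b d , b-D r , h , b-dec (suc s) , bq)
      go : + state j θ r ≡ + D r ℤ.+ I₁ ℤ.- I₂ ℤ.- I₃ → b r ≡ w ⇧[ n ] suc j × state j θ r ≡ D r
      go sp with I₁ | position (x ℤ.+ 1ℤ) (y ℤ.+ 1ℤ) (b r)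
               | I₂ | position ((x ℤ.+ 1ℤ) ⇧[ n ] j) (θ ⇧[ n ] j) (b r)
               | I₃ | position (θ ⇧[ n ] suc j) (y ⇧[ n ] suc j) (b r)
      ... | _ | _ | _ | within _ p | _ | within q _ = ⊥-elim (linear (j ℕ.* n ∷ _ ∷ []) (_ ∷ w ∷ []) (# 0 <ᶻ # 1 ⊕ ↑ lit 1 ⊕ ↑ # 0 ∷ # 1 ⊕ ↑ lit 1 ⊕ ↑ (# 1 ⊕ # 0) ≤ᶻ # 0 ∷ lit 1 ≤ⁿ # 1 ∷ [] ⊢ absurd) (p , q , 1≤n))
      ... | _ | within _ p | _ | beyond _ | _ | within q _ = ⊥-elim (linear (n ∷ j ℕ.* n ∷ []) (_ ∷ _ ∷ _ ∷ _ ∷ []) (# 0 <ᶻ # 1 ⊕ ↑ lit 1 ∷ # 2 ⊕ ↑ lit 1 ⊕ ↑ (# 0 ⊕ # 1) ≤ᶻ # 0 ∷ # 3 ≤ᶻ # 2 ∷ # 1 ≤ᶻ # 3 ⊕ ↑ # 0 ∷ [] ⊢ absurd) (p , q , x≤w , y≤x+n))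
      ... | _ | within _ _ | _ | within _ _ | _ | beyond _ = zero-case (linear (_ ∷ _ ∷ _ ∷ []) [] (↑ # 0 ≈ᶻ ↑ # 1 ⊕ lit 1ℤ ⊕ ⊝ lit 1ℤ ⊕ ⊝ lit 0ℤ ∷ # 0 ≈ⁿ 1+ # 2 ∷ [] ⊢ # 1 ≈ⁿ 1+ # 2) (sp , e))
      ... | _ | within _ p | _ | beyond _ | _ | beyond _ = ⊥-elim (plus-case (linear (_ ∷ _ ∷ _ ∷ []) [] (↑ # 0 ≈ᶻ ↑ # 1 ⊕ lit 1ℤ ⊕ ⊝ lit 0ℤ ⊕ ⊝ lit 0ℤ ∷ # 0 ≈ⁿ 1+ # 2 ∷ [] ⊢ 1+ # 1 ≈ⁿ 1+ # 2) (sp , e)) (linear [] (_ ∷ _ ∷ []) (# 0 <ᶻ # 1 ⊕ ↑ lit 1 ∷ [] ⊢ # 0 ≤ᶻ # 1) p))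
      ... | _ | beyond o | _ | within p q | _ | beyond _ = ⊥-elim (minus-case (linear (_ ∷ _ ∷ _ ∷ []) [] (↑ # 0 ≈ᶻ ↑ # 1 ⊕ lit 0ℤ ⊕ ⊝ lit 1ℤ ⊕ ⊝ lit 0ℤ ∷ # 0 ≈ⁿ 1+ # 2 ∷ [] ⊢ # 1 ≈ⁿ 1+ 1+ # 2) (sp , e)) p q o)
      ... | _ | beyond _ | _ | beyond _ | _ | within q _ = ⊥-elim (high-case (linear (_ ∷ _ ∷ _ ∷ []) [] (↑ # 0 ≈ᶻ ↑ # 1 ⊕ lit 0ℤ ⊕ ⊝ lit 0ℤ ⊕ ⊝ lit 1ℤ ∷ # 0 ≈ⁿ 1+ # 2 ∷ [] ⊢ # 1 ≈ⁿ 1+ 1+ # 2) (sp , e)) q)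
      ... | _ | beyond _ | _ | beyond _ | _ | beyond _ = zero-case (linear (_ ∷ _ ∷ _ ∷ []) [] (↑ # 0 ≈ᶻ ↑ # 1 ⊕ lit 0ℤ ⊕ ⊝ lit 0ℤ ⊕ ⊝ lit 0ℤ ∷ # 0 ≈ⁿ 1+ # 2 ∷ [] ⊢ # 1 ≈ⁿ 1+ # 2) (sp , e))

  module _ (ℓ : ℕ) (L≤ℓ : L ≤ ℓ) {p : ℕ} {f : Fn} (C : Class ℓ p f) where
    open Catalan ℓ

    module LevelΦ (j : ℕ) (W : Window x y j) (top : mem (y ⇧[ n ] j)) (strict : 1 ≤ j → y ℤ.< x ℤ.+ + n)
      (w : ℤ) (x≤w : x ℤ.≤ w) (w<y : w ℤ.< y) (x<w : 1 ≤ j → x ℤ.< w) (s : ℕ) (bq : b (suc s) ≡ w ⇧[ n ] j)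
      (q<ℓ : suc s < ℓ) (q≢p : suc s ≢ p) where
      open Level j W top strict w x≤w w<y x<w s bq

      blocked : (∀ r → b r ≡ w ⇧[ n ] suc j → state j θ r ≢ D r) → ∀ d → Φ n f (state j θ) d ≡ 0ℤ
      blocked none = Φ-zero n s (C .ext) (C .anti s q<ℓ q≢p) q<ℓ (state j θ) equal
        (λ r _ e → none r (proj₁ (preimage r e)) (proj₂ (preimage r e)))

      -- Moving θ from w + 1 to w changes the start function by -1 at the row of w + (j+1)n and by
      -- +1 at row `s + 1`, which are the two changes made by a slide.
      slid : x ℤ.< w → ∀ r → b r ≡ w ⇧[ n ] suc j → ∀ d → Φ n f (state j θ) d ≡ sh (Φ n f (state j w)) d
      slid x<w' r br = Φ-slide n s r (C .ext) (C .anti s q<ℓ q≢p) q<ℓ (ℕP.<-trans (cmp< {r} {suc s} (linear (_ ∷ j ℕ.* n ∷ []) (_ ∷ w ∷ _ ∷ []) (# 0 ≈ᶻ # 1 ⊕ ↑ (# 0 ⊕ # 1) ∷ # 2 ≈ᶻ # 1 ⊕ ↑ # 1 ∷ lit 1 ≤ⁿ # 0 ∷ [] ⊢ # 2 <ᶻ # 0) (br , bq , 1≤n))) q<ℓ)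
        (state j θ) (state j w) equal above at-r (λ k _ e → b-inj (≡.trans (proj₁ (preimage k e)) (sym br))) at-r' at-q' others
        where
        Dr : D r ≡ suc s
        Dr = b-inj {D r} {suc s} (linear (n ∷ j ℕ.* n ∷ []) (_ ∷ _ ∷ w ∷ _ ∷ []) (# 0 ≈ᶻ # 1 ⊖ ↑ # 0 ∷ # 1 ≈ᶻ # 2 ⊕ ↑ (# 0 ⊕ # 1) ∷ # 3 ≈ᶻ # 2 ⊕ ↑ # 1 ∷ [] ⊢ # 0 ≈ᶻ # 3) (b-D r , br , bq))
        not-low : iv (x ℤ.+ 1ℤ) (y ℤ.+ 1ℤ) (b r) ≡ 0ℤ
        not-low = iv-out (λ p q → linear (n ∷ j ℕ.* n ∷ []) (_ ∷ _ ∷ _ ∷ _ ∷ []) (# 0 <ᶻ # 1 ⊕ lit 1ℤ ∷ # 0 ≈ᶻ # 2 ⊕ ↑ (# 0 ⊕ # 1) ∷ # 3 <ᶻ # 2 ∷ # 1 ≤ᶻ # 3 ⊕ ↑ # 0 ∷ [] ⊢ absurd) (q , br , x<w' , y≤x+n))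
        at-r : state j θ r ≡ suc s
        at-r = linear (_ ∷ _ ∷ _ ∷ []) [] (↑ # 0 ≈ᶻ ↑ # 1 ⊕ lit 0ℤ ⊖ lit 0ℤ ⊖ lit 0ℤ ∷ # 1 ≈ⁿ 1+ # 2 ∷ [] ⊢ # 0 ≈ⁿ 1+ # 2) (spec j θ r θ≤y not-low (iv-out (λ p q → linear (j ℕ.* n ∷ _ ∷ []) (_ ∷ w ∷ []) (# 0 <ᶻ # 1 ⊕ lit 1ℤ ⊕ ↑ # 0 ∷ # 0 ≈ᶻ # 1 ⊕ ↑ (# 1 ⊕ # 0) ∷ lit 1 ≤ⁿ # 1 ∷ [] ⊢ absurd) (q , br , 1≤n))) (iv-out (λ p q → linear (n ∷ j ℕ.* n ∷ []) (w ∷ _ ∷ []) (# 0 ⊕ lit 1ℤ ⊕ ↑ (# 0 ⊕ # 1) ≤ᶻ # 1 ∷ # 1 ≈ᶻ # 0 ⊕ ↑ (# 0 ⊕ # 1) ∷ [] ⊢ absurd) (p , br))) , Dr)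
        at-r' : state j w r ≡ s
        at-r' = linear (_ ∷ _ ∷ _ ∷ []) [] (↑ # 0 ≈ᶻ ↑ # 1 ⊕ lit 0ℤ ⊖ lit 0ℤ ⊖ lit 1ℤ ∷ # 1 ≈ⁿ 1+ # 2 ∷ [] ⊢ # 0 ≈ⁿ # 2) (spec j w r (ℤP.<⇒≤ w<y) not-low (iv-out (λ p q → linear (j ℕ.* n ∷ _ ∷ []) (_ ∷ w ∷ []) (# 0 <ᶻ # 1 ⊕ ↑ # 0 ∷ # 0 ≈ᶻ # 1 ⊕ ↑ (# 1 ⊕ # 0) ∷ lit 1 ≤ⁿ # 1 ∷ [] ⊢ absurd) (q , br , 1≤n))) (iv-in (linear (n ∷ j ℕ.* n ∷ []) (_ ∷ w ∷ []) (# 0 ≈ᶻ # 1 ⊕ ↑ (# 0 ⊕ # 1) ∷ [] ⊢ # 1 ⊕ ↑ (# 0 ⊕ # 1) ≤ᶻ # 0) br) (linear (n ∷ j ℕ.* n ∷ []) (_ ∷ _ ∷ _ ∷ []) (# 0 ≈ᶻ # 1 ⊕ ↑ (# 0 ⊕ # 1) ∷ # 1 <ᶻ # 2 ∷ [] ⊢ # 0 <ᶻ # 2 ⊕ ↑ (# 0 ⊕ # 1)) (br , w<y))) , Dr)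
        q-high : iv (w ⇧[ n ] suc j) (y ⇧[ n ] suc j) (b (suc s)) ≡ 0ℤ
        q-high = iv-out (λ p q → linear (_ ∷ j ℕ.* n ∷ []) (w ∷ _ ∷ []) (# 0 ⊕ ↑ (# 0 ⊕ # 1) ≤ᶻ # 1 ∷ # 1 ≈ᶻ # 0 ⊕ ↑ # 1 ∷ lit 1 ≤ⁿ # 0 ∷ [] ⊢ absurd) (p , bq , 1≤n))
        q-mid : iv ((x ℤ.+ 1ℤ) ⇧[ n ] j) (w ⇧[ n ] j) (b (suc s)) ≡ 0ℤ
        q-mid = iv-out (λ p q → linear (j ℕ.* n ∷ []) (_ ∷ w ∷ []) (# 0 <ᶻ # 1 ⊕ ↑ # 0 ∷ # 0 ≈ᶻ # 1 ⊕ ↑ # 0 ∷ [] ⊢ absurd) (q , bq))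
        at-q' : state j w (suc s) ≡ suc (state j θ s)
        at-q' with at-s | level
        ... | inj₁ (e , z) | inj₂ (z' , _) = ⊥-elim (linear (_ ∷ []) [] (# 0 ≈ⁿ lit 0 ∷ lit 1 ≤ⁿ # 0 ∷ [] ⊢ absurd) (z , z'))
        ... | inj₂ (e , z) | inj₁ (z' , _) = ⊥-elim (linear (_ ∷ []) [] (lit 1 ≤ⁿ # 0 ∷ # 0 ≈ⁿ lit 0 ∷ [] ⊢ absurd) (z , z'))
        ... | inj₁ (e , z) | inj₁ (_ , z') = linear (_ ∷ _ ∷ _ ∷ _ ∷ []) [] (↑ # 0 ≈ᶻ ↑ # 1 ⊕ lit 1ℤ ⊖ lit 0ℤ ⊖ lit 0ℤ ∷ # 2 ≈ⁿ 1+ # 3 ∷ # 1 ≈ⁿ 1+ # 3 ∷ [] ⊢ # 0 ≈ⁿ 1+ # 2) (spec j w (suc s) (ℤP.<⇒≤ w<y) (iv-in (linear (_ ∷ []) (_ ∷ _ ∷ _ ∷ []) (# 0 ≈ᶻ # 1 ⊕ ↑ # 0 ∷ # 2 <ᶻ # 1 ∷ # 0 ≈ⁿ lit 0 ∷ [] ⊢ # 2 ⊕ lit 1ℤ ≤ᶻ # 0) (bq , x<w' , z')) (linear (_ ∷ []) (_ ∷ _ ∷ _ ∷ []) (# 0 ≈ᶻ # 1 ⊕ ↑ # 0 ∷ # 1 <ᶻ # 2 ∷ # 0 ≈ⁿ lit 0 ∷ [] ⊢ # 0 <ᶻ # 2 ⊕ lit 1ℤ) (bq , w<y , z'))) q-mid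 q-high , e , Dq)
        ... | inj₂ (e , z) | inj₂ (_ , z') = linear (_ ∷ _ ∷ _ ∷ _ ∷ []) [] (↑ # 0 ≈ᶻ ↑ # 1 ⊕ lit 0ℤ ⊖ lit 0ℤ ⊖ lit 0ℤ ∷ # 2 ≈ⁿ # 3 ∷ # 1 ≈ⁿ 1+ # 3 ∷ [] ⊢ # 0 ≈ⁿ 1+ # 2) (spec j w (suc s) (ℤP.<⇒≤ w<y) (iv-out (λ p q → linear (_ ∷ n ∷ (j ∸ 1) ℕ.* n ∷ []) (_ ∷ _ ∷ _ ∷ _ ∷ []) (# 0 <ᶻ # 1 ⊕ lit 1ℤ ∷ # 0 ≈ᶻ # 2 ⊕ ↑ # 0 ∷ # 3 <ᶻ # 2 ∷ # 1 ≤ᶻ # 3 ⊕ ↑ # 1 ∷ # 2 ⊕ # 1 ≈ⁿ # 0 ∷ [] ⊢ absurd) (q , bq , x<w' , y≤x+n , z'))) q-mid q-high , e , Dq)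
        others : ∀ k → k ≢ r → k ≢ suc s → state j w k ≡ state j θ k
        others k k≢r k≢q = state-cong j w j θ k (ℤP.<⇒≤ w<y) θ≤y (cong₂ ℤ._+_
          (iv-same (λ p q → p , linear (j ℕ.* n ∷ []) (_ ∷ w ∷ []) (# 0 <ᶻ # 1 ⊕ ↑ # 0 ∷ [] ⊢ # 0 <ᶻ # 1 ⊕ lit 1ℤ ⊕ ↑ # 0) q) (λ p q → p , ℤP.≤∧≢⇒< (lem₁ q) (λ e → k≢q (b-inj {k} {suc s} (≡.trans e (sym bq))))))
          (iv-same (λ p q → lem₂ (ℤP.≤∧≢⇒< p (λ e → k≢r (b-inj {k} {r} (≡.trans (sym e) (sym br))))) , q) (λ p q → linear (n ∷ j ℕ.* n ∷ []) (w ∷ _ ∷ []) (# 0 ⊕ lit 1ℤ ⊕ ↑ (# 0 ⊕ # 1) ≤ᶻ # 1 ∷ [] ⊢ # 0 ⊕ ↑ (# 0 ⊕ # 1) ≤ᶻ # 1) p , q)))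
          where
          lem₁ : b k ℤ.< (w ℤ.+ 1ℤ) ⇧[ n ] j → b k ℤ.≤ w ⇧[ n ] j
          lem₁ h = linear (j ℕ.* n ∷ []) (_ ∷ w ∷ []) (# 0 <ᶻ # 1 ⊕ lit 1ℤ ⊕ ↑ # 0 ∷ [] ⊢ # 0 ≤ᶻ # 1 ⊕ ↑ # 0) h
          lem₂ : w ⇧[ n ] suc j ℤ.< b k → (w ℤ.+ 1ℤ) ⇧[ n ] suc j ℤ.≤ b k
          lem₂ h = linear (n ∷ j ℕ.* n ∷ []) (w ∷ _ ∷ []) (# 0 ⊕ ↑ (# 0 ⊕ # 1) <ᶻ # 1 ∷ [] ⊢ # 0 ⊕ lit 1ℤ ⊕ ↑ (# 0 ⊕ # 1) ≤ᶻ # 1) h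

    skipped : ∀ j w → ¬ mem w → x ℤ.< w → w ℤ.< y → ∀ d → Φ n f (state j (w ℤ.+ 1ℤ)) d ≡ Φ n f (state j w) d
    skipped j w w∉ x<w w<y = Φ-cong n (C .ext) (state j (w ℤ.+ 1ℤ)) (state j w) (λ k → state-cong j (w ℤ.+ 1ℤ) j w k (linear [] (_ ∷ _ ∷ []) (# 0 <ᶻ # 1 ∷ [] ⊢ # 0 ⊕ lit 1ℤ ≤ᶻ # 1) w<y) (ℤP.<⇒≤ w<y) (cong₂ ℤ._+_
       (iv-same (λ p q → p , ℤP.≤∧≢⇒< (lem₁ k q) (λ e → w∉ (mem-base {w} j (k , e)))) (λ p q → p , linear (j ℕ.* n ∷ []) (_ ∷ w ∷ []) (# 0 <ᶻ # 1 ⊕ ↑ # 0 ∷ [] ⊢ # 0 <ᶻ # 1 ⊕ lit 1ℤ ⊕ ↑ # 0) q))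
       (iv-same (λ p q → linear (n ∷ j ℕ.* n ∷ []) (w ∷ _ ∷ []) (# 0 ⊕ lit 1ℤ ⊕ ↑ (# 0 ⊕ # 1) ≤ᶻ # 1 ∷ [] ⊢ # 0 ⊕ ↑ (# 0 ⊕ # 1) ≤ᶻ # 1) p , q) (λ p q → lem₂ k (ℤP.≤∧≢⇒< p (λ e → w∉ (mem-base {w} (suc j) (k , sym e)))) , q))))
      where
      lem₁ : ∀ k → b k ℤ.< (w ℤ.+ 1ℤ) ⇧[ n ] j → b k ℤ.≤ w ⇧[ n ] j
      lem₁ k h = linear (j ℕ.* n ∷ []) (_ ∷ w ∷ []) (# 0 <ᶻ # 1 ⊕ lit 1ℤ ⊕ ↑ # 0 ∷ [] ⊢ # 0 ≤ᶻ # 1 ⊕ ↑ # 0) h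
      lem₂ : ∀ k → w ⇧[ n ] suc j ℤ.< b k → (w ℤ.+ 1ℤ) ⇧[ n ] suc j ℤ.≤ b k
      lem₂ k h = linear (n ∷ j ℕ.* n ∷ []) (w ∷ _ ∷ []) (# 0 ⊕ ↑ (# 0 ⊕ # 1) <ᶻ # 1 ∷ [] ⊢ # 0 ⊕ lit 1ℤ ⊕ ↑ (# 0 ⊕ # 1) ≤ᶻ # 1) h

    module Scan (g : ℕ) (y≡ : y ≡ x ℤ.+ 1ℤ ℤ.+ + g) (x-high : ℤ.- + L ℤ.< x)
      (j₀ : ℕ) (bp : b p ≡ y ⇧[ n ] j₀) where

      pt : ℕ → ℤ
      pt i = x ℤ.+ 1ℤ ℤ.+ + i

      pt-suc : ∀ i → pt (suc i) ≡ pt i ℤ.+ 1ℤ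
      pt-suc i = linear (i ∷ []) (x ∷ []) ([] ⊢ # 0 ⊕ lit 1ℤ ⊕ ↑ 1+ # 0 ≈ᶻ # 0 ⊕ lit 1ℤ ⊕ ↑ # 0 ⊕ lit 1ℤ) tt

      count : ℕ → ℕ
      count i = length (window-beads x i)

      -- This is why `Class ℓ p` suffices. Row `p` carries y + j₀n, and w + jn lies below it for j ≤
      -- j₀ and above it for j > j₀, since x < w and y ≤ x + n. On level 0 only the first case
      -- arises, so there w = x is allowed as well.
      avoid : ∀ j w q → w ℤ.< y → x ℤ.< w ⊎ j ≡ 0 → b q ≡ w ⇧[ n ] j → q ≢ p
      avoid j w q w<y o e refl with j ≤? j₀ | o
      ... | yes h | _ = linear (_ ∷ _ ∷ []) (_ ∷ _ ∷ _ ∷ []) (# 0 ≈ᶻ # 1 ⊕ ↑ # 0 ∷ # 0 ≈ᶻ # 2 ⊕ ↑ # 1 ∷ # 1 <ᶻ # 2 ∷ # 0 ≤ⁿ # 1 ∷ [] ⊢ absurd) (e , bp , w<y , ℕP.*-monoˡ-≤ n h)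
      ... | no h | inj₁ x<w = linear (_ ∷ j₀ ℕ.* n ∷ n ∷ []) (_ ∷ _ ∷ _ ∷ _ ∷ []) (# 0 ≈ᶻ # 1 ⊕ ↑ # 0 ∷ # 0 ≈ᶻ # 2 ⊕ ↑ # 1 ∷ # 3 <ᶻ # 1 ∷ # 2 ≤ᶻ # 3 ⊕ ↑ # 2 ∷ # 2 ⊕ # 1 ≤ⁿ # 0 ∷ [] ⊢ absurd) (e , bp , x<w , y≤x+n , ℕP.*-monoˡ-≤ n (ℕP.≰⇒> h))
      ... | no h | inj₂ refl = h z≤n

      row : ∀ j w → x ℤ.≤ w → w ℤ.< y → mem (y ⇧[ n ] j) → mem (w ⇧[ n ] j) → ∃ λ s → b (suc s) ≡ w ⇧[ n ] j × suc s < ℓ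
      row j w h h' (i , t) (zero , e) = ⊥-elim (ℕP.<⇒≱ (cmp< {i} {0} (linear (j ℕ.* n ∷ []) (_ ∷ _ ∷ _ ∷ _ ∷ []) (# 0 ≈ᶻ # 1 ⊕ ↑ # 0 ∷ # 2 ≈ᶻ # 3 ⊕ ↑ # 0 ∷ # 3 <ᶻ # 1 ∷ [] ⊢ # 2 <ᶻ # 0) (t , e , h'))) z≤n)
      row j w h h' (i , t) (suc s , e) = s , e , ℕP.<-≤-trans (ℕP.≰⇒> low) L≤ℓ
        where low : ¬ L ≤ suc s
              low k = linear (_ ∷ j ℕ.* n ∷ _ ∷ []) (_ ∷ _ ∷ _ ∷ []) (# 0 ≈ᶻ ⊝ ↑ 1+ # 0 ∷ # 0 ≈ᶻ # 1 ⊕ ↑ # 1 ∷ # 2 ≤ᶻ # 1 ∷ ⊝ ↑ # 2 <ᶻ # 2 ∷ # 2 ≤ⁿ 1+ # 0 ∷ [] ⊢ absurd) (b-end (suc s) k , e , h , x-high , k)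

      Rises : ℕ → ℕ → Set
      Rises j i = ∀ w → x ℤ.< w → w ℤ.< pt i → mem w → mem (w ⇧[ n ] suc j)

      split-pt : ∀ i {w} → w ℤ.< pt (suc i) → w ≢ pt i → w ℤ.< pt i
      split-pt i h ne = ℤP.≤∧≢⇒< (linear (i ∷ []) (_ ∷ x ∷ []) (# 0 <ᶻ # 1 ⊕ lit 1ℤ ⊕ ↑ 1+ # 0 ∷ [] ⊢ # 0 ≤ᶻ # 1 ⊕ lit 1ℤ ⊕ ↑ # 0) h) ne

      -- The witness is kept next to the vanishing so that a scan along a genuine exchange can be
      -- shown never to stop.
      record Fail (J : ℕ) : Set where
        field
          {w} : ℤ
          {j} : ℕ
          j≤J : j ≤ J
          x<w : x ℤ.< w
          w<y : w ℤ.< y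
          w∈ : mem w
          up∉ : ¬ mem (w ⇧[ n ] suc j)

      fail-≤ : ∀ {J J'} → J ≤ J' → Fail J → Fail J'
      fail-≤ h F = record { j≤J = ℕP.≤-trans j≤J h ; x<w = x<w ; w<y = w<y ; w∈ = w∈ ; up∉ = up∉ }
        where open Fail F

      Outcome : ℕ → ℕ → ℤ → Set
      Outcome j i θ = (Rises j i × (∀ d → Φ n f (state j θ) d ≡ shk (count i) (Φ n f (state j (pt 0))) d)) ⊎ ((∀ d → Φ n f (state j θ) d ≡ 0ℤ) × Fail j)

      level-step : ∀ j → Window x y j → mem (y ⇧[ n ] j) → (1 ≤ j → y ℤ.< x ℤ.+ + n) → ∀ i → suc i ≤ g → Outcome j i (pt i) → Outcome j (suc i) (pt i ℤ.+ 1ℤ)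
      level-step j W top st i h prev with mem? (pt i)
      level-step j W top st i h (inj₂ (z , F)) | no w∉ = inj₂ ((λ d → ≡.trans (skipped j (pt i) w∉ (linear (i ∷ []) (_ ∷ []) ([] ⊢ # 0 <ᶻ # 0 ⊕ lit 1ℤ ⊕ ↑ # 0) tt) (linear (_ ∷ _ ∷ []) (_ ∷ x ∷ []) (# 0 ≈ᶻ # 1 ⊕ ↑ lit 1 ⊕ ↑ # 0 ∷ # 1 <ⁿ # 0 ∷ [] ⊢ # 1 ⊕ lit 1ℤ ⊕ ↑ # 1 <ᶻ # 0) (y≡ , h)) d) (z d)) , F)
      level-step j W top st i h (inj₁ (R , e)) | no w∉ = inj₁ ((λ w a c m → R w a (split-pt i c (λ { refl → w∉ m })) m) ,
              λ d → ≡.trans (skipped j (pt i) w∉ (linear (i ∷ []) (_ ∷ []) ([] ⊢ # 0 <ᶻ # 0 ⊕ lit 1ℤ ⊕ ↑ # 0) tt) (linear (_ ∷ _ ∷ []) (_ ∷ x ∷ []) (# 0 ≈ᶻ # 1 ⊕ ↑ lit 1 ⊕ ↑ # 0 ∷ # 1 <ⁿ # 0 ∷ [] ⊢ # 1 ⊕ lit 1ℤ ⊕ ↑ # 1 <ᶻ # 0) (y≡ , h)) d) (e d))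
      level-step j W top st i h prev | yes w∈ = go (row j (pt i) (linear (i ∷ []) (_ ∷ []) ([] ⊢ # 0 ≤ᶻ # 0 ⊕ lit 1ℤ ⊕ ↑ # 0) tt) w<y top (Window.rise W (pt i) x<w w<y w∈)) (mem? (pt i ⇧[ n ] suc j)) prev
        where
        x<w : x ℤ.< pt i
        x<w = linear (i ∷ []) (_ ∷ []) ([] ⊢ # 0 <ᶻ # 0 ⊕ lit 1ℤ ⊕ ↑ # 0) tt
        w<y : pt i ℤ.< y
        w<y = linear (_ ∷ _ ∷ []) (_ ∷ x ∷ []) (# 0 ≈ᶻ # 1 ⊕ ↑ lit 1 ⊕ ↑ # 0 ∷ # 1 <ⁿ # 0 ∷ [] ⊢ # 1 ⊕ lit 1ℤ ⊕ ↑ # 1 <ᶻ # 0) (y≡ , h)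
        go : (∃ λ s → b (suc s) ≡ pt i ⇧[ n ] j × suc s < ℓ) → Dec (mem (pt i ⇧[ n ] suc j)) → Outcome j i (pt i) →
          (Rises j (suc i) × (∀ d → Φ n f (state j (pt i ℤ.+ 1ℤ)) d ≡ shk (suc (count i)) (Φ n f (state j (pt 0))) d)) ⊎ ((∀ d → Φ n f (state j (pt i ℤ.+ 1ℤ)) d ≡ 0ℤ) × Fail j)
        go (s , e , s<ℓ) (no up∉) _ = inj₂ (LevelΦ.blocked j W top st (pt i) (ℤP.<⇒≤ x<w) w<y (λ _ → x<w) s e s<ℓ
          (avoid j (pt i) (suc s) w<y (inj₁ x<w) e) (λ r br _ → up∉ (r , br)) , record { j≤J = ℕP.≤-refl ; x<w = x<w ; w<y = w<y ; w∈ = w∈ ; up∉ = up∉ })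
        go (s , e , s<ℓ) (yes (r , br)) prev = finish prev
          where
          slid : ∀ d → Φ n f (state j (pt i ℤ.+ 1ℤ)) d ≡ sh (Φ n f (state j (pt i))) d
          slid = LevelΦ.slid j W top st (pt i) (ℤP.<⇒≤ x<w) w<y (λ _ → x<w) s e s<ℓ (avoid j (pt i) (suc s) w<y (inj₁ x<w) e) x<w r br
          finish : Outcome j i (pt i) → _
          finish (inj₂ (z , F)) = inj₂ ((λ d → ≡.trans (slid d) (sh-zero z d)) , F)
          finish (inj₁ (R , e')) = inj₁ (R' , λ d → ≡.trans (slid d) (sh-cong e' d))
            where
            R' : Rises j (suc i)
            R' w a c m with w ℤ.≟ pt i
            ... | yes refl = r , br
            ... | no ne = R w a (split-pt i c ne) m

      level-run : ∀ j → Window x y j → mem (y ⇧[ n ] j) → (1 ≤ j → y ℤ.< x ℤ.+ + n) → ∀ i → i ≤ g → Outcome j i (pt i)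
      level-run j W top st zero h = inj₁ ((λ w a c _ → ⊥-elim (linear [] (_ ∷ _ ∷ []) (# 0 <ᶻ # 1 ∷ # 1 <ᶻ # 0 ⊕ lit 1ℤ ⊕ ↑ lit 0 ∷ [] ⊢ absurd) (a , c))) , λ d → refl)
      level-run j W top st (suc i) h = subst (Outcome j (suc i)) (sym (pt-suc i)) (level-step j W top st i h (level-run j W top st i (ℕP.<⇒≤ h)))

      pt-g : pt g ≡ y
      pt-g = sym y≡

      pt-0 : pt 0 ≡ x ℤ.+ 1ℤ
      pt-0 = ℤP.+-identityʳ (x ℤ.+ 1ℤ)

      level-full : ∀ j → Window x y j → mem (y ⇧[ n ] j) → (1 ≤ j → y ℤ.< x ℤ.+ + n) →
        (Window x y (suc j) × (∀ d → Φ n f (state j y) d ≡ shk (count g) (Φ n f (state j (x ℤ.+ 1ℤ))) d)) ⊎ ((∀ d → Φ n f (state j y) d ≡ 0ℤ) × Fail j)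
      level-full j W top st with level-run j W top st g ℕP.≤-refl
      ... | inj₂ (z , F) = inj₂ (subst (λ θ → ∀ d → Φ n f (state j θ) d ≡ 0ℤ) pt-g z , F)
      ... | inj₁ (R , e) = inj₁ (record { base = Window.base W ; rise = λ w a c m → R w a (subst (w ℤ.<_) (sym pt-g) c) m } ,
        subst₂ (λ θ θ' → ∀ d → Φ n f (state j θ) d ≡ shk (count g) (Φ n f (state j θ')) d) pt-g pt-0 e)

      Levels : ℕ → ℕ → ℕ → Set
      Levels k j J = (Window x y (suc J) × (∀ d → Φ n f (state j y) d ≡ shk (suc k ℕ.* count g) (Φ n f (state J (x ℤ.+ 1ℤ))) d)) ⊎ ((∀ d → Φ n f (state j y) d ≡ 0ℤ) × Fail J)

      next-Φ : ∀ j d → Φ n f (state j (x ℤ.+ 1ℤ)) d ≡ Φ n f (state (suc j) y) d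
      next-Φ j = Φ-cong n (C .ext) (state j (x ℤ.+ 1ℤ)) (state (suc j) y) (next-level j)

      Full : ℕ → Set
      Full j = (Window x y (suc j) × (∀ d → Φ n f (state j y) d ≡ shk (count g) (Φ n f (state j (x ℤ.+ 1ℤ))) d)) ⊎ ((∀ d → Φ n f (state j y) d ≡ 0ℤ) × Fail j)

      base-level : ∀ j → Full j → Levels 0 j j
      base-level j (inj₂ z) = inj₂ z
      base-level j (inj₁ (W' , eq)) = inj₁ (W' , λ d → ≡.trans (eq d) (cong (λ m → shk m (Φ n f (state j (x ℤ.+ 1ℤ))) d) (sym (ℕP.+-identityʳ (count g)))))

      chain-level : ∀ k j J → j ≤ J → Full j → (Window x y (suc j) → Levels k (suc j) J) → Levels (suc k) j J
      chain-level k j J j≤J (inj₂ (z , F)) rest = inj₂ (z , fail-≤ j≤J F)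
      chain-level k j J j≤J (inj₁ (W' , eq)) rest = go (rest W')
        where
        go : Levels k (suc j) J → Levels (suc k) j J
        go (inj₂ (z , F)) = inj₂ ((λ d → ≡.trans (eq d) (shk-zero (count g) (λ d → ≡.trans (next-Φ j d) (z d)) d)) , F)
        go (inj₁ (W'' , eq')) = inj₁ (W'' , λ d → ≡.trans (eq d) (≡.trans (shk-cong (count g) (λ d → ≡.trans (next-Φ j d) (eq' d)) d)
              (shk-+ (count g) (suc k ℕ.* count g) _ d)))

      -- The runners between x and y that carry a bead on the first level carry one on each further
      -- level, so each level costs the same number of slides, and each slide one factor t.
      all-levels : ∀ k j → mem (y ⇧[ n ] (k ℕ.+ j)) → y ℤ.< x ℤ.+ + n → Window x y j → Levels k j (k ℕ.+ j)
      all-levels zero j top st W = base-level j (level-full j W top (λ _ → st))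
      all-levels (suc k) j top st W = chain-level k j (suc k ℕ.+ j) (ℕP.m≤n+m j (suc k)) (level-full j W (mem-le {y} {j} {suc k ℕ.+ j} (ℕP.m≤n+m j (suc k)) top) (λ _ → st))
        (λ W' → subst (Levels k (suc j)) (ℕP.+-suc k j) (all-levels k (suc j) (mem-≡ (cong (λ m → y ⇧[ n ] m) (sym (ℕP.+-suc k j))) top) st W'))

      -- Here x = y - n is itself a bead, and the scan of level 0 arrives at it. The bead one level
      -- above is y, whose row has had its start increased and so no longer starts in the critical
      -- column; the swap kills the value.
      overlap-zero : Window x y 0 → mem y → x ≡ y ℤ.- + n → ∀ d → Φ n f (state 0 y) d ≡ 0ℤ
      overlap-zero W y∈ x≡ with level-full 0 W (mem-≡ (sym (ℤP.+-identityʳ y)) y∈) (λ ())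
      ... | inj₂ (z , _) = z
      ... | inj₁ (_ , eq) = λ d → ≡.trans (eq d) (shk-zero (count g) zero-at d)
        where
        top : mem (y ⇧[ n ] 0)
        top = mem-≡ (sym (ℤP.+-identityʳ y)) y∈
        zero-at : ∀ d → Φ n f (state 0 (x ℤ.+ 1ℤ)) d ≡ 0ℤ
        zero-at with row 0 x ℤP.≤-refl x<y top (mem-≡ (≡.trans (sym x≡) (sym (ℤP.+-identityʳ x))) (mem-pred y∈))
        ... | s , e , s<ℓ = LevelΦ.blocked 0 W top (λ ()) x ℤP.≤-refl x<y (λ ()) s e s<ℓ (avoid 0 x (suc s) x<y (inj₂ refl) e)
          (λ r br q → ℕP.1+n≢n (≡.trans (sym (up r br)) q))
          where
          up : ∀ r → b r ≡ x ⇧[ n ] 1 → state 0 (x ℤ.+ 1ℤ) r ≡ suc (D r)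
          up r br = linear (_ ∷ _ ∷ []) [] (↑ # 0 ≈ᶻ ↑ # 1 ⊕ lit 1ℤ ⊖ lit 0ℤ ⊖ lit 0ℤ ∷ [] ⊢ # 0 ≈ⁿ 1+ # 1) (spec 0 (x ℤ.+ 1ℤ) r (linear [] (_ ∷ _ ∷ []) (# 0 <ᶻ # 1 ∷ [] ⊢ # 0 ⊕ lit 1ℤ ≤ᶻ # 1) x<y) (iv-in (linear (n ∷ []) (_ ∷ _ ∷ _ ∷ []) (# 0 ≈ᶻ # 1 ⊕ ↑ (1 ⊛ # 0) ∷ # 1 ≈ᶻ # 2 ⊖ ↑ # 0 ∷ # 1 <ᶻ # 2 ∷ [] ⊢ # 1 ⊕ lit 1ℤ ≤ᶻ # 0) (br , x≡ , x<y)) (linear (n ∷ []) (_ ∷ _ ∷ y ∷ []) (# 0 ≈ᶻ # 1 ⊕ ↑ (1 ⊛ # 0) ∷ # 1 ≈ᶻ # 2 ⊖ ↑ # 0 ∷ [] ⊢ # 0 <ᶻ # 2 ⊕ lit 1ℤ) (br , x≡))) (iv-out (λ p q → linear (n ∷ []) (x ∷ _ ∷ []) (# 0 ⊕ lit 1ℤ ⊕ ↑ (0 ⊛ # 0) ≤ᶻ # 1 ∷ # 1 <ᶻ # 0 ⊕ lit 1ℤ ⊕ ↑ (0 ⊛ # 0) ∷ [] ⊢ absurd) (p , q))) (iv-out (λ p q → linear (n ∷ []) (x ∷ _ ∷ []) (# 0 ⊕ lit 1ℤ ⊕ ↑ (# 0 ⊕ 0 ⊛ # 0) ≤ᶻ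 # 1 ∷ # 1 ≈ᶻ # 0 ⊕ ↑ (1 ⊛ # 0) ∷ [] ⊢ absurd) (p , br))))

-- Finding the exchange that starts at a given bead

module Decide {n : ℕ} (1≤n : 1 ≤ n) (κ : Beads n) where
  open Rows 1≤n κ

  Base : ℤ → ℤ → Set
  Base x y = ∀ w → x ℤ.< w → w ℤ.< y → mem (w ℤ.- + n) → mem w

  record Hole (x y : ℤ) : Set where
    field
      x<y : x ℤ.< y
      y<x+n : y ℤ.< x ℤ.+ + n
      x∉ : ¬ mem x
      x-n∈ : mem (x ℤ.- + n)
      above : Base x y

  -- Going down from y, the first non-bead with a bead `n` below it is the only candidate for x;
  -- every point passed before satisfies `Base`.
  find-hole : ∀ y m → m < n → (∃ λ x → Hole x y) ⊎ Base (y ℤ.- 1ℤ ℤ.- + m) y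
  find-hole y zero h = inj₂ (λ w p q _ → ⊥-elim (linear [] (_ ∷ _ ∷ []) (# 0 ⊖ lit 1ℤ ⊖ ↑ lit 0 <ᶻ # 1 ∷ # 1 <ᶻ # 0 ∷ [] ⊢ absurd) (p , q)))
  find-hole y (suc m) h with find-hole y m (ℕP.<-trans (ℕP.n<1+n m) h)
  ... | inj₁ found = inj₁ found
  ... | inj₂ B = go (mem? v) (mem? (v ℤ.- + n))
    where
    v = y ℤ.- 1ℤ ℤ.- + m
    extend : (mem (v ℤ.- + n) → mem v) → Base (y ℤ.- 1ℤ ℤ.- + suc m) y
    extend at-v w p q with w ℤ.≟ v
    ... | yes refl = at-v
    ... | no ne = B w (ℤP.≤∧≢⇒< (lem p) (λ e → ne (sym e))) q
      where lem : y ℤ.- 1ℤ ℤ.- + suc m ℤ.< w → v ℤ.≤ w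
            lem p = linear (m ∷ []) (y ∷ _ ∷ []) (# 0 ⊖ lit 1ℤ ⊖ ↑ 1+ # 0 <ᶻ # 1 ∷ [] ⊢ # 0 ⊕ ⊝ lit 1ℤ ⊕ ⊝ ↑ # 0 ≤ᶻ # 1) p
    go : Dec (mem v) → Dec (mem (v ℤ.- + n)) → (∃ λ x → Hole x y) ⊎ Base (y ℤ.- 1ℤ ℤ.- + suc m) y
    go (yes m) _ = inj₂ (extend (λ _ → m))
    go (no v∉) (no u∉) = inj₂ (extend (λ m → ⊥-elim (u∉ m)))
    go (no v∉) (yes u∈) = inj₁ (v , record { x<y = linear (m ∷ []) (_ ∷ []) ([] ⊢ # 0 ⊕ ⊝ lit 1ℤ ⊕ ⊝ ↑ # 0 <ᶻ # 0) tt ; y<x+n = linear (_ ∷ _ ∷ []) (_ ∷ []) (1+ # 0 <ⁿ # 1 ∷ [] ⊢ # 0 <ᶻ # 0 ⊕ ⊝ lit 1ℤ ⊕ ⊝ ↑ # 0 ⊕ ↑ # 1) h ; x∉ = v∉ ; x-n∈ = u∈ ; above = B })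

  hole : ∀ y → (∃ λ x → Hole x y) ⊎ Base (y ℤ.- + n) y
  hole y with find-hole y (ℕ.pred n) (ℕP.≤-reflexive (ℕP.suc-pred n ⦃ ℕ.>-nonZero 1≤n ⦄))
  ... | inj₁ found = inj₁ found
  ... | inj₂ B = inj₂ (λ w p → B w (linear (_ ∷ _ ∷ []) (y ∷ _ ∷ []) (# 0 ⊕ ⊝ ↑ # 0 <ᶻ # 1 ∷ 1+ # 1 ≈ⁿ # 0 ∷ [] ⊢ # 0 ⊕ lit (-[1+ 0 ]) ⊕ ⊝ ↑ # 1 <ᶻ # 1) (p , ℕP.suc-pred n ⦃ ℕ.>-nonZero 1≤n ⦄)))

  -- No bead lies above that of row 0, so the runner of y ends within |b 0 - y| steps.
  top-level : ∀ y → mem y → ∃ λ J → mem (y ⇧[ n ] J) × ¬ mem (y ⇧[ n ] suc J)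
  top-level y y∈ = go (suc ℤ.∣ b 0 ℤ.- y ∣) 0 (mem-≡ (sym (ℤP.+-identityʳ y)) y∈) (lem (b 0) y)
    where
    lem : ∀ u v → u ℤ.- v ℤ.< + (0 ℕ.+ suc ℤ.∣ u ℤ.- v ∣)
    lem u v = lem' (u ℤ.- v)
      where
      lem' : ∀ a → a ℤ.< + suc ℤ.∣ a ∣
      lem' (+ m) = linear (_ ∷ []) [] ([] ⊢ ↑ # 0 <ᶻ ↑ 1+ # 0) tt
      lem' -[1+ m ] = linear (_ ∷ []) [] ([] ⊢ ⊝ ↑ 1+ # 0 <ᶻ ↑ 1+ 1+ # 0) tt
    go : ∀ k J → mem (y ⇧[ n ] J) → b 0 ℤ.- y ℤ.< + (J ℕ.+ k) → ∃ λ J → mem (y ⇧[ n ] J) × ¬ mem (y ⇧[ n ] suc J)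
    go zero J (i , e) h = ⊥-elim (linear (_ ∷ _ ∷ _ ∷ []) (_ ∷ y ∷ _ ∷ []) (# 0 ≈ᶻ # 1 ⊕ ↑ # 0 ∷ # 0 ≤ᶻ # 2 ∷ # 2 ⊖ # 1 <ᶻ ↑ (# 1 ⊕ lit 0) ∷ # 2 ≤ⁿ # 0 ∷ # 2 ≈ⁿ # 1 ∷ [] ⊢ absurd) (e , mono≤ {0} {i} z≤n , h , ℕP.*-monoʳ-≤ J 1≤n , ℕP.*-identityʳ J))
    go (suc k) J m h with mem? (y ⇧[ n ] suc J)
    ... | no t = J , m , t
    ... | yes m' = go k (suc J) m' (linear (J ∷ k ∷ []) (b 0 ∷ y ∷ []) (# 0 ⊕ ⊝ # 1 <ᶻ ↑ (# 0 ⊕ 1+ # 1) ∷ [] ⊢ # 0 ⊖ # 1 <ᶻ ↑ (1+ # 0 ⊕ # 1)) h)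

  exchange⇒base : ∀ {x y J} → Exchange x y J → Base x y
  exchange⇒base {J = J} X w p q m = mem-base {w} (suc J) (Exchange.gap X w p q m)

  -- The larger candidate lies in the window of the smaller one, whose base condition would make it
  -- a bead.
  x-unique : ∀ {x x' y} → Base x y → ¬ mem x → mem (x ℤ.- + n) → x ℤ.< y → Base x' y → ¬ mem x' → mem (x' ℤ.- + n) → x' ℤ.< y → x ≡ x'
  x-unique {x} {x'} B x∉ x∈ lt B' x'∉ x'∈ lt' with ℤP.<-cmp x x'
  ... | Relation.Binary.Definitions.tri< h _ _ = ⊥-elim (x'∉ (B x' h lt' x'∈))
  ... | Relation.Binary.Definitions.tri≈ _ e _ = e
  ... | Relation.Binary.Definitions.tri> _ _ h = ⊥-elim (x∉ (B' x h lt x∈))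

  J-unique : ∀ {y J J'} → mem (y ⇧[ n ] J) → ¬ mem (y ⇧[ n ] suc J) → mem (y ⇧[ n ] J') → ¬ mem (y ⇧[ n ] suc J') → J ≡ J'
  J-unique {y} {J} {J'} a c a' c' with ℕP.<-cmp J J'
  ... | Relation.Binary.Definitions.tri< h _ _ = ⊥-elim (c (mem-le {y} h a'))
  ... | Relation.Binary.Definitions.tri≈ _ e _ = e
  ... | Relation.Binary.Definitions.tri> _ _ h = ⊥-elim (c' (mem-le {y} h a))

  exchange-unique : ∀ {x x' y J J'} → Exchange x y J → Exchange x' y J' → x ≡ x' × J ≡ J'
  exchange-unique {y = y} X X' = x-unique (exchange⇒base X) (x∉ X) (x-n∈ X) (x<y X) (exchange⇒base X') (x∉ X') (x-n∈ X') (x<y X') ,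
    J-unique {y} (top∈ X) (top∉ X) (top∈ X') (top∉ X')
    where open Exchange

  hole-exchange : ∀ {x x' y J} → Hole x y → Exchange x' y J → x ≡ x'
  hole-exchange H X = x-unique (Hole.above H) (Hole.x∉ H) (Hole.x-n∈ H) (Hole.x<y H) (exchange⇒base X) (Exchange.x∉ X) (Exchange.x-n∈ X) (Exchange.x<y X)

  no-hole : ∀ {x y J} → Base (y ℤ.- + n) y → ¬ Exchange x y J
  no-hole {x} B X = x∉ (B x (linear (n ∷ []) (_ ∷ _ ∷ []) (# 0 <ᶻ # 1 ⊕ ↑ # 0 ∷ [] ⊢ # 0 ⊖ ↑ # 0 <ᶻ # 1) y<x+n) x<y x-n∈)
    where open Exchange X

  width : ∀ {x y} → x ℤ.< y → ∃ λ g → y ≡ x ℤ.+ 1ℤ ℤ.+ + g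
  width {x} {y} h = ℤ.∣ y ℤ.- x ℤ.- 1ℤ ∣ , linear (_ ∷ []) (_ ∷ x ∷ []) (↑ # 0 ≈ᶻ # 0 ⊖ # 1 ⊖ lit 1ℤ ∷ [] ⊢ # 0 ≈ᶻ # 1 ⊕ lit 1ℤ ⊕ ↑ # 0) (ℤP.0≤i⇒+∣i∣≡i {y ℤ.- x ℤ.- 1ℤ} (linear [] (_ ∷ _ ∷ []) (# 0 <ᶻ # 1 ∷ [] ⊢ lit 0ℤ ≤ᶻ # 1 ⊖ # 0 ⊖ lit 1ℤ) h))

  exchange? : ∀ y → mem y → Dec (∃ λ x → ∃ λ J → Exchange x y J)
  exchange? y y∈ with hole y
  ... | inj₂ B = no (λ { (x , J , X) → no-hole B X })
  ... | inj₁ (x , H) = decide (top-level y y∈) (width (Hole.x<y H))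
    where
    decide : (∃ λ J → mem (y ⇧[ n ] J) × ¬ mem (y ⇧[ n ] suc J)) → (∃ λ g → y ≡ x ℤ.+ 1ℤ ℤ.+ + g) → Dec (∃ λ x → ∃ λ J → Exchange x y J)
    decide (J , a , c) (g , e) with ℕP.allUpTo? (λ i → ok? (x ℤ.+ 1ℤ ℤ.+ + i)) g
      where
      ok? : ∀ w → Dec (mem (w ℤ.- + n) → mem (w ⇧[ n ] suc J))
      ok? w with mem? (w ℤ.- + n) | mem? (w ⇧[ n ] suc J)
      ... | _ | yes m = yes (λ _ → m)
      ... | no u∉ | no _ = yes (λ m → ⊥-elim (u∉ m))
      ... | yes u∈ | no v∉ = no (λ k → v∉ (k u∈))
    ... | yes all = yes (x , J , record { x<y = Hole.x<y H ; y<x+n = Hole.y<x+n H ; x∉ = Hole.x∉ H ; x-n∈ = Hole.x-n∈ H ; top∈ = a ; top∉ = c ; gap = gap })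
      where
      gap : ∀ w → x ℤ.< w → w ℤ.< y → mem (w ℤ.- + n) → mem (w ⇧[ n ] suc J)
      gap w p q m with width p
      ... | i , refl = all {i} (linear (_ ∷ _ ∷ []) (x ∷ _ ∷ []) (# 0 ⊕ ↑ lit 1 ⊕ ↑ # 0 <ᶻ # 1 ∷ # 1 ≈ᶻ # 0 ⊕ ↑ lit 1 ⊕ ↑ # 1 ∷ [] ⊢ # 0 <ⁿ # 1) (q , e)) m
    ... | no bad = no (λ { (x' , J' , X) → bad (λ {i} i<g m → at X (hole-exchange H X) (J-unique {y} a c (Exchange.top∈ X) (Exchange.top∉ X)) i i<g m) })
      where
      at : ∀ {x' J'} → Exchange x' y J' → x ≡ x' → J ≡ J' → ∀ i → i < g → mem (x ℤ.+ 1ℤ ℤ.+ + i ℤ.- + n) → mem ((x ℤ.+ 1ℤ ℤ.+ + i) ⇧[ n ] suc J)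
      at X refl refl i i<g m = Exchange.gap X (x ℤ.+ 1ℤ ℤ.+ + i) (linear (i ∷ []) (_ ∷ []) ([] ⊢ # 0 <ᶻ # 0 ⊕ lit 1ℤ ⊕ ↑ # 0) tt) (linear (_ ∷ _ ∷ []) (_ ∷ x ∷ []) (# 0 ≈ᶻ # 1 ⊕ lit 1ℤ ⊕ ↑ # 0 ∷ # 1 <ⁿ # 0 ∷ [] ⊢ # 1 ⊕ lit 1ℤ ⊕ ↑ # 1 <ᶻ # 0) (e , i<g)) m

  -- The lowest non-bead lies just above the beads of the empty rows, so it stops the scan in time.
  base-high : ∀ z → ℤ.- + z ℤ.< b z → Base (b z ℤ.- + n) (b z) → ℤ.- + L ℤ.< b z ℤ.- + n
  base-high z κz B = go L ℕP.≤-refl (λ i h → b-end i h)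
    where
    go : ∀ m → m ≤ L → (∀ i → m ≤ i → b i ≡ ℤ.- + i) → ℤ.- + L ℤ.< b z ℤ.- + n
    go zero _ e = ⊥-elim (linear (z ∷ []) (_ ∷ []) (# 0 ≈ᶻ ⊝ ↑ # 0 ∷ ⊝ ↑ # 0 <ᶻ # 0 ∷ [] ⊢ absurd) (e z z≤n , κz))
    go (suc m) h e with b m ℤ.≟ ℤ.- + m
    ... | yes q = go m (ℕP.<⇒≤ h) e'
      where
      e' : ∀ i → m ≤ i → b i ≡ ℤ.- + i
      e' i m≤i with m ≟ i
      ... | yes refl = q
      ... | no ne = e i (ℕP.≤∧≢⇒< m≤i ne)
    ... | no q with v ℤ.≤? b z ℤ.- + n
      where v = ℤ.- + m
    ...   | yes le = linear (_ ∷ n ∷ _ ∷ []) (b z ∷ []) (⊝ ↑ # 0 ≤ᶻ # 0 ⊕ ⊝ ↑ # 1 ∷ # 0 <ⁿ # 2 ∷ [] ⊢ ⊝ ↑ # 2 <ᶻ # 0 ⊕ ⊝ ↑ # 1) (le , h)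
    ...   | no nle = ⊥-elim (no-between m {ℤ.- + m} (linear (m ∷ []) (_ ∷ []) (# 0 ≈ᶻ ⊝ ↑ 1+ # 0 ∷ [] ⊢ # 0 <ᶻ ⊝ ↑ # 0) (e (suc m) ℕP.≤-refl)) bm (B (ℤ.- + m) (ℤP.≰⇒> nle) (linear (m ∷ []) (_ ∷ _ ∷ []) (⊝ ↑ # 0 <ᶻ # 0 ∷ # 0 ≤ᶻ # 1 ∷ [] ⊢ ⊝ ↑ # 0 <ᶻ # 1) (bm , mono≤ z≤m))
              (m ℕ.+ n , linear (m ∷ n ∷ []) (_ ∷ []) (# 0 ≈ᶻ ⊝ ↑ (# 0 ⊕ # 1) ∷ [] ⊢ # 0 ≈ᶻ ⊝ ↑ # 0 ⊕ ⊝ ↑ # 1) (e (m ℕ.+ n) (linear (_ ∷ _ ∷ []) [] (lit 1 ≤ⁿ # 0 ∷ [] ⊢ # 1 <ⁿ # 1 ⊕ # 0) 1≤n)))))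
      where
      bm : ℤ.- + m ℤ.< b m
      bm = ℤP.≤∧≢⇒< (b-≥ m) (λ k → q (sym k))
      z≤m : z ≤ m
      z≤m with z ≤? m
      ... | yes p = p
      ... | no p = ⊥-elim (linear (z ∷ []) (_ ∷ []) (# 0 ≈ᶻ ⊝ ↑ # 0 ∷ ⊝ ↑ # 0 <ᶻ # 0 ∷ [] ⊢ absurd) (e z (ℕP.≰⇒> p) , κz))

  module _ (ℓ : ℕ) (L≤ℓ : L ≤ ℓ) {p : ℕ} {f : Fn} (C : Class ℓ p f) (z j₀ : ℕ) (bp : b p ≡ b z ⇧[ n ] j₀) where
    open Catalan ℓ

    bumped : ℕ → ℕ
    bumped = upd D z (suc (D z))

    module _ (x : ℤ) (x<y : x ℤ.< b z) (y≤x+n : b z ℤ.≤ x ℤ.+ + n) (x-high : ℤ.- + L ℤ.< x) where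
      open Straighten 1≤n κ x (b z) x<y y≤x+n

      bumped-state : ∀ r → bumped r ≡ state 0 (b z) r
      bumped-state r with r ≟ z
      ... | yes refl = sym (start-at r refl)
      ... | no ne = sym (start-off r (λ e → ne (b-inj e)))

    -- The exponent is c(h - 1): there are J + 1 ribbons, and the rows of each correspond to y and
    -- the inner beads, one slide being spent on each inner bead.
    Φ-exchange : ∀ {x J} (X : Exchange x (b z) J) → ∀ d →
      Φ n f bumped d ≡ shk (suc J ℕ.* length (window-beads x (proj₁ (width (Exchange.x<y X))))) (Φ n f (Swap.Dσ 1≤n κ X)) d
    Φ-exchange {x} {J} X d = ≡.trans (Φ-cong n (C .ext) bumped (state 0 (b z)) (bumped-state x x<y (ℤP.<⇒≤ y<x+n) x-high) d) (go result)
      where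
      open Exchange X
      open Swap 1≤n κ X using (Dσ; Dσ-low; Dσ-high; Dσ-else; low?; high?)
      open Straighten 1≤n κ x (b z) x<y (ℤP.<⇒≤ y<x+n)
      x-high = nonmember-high x∉
      open Scan ℓ L≤ℓ C (proj₁ (width x<y)) (proj₂ (width x<y)) x-high j₀ bp
      W : Window x (b z) (suc J)
      W = exchange-window X
      result : Levels J 0 (J ℕ.+ 0)
      result = all-levels J 0 (mem-≡ (cong (λ m → b z ⇧[ n ] m) (sym (ℕP.+-identityʳ J))) top∈) y<x+n (window-≤ z≤n W)
      end : ∀ r → state J (x ℤ.+ 1ℤ) r ≡ Dσ r
      end r with low? (b r) | high? (b r)
      ... | yes (p , q) | _ = linear (_ ∷ _ ∷ _ ∷ []) [] (↑ # 0 ≈ᶻ ↑ # 1 ⊕ lit 1ℤ ⊖ lit 0ℤ ⊖ lit 0ℤ ∷ # 2 ≈ⁿ 1+ # 1 ∷ [] ⊢ # 0 ≈ⁿ # 2) (spec J (x ℤ.+ 1ℤ) r (linear [] (_ ∷ _ ∷ []) (# 0 <ᶻ # 1 ∷ [] ⊢ # 0 ⊕ lit 1ℤ ≤ᶻ # 1) x<y) (iv-in (linear [] (_ ∷ _ ∷ []) (# 0 <ᶻ # 1 ∷ [] ⊢ # 0 ⊕ lit 1ℤ ≤ᶻ # 1) p) (linear [] (_ ∷ _ ∷ []) (# 0 ≤ᶻ # 1 ∷ [] ⊢ # 0 <ᶻ # 1 ⊕ lit 1ℤ) q)) (iv-out (λ p q → linear (J ℕ.* n ∷ []) (x ∷ _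 ∷ []) (# 0 ⊕ lit 1ℤ ⊕ ↑ # 0 ≤ᶻ # 1 ∷ # 1 <ᶻ # 0 ⊕ lit 1ℤ ⊕ ↑ # 0 ∷ [] ⊢ absurd) (p , q))) (iv-out (λ p q' → linear (n ∷ J ℕ.* n ∷ []) (x ∷ _ ∷ _ ∷ []) (# 0 ⊕ lit 1ℤ ⊕ ↑ (# 0 ⊕ # 1) ≤ᶻ # 1 ∷ # 1 ≤ᶻ # 2 ∷ # 2 <ᶻ # 0 ⊕ ↑ # 0 ∷ [] ⊢ absurd) (p , q , y<x+n))) , Dσ-low r (p , q))
      ... | no l | yes (p , q) = linear (_ ∷ _ ∷ _ ∷ []) [] (↑ # 0 ≈ᶻ ↑ # 1 ⊕ lit 0ℤ ⊖ lit 0ℤ ⊖ lit 1ℤ ∷ 1+ # 2 ≈ⁿ # 1 ∷ [] ⊢ # 0 ≈ⁿ # 2) (spec J (x ℤ.+ 1ℤ) r (linear [] (_ ∷ _ ∷ []) (# 0 <ᶻ # 1 ∷ [] ⊢ # 0 ⊕ lit 1ℤ ≤ᶻ # 1) x<y) (iv-out (λ p q → l (linear [] (_ ∷ _ ∷ []) (# 0 ⊕ lit 1ℤ ≤ᶻ # 1 ∷ [] ⊢ # 0 <ᶻ # 1) p , linear [] (_ ∷ _ ∷ []) (# 0 <ᶻ # 1 ⊕ lit 1ℤ ∷ [] ⊢ # 0 ≤ᶻ # 1) q))) (iv-out (λ p q → linear (J ℕ.* n ∷ []) (x ∷ _ ∷ []) (# 0 ⊕ lit 1ℤ ⊕ ↑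 # 0 ≤ᶻ # 1 ∷ # 1 <ᶻ # 0 ⊕ lit 1ℤ ⊕ ↑ # 0 ∷ [] ⊢ absurd) (p , q))) (iv-in (linear (n ∷ J ℕ.* n ∷ []) (x ∷ _ ∷ []) (# 0 ⊕ ↑ (# 0 ⊕ # 1) <ᶻ # 1 ∷ [] ⊢ # 0 ⊕ lit 1ℤ ⊕ ↑ (# 0 ⊕ # 1) ≤ᶻ # 1) p) q) , Dσ-high r (p , q))
      ... | no l | no h = linear (_ ∷ _ ∷ _ ∷ []) [] (↑ # 0 ≈ᶻ ↑ # 1 ⊕ lit 0ℤ ⊖ lit 0ℤ ⊖ lit 0ℤ ∷ # 2 ≈ⁿ # 1 ∷ [] ⊢ # 0 ≈ⁿ # 2) (spec J (x ℤ.+ 1ℤ) r (linear [] (_ ∷ _ ∷ []) (# 0 <ᶻ # 1 ∷ [] ⊢ # 0 ⊕ lit 1ℤ ≤ᶻ # 1) x<y) (iv-out (λ p q → l (linear [] (_ ∷ _ ∷ []) (# 0 ⊕ lit 1ℤ ≤ᶻ # 1 ∷ [] ⊢ # 0 <ᶻ # 1) p , linear [] (_ ∷ _ ∷ []) (# 0 <ᶻ # 1 ⊕ lit 1ℤ ∷ [] ⊢ # 0 ≤ᶻ # 1) q))) (iv-out (λ p q → linear (J ℕ.* n ∷ []) (x ∷ _ ∷ []) (# 0 ⊕ lit 1ℤ ⊕ ↑ # 0 ≤ᶻ # 1 ∷ # 1 <ᶻ # 0 ⊕ lit 1ℤ ⊕ ↑ # 0 ∷ [] ⊢ absurd) (p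 , q))) (iv-out (λ p q → h (linear (n ∷ J ℕ.* n ∷ []) (x ∷ _ ∷ []) (# 0 ⊕ lit 1ℤ ⊕ ↑ (# 0 ⊕ # 1) ≤ᶻ # 1 ∷ [] ⊢ # 0 ⊕ ↑ (# 0 ⊕ # 1) <ᶻ # 1) p , q))) , Dσ-else r l h)
      go : Levels J 0 (J ℕ.+ 0) → _
      go (inj₁ (_ , eq)) = ≡.trans (eq d) (shk-cong (suc J ℕ.* count (proj₁ (width x<y)))
        (λ d → ≡.trans (cong (λ m → Φ n f (state m (x ℤ.+ 1ℤ)) d) (ℕP.+-identityʳ J)) (Φ-cong n (C .ext) (state J (x ℤ.+ 1ℤ)) Dσ end d)) d)
      go (inj₂ (_ , F)) = ⊥-elim (up∉ (mem-le {w} (s≤s (ℕP.≤-trans j≤J (ℕP.≤-reflexive (ℕP.+-identityʳ J)))) (Window.rise W w x<w w<y' w∈)))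
        where open Fail F renaming (w<y to w<y')

    -- Without a hole below y the window is the degenerate one of length `n`. With a hole, a scan
    -- that got through all levels would have verified the gap condition and so produced an
    -- exchange.
    Φ-no-exchange : ℤ.- + z ℤ.< b z → ¬ (∃ λ x → ∃ λ J → Exchange x (b z) J) → ∀ d → Φ n f bumped d ≡ 0ℤ
    Φ-no-exchange κz none with hole (b z)
    ... | inj₂ B = λ d → ≡.trans (Φ-cong n (C .ext) bumped (state 0 y) (bumped-state x x<y y≤x+n x-high) d)
            (Scan.overlap-zero ℓ L≤ℓ C (proj₁ (width x<y)) (proj₂ (width x<y)) x-high j₀ bp
              (record { base = B ; rise = λ w _ _ m → mem-≡ (sym (ℤP.+-identityʳ w)) m }) (z , refl) refl d)
      where
      y = b z
      x = y ℤ.- + n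
      x<y : x ℤ.< y
      x<y = linear (_ ∷ []) (_ ∷ []) (lit 1 ≤ⁿ # 0 ∷ [] ⊢ # 0 ⊕ ⊝ ↑ # 0 <ᶻ # 0) 1≤n
      y≤x+n : y ℤ.≤ x ℤ.+ + n
      y≤x+n = linear (n ∷ []) (_ ∷ []) ([] ⊢ # 0 ≤ᶻ # 0 ⊕ ⊝ ↑ # 0 ⊕ ↑ # 0) tt
      x-high = base-high z κz B
      open Straighten 1≤n κ x y x<y y≤x+n
    ... | inj₁ (x , H) = λ d → ≡.trans (Φ-cong n (C .ext) bumped (state 0 y) (bumped-state x x<y (ℤP.<⇒≤ y<x+n) x-high) d) (go result d)
      where
      open Hole H
      y = b z
      x-high = nonmember-high x∉
      open Straighten 1≤n κ x y x<y (ℤP.<⇒≤ y<x+n)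
      open Scan ℓ L≤ℓ C (proj₁ (width x<y)) (proj₂ (width x<y)) x-high j₀ bp
      top = top-level y (z , refl)
      J = proj₁ top
      result : Levels J 0 (J ℕ.+ 0)
      result = all-levels J 0 (mem-≡ (cong (λ m → y ⇧[ n ] m) (sym (ℕP.+-identityʳ J))) (proj₁ (proj₂ top))) y<x+n
        (record { base = above ; rise = λ w _ _ m → mem-≡ (sym (ℤP.+-identityʳ w)) m })
      go : Levels J 0 (J ℕ.+ 0) → ∀ d → Φ n f (state 0 y) d ≡ 0ℤ
      go (inj₂ (zr , _)) = zr
      go (inj₁ (W , _)) = ⊥-elim (none (x , J , record { x<y = x<y ; y<x+n = y<x+n ; x∉ = x∉ ; x-n∈ = x-n∈
        ; top∈ = proj₁ (proj₂ top) ; top∉ = proj₂ (proj₂ top)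
        ; gap = λ w p q m → subst (λ k → mem (w ⇧[ n ] suc k)) (ℕP.+-identityʳ J) (Window.rise W w p q (Window.base W w p q m)) }))

-- Partitions, hooks and 𝔭

part-beyond : ∀ κ i → length κ ≤ i → part κ i ≡ 0
part-beyond [] i h = refl
part-beyond (x ∷ κ) (suc i) (s≤s h) = part-beyond κ i h

part-positive : ∀ {κ} → All (1 ≤_) κ → ∀ i → i < length κ → 1 ≤ part κ i
part-positive (p ∷ ps) zero h = p
part-positive (p ∷ ps) (suc i) (s≤s h) = part-positive ps i h

part-support : ∀ κ i → 0 < part κ i → i < length κ
part-support (x ∷ κ) zero h = s≤s z≤n
part-support (x ∷ κ) (suc i) h = s≤s (part-support κ i h)

part-ext : ∀ {κ τ} → All (1 ≤_) κ → All (1 ≤_) τ → (∀ i → part κ i ≡ part τ i) → κ ≡ τ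
part-ext [] [] h = refl
part-ext [] (p ∷ _) h = ⊥-elim (ℕP.<⇒≱ p (ℕP.≤-reflexive (sym (h 0))))
part-ext (p ∷ _) [] h = ⊥-elim (ℕP.<⇒≱ p (ℕP.≤-reflexive (h 0)))
part-ext (p ∷ ps) (q ∷ qs) h = cong₂ _∷_ (h 0) (part-ext ps qs (h ∘ suc))

sum-part : ∀ κ ℓ → length κ ≤ ℓ → + sum κ ≡ Σ< ℓ (λ i → + part κ i)
sum-part [] ℓ h = sym (Σ<-zero ℓ)
sum-part (x ∷ κ) (suc ℓ) (s≤s h) = ≡.trans (cong (λ s → + x ℤ.+ s) (sum-part κ ℓ h)) (sym (front ℓ (λ i → + part (x ∷ κ) i)))
  where
  front : ∀ m (g : ℕ → ℤ) → Σ< (suc m) g ≡ g 0 ℤ.+ Σ< m (g ∘ suc)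
  front zero g = ≡.trans (ℤP.+-identityˡ (g 0)) (sym (ℤP.+-identityʳ (g 0)))
  front (suc m) g = ≡.trans (cong (λ s → s ℤ.+ g (suc m)) (front m g)) (ℤP.+-assoc (g 0) _ _)

Decreasing : (ℕ → ℕ) → Set
Decreasing r = ∀ i → r (suc i) ≤ r i

decreasing-≤ : ∀ {r} → Decreasing r → ∀ {i j} → i ≤ j → r j ≤ r i
decreasing-≤ {r} dec {i} {j} h = subst (λ j → r j ≤ r i) (ℕP.m+[n∸m]≡n h) (go (j ∸ i))
  where
  go : ∀ k → r (i ℕ.+ k) ≤ r i
  go zero = ℕP.≤-reflexive (cong r (ℕP.+-identityʳ i))
  go (suc k) = ℕP.≤-trans (ℕP.≤-reflexive (cong r (ℕP.+-suc i k))) (ℕP.≤-trans (dec (i ℕ.+ k)) (go k))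

fromRows : (ℕ → ℕ) → ℕ → List ℕ
fromRows r zero = []
fromRows r (suc m) with r 0
... | zero = []
... | suc x = suc x ∷ fromRows (r ∘ suc) m

part-fromRows : ∀ r m → Decreasing r → (∀ i → m ≤ i → r i ≡ 0) → ∀ i → part (fromRows r m) i ≡ r i
part-fromRows r zero dec z i = sym (z i z≤n)
part-fromRows r (suc m) dec z i with r 0 in eq
part-fromRows r (suc m) dec z i | zero = sym (ℕP.n≤0⇒n≡0 (subst (r i ≤_) eq (decreasing-≤ dec z≤n)))
part-fromRows r (suc m) dec z zero | suc x = sym eq
part-fromRows r (suc m) dec z (suc i) | suc x = part-fromRows (r ∘ suc) m (λ i → dec (suc i)) (λ i h → z (suc i) (s≤s h)) i

fromRows-positive : ∀ r m → All (1 ≤_) (fromRows r m)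
fromRows-positive r zero = []
fromRows-positive r (suc m) with r 0
... | zero = []
... | suc x = s≤s z≤n ∷ fromRows-positive (r ∘ suc) m

length-fromRows : ∀ r m → length (fromRows r m) ≤ m
length-fromRows r zero = z≤n
length-fromRows r (suc m) with r 0
... | zero = z≤n
... | suc x = s≤s (length-fromRows (r ∘ suc) m)

-- In a partition the rows reaching beyond column `j` form an initial segment, so their number
-- locates them.
colLen-spec : ∀ κ → Decreasing (part κ) → ∀ j r → (j < part κ r → r < colLen κ j) × (r < colLen κ j → j < part κ r)
colLen-spec [] dec j r = (λ ()) , (λ ())
colLen-spec (x ∷ κ) dec j r with j <? x
... | yes p = subst (λ m → (j < part (x ∷ κ) r → r < m) × (r < m → j < part (x ∷ κ) r)) (sym (cong length (filter-accept (j <?_) p))) (go r)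
  where
  go : ∀ r → (j < part (x ∷ κ) r → r < suc (colLen κ j)) × (r < suc (colLen κ j) → j < part (x ∷ κ) r)
  go zero = (λ _ → s≤s z≤n) , (λ _ → p)
  go (suc r) = (λ h → s≤s (proj₁ rec h)) , (λ h → proj₂ rec (ℕP.≤-pred h))
    where rec = colLen-spec κ (λ i → dec (suc i)) j r
... | no p = subst (λ m → (j < part (x ∷ κ) r → r < m) × (r < m → j < part (x ∷ κ) r)) (sym (cong length (filter-reject (j <?_) p)))
  ((λ h → ⊥-elim (p (ℕP.<-≤-trans h (decreasing-≤ dec {0} {r} z≤n)))) ,
   λ h → ⊥-elim (p (ℕP.<-≤-trans (proj₂ (colLen-spec κ (λ i → dec (suc i)) j 0) (ℕP.≤-<-trans z≤n h)) (dec 0))))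

count-from : ∀ {P : ℕ → Set} (P? : ∀ i → Dec (P i)) (g : ℕ → ℕ) N m → m ≤ N →
  (∀ i → i < N → m ≤ i → P (g i)) → (∀ i → i < N → i < m → ¬ P (g i)) → length (filter P? (applyUpTo g N)) ≡ N ∸ m
count-from P? g zero m h f k = sym (ℕP.0∸n≡0 m)
count-from P? g (suc N) zero h f k with P? (g 0)
... | yes _ = cong suc (count-from P? (g ∘ suc) N 0 z≤n (λ i h _ → f (suc i) (s≤s h) z≤n) (λ i _ ()))
... | no ¬p = ⊥-elim (¬p (f 0 (s≤s z≤n) z≤n))
count-from P? g (suc N) (suc m) (s≤s h) f k with P? (g 0)
... | yes p = ⊥-elim (k 0 (s≤s z≤n) (s≤s z≤n) p)
... | no _ = count-from P? (g ∘ suc) N m h (λ i a c → f (suc i) (s≤s a) (s≤s c)) (λ i a c → k (suc i) (s≤s a) (s≤s c))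

part-applyUpTo : ∀ f m i → i < m → part (applyUpTo f m) i ≡ f i
part-applyUpTo f (suc m) zero h = refl
part-applyUpTo f (suc m) (suc i) (s≤s h) = part-applyUpTo (f ∘ suc) m i h

length-applyUpTo : ∀ {A : Set} (f : ℕ → A) m → length (applyUpTo f m) ≡ m
length-applyUpTo f zero = refl
length-applyUpTo f (suc m) = cong suc (length-applyUpTo (f ∘ suc) m)

row-bead : (ℕ → ℕ) → ℕ → ℤ
row-bead r i = + r i ℤ.- + i

module ListCore (K : ℕ) (κ : List ℕ) (dec : Decreasing (part κ)) where
  n = suc K

  b : ℕ → ℤ
  b = row-bead (part κ)

  b-dec : ∀ i → b (suc i) ℤ.< b i
  b-dec i = lem (part κ (suc i)) (part κ i) (dec i)
    where lem : ∀ u v → u ≤ v → + u ℤ.- + suc i ℤ.< + v ℤ.- + i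
          lem u v h = linear (_ ∷ _ ∷ i ∷ []) [] (# 0 ≤ⁿ # 1 ∷ [] ⊢ ↑ # 0 ⊖ ↑ 1+ # 2 <ᶻ ↑ # 1 ⊖ ↑ # 2) h

  b-end : ∀ i → length κ ≤ i → b i ≡ ℤ.- + i
  b-end i h = ≡.trans (cong (λ x → + x ℤ.- + i) (part-beyond κ i h)) (ℤP.+-identityˡ (ℤ.- + i))

  open Seq b (length κ) b-dec b-end using (first; mono<; mono≤; cmp<; cmp≤)

  hook-exact : ∀ i j r → j < part κ i → j < part κ r → part κ (suc r) ≤ j → i ≤ r → hook κ i j ≡ (suc r ∸ suc i) ℕ.+ (part κ i ∸ j)
  hook-exact i j r h a c i≤r = cong (λ x → (x ∸ suc i) ℕ.+ (part κ i ∸ j)) (ℕP.≤-antisym (ℕP.≮⇒≥ (λ k → ℕP.<⇒≱ (proj₂ (colLen-spec κ dec j (suc r)) k) c)) (proj₁ (colLen-spec κ dec j r) a))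

  -- Let `d` be the first row whose bead is at most b_i - n. If b_i - n is not attained, it lies
  -- strictly between the beads of rows r = d - 1 and d, and then the box of row `i` in column b_i -
  -- n + r has hook length exactly `n`.
  closed : (∀ i j → j < part κ i → hook κ i j ≢ n) → ∀ i → ∃ λ d → b d ≡ b i ℤ.- + n
  closed no-n i with first (b i ℤ.- + n)
  ... | d , le , before with b d ℤ.≟ b i ℤ.- + n
  ...   | yes e = d , e
  ...   | no ne = ⊥-elim (gap d le before (ℤP.≤∧≢⇒< le ne))
    where
    gap : ∀ d → b d ℤ.≤ b i ℤ.- + n → (∀ j → j < d → b i ℤ.- + n ℤ.< b j) → b d ℤ.< b i ℤ.- + n → ⊥
    gap zero le before lt = lem (mono≤ {0} {i} z≤n) lt
      where lem : b i ℤ.≤ b 0 → b 0 ℤ.< b i ℤ.- + n → ⊥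
            lem p q = linear (part κ i ∷ i ∷ part κ 0 ∷ K ∷ []) [] (↑ # 0 ⊕ ⊝ ↑ # 1 ≤ᶻ ↑ (# 2 ⊕ lit 0) ∷ ↑ (# 2 ⊕ lit 0) <ᶻ ↑ # 0 ⊕ ⊝ ↑ # 1 ⊖ ↑ 1+ # 3 ∷ [] ⊢ absurd) (p , q)
    gap (suc r) le before lt = no-n i j j<i (≡.trans (hook-exact i j r j<i j<r c i≤r) hook-n)
      where
      above : b i ℤ.- + n ℤ.< b r
      above = before r (ℕP.n<1+n r)
      i≤r : i ≤ r
      i≤r = ℕP.≤-pred (cmp< {i} {suc r} (linear (part κ i ∷ i ∷ K ∷ []) (_ ∷ []) (# 0 <ᶻ ↑ # 0 ⊕ ⊝ ↑ # 1 ⊖ ↑ 1+ # 2 ∷ [] ⊢ # 0 <ᶻ ↑ # 0 ⊕ ⊝ ↑ # 1) lt))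
      jℤ : ℤ
      jℤ = b i ℤ.- + n ℤ.+ + r
      j : ℕ
      j = ℤ.∣ jℤ ∣
      j≡ : + j ≡ jℤ
      j≡ = ℤP.0≤i⇒+∣i∣≡i (lem (part κ (suc r)) lt)
        where lem : ∀ u → + u ℤ.- + suc r ℤ.< b i ℤ.- + n → 0ℤ ℤ.≤ jℤ
              lem u h = linear (u ∷ r ∷ part κ i ∷ i ∷ K ∷ []) [] (↑ # 0 ⊖ ↑ 1+ # 1 <ᶻ ↑ # 2 ⊕ ⊝ ↑ # 3 ⊖ ↑ 1+ # 4 ∷ [] ⊢ lit 0ℤ ≤ᶻ ↑ # 2 ⊕ ⊝ ↑ # 3 ⊕ ⊝ ↑ 1+ # 4 ⊕ ↑ # 1) h
      j<r : j < part κ r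
      j<r = lem (part κ r) above
        where lem : ∀ u → b i ℤ.- + n ℤ.< + u ℤ.- + r → j < u
              lem u h = linear (part κ i ∷ i ∷ K ∷ _ ∷ r ∷ _ ∷ []) [] (↑ # 0 ⊕ ⊝ ↑ # 1 ⊖ ↑ 1+ # 2 <ᶻ ↑ # 3 ⊖ ↑ # 4 ∷ ↑ # 5 ≈ᶻ ↑ # 0 ⊕ ⊝ ↑ # 1 ⊕ ⊝ ↑ 1+ # 2 ⊕ ↑ # 4 ∷ [] ⊢ # 5 <ⁿ # 3) (h , j≡)
      c : part κ (suc r) ≤ j
      c = lem (part κ (suc r)) lt
        where lem : ∀ u → + u ℤ.- + suc r ℤ.< b i ℤ.- + n → u ≤ j
              lem u h = linear (_ ∷ r ∷ part κ i ∷ i ∷ K ∷ _ ∷ []) [] (↑ # 0 ⊖ ↑ 1+ # 1 <ᶻ ↑ # 2 ⊕ ⊝ ↑ # 3 ⊖ ↑ 1+ # 4 ∷ ↑ # 5 ≈ᶻ ↑ # 2 ⊕ ⊝ ↑ # 3 ⊕ ⊝ ↑ 1+ # 4 ⊕ ↑ # 1 ∷ [] ⊢ # 0 ≤ⁿ # 5) (h , j≡)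
      j<i : j < part κ i
      j<i = ℕP.<-≤-trans j<r (decreasing-≤ dec i≤r)
      hook-n : (suc r ∸ suc i) ℕ.+ (part κ i ∸ j) ≡ n
      hook-n = linear (r ∸ i ∷ i ∷ _ ∷ part κ i ∸ ℤ.∣ + part κ i ℤ.+ ℤ.- (+ i) ℤ.+ ℤ.- (+ n) ℤ.+ + r ∣ ∷ _ ∷ _ ∷ _ ∷ []) [] (# 0 ⊕ # 1 ≈ⁿ # 2 ∷ # 3 ⊕ # 4 ≈ⁿ # 5 ∷ ↑ # 4 ≈ᶻ ↑ # 5 ⊕ ⊝ ↑ # 1 ⊕ ⊝ ↑ 1+ # 6 ⊕ ↑ # 2 ∷ [] ⊢ # 0 ⊕ # 3 ≈ⁿ 1+ # 6) (ℕP.m∸n+n≡m i≤r , ℕP.m∸n+n≡m (ℕP.<⇒≤ j<i) , j≡)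

  module Closed (D : ℕ → ℕ) (b-D : ∀ i → b (D i) ≡ b i ℤ.- + n) where

    beads : Beads n
    beads = record { b = b ; D = D ; L = length κ ; b-dec = b-dec ; b-D = b-D ; b-end = b-end }

    part-D : ∀ i → part κ (D i) ℕ.+ (i ℕ.+ n) ≡ part κ i ℕ.+ D i
    part-D i = lem (part κ (D i)) (part κ i) (D i) (b-D i)
      where lem : ∀ u v d → + u ℤ.- + d ≡ + v ℤ.- + i ℤ.- + n → u ℕ.+ (i ℕ.+ n) ≡ v ℕ.+ d
            lem u v d h = linear (u ∷ d ∷ v ∷ i ∷ K ∷ []) [] (↑ # 0 ⊖ ↑ # 1 ≈ᶻ ↑ # 2 ⊖ ↑ # 3 ⊖ ↑ 1+ # 4 ∷ [] ⊢ # 0 ⊕ (# 3 ⊕ 1+ # 4) ≈ⁿ # 2 ⊕ # 1) h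

    D->i : ∀ i → i < D i
    D->i i = cmp< {i} {D i} (linear (part κ (D i) ∷ D i ∷ part κ i ∷ i ∷ K ∷ []) [] (↑ # 0 ⊕ ⊝ ↑ # 1 ≈ᶻ ↑ # 2 ⊕ ⊝ ↑ # 3 ⊖ ↑ 1+ # 4 ∷ [] ⊢ ↑ # 0 ⊕ ⊝ ↑ # 1 <ᶻ ↑ # 2 ⊕ ⊝ ↑ # 3) (b-D i))

    D≤ : ∀ i → part κ (D i) ≤ part κ i
    D≤ i = decreasing-≤ dec (ℕP.<⇒≤ (D->i i))

    -- The column of a box reaches row `D i` exactly if the box lies to the left of column κ_(D i).
    -- Since κ_(D i) - D i = κ_i - i - n, this separates hooks above `n` from hooks below `n`, and 𝔭
    -- counts the boxes of row `i` beyond row `D i`.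
    hook-small : ∀ i j → j < part κ i → part κ (D i) ≤ j → hook κ i j ≤ K
    hook-small i j h k = linear (_ ∷ _ ∷ _ ∷ _ ∷ _ ∷ _ ∷ part κ i ∸ j ∷ _ ∷ colLen κ j ∸ suc i ∷ []) [] (# 0 ⊕ (# 1 ⊕ 1+ # 2) ≈ⁿ # 3 ⊕ # 4 ∷ # 5 ≤ⁿ # 4 ∷ # 1 <ⁿ # 5 ∷ # 6 ⊕ # 7 ≈ⁿ # 3 ∷ # 8 ⊕ 1+ # 1 ≈ⁿ # 5 ∷ # 0 ≤ⁿ # 7 ∷ [] ⊢ # 8 ⊕ # 6 ≤ⁿ # 2) (part-D i , col , col' , ℕP.m∸n+n≡m (ℕP.<⇒≤ h) , ℕP.m∸n+n≡m col' , k)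
      where
      col : colLen κ j ≤ D i
      col = ℕP.≮⇒≥ (λ p → ℕP.<⇒≱ (proj₂ (colLen-spec κ dec j (D i)) p) k)
      col' : suc i ≤ colLen κ j
      col' = proj₁ (colLen-spec κ dec j i) h

    hook-large : ∀ i j → j < part κ i → j < part κ (D i) → n < hook κ i j
    hook-large i j h k = linear (_ ∷ i ∷ _ ∷ _ ∷ _ ∷ _ ∷ part κ i ∸ j ∷ _ ∷ colLen κ j ∸ suc i ∷ []) [] (# 0 ⊕ (# 1 ⊕ 1+ # 2) ≈ⁿ # 3 ⊕ # 4 ∷ # 4 <ⁿ # 5 ∷ # 6 ⊕ # 7 ≈ⁿ # 3 ∷ # 8 ⊕ 1+ # 1 ≈ⁿ # 5 ∷ # 7 <ⁿ # 0 ∷ [] ⊢ 1+ # 2 <ⁿ # 8 ⊕ # 6) (part-D i , col , ℕP.m∸n+n≡m (ℕP.<⇒≤ h) , ℕP.m∸n+n≡m col' , k)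
      where
      col : D i < colLen κ j
      col = proj₁ (colLen-spec κ dec j (D i)) k
      col' : suc i ≤ colLen κ j
      col' = proj₁ (colLen-spec κ dec j i) h

    no-hook-n : ∀ i j → j < part κ i → hook κ i j ≢ n
    no-hook-n i j h e with j <? part κ (D i)
    ... | yes k = ℕP.<-irrefl (sym e) (hook-large i j h k)
    ... | no k = ℕP.<-irrefl refl (subst (_≤ K) e (hook-small i j h (ℕP.≮⇒≥ k)))

    part-pmap : ∀ i → part (pmap K κ) i ≡ part κ i ∸ part κ (D i)
    part-pmap i with i <? length κ
    ... | yes h = ≡.trans (part-applyUpTo _ (length κ) i h) (count-from (λ j → hook κ i j ≤? K) (λ j → j) (part κ i) (part κ (D i)) (D≤ i)
                    (λ j a c → hook-small i j a c) (λ j a c k → ℕP.<⇒≱ (hook-large i j a c) (ℕP.m≤n⇒m≤1+n k)))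
    ... | no h = ≡.trans (part-beyond (pmap K κ) i (ℕP.≤-trans (ℕP.≤-reflexive (length-applyUpTo _ (length κ))) (ℕP.≮⇒≥ h)))
                   (sym (≡.trans (cong (λ x → x ∸ part κ (D i)) (part-beyond κ i (ℕP.≮⇒≥ h))) (ℕP.0∸n≡0 (part κ (D i)))))

    part-pmap-wt : ∀ i → + part (pmap K κ) i ≡ wt n D i
    part-pmap-wt i = lem (part (pmap K κ) i) (≡.trans (cong (ℕ._+ part κ (D i)) (part-pmap i)) (ℕP.m∸n+n≡m (D≤ i)))
      where lem : ∀ u → u ℕ.+ part κ (D i) ≡ part κ i → + u ≡ + (i ℕ.+ n) ℤ.- + D i
            lem u h = linear (_ ∷ part κ (D i) ∷ _ ∷ i ∷ K ∷ D i ∷ []) [] (# 0 ⊕ # 1 ≈ⁿ # 2 ∷ # 1 ⊕ (# 3 ⊕ 1+ # 4) ≈ⁿ # 2 ⊕ # 5 ∷ [] ⊢ ↑ # 0 ≈ᶻ ↑ (# 3 ⊕ 1+ # 4) ⊖ ↑ # 5) (h , part-D i)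

-- The bijection between cores and bounded partitions

core-dec : ∀ {K κ} → IsCore K κ → Decreasing (part κ)
core-dec c = proj₁ (proj₁ c)

core-pos : ∀ {K κ} → IsCore K κ → All (1 ≤_) κ
core-pos c = proj₂ (proj₁ c)

module _ {K : ℕ} {κ : List ℕ} (c : IsCore K κ) where
  private
    module LC = ListCore K κ (core-dec c)

  opaque
    coreD : ℕ → ℕ
    coreD i = proj₁ (LC.closed (proj₂ c) i)

    core-bD : ∀ i → row-bead (part κ) (coreD i) ≡ row-bead (part κ) i ℤ.- + suc K
    core-bD i = proj₂ (LC.closed (proj₂ c) i)

  coreBeads : Beads (suc K)
  coreBeads = LC.Closed.beads coreD core-bD

  core-pmap : ∀ i → + part (pmap K κ) i ≡ wt (suc K) coreD i
  core-pmap = LC.Closed.part-pmap-wt coreD core-bD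

  core-rows : ∀ i → part κ i ≡ part (pmap K κ) i ℕ.+ part κ (coreD i)
  core-rows i = linear (_ ∷ i ∷ K ∷ coreD i ∷ part κ (coreD i) ∷ _ ∷ []) [] (↑ # 0 ≈ᶻ ↑ (# 1 ⊕ 1+ # 2) ⊕ ⊝ ↑ # 3 ∷ # 4 ⊕ (# 1 ⊕ 1+ # 2) ≈ⁿ # 5 ⊕ # 3 ∷ [] ⊢ # 5 ≈ⁿ # 0 ⊕ # 4) (core-pmap i , LC.Closed.part-D coreD core-bD i)

length-pmap : ∀ K κ → length (pmap K κ) ≡ length κ
length-pmap K κ = length-applyUpTo _ (length κ)

row-bead-inj : ∀ {r s : ℕ → ℕ} i → row-bead r i ≡ row-bead s i → r i ≡ s i
row-bead-inj {r} {s} i e = lem (r i) (s i) e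
  where lem : ∀ u v → + u ℤ.- + i ≡ + v ℤ.- + i → u ≡ v
        lem u v h = linear (_ ∷ i ∷ _ ∷ []) [] (↑ # 0 ⊖ ↑ # 1 ≈ᶻ ↑ # 2 ⊖ ↑ # 1 ∷ [] ⊢ # 0 ≈ⁿ # 2) h

module FromBeads {K : ℕ} (B : Beads (suc K)) where
  open Rows (s≤s z≤n) B

  rows : ℕ → ℕ
  rows i = ℤ.∣ b i ℤ.+ + i ∣

  rows-ℤ : ∀ i → + rows i ≡ b i ℤ.+ + i
  rows-ℤ i = ℤP.0≤i⇒+∣i∣≡i (linear (i ∷ []) (_ ∷ []) (⊝ ↑ # 0 ≤ᶻ # 0 ∷ [] ⊢ lit 0ℤ ≤ᶻ # 0 ⊕ ↑ # 0) (b-≥ i))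

  rows-dec : Decreasing rows
  rows-dec i = linear (_ ∷ i ∷ _ ∷ []) (_ ∷ _ ∷ []) (↑ # 0 ≈ᶻ # 0 ⊕ ↑ # 1 ∷ ↑ # 2 ≈ᶻ # 1 ⊕ ↑ 1+ # 1 ∷ # 1 <ᶻ # 0 ∷ [] ⊢ # 2 ≤ⁿ # 0) (rows-ℤ i , rows-ℤ (suc i) , b-dec i)

  rows-end : ∀ i → L ≤ i → rows i ≡ 0
  rows-end i h = linear (_ ∷ i ∷ []) (_ ∷ []) (↑ # 0 ≈ᶻ # 0 ⊕ ↑ # 1 ∷ # 0 ≈ᶻ ⊝ ↑ # 1 ∷ [] ⊢ # 0 ≈ⁿ lit 0) (rows-ℤ i , b-end i h)

  list : List ℕ
  list = fromRows rows L

  list-rows : ∀ i → part list i ≡ rows i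
  list-rows = part-fromRows rows L rows-dec rows-end

  list-beads : ∀ i → row-bead (part list) i ≡ b i
  list-beads i = lem (part list i) (list-rows i)
    where lem : ∀ u → u ≡ rows i → + u ℤ.- + i ≡ b i
          lem u e = linear (_ ∷ _ ∷ i ∷ []) (_ ∷ []) (# 0 ≈ⁿ # 1 ∷ ↑ # 1 ≈ᶻ # 0 ⊕ ↑ # 2 ∷ [] ⊢ ↑ # 0 ⊖ ↑ # 2 ≈ᶻ # 0) (e , rows-ℤ i)

  list-dec : Decreasing (part list)
  list-dec i = subst₂ _≤_ (sym (list-rows (suc i))) (sym (list-rows i)) (rows-dec i)

  list-bD : ∀ i → row-bead (part list) (D i) ≡ row-bead (part list) i ℤ.- + suc K
  list-bD i = ≡.trans (list-beads (D i)) (≡.trans (b-D i) (cong (λ v → v ℤ.- + suc K) (sym (list-beads i))))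

  list-core : IsCore K list
  list-core = (list-dec , fromRows-positive rows L) , ListCore.Closed.no-hook-n K list list-dec D list-bD

  list-pmap : ∀ i → + part (pmap K list) i ≡ wt (suc K) D i
  list-pmap = ListCore.Closed.part-pmap-wt K list list-dec D list-bD

  list-length : length list ≤ L
  list-length = length-fromRows rows L

D-of : ∀ K → (ℕ → ℕ) → ℕ → ℕ
D-of K μ i = i ℕ.+ suc K ∸ μ i

module FromBounded (K ℓ : ℕ) (μ : ℕ → ℕ) (μ-dec : Decreasing μ) (μ≤K : ∀ i → μ i ≤ K) (μ-end : ∀ i → ℓ ≤ i → μ i ≡ 0) where
  D : ℕ → ℕ
  D = D-of K μ

  D-eq : ∀ i → D i ℕ.+ μ i ≡ i ℕ.+ suc K
  D-eq i = ℕP.m∸n+n≡m (ℕP.≤-trans (μ≤K i) (ℕP.≤-trans (ℕP.n≤1+n K) (ℕP.m≤n+m (suc K) i)))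

  D-inc : ∀ {i j} → i ≤ j → D i ≤ D j
  D-inc {i} {j} h = linear (_ ∷ _ ∷ _ ∷ K ∷ _ ∷ _ ∷ _ ∷ []) [] (# 0 ⊕ # 1 ≈ⁿ # 2 ⊕ 1+ # 3 ∷ # 4 ⊕ # 5 ≈ⁿ # 6 ⊕ 1+ # 3 ∷ # 2 ≤ⁿ # 6 ∷ # 5 ≤ⁿ # 1 ∷ [] ⊢ # 0 ≤ⁿ # 4) (D-eq i , D-eq j , h , decreasing-≤ μ-dec h)

  -- The core is determined by κ_i = μ_i + κ_(D i). The first argument bounds the depth of the
  -- recursion: as D i > i, depth ℓ always leads to an empty row.
  build : ℕ → ℕ → ℕ
  build zero i = 0
  build (suc m) i = μ i ℕ.+ build m (D i)

  build-dec : ∀ m {i j} → i ≤ j → build m j ≤ build m i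
  build-dec zero h = z≤n
  build-dec (suc m) h = ℕP.+-mono-≤ (decreasing-≤ μ-dec h) (build-dec m (D-inc h))

  build-stable : ∀ m i → ℓ ≤ i ℕ.+ m → build (suc m) i ≡ build m i
  build-stable zero i h = ≡.trans (ℕP.+-identityʳ (μ i)) (μ-end i (subst (ℓ ≤_) (ℕP.+-identityʳ i) h))
  build-stable (suc m) i h = cong (μ i ℕ.+_) (build-stable m (D i) (linear (_ ∷ i ∷ m ∷ D i ∷ _ ∷ _ ∷ []) [] (# 0 ≤ⁿ # 1 ⊕ 1+ # 2 ∷ # 3 ⊕ # 4 ≈ⁿ # 1 ⊕ 1+ # 5 ∷ # 4 ≤ⁿ # 5 ∷ [] ⊢ # 0 ≤ⁿ # 3 ⊕ # 2) (h , D-eq i , μ≤K i)))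

  κ : ℕ → ℕ
  κ = build ℓ

  κ-rec : ∀ i → κ i ≡ μ i ℕ.+ κ (D i)
  κ-rec i = sym (build-stable ℓ i (ℕP.m≤n+m ℓ i))

  κ-end : ∀ i → ℓ ≤ i → κ i ≡ 0
  κ-end i h = go ℓ i h
    where
    go : ∀ m i → ℓ ≤ i → build m i ≡ 0
    go zero i h = refl
    go (suc m) i h = cong₂ ℕ._+_ (μ-end i h) (go m (D i) (linear (_ ∷ _ ∷ _ ∷ _ ∷ _ ∷ []) [] (# 0 ≤ⁿ # 1 ∷ # 2 ⊕ # 3 ≈ⁿ # 1 ⊕ 1+ # 4 ∷ # 3 ≤ⁿ # 4 ∷ [] ⊢ # 0 ≤ⁿ # 2) (h , D-eq i , μ≤K i)))

  beads : Beads (suc K)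
  beads = record { b = row-bead κ ; D = D ; L = ℓ ; b-dec = λ i → lem i (κ (suc i)) (κ i) (build-dec ℓ (ℕP.n≤1+n i))
                 ; b-D = λ i → lem₂ i (κ i) (κ (D i)) (κ-rec i) ; b-end = λ i h → ≡.trans (cong (λ x → + x ℤ.- + i) (κ-end i h)) (ℤP.+-identityˡ (ℤ.- + i)) }
    where
    lem : ∀ i u v → u ≤ v → + u ℤ.- + suc i ℤ.< + v ℤ.- + i
    lem i u v h = linear (_ ∷ _ ∷ i ∷ []) [] (# 0 ≤ⁿ # 1 ∷ [] ⊢ ↑ # 0 ⊖ ↑ 1+ # 2 <ᶻ ↑ # 1 ⊖ ↑ # 2) h
    lem₂ : ∀ i u v → u ≡ μ i ℕ.+ v → + v ℤ.- + D i ≡ + u ℤ.- + i ℤ.- + suc K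
    lem₂ i u v h = linear (_ ∷ μ i ∷ v ∷ D i ∷ i ∷ K ∷ []) [] (# 0 ≈ⁿ # 1 ⊕ # 2 ∷ # 3 ⊕ # 1 ≈ⁿ # 4 ⊕ 1+ # 5 ∷ [] ⊢ ↑ # 2 ⊖ ↑ # 3 ≈ᶻ ↑ # 0 ⊖ ↑ # 4 ⊖ ↑ 1+ # 5) (h , D-eq i)

  open FromBeads beads public using (list; list-core; list-length; list-pmap)

  list-μ : ∀ i → part (pmap K list) i ≡ μ i
  list-μ i = linear (_ ∷ i ∷ K ∷ i ℕ.+ suc K ∸ μ i ∷ _ ∷ []) [] (↑ # 0 ≈ᶻ ↑ (# 1 ⊕ 1+ # 2) ⊕ ⊝ ↑ # 3 ∷ # 3 ⊕ # 4 ≈ⁿ # 1 ⊕ 1+ # 2 ∷ [] ⊢ # 0 ≈ⁿ # 4) (list-pmap i , D-eq i)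

-- The function D can be read off from 𝔭, and `core-rows` then recovers the rows, starting from the
-- empty ones.
pmap-injective : ∀ {K κ τ} → IsCore K κ → IsCore K τ → (∀ i → part (pmap K κ) i ≡ part (pmap K τ) i) → κ ≡ τ
pmap-injective {K} {κ} {τ} c c' h = part-ext (core-pos c) (core-pos c') (λ i → go (length κ ℕ.+ length τ) i (ℕP.m≤n+m _ i))
  where
  D≡ : ∀ i → coreD c i ≡ coreD c' i
  D≡ i = linear (_ ∷ i ∷ K ∷ _ ∷ _ ∷ _ ∷ []) [] (↑ # 0 ≈ᶻ ↑ (# 1 ⊕ 1+ # 2) ⊕ ⊝ ↑ # 3 ∷ ↑ # 4 ≈ᶻ ↑ (# 1 ⊕ 1+ # 2) ⊕ ⊝ ↑ # 5 ∷ # 0 ≈ⁿ # 4 ∷ [] ⊢ # 3 ≈ⁿ # 5) (core-pmap c i , core-pmap c' i , h i)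
  go : ∀ m i → length κ ℕ.+ length τ ≤ i ℕ.+ m → part κ i ≡ part τ i
  go zero i le = ≡.trans (part-beyond κ i (linear (_ ∷ length τ ∷ _ ∷ []) [] (# 0 ⊕ # 1 ≤ⁿ # 2 ⊕ lit 0 ∷ [] ⊢ # 0 ≤ⁿ # 2) le)) (sym (part-beyond τ i (linear (length κ ∷ _ ∷ _ ∷ []) [] (# 0 ⊕ # 1 ≤ⁿ # 2 ⊕ lit 0 ∷ [] ⊢ # 1 ≤ⁿ # 2) le)))
  go (suc m) i le = ≡.trans (core-rows c i) (≡.trans (cong₂ ℕ._+_ (h i) (≡.trans (cong (part κ) (D≡ i))
    (go m (coreD c' i) (linear (length κ ∷ length τ ∷ _ ∷ m ∷ _ ∷ []) [] (# 0 ⊕ # 1 ≤ⁿ # 2 ⊕ 1+ # 3 ∷ # 2 <ⁿ # 4 ∷ [] ⊢ # 0 ⊕ # 1 ≤ⁿ # 4 ⊕ # 3) (le , Rows.D-> (s≤s z≤n) (coreBeads c') i))))) (sym (core-rows c' i)))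

part-trim : ∀ xs i → part (trim xs) i ≡ part xs i
part-trim [] i = refl
part-trim (x ∷ xs) i with trim xs | part-trim xs
part-trim (zero ∷ xs) zero | [] | h = refl
part-trim (zero ∷ xs) (suc i) | [] | h = h i
part-trim (suc x ∷ xs) zero | [] | h = refl
part-trim (suc x ∷ xs) (suc i) | [] | h = h i
part-trim (zero ∷ xs) zero | y ∷ ys | h = refl
part-trim (zero ∷ xs) (suc i) | y ∷ ys | h = h i
part-trim (suc x ∷ xs) zero | y ∷ ys | h = refl
part-trim (suc x ∷ xs) (suc i) | y ∷ ys | h = h i

trim-zero : ∀ xs → (∀ i → part xs i ≡ 0) → trim xs ≡ []
trim-zero [] h = refl
trim-zero (x ∷ xs) h with trim xs | trim-zero xs (h ∘ suc) | x | h 0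
... | .[] | refl | .0 | refl = refl

trim-ext : ∀ xs ys → (∀ i → part xs i ≡ part ys i) → trim xs ≡ trim ys
trim-ext [] ys h = sym (trim-zero ys (λ i → sym (h i)))
trim-ext (x ∷ xs) [] h = trim-zero (x ∷ xs) h
trim-ext (x ∷ xs) (y ∷ ys) h with trim xs | trim-ext xs ys (h ∘ suc) | x | h 0
... | .(trim ys) | refl | .y | refl = refl

trim⇒part : ∀ {xs ys} → trim xs ≡ trim ys → ∀ i → part xs i ≡ part ys i
trim⇒part {xs} {ys} e i = ≡.trans (sym (part-trim xs i)) (≡.trans (cong (λ zs → part zs i) e) (part-trim ys i))

-- Connected components of a skew shape

module Components (τ κ : List ℕ) (τ-dec : Decreasing (part τ)) (κ-dec : Decreasing (part κ)) where

  -- The columns shared by rows `r` and `r + 1` of κ/τ are those from τ_r up to κ_(r+1) - 1, so this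
  -- says that the two rows touch.
  Link : ℕ → Set
  Link r = part τ r < part κ (suc r)

  -- A path changes rows only by vertical steps, and both boxes of such a step lie in a common
  -- column of the two rows.
  conn-links : ∀ {i j i' j'} → Conn τ κ (i , j) (i' , j') → ∀ r → (i ≤ r × r < i') ⊎ (i' ≤ r × r < i) → Link r
  conn-links ε r (inj₁ (a , c)) = ⊥-elim (ℕP.<⇒≱ c a)
  conn-links ε r (inj₂ (a , c)) = ⊥-elim (ℕP.<⇒≱ c a)
  conn-links ((_ , _ , inj₁ (refl , _)) ◅ rest) r h = conn-links rest r h
  conn-links {i} (((p , _) , (_ , q) , inj₂ (refl , inj₁ refl)) ◅ rest) r (inj₁ (a , c)) with i ≟ r
  ... | yes refl = ℕP.≤-<-trans p q
  ... | no ne = conn-links rest r (inj₁ (ℕP.≤∧≢⇒< a ne , c))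
  conn-links ((_ , _ , inj₂ (refl , inj₁ refl)) ◅ rest) r (inj₂ (a , c)) = conn-links rest r (inj₂ (a , ℕP.m<n⇒m<1+n c))
  conn-links ((_ , _ , inj₂ (refl , inj₂ refl)) ◅ rest) r (inj₁ (a , c)) = conn-links rest r (inj₁ (ℕP.<⇒≤ a , c))
  conn-links {suc i} (((_ , q) , (p , _) , inj₂ (refl , inj₂ refl)) ◅ rest) r (inj₂ (a , c)) with i ≟ r
  ... | yes refl = ℕP.≤-<-trans p q
  ... | no ne = conn-links rest r (inj₂ (a , ℕP.≤∧≢⇒< (ℕP.≤-pred c) (ne ∘ sym)))

  go-left : ∀ i j k → part τ i ≤ j → j ℕ.+ k < part κ i → Conn τ κ (i , j ℕ.+ k) (i , j)
  go-left i j zero p q rewrite ℕP.+-identityʳ j = ε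
  go-left i j (suc k) p q rewrite ℕP.+-suc j k =
    ((ℕP.≤-trans p (ℕP.≤-trans (ℕP.m≤m+n j k) (ℕP.n≤1+n _)) , q) , (ℕP.≤-trans p (ℕP.m≤m+n j k) , ℕP.<⇒≤ q) , inj₁ (refl , inj₂ refl))
      ◅ go-left i j k p (ℕP.<⇒≤ q)

  go-right : ∀ i j k → part τ i ≤ j → j ℕ.+ k < part κ i → Conn τ κ (i , j) (i , j ℕ.+ k)
  go-right i j zero p q rewrite ℕP.+-identityʳ j = ε
  go-right i j (suc k) p q rewrite ℕP.+-suc j k =
    ((p , ℕP.≤-<-trans (ℕP.≤-trans (ℕP.m≤m+n j k) (ℕP.n≤1+n _)) q) , (ℕP.m≤n⇒m≤1+n p , ℕP.≤-<-trans (s≤s (ℕP.m≤m+n j k)) q) , inj₁ (refl , inj₁ refl))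
      ◅ go-right i (suc j) k (ℕP.m≤n⇒m≤1+n p) q

  to-first : ∀ {i j} → Skew τ κ (i , j) → Conn τ κ (i , j) (i , part τ i)
  to-first {i} {j} (p , q) = subst (λ j → Conn τ κ (i , j) (i , part τ i)) (ℕP.m+[n∸m]≡n p)
    (go-left i (part τ i) (j ∸ part τ i) ℕP.≤-refl (subst (_< part κ i) (sym (ℕP.m+[n∸m]≡n p)) q))

  from-first : ∀ {i j} → Skew τ κ (i , j) → Conn τ κ (i , part τ i) (i , j)
  from-first {i} {j} (p , q) = subst (λ j → Conn τ κ (i , part τ i) (i , j)) (ℕP.m+[n∸m]≡n p)
    (go-right i (part τ i) (j ∸ part τ i) ℕP.≤-refl (subst (_< part κ i) (sym (ℕP.m+[n∸m]≡n p)) q))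

  link-skew : ∀ {r} → Link r → Skew τ κ (suc r , part τ r)
  link-skew {r} l = τ-dec r , l

  link-skew' : ∀ {r} → Link r → Skew τ κ (r , part τ r)
  link-skew' {r} l = ℕP.≤-refl , ℕP.<-≤-trans l (κ-dec r)

  climb : ∀ {r} → Link r → Conn τ κ (suc r , part τ (suc r)) (r , part τ r)
  climb {r} l = from-first (link-skew l) ◅◅ ((link-skew l , link-skew' l , inj₂ (refl , inj₂ refl)) ◅ ε)

  descend : ∀ {r} → Link r → Conn τ κ (r , part τ r) (suc r , part τ (suc r))
  descend {r} l = (link-skew' l , link-skew l , inj₂ (refl , inj₁ refl)) ◅ to-first (link-skew l)

  Head : ℕ → Set
  Head i = part τ i < part κ i × (∀ r → i ≡ suc r → ¬ Link r)

  -- The least box of a component lies at the left end of its row, and a link to the row above would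
  -- lead to a smaller box.
  rep⇒ : ∀ {i j} → Rep τ κ (i , j) → j ≡ part τ i × Head i
  rep⇒ {i} {j} ((p , q) , least) = j≡ , ℕP.≤-<-trans p q , no-link
    where
    j≡ : j ≡ part τ i
    j≡ with least (i , part τ i) (ℕP.≤-refl , ℕP.≤-<-trans p q) (from-first (p , q))
    ... | inj₁ lt = ⊥-elim (ℕP.<-irrefl refl lt)
    ... | inj₂ (_ , le) = ℕP.≤-antisym le p
    no-link : ∀ r → i ≡ suc r → ¬ Link r
    no-link r refl l with least (r , part τ r) (link-skew' l) (descend l ◅◅ from-first (p , q))
    ... | inj₁ lt = ℕP.<⇒≱ lt (ℕP.n≤1+n r)
    ... | inj₂ (e , _) = ℕP.1+n≢n e

  rep⇐ : ∀ {i} → Head i → Rep τ κ (i , part τ i)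
  rep⇐ {i} (ne , top) = (ℕP.≤-refl , ne) , least
    where
    least : ∀ a → Skew τ κ a → Conn τ κ a (i , part τ i) → (i , part τ i) ≤lex a
    least (i' , j') (p , q) c with ℕP.<-cmp i i'
    ... | Relation.Binary.Definitions.tri< lt _ _ = inj₁ lt
    ... | Relation.Binary.Definitions.tri≈ _ refl _ = inj₂ (refl , p)
    least (i' , j') (p , q) c | Relation.Binary.Definitions.tri> _ _ (s≤s {n = r} gt) = ⊥-elim (top r refl (conn-links c r (inj₁ (gt , ℕP.≤-refl))))

  rows⇒ : ∀ {i i'} → Head i → RowsOf τ κ (i , part τ i) i' → i ≤ i' × (∀ r → i ≤ r → r < i' → Link r)
  rows⇒ {i} {i'} (ne , top) (j , s , c) = le , λ r a lt → conn-links c r (inj₂ (a , lt))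
    where
    le : i ≤ i'
    le with i ≤? i'
    ... | yes p = p
    ... | no p with ℕP.≰⇒> p
    ...   | s≤s {n = r} gt = ⊥-elim (top r refl (conn-links c r (inj₁ (gt , ℕP.≤-refl))))

  rows⇐ : ∀ {i} → Head i → ∀ k → (∀ r → i ≤ r → r < i ℕ.+ k → Link r) → RowsOf τ κ (i , part τ i) (i ℕ.+ k)
  rows⇐ {i} hd zero h rewrite ℕP.+-identityʳ i = part τ i , (ℕP.≤-refl , proj₁ hd) , ε
  rows⇐ {i} hd (suc k) h with rows⇐ hd k (λ r a c → h r a (subst (r <_) (sym (ℕP.+-suc i k)) (ℕP.m<n⇒m<1+n c)))
  ... | j , s , c rewrite ℕP.+-suc i k = part τ (suc (i ℕ.+ k)) , (ℕP.≤-refl , ℕP.≤-<-trans (τ-dec (i ℕ.+ k)) l) , climb l ◅◅ from-first s ◅◅ c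
    where l = h (i ℕ.+ k) (ℕP.m≤m+n i k) ℕP.≤-refl

-- Strong covers as exchanges of beads

module Between {n : ℕ} (1≤n : 1 ≤ n) (κ τ : Beads n) (τ⊆κ : ∀ i → Beads.b τ i ℤ.≤ Beads.b κ i) where
  open Rows 1≤n κ
  module T = Rows 1≤n τ
  open Decide 1≤n κ using (width)

  -- κ/τ has a box of content v
  Pos : ℤ → Set
  Pos v = ∃ λ i → T.b i ℤ.< v × v ℤ.≤ b i

  M : ℕ
  M = L ℕ.+ T.L

  pos-index : ∀ {v} → (p : Pos v) → proj₁ p < M
  pos-index (i , lo , hi) with i <? M
  ... | yes h = h
  ... | no h = ⊥-elim (linear (i ∷ []) (_ ∷ _ ∷ _ ∷ []) (# 0 <ᶻ # 1 ∷ # 1 ≤ᶻ # 2 ∷ # 2 ≈ᶻ ⊝ ↑ # 0 ∷ # 0 ≈ᶻ ⊝ ↑ # 0 ∷ [] ⊢ absurd) (lo , hi , b-end i (linear (_ ∷ T.L ∷ _ ∷ []) [] (# 0 ⊕ # 1 ≤ⁿ # 2 ∷ [] ⊢ # 0 ≤ⁿ # 2) (ℕP.≮⇒≥ h)) , T.b-end i (linear (L ∷ _ ∷ _ ∷ []) [] (# 0 ⊕ # 1 ≤ⁿ # 2 ∷ [] ⊢ # 1 ≤ⁿ # 2) (ℕP.≮⇒≥ h))))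

  pos-low : ∀ {v} → Pos v → ℤ.- + M ℤ.< v
  pos-low p@(i , lo , hi) = linear (_ ∷ L ∷ T.L ∷ []) (_ ∷ _ ∷ []) (# 0 <ⁿ # 1 ⊕ # 2 ∷ # 0 <ᶻ # 1 ∷ ⊝ ↑ # 0 ≤ᶻ # 0 ∷ [] ⊢ ⊝ ↑ (# 1 ⊕ # 2) <ᶻ # 1) (pos-index p , lo , T.b-≥ i)

  opaque
    pos? : ∀ v → Dec (Pos v)
    pos? v with ℕP.anyUpTo? (λ i → at? i) M
      where
      at? : ∀ i → Dec (T.b i ℤ.< v × v ℤ.≤ b i)
      at? i with T.b i ℤ.<? v | v ℤ.≤? b i
      ... | yes p | yes q = yes (p , q)
      ... | no p | _ = no (p ∘ proj₁)
      ... | yes _ | no q = no (q ∘ proj₂)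
    ... | yes (i , _ , p) = yes (i , p)
    ... | no none = no (λ p → none (proj₁ p , pos-index p , proj₂ p))

  -- Occupied values come in runs. The upper end of a run is a bead of κ that τ lacks; dually, the
  -- value just below a run is a bead of τ that κ lacks.
  pos-end : ∀ {v} → Pos v → ¬ Pos (v ℤ.+ 1ℤ) → mem v × ¬ T.mem v
  pos-end {v} (i , lo , hi) np = (i , bi) , λ { (j , e) → np (j , linear [] (_ ∷ _ ∷ []) (# 0 ≈ᶻ # 1 ∷ [] ⊢ # 0 <ᶻ # 1 ⊕ lit 1ℤ) e , linear [] (_ ∷ _ ∷ _ ∷ []) (# 0 ≈ᶻ # 1 ∷ # 0 <ᶻ # 2 ∷ # 0 <ᶻ # 2 ∷ [] ⊢ # 1 ⊕ lit 1ℤ ≤ᶻ # 2) (bi , mono< (T.cmp< {j} {i} (linear [] (_ ∷ _ ∷ _ ∷ []) (# 0 ≈ᶻ # 1 ∷ # 2 <ᶻ # 1 ∷ [] ⊢ # 2 <ᶻ # 0) (e , lo))) , TI j i e lo)) }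
    where
    bi : b i ≡ v
    bi with b i ℤ.≟ v
    ... | yes e = e
    ... | no ne = ⊥-elim (np (i , linear [] (_ ∷ _ ∷ []) (# 0 <ᶻ # 1 ∷ [] ⊢ # 0 <ᶻ # 1 ⊕ ↑ lit 1) lo , lem (ℤP.≤∧≢⇒< hi (λ e → ne (sym e)))))
      where lem : v ℤ.< b i → v ℤ.+ 1ℤ ℤ.≤ b i
            lem h = linear [] (_ ∷ _ ∷ []) (# 0 <ᶻ # 1 ∷ [] ⊢ # 0 ⊕ lit 1ℤ ≤ᶻ # 1) h
    TI : ∀ j i → T.b j ≡ v → T.b i ℤ.< v → b i ℤ.< b j
    TI j i e lo = mono< (ℕP.≰⇒> (λ le → ℤP.<⇒≱ lo (subst (ℤ._≤ T.b i) e (T.mono≤ le))))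

  pos-start : ∀ {v} → Pos (v ℤ.+ 1ℤ) → ¬ Pos v → T.mem v × ¬ mem v
  pos-start {v} (i , lo , hi) np = (i , ti) , λ { (j , e) → np (j , lem j (ℕP.≰⇒> (λ le → ℤP.<⇒≱ (lem₂ hi) (subst (b i ℤ.≤_) e (mono≤ le)))) , ℤP.≤-reflexive (sym e)) }
    where
    ti : T.b i ≡ v
    ti with T.b i ℤ.≟ v
    ... | yes e = e
    ... | no ne = ⊥-elim (np (i , ℤP.≤∧≢⇒< (lem₁ lo) ne , linear [] (_ ∷ _ ∷ []) (# 0 ⊕ ↑ lit 1 ≤ᶻ # 1 ∷ [] ⊢ # 0 ≤ᶻ # 1) hi))
      where lem₁ : T.b i ℤ.< v ℤ.+ 1ℤ → T.b i ℤ.≤ v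
            lem₁ h = linear [] (_ ∷ _ ∷ []) (# 0 <ᶻ # 1 ⊕ lit 1ℤ ∷ [] ⊢ # 0 ≤ᶻ # 1) h
    lem₂ : v ℤ.+ 1ℤ ℤ.≤ b i → v ℤ.< b i
    lem₂ h = linear [] (_ ∷ _ ∷ []) (# 0 ⊕ lit 1ℤ ≤ᶻ # 1 ∷ [] ⊢ # 0 <ᶻ # 1) h
    lem : ∀ j → i < j → T.b j ℤ.< v
    lem j h = subst (T.b j ℤ.<_) ti (T.mono< h)

  pos-at : ∀ {v} → mem v → ¬ T.mem v → Pos v
  pos-at (i , e) no' = i , ℤP.≤∧≢⇒< (subst (T.b i ℤ.≤_) e (τ⊆κ i)) (λ q → no' (i , q)) , ℤP.≤-reflexive (sym e)

  pos-after : ∀ {v} → T.mem v → ¬ mem v → Pos (v ℤ.+ 1ℤ)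
  pos-after {v} (i , e) no' = i , linear [] (_ ∷ _ ∷ []) (# 0 ≈ᶻ # 1 ∷ [] ⊢ # 0 <ᶻ # 1 ⊕ lit 1ℤ) e , lem (ℤP.≤∧≢⇒< (subst (ℤ._≤ b i) e (τ⊆κ i)) (λ q → no' (i , sym q)))
    where lem : v ℤ.< b i → v ℤ.+ 1ℤ ℤ.≤ b i
          lem h = linear [] (_ ∷ _ ∷ []) (# 0 <ᶻ # 1 ∷ [] ⊢ # 0 ⊕ lit 1ℤ ≤ᶻ # 1) h

  PosOn : ℤ → ℤ → Set
  PosOn u v = ∀ w → u ℤ.< w → w ℤ.≤ v → Pos w

  extend-low : ∀ {u v} → PosOn (u ℤ.+ 1ℤ) v → Pos (u ℤ.+ 1ℤ) → PosOn u v
  extend-low {u} {v} P q w a c = at (w ℤ.≟ u ℤ.+ 1ℤ)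
    where
    at : Dec (w ≡ u ℤ.+ 1ℤ) → Pos w
    at (yes e) = subst Pos (sym e) q
    at (no ne) = P w (ℤP.≤∧≢⇒< (lem a) (λ e → ne (sym e))) c
      where lem : u ℤ.< w → u ℤ.+ 1ℤ ℤ.≤ w
            lem h = linear [] (_ ∷ _ ∷ []) (# 0 <ᶻ # 1 ∷ [] ⊢ # 0 ⊕ lit 1ℤ ≤ᶻ # 1) h

  extend-high : ∀ {u v} → PosOn u v → Pos (v ℤ.+ 1ℤ) → PosOn u (v ℤ.+ 1ℤ)
  extend-high {u} {v} P q w a c = at (w ℤ.≟ v ℤ.+ 1ℤ)
    where
    at : Dec (w ≡ v ℤ.+ 1ℤ) → Pos w
    at (yes e) = subst Pos (sym e) q
    at (no ne) = P w a (lem (ℤP.≤∧≢⇒< c ne))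
      where lem : w ℤ.< v ℤ.+ 1ℤ → w ℤ.≤ v
            lem h = linear [] (_ ∷ _ ∷ []) (# 0 <ᶻ # 1 ⊕ lit 1ℤ ∷ [] ⊢ # 0 ≤ᶻ # 1) h

  -- Either the interval from u to v is completely occupied, or the run is followed from one end
  -- until it first breaks off: from v downwards in `Down`, from u upwards in `Up`.
  Down Up : ℤ → ℤ → Set
  Down u v = PosOn u v ⊎ (∃ λ x → u ℤ.< x × x ℤ.< v × ¬ Pos x × PosOn x v)
  Up u v = PosOn u v ⊎ (∃ λ y → u ℤ.< y × y ℤ.< v × ¬ Pos (y ℤ.+ 1ℤ) × PosOn u y)

  run-down : ∀ g {u v} → v ≡ u ℤ.+ 1ℤ ℤ.+ + g → Pos v → Down u v
  run-down zero {u} {v} e p = inj₁ (λ w a c → subst Pos (lem w a c) p)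
    where lem : ∀ w → u ℤ.< w → w ℤ.≤ v → v ≡ w
          lem w a c = linear [] (_ ∷ _ ∷ _ ∷ []) (# 0 ≈ᶻ # 1 ⊕ lit 1ℤ ⊕ ↑ lit 0 ∷ # 1 <ᶻ # 2 ∷ # 2 ≤ᶻ # 0 ∷ [] ⊢ # 0 ≈ᶻ # 2) (e , a , c)
  run-down (suc g) {u} {v} e p = go (run-down g {u ℤ.+ 1ℤ} {v} (linear (g ∷ []) (_ ∷ u ∷ []) (# 0 ≈ᶻ # 1 ⊕ lit 1ℤ ⊕ ↑ 1+ # 0 ∷ [] ⊢ # 0 ≈ᶻ # 1 ⊕ lit 1ℤ ⊕ lit 1ℤ ⊕ ↑ # 0) e) p) (pos? (u ℤ.+ 1ℤ))
    where
    go : Down (u ℤ.+ 1ℤ) v → Dec (Pos (u ℤ.+ 1ℤ)) → Down u v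
    go (inj₂ (x , a , c , d , f)) _ = inj₂ (x , linear [] (_ ∷ _ ∷ []) (# 0 ⊕ lit 1ℤ <ᶻ # 1 ∷ [] ⊢ # 0 <ᶻ # 1) a , c , d , f)
    go (inj₁ P) (yes q) = inj₁ (extend-low P q)
    go (inj₁ P) (no q) = inj₂ (u ℤ.+ 1ℤ , linear [] (_ ∷ []) ([] ⊢ # 0 <ᶻ # 0 ⊕ lit 1ℤ) tt , linear (g ∷ []) (_ ∷ u ∷ []) (# 0 ≈ᶻ # 1 ⊕ lit 1ℤ ⊕ ↑ 1+ # 0 ∷ [] ⊢ # 1 ⊕ lit 1ℤ <ᶻ # 0) e , q , P)

  run-up : ∀ g {u v} → v ≡ u ℤ.+ 1ℤ ℤ.+ + g → Pos (u ℤ.+ 1ℤ) → Up u v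
  run-up zero {u} {v} e p = inj₁ (λ w a c → subst Pos (lem w a c) p)
    where lem : ∀ w → u ℤ.< w → w ℤ.≤ v → u ℤ.+ 1ℤ ≡ w
          lem w a c = linear [] (_ ∷ _ ∷ _ ∷ []) (# 0 ≈ᶻ # 1 ⊕ lit 1ℤ ⊕ ↑ lit 0 ∷ # 1 <ᶻ # 2 ∷ # 2 ≤ᶻ # 0 ∷ [] ⊢ # 1 ⊕ lit 1ℤ ≈ᶻ # 2) (e , a , c)
  run-up (suc g) {u} {v} e p = go (run-up g {u} {v'} refl p) (pos? (v' ℤ.+ 1ℤ))
    where
    v' = u ℤ.+ 1ℤ ℤ.+ + g
    go : Up u v' → Dec (Pos (v' ℤ.+ 1ℤ)) → Up u v
    go (inj₂ (x , a , c , d , f)) _ = inj₂ (x , a , linear (g ∷ []) (_ ∷ u ∷ _ ∷ []) (# 0 <ᶻ # 1 ⊕ lit 1ℤ ⊕ ↑ # 0 ∷ # 2 ≈ᶻ # 1 ⊕ lit 1ℤ ⊕ ↑ 1+ # 0 ∷ [] ⊢ # 0 <ᶻ # 2) (c , e) , d , f)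
    go (inj₁ P) (yes q) = inj₁ (subst (PosOn u) {v' ℤ.+ 1ℤ} {v} (linear (g ∷ []) (_ ∷ u ∷ []) (# 0 ≈ᶻ # 1 ⊕ lit 1ℤ ⊕ ↑ 1+ # 0 ∷ [] ⊢ # 1 ⊕ lit 1ℤ ⊕ ↑ # 0 ⊕ lit 1ℤ ≈ᶻ # 0) e) (extend-high P q))
    go (inj₁ P) (no q) = inj₂ (v' , linear (g ∷ []) (_ ∷ []) ([] ⊢ # 0 <ᶻ # 0 ⊕ lit 1ℤ ⊕ ↑ # 0) tt , linear (g ∷ []) (_ ∷ u ∷ []) (# 0 ≈ᶻ # 1 ⊕ lit 1ℤ ⊕ ↑ 1+ # 0 ∷ [] ⊢ # 1 ⊕ lit 1ℤ ⊕ ↑ # 0 <ᶻ # 0) e , q , P)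

  -- An exchange in the making: each end is either already blocked in κ or a point where κ and τ differ.
  record Quasi (x y : ℤ) (J : ℕ) : Set where
    field
      x<y : x ℤ.< y
      x∉ : ¬ mem x
      low : T.mem x ⊎ mem (x ℤ.- + n)
      top∈ : mem (y ⇧[ n ] J)
      up : ¬ T.mem y ⊎ ¬ mem (y ⇧[ n ] suc J)
      pos : ∀ j → j ≤ J → PosOn (x ⇧[ n ] j) (y ⇧[ n ] j)

  Goal : Set
  Goal = ∃ λ x → ∃ λ y → ∃ λ J → Exchange x y J × (∀ j → j ≤ J → PosOn (x ⇧[ n ] j) (y ⇧[ n ] j))

  on-0 : ∀ {x y} → PosOn x y → ∀ j → j ≤ 0 → PosOn (x ⇧[ n ] j) (y ⇧[ n ] j)
  on-0 P zero h w a c = P w (linear [] (_ ∷ _ ∷ []) (# 0 ⊕ ↑ lit 0 <ᶻ # 1 ∷ [] ⊢ # 0 <ᶻ # 1) a) (linear [] (_ ∷ _ ∷ []) (# 0 ≤ᶻ # 1 ⊕ ↑ lit 0 ∷ [] ⊢ # 0 ≤ᶻ # 1) c)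

  at-0 : ∀ {v} → mem v → mem (v ⇧[ n ] 0)
  at-0 {v} = mem-≡ (sym (ℤP.+-identityʳ v))

  up-bound : ∀ y J k → mem (y ⇧[ n ] J) → b 0 ℤ.- y ℤ.< + (J ℕ.+ k) → 1 ≤ k
  up-bound y J zero (i , e) h = ⊥-elim (linear (_ ∷ _ ∷ _ ∷ []) (_ ∷ y ∷ _ ∷ []) (# 0 ≈ᶻ # 1 ⊕ ↑ # 0 ∷ # 0 ≤ᶻ # 2 ∷ # 2 ⊖ # 1 <ᶻ ↑ (# 1 ⊕ lit 0) ∷ # 2 ≤ⁿ # 0 ∷ # 2 ≈ⁿ # 1 ∷ [] ⊢ absurd) (e , mono≤ {0} {i} z≤n , h , ℕP.*-monoʳ-≤ J 1≤n , ℕP.*-identityʳ J))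
  up-bound y J (suc k) _ _ = s≤s z≤n

  abs-bound : ∀ a → a ℤ.< + suc ℤ.∣ a ∣
  abs-bound (+ m) = linear (_ ∷ []) [] ([] ⊢ ↑ # 0 <ᶻ ↑ 1+ # 0) tt
  abs-bound -[1+ m ] = linear (_ ∷ []) [] ([] ⊢ ⊝ ↑ 1+ # 0 <ᶻ ↑ 1+ 1+ # 0) tt

  -- Induction on the width y - x. Every repair of a `Quasi` that is not yet an exchange either
  -- keeps the width and adds a level above or below, which can happen only finitely often, or makes
  -- the interval strictly narrower.
  Search : ℕ → Set
  Search w = ∀ {x y J} → Quasi x y J → y ℤ.≤ x ℤ.+ + w → Goal

  first-gap : ∀ v → mem (v ℤ.- + n) → ∀ k → ¬ mem (v ⇧[ n ] k) → ∃ λ i → i ≤ k × ¬ mem (v ⇧[ n ] i) × mem (v ⇧[ n ] i ℤ.- + n)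
  first-gap v m zero u = 0 , z≤n , u , mem-≡ (cong (λ x → x ℤ.- + n) (sym (ℤP.+-identityʳ v))) m
  first-gap v m (suc k) u with mem? (v ⇧[ n ] k)
  ... | yes m' = suc k , ℕP.≤-refl , u , mem-≡ (lem v (+ (k ℕ.* n)) (+ n)) m'
    where lem : ∀ v x m → v ℤ.+ x ≡ v ℤ.+ (m ℤ.+ x) ℤ.- m
          lem = solve-∀
  ... | no u' with first-gap v m k u'
  ...   | i , h , r = i , ℕP.m≤n⇒m≤1+n h , r

  ⇧-+ : ∀ v i j → (v ⇧[ n ] i) ⇧[ n ] j ≡ v ⇧[ n ] (i ℕ.+ j)
  ⇧-+ v i j = linear (_ ∷ i ℕ.* n ∷ j ℕ.* n ∷ []) (v ∷ []) (# 0 ≈ⁿ # 1 ⊕ # 2 ∷ [] ⊢ # 0 ⊕ ↑ # 1 ⊕ ↑ # 2 ≈ᶻ # 0 ⊕ ↑ # 0) (ℕP.*-distribʳ-+ n i j)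

  -- The runner of w stops at some level i with 0 ≤ i ≤ J + 1. If i ≤ J, the hole w + in replaces x
  -- and only the levels from i on are kept. If i = J + 1, the bead w + Jn is the top of its runner
  -- and w replaces y.
  violated : ∀ {w₀ x y J} → Search w₀ → y ℤ.≤ x ℤ.+ + suc w₀ → (Q : Quasi x y J) → mem (x ℤ.- + n) → ¬ mem (y ⇧[ n ] suc J) →
    ∀ w → x ℤ.< w → w ℤ.< y → mem (w ℤ.- + n) → ¬ mem (w ⇧[ n ] suc J) → Goal
  violated {w₀} {x} {y} {J} go h Q x-n∈ top∉ w x<w w<y w-n∈ w∉ with first-gap w w-n∈ (suc J) w∉
  ... | i , i≤ , u , m with i ≤? J
  ...   | yes i≤J = go {w ⇧[ n ] i} {y ⇧[ n ] i} {J ∸ i} (record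
      { x<y = linear (i ℕ.* n ∷ []) (_ ∷ _ ∷ []) (# 0 <ᶻ # 1 ∷ [] ⊢ # 0 ⊕ ↑ # 0 <ᶻ # 1 ⊕ ↑ # 0) w<y ; x∉ = u ; low = inj₂ m ; top∈ = mem-≡ (sym (shift (J ∸ i) (ℕP.m+[n∸m]≡n i≤J))) top∈
      ; up = inj₂ (λ k → top∉ (mem-≡ (shift (suc (J ∸ i)) (≡.trans (ℕP.+-suc i (J ∸ i)) (cong suc (ℕP.m+[n∸m]≡n i≤J)))) k))
      ; pos = λ j j≤ v a c → pos (i ℕ.+ j) (ℕP.≤-trans (ℕP.+-monoʳ-≤ i j≤) (ℕP.≤-reflexive (ℕP.m+[n∸m]≡n i≤J))) v
          (linear (i ℕ.* n ∷ j ℕ.* n ∷ _ ∷ []) (_ ∷ _ ∷ _ ∷ []) (# 0 ⊕ ↑ # 0 ⊕ ↑ # 1 <ᶻ # 1 ∷ # 2 <ᶻ # 0 ∷ # 2 ≈ⁿ # 0 ⊕ # 1 ∷ [] ⊢ # 2 ⊕ ↑ # 2 <ᶻ # 1) (a , x<w , ℕP.*-distribʳ-+ n i j)) (linear (i ℕ.* n ∷ j ℕ.* n ∷ _ ∷ []) (_ ∷ y ∷ []) (# 0 ≤ᶻ # 1 ⊕ ↑ # 0 ⊕ ↑ # 1 ∷ # 2 ≈ⁿ # 0 ⊕ # 1 ∷ [] ⊢ # 0 ≤ᶻ # 1 ⊕ ↑ # 2) (c , ℕP.*-distribʳ-+ n i j)) }) (linear (w₀ ∷ i ℕ.* n ∷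 []) (_ ∷ _ ∷ _ ∷ []) (# 0 ≤ᶻ # 1 ⊕ ↑ 1+ # 0 ∷ # 1 <ᶻ # 2 ∷ [] ⊢ # 0 ⊕ ↑ # 1 ≤ᶻ # 2 ⊕ ↑ # 1 ⊕ ↑ # 0) (h , x<w))
    where
    open Quasi Q
    shift : ∀ j {m} → i ℕ.+ j ≡ m → (y ⇧[ n ] i) ⇧[ n ] j ≡ y ⇧[ n ] m
    shift j refl = ⇧-+ y i j
  ...   | no i≰J = go {x} {w} {J} (record { x<y = x<w ; x∉ = x∉ ; low = inj₂ x-n∈ ; top∈ = at-J ; up = inj₂ w∉
      ; pos = λ j j≤ v a c → pos j j≤ v a (linear (j ℕ.* n ∷ []) (_ ∷ _ ∷ _ ∷ []) (# 0 ≤ᶻ # 1 ⊕ ↑ # 0 ∷ # 1 <ᶻ # 2 ∷ [] ⊢ # 0 ≤ᶻ # 2 ⊕ ↑ # 0) (c , w<y)) }) (linear (w₀ ∷ []) (_ ∷ x ∷ _ ∷ []) (# 0 ≤ᶻ # 1 ⊕ ↑ 1+ # 0 ∷ # 2 <ᶻ # 0 ∷ [] ⊢ # 2 ≤ᶻ # 1 ⊕ ↑ # 0) (h , w<y))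
    where
    open Quasi Q
    at-J : mem (w ⇧[ n ] J)
    at-J = mem-≡ (≡.trans (cong (λ k → w ⇧[ n ] k ℤ.- + n) (ℕP.≤-antisym i≤ (ℕP.≰⇒> i≰J))) (lem w (+ (J ℕ.* n)) (+ n))) m
      where lem : ∀ v x m → v ℤ.+ (m ℤ.+ x) ℤ.- m ≡ v ℤ.+ x
            lem = solve-∀

  module Final {w₀ : ℕ} {x y : ℤ} {J : ℕ} (go : Search w₀) (h : y ℤ.≤ x ℤ.+ + suc w₀) (Q : Quasi x y J)
    (x-n∈ : mem (x ℤ.- + n)) (top∉ : ¬ mem (y ⇧[ n ] suc J)) where
    open Quasi Q

    lem₁ : ∀ y m a → y ℤ.+ a ≡ y ℤ.- m ℤ.+ (m ℤ.+ a)
    lem₁ = solve-∀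

    -- Beads at least `n` apart: the bead y - n takes the place of y, with one more level to reach
    -- the same top.
    wide : x ℤ.+ + n ℤ.≤ y → Goal
    wide far = go {x} {y ℤ.- + n} {suc J} (record
      { x<y = ℤP.≤∧≢⇒< (linear (n ∷ []) (_ ∷ _ ∷ []) (# 0 ⊕ ↑ # 0 ≤ᶻ # 1 ∷ [] ⊢ # 0 ≤ᶻ # 1 ⊖ ↑ # 0) far) (λ e → x∉ (mem-≡ (sym e) (mem-pred (mem-base {y} J top∈))))
      ; x∉ = x∉ ; low = inj₂ x-n∈ ; top∈ = mem-≡ (lem₁ y (+ n) (+ (J ℕ.* n))) top∈
      ; up = inj₂ (λ m → top∉ (mem-≡ (sym (lem₁ y (+ n) (+ (suc J ℕ.* n)))) m)) ; pos = pos' }) (linear (w₀ ∷ _ ∷ []) (_ ∷ x ∷ []) (# 0 ≤ᶻ # 1 ⊕ ↑ 1+ # 0 ∷ lit 1 ≤ⁿ # 1 ∷ [] ⊢ # 0 ⊖ ↑ # 1 ≤ᶻ # 1 ⊕ ↑ # 0) (h , 1≤n))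
      where
      pos' : ∀ j → j ≤ suc J → PosOn (x ⇧[ n ] j) ((y ℤ.- + n) ⇧[ n ] j)
      pos' zero _ v a c = pos 0 z≤n v (linear (n ∷ []) (x ∷ _ ∷ []) (# 0 ⊕ ↑ lit 0 <ᶻ # 1 ∷ [] ⊢ # 0 ⊕ ↑ (0 ⊛ # 0) <ᶻ # 1) a) (linear (n ∷ []) (_ ∷ y ∷ []) (# 0 ≤ᶻ # 1 ⊕ ⊝ ↑ # 0 ⊕ ↑ lit 0 ∷ [] ⊢ # 0 ≤ᶻ # 1 ⊕ ↑ (0 ⊛ # 0)) c)
      pos' (suc j) h v a c = pos j (ℕP.≤-pred h) v (linear (n ∷ j ℕ.* n ∷ []) (x ∷ _ ∷ []) (# 0 ⊕ ↑ (# 0 ⊕ # 1) <ᶻ # 1 ∷ [] ⊢ # 0 ⊕ ↑ # 1 <ᶻ # 1) a) (linear (n ∷ j ℕ.* n ∷ []) (_ ∷ y ∷ []) (# 0 ≤ᶻ # 1 ⊕ ⊝ ↑ # 0 ⊕ ↑ (# 0 ⊕ # 1) ∷ [] ⊢ # 0 ≤ᶻ # 1 ⊕ ↑ # 1) c)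

    bad? : ∀ w → Dec (mem (w ℤ.- + n) × ¬ mem (w ⇧[ n ] suc J))
    bad? w with mem? (w ℤ.- + n) | mem? (w ⇧[ n ] suc J)
    ... | yes p | no q = yes (p , q)
    ... | no p | _ = no (p ∘ proj₁)
    ... | _ | yes q = no (λ k → proj₂ k q)

    narrow : y ℤ.< x ℤ.+ + n → (∃ λ g → y ≡ x ℤ.+ 1ℤ ℤ.+ + g) → Goal
    narrow near (g , e) = choose (ℕP.anyUpTo? (λ i → bad? (x ℤ.+ 1ℤ ℤ.+ + i)) g)
      where
      choose : Dec (∃ λ i → i < g × mem (x ℤ.+ 1ℤ ℤ.+ + i ℤ.- + n) × ¬ mem ((x ℤ.+ 1ℤ ℤ.+ + i) ⇧[ n ] suc J)) → Goal
      choose (yes (i , i<g , p , q)) = violated go h Q x-n∈ top∉ (x ℤ.+ 1ℤ ℤ.+ + i) (linear (i ∷ []) (_ ∷ []) ([] ⊢ # 0 <ᶻ # 0 ⊕ lit 1ℤ ⊕ ↑ # 0) tt) (linear (_ ∷ _ ∷ []) (_ ∷ x ∷ []) (# 0 ≈ᶻ # 1 ⊕ lit 1ℤ ⊕ ↑ # 0 ∷ # 1 <ⁿ # 0 ∷ [] ⊢ # 1 ⊕ lit 1ℤ ⊕ ↑ # 1 <ᶻ # 0) (e , i<g)) p q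
      choose (no none) = x , y , J , record { x<y = x<y ; y<x+n = near ; x∉ = x∉ ; x-n∈ = x-n∈ ; top∈ = top∈ ; top∉ = top∉ ; gap = gap } , pos
        where
        gap : ∀ w → x ℤ.< w → w ℤ.< y → mem (w ℤ.- + n) → mem (w ⇧[ n ] suc J)
        gap w p q m = at (width p) (mem? (w ⇧[ n ] suc J))
          where
          at : (∃ λ i → w ≡ x ℤ.+ 1ℤ ℤ.+ + i) → Dec (mem (w ⇧[ n ] suc J)) → mem (w ⇧[ n ] suc J)
          at _ (yes r) = r
          at (i , e') (no r) = ⊥-elim (none (i , linear (_ ∷ _ ∷ []) (_ ∷ _ ∷ x ∷ []) (# 0 <ᶻ # 1 ∷ # 1 ≈ᶻ # 2 ⊕ lit 1ℤ ⊕ ↑ # 0 ∷ # 0 ≈ᶻ # 2 ⊕ lit 1ℤ ⊕ ↑ # 1 ∷ [] ⊢ # 1 <ⁿ # 0) (q , e , e') , mem-≡ (cong (λ v → v ℤ.- + n) e') m , (λ k → r (mem-≡ (cong (λ v → v ⇧[ n ] suc J) (sym e')) k))))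

    final : Goal
    final with y ℤ.<? x ℤ.+ + n
    ... | no far = wide (ℤP.≮⇒≥ far)
    ... | yes near = narrow near (width x<y)

  -- If x - n is not a bead of κ, then x is one of τ, hence so is x - n, and the two cores differ
  -- there as well. Following the run upwards from x - n either adds a level at the bottom or gives
  -- a narrower interval. The bound `d` decreases because κ/τ occupies nothing below -M.
  down : ∀ {w₀} → Search w₀ → ∀ d {x y J} → y ℤ.≤ x ℤ.+ + suc w₀ → x ℤ.+ + M ℤ.< + d → (Q : Quasi x y J) → ¬ mem (y ⇧[ n ] suc J) → Goal
  down {w₀} go d {x} {y} {J} h bd Q top∉ with mem? (x ℤ.- + n) | Quasi.low Q
  ... | yes m | _ = Final.final go h Q m top∉
  ... | no m | inj₂ m' = ⊥-elim (m m')
  ... | no m | inj₁ t = next d bd (width {x ℤ.- + n} {y ℤ.- + n} (linear (n ∷ []) (_ ∷ _ ∷ []) (# 0 <ᶻ # 1 ∷ [] ⊢ # 0 ⊖ ↑ # 0 <ᶻ # 1 ⊖ ↑ # 0) x<y))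
    where
    open Quasi Q
    p = pos-after (T.mem-pred t) m
    next : ∀ d → x ℤ.+ + M ℤ.< + d → (∃ λ g → y ℤ.- + n ≡ x ℤ.- + n ℤ.+ 1ℤ ℤ.+ + g) → Goal
    next zero bd _ = ⊥-elim (linear (L ∷ T.L ∷ _ ∷ []) (x ∷ []) (# 0 ⊕ ↑ (# 0 ⊕ # 1) <ᶻ ↑ lit 0 ∷ ⊝ ↑ (# 0 ⊕ # 1) <ᶻ # 0 ⊖ ↑ # 2 ⊕ lit 1ℤ ∷ lit 1 ≤ⁿ # 2 ∷ [] ⊢ absurd) (bd , pos-low p , 1≤n))
    next (suc d) bd (g , e) = branch (run-up g {x ℤ.- + n} {y ℤ.- + n} e p)
      where
      lem₁ : ∀ y m a → y ℤ.+ a ≡ y ℤ.- m ℤ.+ (m ℤ.+ a)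
      lem₁ = solve-∀
      up' : ¬ mem ((y ℤ.- + n) ⇧[ n ] suc (suc J))
      up' k = top∉ (mem-≡ (sym (lem₁ y (+ n) (+ (suc J ℕ.* n)))) k)
      pos' : PosOn (x ℤ.- + n) (y ℤ.- + n) → ∀ j → j ≤ suc J → PosOn ((x ℤ.- + n) ⇧[ n ] j) ((y ℤ.- + n) ⇧[ n ] j)
      pos' P zero _ v a c = P v (linear (n ∷ []) (x ∷ _ ∷ []) (# 0 ⊕ ⊝ ↑ # 0 ⊕ ↑ lit 0 <ᶻ # 1 ∷ [] ⊢ # 0 ⊖ ↑ # 0 <ᶻ # 1) a) (linear (n ∷ []) (_ ∷ y ∷ []) (# 0 ≤ᶻ # 1 ⊕ ⊝ ↑ # 0 ⊕ ↑ lit 0 ∷ [] ⊢ # 0 ≤ᶻ # 1 ⊖ ↑ # 0) c)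
      pos' P (suc j) h v a c = pos j (ℕP.≤-pred h) v (linear (n ∷ j ℕ.* n ∷ []) (x ∷ _ ∷ []) (# 0 ⊕ ⊝ ↑ # 0 ⊕ ↑ (# 0 ⊕ # 1) <ᶻ # 1 ∷ [] ⊢ # 0 ⊕ ↑ # 1 <ᶻ # 1) a) (linear (n ∷ j ℕ.* n ∷ []) (_ ∷ y ∷ []) (# 0 ≤ᶻ # 1 ⊕ ⊝ ↑ # 0 ⊕ ↑ (# 0 ⊕ # 1) ∷ [] ⊢ # 0 ≤ᶻ # 1 ⊕ ↑ # 1) c)
      branch : Up (x ℤ.- + n) (y ℤ.- + n) → Goal
      branch (inj₁ P) = down go d {x ℤ.- + n} {y ℤ.- + n} {suc J} (linear (w₀ ∷ n ∷ []) (_ ∷ x ∷ []) (# 0 ≤ᶻ # 1 ⊕ ↑ 1+ # 0 ∷ [] ⊢ # 0 ⊖ ↑ # 1 ≤ᶻ # 1 ⊖ ↑ # 1 ⊕ ↑ 1+ # 0) h) (linear (L ∷ T.L ∷ _ ∷ _ ∷ []) (x ∷ []) (# 0 ⊕ ↑ (# 0 ⊕ # 1) <ᶻ ↑ 1+ # 2 ∷ lit 1 ≤ⁿ # 3 ∷ [] ⊢ # 0 ⊖ ↑ # 3 ⊕ ↑ (# 0 ⊕ # 1) <ᶻ ↑ # 2) (bd , 1≤n)) (record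
        { x<y = linear (n ∷ []) (_ ∷ _ ∷ []) (# 0 <ᶻ # 1 ∷ [] ⊢ # 0 ⊖ ↑ # 0 <ᶻ # 1 ⊖ ↑ # 0) x<y ; x∉ = m ; low = inj₁ (T.mem-pred t) ; top∈ = mem-≡ (lem₁ y (+ n) (+ (J ℕ.* n))) top∈
        ; up = inj₂ up' ; pos = pos' P }) up'
      branch (inj₂ (y₁ , a , c , np , P)) = go {x ℤ.- + n} {y₁} {0} (record
        { x<y = a ; x∉ = m ; low = inj₁ (T.mem-pred t) ; top∈ = at-0 (proj₁ pe) ; up = inj₁ (proj₂ pe) ; pos = on-0 P }) (linear (w₀ ∷ n ∷ []) (_ ∷ x ∷ _ ∷ []) (# 0 ≤ᶻ # 1 ⊕ ↑ 1+ # 0 ∷ # 2 <ᶻ # 0 ⊖ ↑ # 1 ∷ [] ⊢ # 2 ≤ᶻ # 1 ⊖ ↑ # 1 ⊕ ↑ # 0) (h , c))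
        where pe = pos-end (P y₁ a ℤP.≤-refl) np

  -- If the runner of y continues in κ above level J, the next bead is missing in τ, as y is.
  -- Following the run downwards from it either adds a level at the top or gives a narrower
  -- interval. The bound `u` comes from the highest bead `b 0`.
  climb-up : ∀ {w₀} → Search w₀ → ∀ u {x y J} → y ℤ.≤ x ℤ.+ + suc w₀ → b 0 ℤ.- y ℤ.< + (J ℕ.+ u) → (Q : Quasi x y J) → Goal
  climb-up {w₀} go u {x} {y} {J} h bd Q with mem? (y ⇧[ n ] suc J) | Quasi.up Q
  ... | no m | _ = down go (suc ℤ.∣ x ℤ.+ + M ∣) h (abs-bound (x ℤ.+ + M)) Q m
  ... | yes m | inj₂ m' = ⊥-elim (m' m)
  ... | yes m | inj₁ t = next u bd (width {x ⇧[ n ] suc J} {y ⇧[ n ] suc J} (linear (n ∷ J ℕ.* n ∷ []) (_ ∷ _ ∷ []) (# 0 <ᶻ # 1 ∷ [] ⊢ # 0 ⊕ ↑ (# 0 ⊕ # 1) <ᶻ # 1 ⊕ ↑ (# 0 ⊕ # 1)) x<y))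
    where
    open Quasi Q
    t' : ¬ T.mem (y ⇧[ n ] suc J)
    t' k = t (T.mem-base {y} (suc J) k)
    next : ∀ u → b 0 ℤ.- y ℤ.< + (J ℕ.+ u) → (∃ λ g → y ⇧[ n ] suc J ≡ x ⇧[ n ] suc J ℤ.+ 1ℤ ℤ.+ + g) → Goal
    next zero bd _ = ⊥-elim (ℕP.<⇒≱ (up-bound y J 0 top∈ bd) z≤n)
    next (suc u) bd (g , e) = branch (run-down g {x ⇧[ n ] suc J} {y ⇧[ n ] suc J} e (pos-at m t'))
      where
      branch : Down (x ⇧[ n ] suc J) (y ⇧[ n ] suc J) → Goal
      branch (inj₁ P) = climb-up go u {x} {y} {suc J} h (linear (J ∷ u ∷ []) (b 0 ∷ y ∷ []) (# 0 ⊖ # 1 <ᶻ ↑ (# 0 ⊕ 1+ # 1) ∷ [] ⊢ # 0 ⊖ # 1 <ᶻ ↑ (1+ # 0 ⊕ # 1)) bd) (record { x<y = x<y ; x∉ = x∉ ; low = low ; top∈ = m ; up = inj₁ t ; pos = pos' })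
        where
        pos' : ∀ j → j ≤ suc J → PosOn (x ⇧[ n ] j) (y ⇧[ n ] j)
        pos' j h with j ≟ suc J
        ... | yes refl = P
        ... | no ne = pos j (ℕP.≤-pred (ℕP.≤∧≢⇒< h ne))
      branch (inj₂ (x₁ , a , c , np , P)) = go {x₁} {y ⇧[ n ] suc J} {0} (record
        { x<y = c ; x∉ = proj₂ ps ; low = inj₁ (proj₁ ps) ; top∈ = at-0 m ; up = inj₁ t' ; pos = on-0 P }) (linear (w₀ ∷ n ∷ J ℕ.* n ∷ []) (_ ∷ x ∷ _ ∷ []) (# 0 ≤ᶻ # 1 ⊕ ↑ 1+ # 0 ∷ # 1 ⊕ ↑ (# 1 ⊕ # 2) <ᶻ # 2 ∷ [] ⊢ # 0 ⊕ ↑ (# 1 ⊕ # 2) ≤ᶻ # 2 ⊕ ↑ # 0) (h , a))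
        where ps = pos-start (P (x₁ ℤ.+ 1ℤ) (linear [] (_ ∷ []) ([] ⊢ # 0 <ᶻ # 0 ⊕ lit 1ℤ) tt) (linear (n ∷ J ℕ.* n ∷ []) (_ ∷ y ∷ []) (# 0 <ᶻ # 1 ⊕ ↑ (# 0 ⊕ # 1) ∷ [] ⊢ # 0 ⊕ lit 1ℤ ≤ᶻ # 1 ⊕ ↑ (# 0 ⊕ # 1)) c)) np

  search : ∀ w → Search w
  search zero Q h = ⊥-elim (linear [] (_ ∷ _ ∷ []) (# 0 <ᶻ # 1 ∷ # 1 ≤ᶻ # 0 ⊕ ↑ lit 0 ∷ [] ⊢ absurd) (Quasi.x<y Q , h))
  search (suc w) {x} {y} {J} Q h = climb-up (search w) (suc ℤ.∣ b 0 ℤ.- y ∣) h (linear (_ ∷ J ∷ []) (b 0 ∷ y ∷ []) (# 0 ⊖ # 1 <ᶻ ↑ 1+ # 0 ∷ [] ⊢ # 0 ⊖ # 1 <ᶻ ↑ (# 1 ⊕ 1+ # 0)) (abs-bound (b 0 ℤ.- y))) Q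

  exchange-exists : ∀ i → T.b i ℤ.< b i → Goal
  exchange-exists i lt = from-top (up-end (suc ℤ.∣ b 0 ℤ.- b i ∣) (b i) (i , lt , ℤP.≤-refl) (abs-bound (b 0 ℤ.- b i)))
    where
    up-end : ∀ k v → Pos v → b 0 ℤ.- v ℤ.< + k → ∃ λ y → Pos y × ¬ Pos (y ℤ.+ 1ℤ)
    up-end zero v (j , _ , hi) h = ⊥-elim (linear [] (_ ∷ _ ∷ _ ∷ []) (# 0 ≤ᶻ # 1 ∷ # 2 ⊖ # 0 <ᶻ ↑ lit 0 ∷ # 1 ≤ᶻ # 2 ∷ [] ⊢ absurd) (hi , h , mono≤ {0} {j} z≤n))
    up-end (suc k) v p h with pos? (v ℤ.+ 1ℤ)
    ... | no q = v , p , q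
    ... | yes q = up-end k (v ℤ.+ 1ℤ) q (linear (_ ∷ []) (b 0 ∷ v ∷ []) (# 0 ⊕ ⊝ # 1 <ᶻ ↑ 1+ # 0 ∷ [] ⊢ # 0 ⊖ (# 1 ⊕ lit 1ℤ) <ᶻ ↑ # 0) h)
    from-top : (∃ λ y → Pos y × ¬ Pos (y ℤ.+ 1ℤ)) → Goal
    from-top (y , p , np) = go (width {ℤ.- + M ℤ.- 1ℤ} {y} (linear (L ∷ T.L ∷ []) (_ ∷ []) (⊝ ↑ (# 0 ⊕ # 1) <ᶻ # 0 ∷ [] ⊢ ⊝ ↑ (# 0 ⊕ # 1) ⊖ lit 1ℤ <ᶻ # 0) (pos-low p)))
      where
      pe = pos-end p np
      branch : Down (ℤ.- + M ℤ.- 1ℤ) y → Goal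
      branch (inj₁ P) = ⊥-elim (linear (L ∷ T.L ∷ []) [] (⊝ ↑ (# 0 ⊕ # 1) <ᶻ ⊝ ↑ (# 0 ⊕ # 1) ∷ [] ⊢ absurd) (pos-low (P (ℤ.- + M) (linear (L ∷ T.L ∷ []) [] ([] ⊢ ⊝ ↑ (# 0 ⊕ # 1) ⊖ lit 1ℤ <ᶻ ⊝ ↑ (# 0 ⊕ # 1)) tt) (linear (L ∷ T.L ∷ []) (_ ∷ []) (⊝ ↑ (# 0 ⊕ # 1) <ᶻ # 0 ∷ [] ⊢ ⊝ ↑ (# 0 ⊕ # 1) ≤ᶻ # 0) (pos-low p)))))
      branch (inj₂ (x , a , c , nx , P)) = search ℤ.∣ y ℤ.- x ∣ {x} {y} {0} (record
        { x<y = c ; x∉ = proj₂ ps ; low = inj₁ (proj₁ ps) ; top∈ = at-0 (proj₁ pe) ; up = inj₁ (proj₂ pe) ; pos = on-0 P })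
        (linear (_ ∷ []) (_ ∷ x ∷ []) (↑ # 0 ≈ᶻ # 0 ⊖ # 1 ∷ [] ⊢ # 0 ≤ᶻ # 1 ⊕ ↑ # 0) (ℤP.0≤i⇒+∣i∣≡i {y ℤ.- x} (linear [] (_ ∷ _ ∷ []) (# 0 <ᶻ # 1 ∷ [] ⊢ lit 0ℤ ≤ᶻ # 1 ⊖ # 0) c)))
        where ps = pos-start (P (x ℤ.+ 1ℤ) (linear [] (_ ∷ []) ([] ⊢ # 0 <ᶻ # 0 ⊕ lit 1ℤ) tt) (linear [] (_ ∷ _ ∷ []) (# 0 <ᶻ # 1 ∷ [] ⊢ # 0 ⊕ lit 1ℤ ≤ᶻ # 1) c)) nx
      go : (∃ λ g → y ≡ ℤ.- + M ℤ.- 1ℤ ℤ.+ 1ℤ ℤ.+ + g) → Goal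
      go (g , e) = branch (run-down g {ℤ.- + M ℤ.- 1ℤ} {y} e p)

  -- Everything between the exchanged beads is occupied by κ/τ, so pushing the beads of κ down by
  -- one place there does not push them below those of τ.
  below-σ : ∀ {x y J} (X : Exchange x y J) → (∀ j → j ≤ J → PosOn (x ⇧[ n ] j) (y ⇧[ n ] j)) → ∀ r → T.b r ℤ.≤ Swap.bσ 1≤n κ X r
  below-σ {x} {y} {J} X P r with Swap.view 1≤n κ X r
  ... | Swap.outside _ e = subst (T.b r ℤ.≤_) (sym e) (τ⊆κ r)
  ... | Swap.step j h i lt e = subst (T.b r ℤ.≤_) (sym e) (at (P j h (b (suc r) ℤ.+ 1ℤ) (linear (j ℕ.* n ∷ []) (x ∷ _ ∷ []) (# 0 ⊕ ↑ # 0 <ᶻ # 1 ∷ [] ⊢ # 0 ⊕ ↑ # 0 <ᶻ # 1 ⊕ lit 1ℤ) lt) (linear (j ℕ.* n ∷ []) (_ ∷ _ ∷ y ∷ []) (# 0 <ᶻ # 1 ∷ # 1 ≤ᶻ # 2 ⊕ ↑ # 0 ∷ [] ⊢ # 0 ⊕ lit 1ℤ ≤ᶻ # 2 ⊕ ↑ # 0) (b-dec r , Swap.Inside.hi i))))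
    where
    at : Pos (b (suc r) ℤ.+ 1ℤ) → T.b r ℤ.≤ b (suc r)
    at (k , lo , hi) = linear [] (_ ∷ _ ∷ _ ∷ []) (# 0 <ᶻ # 1 ⊕ lit 1ℤ ∷ # 2 ≤ᶻ # 0 ∷ [] ⊢ # 2 ≤ᶻ # 1) (lo , T.mono≤ (ℕP.≤-pred (cmp< {k} {suc r} (linear [] (_ ∷ _ ∷ []) (# 0 ⊕ lit 1ℤ ≤ᶻ # 1 ∷ [] ⊢ # 0 <ᶻ # 1) hi))))
  ... | Swap.last j h i lt e = subst (T.b r ℤ.≤_) (sym e) (at (P j h (x ⇧[ n ] j ℤ.+ 1ℤ) (linear (j ℕ.* n ∷ []) (x ∷ []) ([] ⊢ # 0 ⊕ ↑ # 0 <ᶻ # 0 ⊕ ↑ # 0 ⊕ lit 1ℤ) tt) (linear (j ℕ.* n ∷ []) (x ∷ _ ∷ y ∷ []) (# 0 ⊕ ↑ # 0 <ᶻ # 1 ∷ # 1 ≤ᶻ # 2 ⊕ ↑ # 0 ∷ [] ⊢ # 0 ⊕ ↑ # 0 ⊕ lit 1ℤ ≤ᶻ # 2 ⊕ ↑ # 0) (Swap.Inside.lo i , Swap.Inside.hi i))))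
    where
    at : Pos (x ⇧[ n ] j ℤ.+ 1ℤ) → T.b r ℤ.≤ x ⇧[ n ] j
    at (k , lo , hi) = linear (j ℕ.* n ∷ []) (_ ∷ x ∷ _ ∷ []) (# 0 <ᶻ # 1 ⊕ ↑ # 0 ⊕ lit 1ℤ ∷ # 2 ≤ᶻ # 0 ∷ [] ⊢ # 2 ≤ᶻ # 1 ⊕ ↑ # 0) (lo , T.mono≤ (ℕP.≤-pred (cmp< {k} {suc r} (linear (j ℕ.* n ∷ []) (x ∷ _ ∷ _ ∷ []) (# 0 ⊕ ↑ # 0 ⊕ lit 1ℤ ≤ᶻ # 1 ∷ # 2 <ᶻ # 0 ⊕ ↑ # 0 ∷ [] ⊢ # 2 <ᶻ # 1) (hi , lt)))))

unique-map : ∀ {A B : Set} (f : A → B) {xs : List A} → Unique xs → (∀ a a' → a ∈ xs → a' ∈ xs → f a ≡ f a' → a ≡ a') → Unique (map f xs)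
unique-map f [] inj = []
unique-map f {x ∷ xs} (p ∷ u) inj = All.tabulate fresh ∷ unique-map f u (λ a a' m m' → inj a a' (there m) (there m'))
  where
  fresh : ∀ {y} → y ∈ map f xs → f x ≢ y
  fresh m e with ∈-map⁻ f m
  ... | a , m' , refl = All.lookup p m' (inj x a (here refl) (there m') e)

mapCount : ∀ {A B : Set} {P : B → Set} (f : A → B) (xs : List A) → Unique xs → (∀ a a' → a ∈ xs → a' ∈ xs → f a ≡ f a' → a ≡ a') →
  (∀ a → a ∈ xs → P (f a)) → (∀ b → P b → ∃ λ a → a ∈ xs × b ≡ f a) → Count P (length xs)
mapCount {P = P} f xs u inj snd cmp = record
  { elems = map f xs
  ; sound = All.tabulate sound'
  ; complete = λ b p → complete' b (cmp b p)
  ; unique = unique-map f u inj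
  ; size = length-map f xs }
  where
  sound' : ∀ {y} → y ∈ map f xs → P y
  sound' m with ∈-map⁻ f m
  ... | a , m' , refl = snd a m'
  complete' : ∀ b → (∃ λ a → a ∈ xs × b ≡ f a) → b ∈ map f xs
  complete' b (a , m , refl) = ∈-map⁺ f m

count-unique : ∀ {A : Set} {P Q : A → Set} {m n} → Count P m → Count Q n → (∀ a → P a → Q a) → (∀ a → Q a → P a) → m ≡ n
count-unique C C' f g = ≡.trans (sym (Count.size C)) (≡.trans (↭-length (same-members⇒↭ (Count.unique C) (Count.unique C')
  (λ x m → Count.complete C' x (f x (All.lookup (Count.sound C) m))) (λ x m → Count.complete C x (g x (All.lookup (Count.sound C') m))))) (Count.size C'))

-- Counting the rows and components of an exchange

module RowLists {n : ℕ} (1≤n : 1 ≤ n) (κ : Beads n) where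
  open Rows 1≤n κ

  index : ℤ → ℕ
  index v = proj₁ (first v)

  b-index : ∀ {v} → mem v → b (index v) ≡ v
  b-index {v} (i , e) = ℤP.≤-antisym (proj₁ (proj₂ (first v))) (subst (ℤ._≤ b (index v)) e (mono≤ le))
    where
    le : index v ≤ i
    le with index v ≤? i
    ... | yes p = p
    ... | no p = ⊥-elim (ℤP.<-irrefl (sym e) (proj₂ (proj₂ (first v)) i (ℕP.≰⇒> p)))

  index-b : ∀ {v} r → b r ≡ v → index v ≡ r
  index-b r e = b-inj (≡.trans (b-index (r , e)) (sym e))

  index-inj : ∀ {v w} → mem v → mem w → index v ≡ index w → v ≡ w
  index-inj m m' e = ≡.trans (sym (b-index m)) (≡.trans (cong b e) (b-index m'))

  ∈-window⁻ : ∀ x g {w} → w ∈ window-beads x g → x ℤ.< w × w ℤ.< x ℤ.+ 1ℤ ℤ.+ + g × mem w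
  ∈-window⁻ x (suc g) m with mem? (x ℤ.+ 1ℤ ℤ.+ + g)
  ∈-window⁻ x (suc g) (here refl) | yes p = linear (g ∷ []) (_ ∷ []) ([] ⊢ # 0 <ᶻ # 0 ⊕ lit 1ℤ ⊕ ↑ # 0) tt , linear (g ∷ []) (x ∷ []) ([] ⊢ # 0 ⊕ lit 1ℤ ⊕ ↑ # 0 <ᶻ # 0 ⊕ ↑ lit 1 ⊕ ↑ 1+ # 0) tt , p
  ∈-window⁻ x (suc g) (there m) | yes p = let (a , c , d) = ∈-window⁻ x g m in a , linear (g ∷ []) (_ ∷ x ∷ []) (# 0 <ᶻ # 1 ⊕ lit 1ℤ ⊕ ↑ # 0 ∷ [] ⊢ # 0 <ᶻ # 1 ⊕ ↑ lit 1 ⊕ ↑ 1+ # 0) c , d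
  ∈-window⁻ x (suc g) m | no _ = let (a , c , d) = ∈-window⁻ x g m in a , linear (g ∷ []) (_ ∷ x ∷ []) (# 0 <ᶻ # 1 ⊕ lit 1ℤ ⊕ ↑ # 0 ∷ [] ⊢ # 0 <ᶻ # 1 ⊕ ↑ lit 1 ⊕ ↑ 1+ # 0) c , d

  ∈-window⁺ : ∀ x g {w} → x ℤ.< w → w ℤ.< x ℤ.+ 1ℤ ℤ.+ + g → mem w → w ∈ window-beads x g
  ∈-window⁺ x zero a c m = ⊥-elim (linear [] (_ ∷ _ ∷ []) (# 0 <ᶻ # 1 ∷ # 1 <ᶻ # 0 ⊕ lit 1ℤ ⊕ ↑ lit 0 ∷ [] ⊢ absurd) (a , c))
  ∈-window⁺ x (suc g) {w} a c m with mem? (x ℤ.+ 1ℤ ℤ.+ + g) | w ℤ.≟ x ℤ.+ 1ℤ ℤ.+ + g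
  ... | yes p | yes e = here e
  ... | yes p | no ne = there (∈-window⁺ x g a (ℤP.≤∧≢⇒< (lem c) ne) m)
    where lem : w ℤ.< x ℤ.+ 1ℤ ℤ.+ + suc g → w ℤ.≤ x ℤ.+ 1ℤ ℤ.+ + g
          lem h = linear (g ∷ []) (_ ∷ x ∷ []) (# 0 <ᶻ # 1 ⊕ lit 1ℤ ⊕ ↑ 1+ # 0 ∷ [] ⊢ # 0 ≤ᶻ # 1 ⊕ lit 1ℤ ⊕ ↑ # 0) h
  ... | no p | yes e = ⊥-elim (p (mem-≡ e m))
  ... | no p | no ne = ∈-window⁺ x g a (ℤP.≤∧≢⇒< (lem c) ne) m
    where lem : w ℤ.< x ℤ.+ 1ℤ ℤ.+ + suc g → w ℤ.≤ x ℤ.+ 1ℤ ℤ.+ + g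
          lem h = linear (g ∷ []) (_ ∷ x ∷ []) (# 0 <ᶻ # 1 ⊕ lit 1ℤ ⊕ ↑ 1+ # 0 ∷ [] ⊢ # 0 ≤ᶻ # 1 ⊕ lit 1ℤ ⊕ ↑ # 0) h

  window-unique : ∀ x g → Unique (window-beads x g)
  window-unique x zero = []
  window-unique x (suc g) with mem? (x ℤ.+ 1ℤ ℤ.+ + g)
  ... | yes _ = All.tabulate (λ m e → ℤP.<-irrefl (sym e) (proj₁ (proj₂ (∈-window⁻ x g m)))) ∷ window-unique x g
  ... | no _ = window-unique x g

occ : List ℕ → ℕ → ℤ
occ [] r = 0ℤ
occ (q ∷ R) r = δ q r ℤ.+ occ R r

occ-out : ∀ R r → ¬ r ∈ R → occ R r ≡ 0ℤ
occ-out [] r h = refl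
occ-out (q ∷ R) r h = cong₂ ℤ._+_ (δ-≢ q r (λ e → h (here (sym e)))) (occ-out R r (h ∘ there))

occ-in : ∀ {R} → Unique R → ∀ r → r ∈ R → occ R r ≡ 1ℤ
occ-in {q ∷ R} (p ∷ u) r (here refl) = cong₂ ℤ._+_ (δ-refl r) (occ-out R r (λ m → All.lookup p m refl))
occ-in {q ∷ R} (p ∷ u) r (there m) = cong₂ ℤ._+_ (δ-≢ q r (λ { refl → All.lookup p m refl })) (occ-in u r m)

Σ<-occ : ∀ ℓ R → (∀ r → r ∈ R → r < ℓ) → Σ< ℓ (occ R) ≡ + length R
Σ<-occ ℓ [] h = Σ<-zero ℓ
Σ<-occ ℓ (q ∷ R) h = ≡.trans (Σ<-add ℓ (δ q) (occ R)) (cong₂ ℤ._+_ (Σ<-δ-in ℓ q (h q (here refl))) (Σ<-occ ℓ R (λ r m → h r (there m))))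
  where
  Σ<-add : ∀ m (f g : ℕ → ℤ) → Σ< m (λ i → f i ℤ.+ g i) ≡ Σ< m f ℤ.+ Σ< m g
  Σ<-add zero f g = refl
  Σ<-add (suc m) f g = linear [] (_ ∷ Σ< m f ∷ Σ< m g ∷ f m ∷ g m ∷ []) (# 0 ≈ᶻ # 1 ⊕ # 2 ∷ [] ⊢ # 0 ⊕ (# 3 ⊕ # 4) ≈ᶻ # 1 ⊕ # 3 ⊕ (# 2 ⊕ # 4)) (Σ<-add m f g)

module Ribbon {n : ℕ} (1≤n : 1 ≤ n) (B : Beads n) {x y : ℤ} {J : ℕ} (X : Rows.Exchange 1≤n B x y J) where
  open Rows 1≤n B
  open Exchange X
  open Swap 1≤n B X
  open RowLists 1≤n B
  open Decide 1≤n B using (width)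

  gap-width : ℕ
  gap-width = proj₁ (width x<y)

  y≡ : y ≡ x ℤ.+ 1ℤ ℤ.+ + gap-width
  y≡ = proj₂ (width x<y)

  inner : List ℤ
  inner = window-beads x gap-width

  inner⁻ : ∀ {w} → w ∈ inner → x ℤ.< w × w ℤ.< y × mem w
  inner⁻ m = let (a , d , e) = ∈-window⁻ x gap-width m in a , subst (_ ℤ.<_) (sym y≡) d , e

  inner⁺ : ∀ {w} → x ℤ.< w → w ℤ.< y → mem w → w ∈ inner
  inner⁺ a d = ∈-window⁺ x gap-width a (subst (_ ℤ.<_) y≡ d)

  inner-up : ∀ {w} j → j ≤ suc J → w ∈ inner → mem (w ⇧[ n ] j)
  inner-up {w} j h m = let (a , d , e) = inner⁻ m in Window.rise (W h) w a d e

  -- the beads of the exchanged ribbon on level 0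
  ribbon : List ℤ
  ribbon = y ∷ inner

  ribbon-unique : Unique ribbon
  ribbon-unique = All.tabulate (λ m e → ℤP.<-irrefl (sym e) (proj₁ (proj₂ (inner⁻ m)))) ∷ window-unique x gap-width

  ribbon-up : ∀ {w} j → j ≤ J → w ∈ ribbon → mem (w ⇧[ n ] j)
  ribbon-up j h (here refl) = y∈ h
  ribbon-up j h (there m) = inner-up j (ℕP.m≤n⇒m≤1+n h) m

  ribbon-inside : ∀ {w} j → w ∈ ribbon → Inside j (w ⇧[ n ] j)
  ribbon-inside j (here refl) = linear (j ℕ.* n ∷ []) (_ ∷ _ ∷ []) (# 0 <ᶻ # 1 ∷ [] ⊢ # 0 ⊕ ↑ # 0 <ᶻ # 1 ⊕ ↑ # 0) x<y , ℤP.≤-refl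
  ribbon-inside j (there m) = let (a , d , _) = inner⁻ m in linear (j ℕ.* n ∷ []) (_ ∷ _ ∷ []) (# 0 <ᶻ # 1 ∷ [] ⊢ # 0 ⊕ ↑ # 0 <ᶻ # 1 ⊕ ↑ # 0) a , linear (j ℕ.* n ∷ []) (_ ∷ _ ∷ []) (# 0 <ᶻ # 1 ∷ [] ⊢ # 0 ⊕ ↑ # 0 ≤ᶻ # 1 ⊕ ↑ # 0) d

  ⇧-inj : ∀ {v w} j → v ⇧[ n ] j ≡ w ⇧[ n ] j → v ≡ w
  ⇧-inj j e = linear (j ℕ.* n ∷ []) (_ ∷ _ ∷ []) (# 0 ⊕ ↑ # 0 ≈ᶻ # 1 ⊕ ↑ # 0 ∷ [] ⊢ # 0 ≈ᶻ # 1) e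

  level-inj : ∀ {v w} j → mem (v ⇧[ n ] j) → mem (w ⇧[ n ] j) → index (v ⇧[ n ] j) ≡ index (w ⇧[ n ] j) → v ≡ w
  level-inj j m m' e = ⇧-inj j (index-inj m m' e)

  back : ∀ v j → v ≡ (v ℤ.- + (j ℕ.* n)) ⇧[ n ] j
  back v j = lem v (+ (j ℕ.* n))
    where lem : ∀ v a → v ≡ v ℤ.- a ℤ.+ a
          lem = solve-∀

  inside-ribbon : ∀ {r} j → j ≤ J → Inside j (b r) → ∃ λ w → w ∈ ribbon × b r ≡ w ⇧[ n ] j
  inside-ribbon {r} j h i = w , member (w ℤ.≟ y) , back (b r) j
    where
    w = b r ℤ.- + (j ℕ.* n)
    lo' : x ℤ.< w
    lo' = linear (j ℕ.* n ∷ []) (_ ∷ _ ∷ []) (# 0 ⊕ ↑ # 0 <ᶻ # 1 ∷ [] ⊢ # 0 <ᶻ # 1 ⊕ ⊝ ↑ # 0) (Inside.lo i)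
    hi' : w ℤ.≤ y
    hi' = linear (j ℕ.* n ∷ []) (_ ∷ _ ∷ []) (# 0 ≤ᶻ # 1 ⊕ ↑ # 0 ∷ [] ⊢ # 0 ⊕ ⊝ ↑ # 0 ≤ᶻ # 1) (Inside.hi i)
    member : Dec (w ≡ y) → w ∈ ribbon
    member (yes e) = here e
    member (no ne) = there (inner⁺ lo' (ℤP.≤∧≢⇒< hi' ne) (mem-base {w} j (r , back (b r) j)))

  high-inner : ∀ {r} → High (b r) → ∃ λ w → w ∈ inner × b r ≡ w ⇧[ n ] suc J
  high-inner {r} (p , q) = w , inner⁺ {w} (linear (n ∷ J ℕ.* n ∷ []) (_ ∷ _ ∷ []) (# 0 ⊕ ↑ (# 0 ⊕ # 1) <ᶻ # 1 ∷ [] ⊢ # 0 <ᶻ # 1 ⊕ ⊝ ↑ (# 0 ⊕ # 1)) p) (linear (n ∷ J ℕ.* n ∷ []) (_ ∷ _ ∷ []) (# 0 <ᶻ # 1 ⊕ ↑ (# 0 ⊕ # 1) ∷ [] ⊢ # 0 ⊕ ⊝ ↑ (# 0 ⊕ # 1) <ᶻ # 1) q) (mem-base {w} (suc J) (r , back (b r) (suc J))) , back (b r) (suc J)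
    where w = b r ℤ.- + (suc J ℕ.* n)

  lowRows highRows : List ℕ
  lowRows = map (λ w → index (w ⇧[ n ] 0)) ribbon
  highRows = map (λ w → index (w ⇧[ n ] suc J)) inner

  lowRows-unique : Unique lowRows
  lowRows-unique = unique-map _ ribbon-unique (λ a a' m m' → level-inj 0 (ribbon-up 0 z≤n m) (ribbon-up 0 z≤n m'))

  highRows-unique : Unique highRows
  highRows-unique = unique-map _ (window-unique x gap-width) (λ a a' m m' → level-inj (suc J) (inner-up (suc J) ℕP.≤-refl m) (inner-up (suc J) ℕP.≤-refl m'))

  lowRows⁻ : ∀ {r} → r ∈ lowRows → Low (b r)
  lowRows⁻ m = let (w , m' , e) = ∈-map⁻ (λ w → index (w ⇧[ n ] 0)) m in
    subst Low (sym (≡.trans (cong b e) (b-index (ribbon-up 0 z≤n m')))) (inside⇒low (ribbon-inside 0 m'))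

  lowRows⁺ : ∀ {r} → Low (b r) → r ∈ lowRows
  lowRows⁺ {r} l = let (w , m , e) = inside-ribbon {r} 0 z≤n (low⇒inside l) in
    subst (_∈ lowRows) (index-b r e) (∈-map⁺ (λ w → index (w ⇧[ n ] 0)) m)

  highRows⁻ : ∀ {r} → r ∈ highRows → High (b r)
  highRows⁻ m = let (w , m' , e) = ∈-map⁻ (λ w → index (w ⇧[ n ] suc J)) m ; (a , d , _) = inner⁻ m' in
    subst High (sym (≡.trans (cong b e) (b-index (inner-up (suc J) ℕP.≤-refl m')))) (linear (n ∷ J ℕ.* n ∷ []) (_ ∷ _ ∷ []) (# 0 <ᶻ # 1 ∷ [] ⊢ # 0 ⊕ ↑ (# 0 ⊕ # 1) <ᶻ # 1 ⊕ ↑ (# 0 ⊕ # 1)) a , linear (n ∷ J ℕ.* n ∷ []) (_ ∷ _ ∷ []) (# 0 <ᶻ # 1 ∷ [] ⊢ # 0 ⊕ ↑ (# 0 ⊕ # 1) <ᶻ # 1 ⊕ ↑ (# 0 ⊕ # 1)) d)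

  highRows⁺ : ∀ {r} → High (b r) → r ∈ highRows
  highRows⁺ {r} l = let (w , m , e) = high-inner {r} l in
    subst (_∈ highRows) (index-b r e) (∈-map⁺ (λ w → index (w ⇧[ n ] suc J)) m)

  net : ∀ {s d : ℕ} {u v a c : ℤ} → + s ≡ + d ℤ.+ (a ℤ.- c) → u ≡ a → v ≡ c → + s ≡ + d ℤ.+ (u ℤ.- v)
  net h refl refl = h

  Dσ-occ : ∀ r → + Dσ r ≡ + D r ℤ.+ (occ lowRows r ℤ.- occ highRows r)
  Dσ-occ r with low? (b r) | high? (b r)
  ... | yes l | yes h = ⊥-elim (high⇒outside h 0 z≤n (low⇒inside l))
  ... | yes l | no h = net (linear (_ ∷ _ ∷ []) [] (# 0 ≈ⁿ 1+ # 1 ∷ [] ⊢ ↑ # 0 ≈ᶻ ↑ # 1 ⊕ (lit 1ℤ ⊖ lit 0ℤ)) (Dσ-low r l))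
    (occ-in lowRows-unique r (lowRows⁺ l)) (occ-out highRows r (λ m → h (highRows⁻ m)))
  ... | no l | yes h = net (linear (_ ∷ _ ∷ []) [] (1+ # 0 ≈ⁿ # 1 ∷ [] ⊢ ↑ # 0 ≈ᶻ ↑ # 1 ⊕ (lit 0ℤ ⊖ lit 1ℤ)) (Dσ-high r h))
    (occ-out lowRows r (λ m → l (lowRows⁻ m))) (occ-in highRows-unique r (highRows⁺ h))
  ... | no l | no h = net (linear (_ ∷ _ ∷ []) [] (# 0 ≈ⁿ # 1 ∷ [] ⊢ ↑ # 0 ≈ᶻ ↑ # 1 ⊕ (lit 0ℤ ⊖ lit 0ℤ)) (Dσ-else r l h))
    (occ-out lowRows r (λ m → l (lowRows⁻ m))) (occ-out highRows r (λ m → h (highRows⁻ m)))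

  row-< : ∀ {r} → x ℤ.< b r → r < L
  row-< {r} h with r <? L
  ... | yes p = p
  ... | no p = ⊥-elim (linear (_ ∷ _ ∷ []) (_ ∷ _ ∷ []) (# 0 <ᶻ # 1 ∷ ⊝ ↑ # 0 <ᶻ # 0 ∷ # 1 ≈ᶻ ⊝ ↑ # 1 ∷ # 0 ≤ⁿ # 1 ∷ [] ⊢ absurd) (h , x-high , b-end r (ℕP.≮⇒≥ p) , ℕP.≮⇒≥ p))

  -- The size of 𝔭 is the sum of i + n - D i. The exchange increases D by one in the rows of y and
  -- of the inner beads on level 0, and decreases it by one in the rows of the inner beads on level
  -- J + 1: the balance is one box.
  size-drop : ∀ {p q : ℕ} → + p ≡ Σ< L (wt n D) → + q ≡ Σ< L (wt n Dσ) → q ℕ.+ 1 ≡ p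
  size-drop e e' = count e (≡.trans e' (≡.trans (Σ<-cong L (λ i _ → lem (+ (i ℕ.+ n)) (occ lowRows i) (occ highRows i) (Dσ-occ i))) (Σ<-lin L (wt n D) (occ highRows) (occ lowRows))))
    (Σ<-occ L lowRows (λ r m → row-< {r} (proj₁ (lowRows⁻ m)))) (Σ<-occ L highRows (λ r m → row-< {r} (lem₂ (proj₁ (highRows⁻ m)))))
    (length-map (λ w → index (w ⇧[ n ] 0)) ribbon) (length-map (λ w → index (w ⇧[ n ] suc J)) inner)
    where
    count : ∀ {p q k l m : ℕ} {s t u : ℤ} → + p ≡ s → + q ≡ s ℤ.+ (t ℤ.- u) → u ≡ + k → t ≡ + l → k ≡ suc m → l ≡ m → q ℕ.+ 1 ≡ p
    count e₁ e₂ e₃ e₄ e₅ e₆ = linear (_ ∷ _ ∷ _ ∷ _ ∷ _ ∷ []) (_ ∷ _ ∷ _ ∷ []) (↑ # 0 ≈ᶻ # 0 ∷ ↑ # 1 ≈ᶻ # 0 ⊕ (# 1 ⊖ # 2) ∷ # 2 ≈ᶻ ↑ # 2 ∷ # 1 ≈ᶻ ↑ # 3 ∷ # 2 ≈ⁿ 1+ # 4 ∷ # 3 ≈ⁿ # 4 ∷ [] ⊢ # 1 ⊕ lit 1 ≈ⁿ # 0) (e₁ , e₂ , e₃ , e₄ , e₅ , e₆)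
    lem : ∀ a {s d} (u v : ℤ) → + s ≡ + d ℤ.+ (u ℤ.- v) → a ℤ.- + s ≡ a ℤ.- + d ℤ.+ (v ℤ.- u)
    lem a {s} {d} u v e = linear (_ ∷ d ∷ []) (a ∷ u ∷ v ∷ []) (↑ # 0 ≈ᶻ ↑ # 1 ⊕ (# 1 ⊖ # 2) ∷ [] ⊢ # 0 ⊖ ↑ # 0 ≈ᶻ # 0 ⊖ ↑ # 1 ⊕ (# 2 ⊖ # 1)) e
    lem₂ : ∀ {v} → x ⇧[ n ] suc J ℤ.< v → x ℤ.< v
    lem₂ h = linear (n ∷ J ℕ.* n ∷ []) (_ ∷ _ ∷ []) (# 0 ⊕ ↑ (# 0 ⊕ # 1) <ᶻ # 1 ∷ [] ⊢ # 0 <ᶻ # 1) h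

  module InLists (τ κ : List ℕ) (τ-dec : Decreasing (part τ)) (κ-dec : Decreasing (part κ))
    (τb : ∀ r → row-bead (part τ) r ≡ bσ r) (κb : ∀ r → row-bead (part κ) r ≡ b r) where
    open Components τ κ τ-dec κ-dec

    nonempty⇒ : ∀ {r} → part τ r < part κ r → bσ r ℤ.< b r
    nonempty⇒ {r} h = lem (part τ r) (part κ r) h (τb r) (κb r)
      where lem : ∀ u v → u < v → + u ℤ.- + r ≡ bσ r → + v ℤ.- + r ≡ b r → bσ r ℤ.< b r
            lem u v h e e' = linear (_ ∷ _ ∷ r ∷ []) (_ ∷ _ ∷ []) (# 0 <ⁿ # 1 ∷ ↑ # 0 ⊖ ↑ # 2 ≈ᶻ # 0 ∷ ↑ # 1 ⊖ ↑ # 2 ≈ᶻ # 1 ∷ [] ⊢ # 0 <ᶻ # 1) (h , e , e')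

    nonempty⇐ : ∀ {r} → bσ r ℤ.< b r → part τ r < part κ r
    nonempty⇐ {r} h = lem (part τ r) (part κ r) h (τb r) (κb r)
      where lem : ∀ u v → bσ r ℤ.< b r → + u ℤ.- + r ≡ bσ r → + v ℤ.- + r ≡ b r → u < v
            lem u v h e e' = linear (_ ∷ r ∷ _ ∷ []) (_ ∷ _ ∷ []) (# 0 <ᶻ # 1 ∷ ↑ # 0 ⊖ ↑ # 1 ≈ᶻ # 0 ∷ ↑ # 2 ⊖ ↑ # 1 ≈ᶻ # 1 ∷ [] ⊢ # 0 <ⁿ # 2) (h , e , e')

    link-b : ∀ {r} → (Link r → bσ r ℤ.≤ b (suc r)) × (bσ r ℤ.≤ b (suc r) → Link r)
    link-b {r} = (λ h → lem (part τ r) (part κ (suc r)) h (τb r) (κb (suc r))) , λ h → lem' (part τ r) (part κ (suc r)) h (τb r) (κb (suc r))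
      where
      lem : ∀ u v → u < v → + u ℤ.- + r ≡ bσ r → + v ℤ.- + suc r ≡ b (suc r) → bσ r ℤ.≤ b (suc r)
      lem u v h e e' = linear (_ ∷ _ ∷ r ∷ []) (_ ∷ _ ∷ []) (# 0 <ⁿ # 1 ∷ ↑ # 0 ⊖ ↑ # 2 ≈ᶻ # 0 ∷ ↑ # 1 ⊖ ↑ 1+ # 2 ≈ᶻ # 1 ∷ [] ⊢ # 0 ≤ᶻ # 1) (h , e , e')
      lem' : ∀ u v → bσ r ℤ.≤ b (suc r) → + u ℤ.- + r ≡ bσ r → + v ℤ.- + suc r ≡ b (suc r) → u < v
      lem' u v h e e' = linear (_ ∷ r ∷ _ ∷ []) (_ ∷ _ ∷ []) (# 0 ≤ᶻ # 1 ∷ ↑ # 0 ⊖ ↑ # 1 ≈ᶻ # 0 ∷ ↑ # 2 ⊖ ↑ 1+ # 1 ≈ᶻ # 1 ∷ [] ⊢ # 0 <ⁿ # 2) (h , e , e')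

    affected : ∀ {r} → part τ r < part κ r → ∃ λ j → j ≤ J × Inside j (b r)
    affected {r} h with view r
    ... | step j j≤ i _ _ = j , j≤ , i
    ... | last j j≤ i _ _ = j , j≤ , i
    ... | outside _ e = ⊥-elim (ℤP.<-irrefl e (nonempty⇒ h))

    link⇒ : ∀ {r} → Link r → ∃ λ j → j ≤ J × Inside j (b r) × Inside j (b (suc r))
    link⇒ {r} h with view r
    ... | step j j≤ i lt _ = j , j≤ , i , next-inside {r} i lt
    ... | last j _ _ lt e = ⊥-elim (ℤP.<⇒≱ lt (subst (ℤ._≤ b (suc r)) e (proj₁ link-b h)))
    ... | outside _ e = ⊥-elim (ℤP.<⇒≱ (b-dec r) (subst (ℤ._≤ b (suc r)) e (proj₁ link-b h)))

    link⇐ : ∀ {r} j → j ≤ J → Inside j (b r) → x ⇧[ n ] j ℤ.< b (suc r) → Link r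
    link⇐ {r} j j≤ i lt = proj₂ link-b (ℤP.≤-reflexive (bσ-step r j j≤ i lt))

    -- Unless its bead is the upper end y + jn, a row in the window of level j has its predecessor
    -- in the same window, and the two rows touch.
    head⇒ : ∀ {i} → Head i → ∃ λ j → j ≤ J × b i ≡ y ⇧[ n ] j
    head⇒ {i} (ne , top) with affected ne
    ... | j , j≤ , a with b i ℤ.≟ y ⇧[ n ] j
    ...   | yes e = j , j≤ , e
    ...   | no ne' = ⊥-elim (contra (row-above {i} {j} j≤ (ℤP.≤∧≢⇒< (Inside.hi a) ne')))
      where
      contra : (∃ λ s → i ≡ suc s × b s ℤ.≤ y ⇧[ n ] j) → ⊥
      contra (s , refl , le) = top s refl (link⇐ j j≤ (ℤP.<-trans (Inside.lo a) (b-dec s) , le) (Inside.lo a))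

    top-inside : ∀ j {v} → v ≡ y ⇧[ n ] j → Inside j v
    top-inside j refl = ribbon-inside j (here refl)

    head⇐ : ∀ {i} j → j ≤ J → b i ≡ y ⇧[ n ] j → Head i
    head⇐ {i} j j≤ e = nonempty⇐ (bσ-< i j j≤ (top-inside j e)) , top
      where
      top : ∀ r → i ≡ suc r → ¬ Link r
      top r refl l with link⇒ l
      ... | j' , _ , a , a' with inside-unique a' (top-inside j e)
      ...   | refl = ℤP.<⇒≱ (b-dec r) (subst (b r ℤ.≤_) (sym e) (Inside.hi a))

    rows-inside⇒ : ∀ {i} j → j ≤ J → b i ≡ y ⇧[ n ] j → ∀ {i'} → RowsOf τ κ (i , part τ i) i' → Inside j (b i')
    rows-inside⇒ {i} j j≤ e {i'} R = subst (λ m → Inside j (b m)) (ℕP.m+[n∸m]≡n (proj₁ links)) (go (i' ∸ i) (ℕP.≤-reflexive (ℕP.m+[n∸m]≡n (proj₁ links))))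
      where
      links = rows⇒ (head⇐ j j≤ e) R
      go : ∀ k → i ℕ.+ k ≤ i' → Inside j (b (i ℕ.+ k))
      go zero _ = subst (λ m → Inside j (b m)) (sym (ℕP.+-identityʳ i)) (top-inside j e)
      go (suc k) h = subst (λ m → Inside j (b m)) (sym (ℕP.+-suc i k)) (next (go k (ℕP.<⇒≤ lt)) (link⇒ (proj₂ links (i ℕ.+ k) (ℕP.m≤m+n i k) lt)))
        where
        lt : i ℕ.+ k < i'
        lt = subst (_≤ i') (ℕP.+-suc i k) h
        next : Inside j (b (i ℕ.+ k)) → (∃ λ j' → j' ≤ J × Inside j' (b (i ℕ.+ k)) × Inside j' (b (suc (i ℕ.+ k)))) → Inside j (b (suc (i ℕ.+ k)))
        next a (j' , _ , a' , a'') = subst (λ m → Inside m (b (suc (i ℕ.+ k)))) (inside-unique a' a) a''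

    rows-inside⇐ : ∀ {i} j → j ≤ J → b i ≡ y ⇧[ n ] j → ∀ {i'} → Inside j (b i') → RowsOf τ κ (i , part τ i) i'
    rows-inside⇐ {i} j j≤ e {i'} a = subst (RowsOf τ κ (i , part τ i)) (ℕP.m+[n∸m]≡n le) (rows⇐ (head⇐ j j≤ e) (i' ∸ i) links)
      where
      le : i ≤ i'
      le = cmp≤ {i} {i'} (subst (b i' ℤ.≤_) (sym e) (Inside.hi a))
      links : ∀ r → i ≤ r → r < i ℕ.+ (i' ∸ i) → Link r
      links r p q = link⇐ j j≤ (ℤP.<-≤-trans (Inside.lo a) (mono≤ (ℕP.<⇒≤ r<)) , subst (b r ℤ.≤_) e (mono≤ p)) (ℤP.<-≤-trans (Inside.lo a) (mono≤ r<))
        where r< : r < i'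
              r< = subst (r <_) (ℕP.m+[n∸m]≡n le) q

    topRow : ℕ → ℕ
    topRow j = index (y ⇧[ n ] j)

    b-topRow : ∀ {j} → j ≤ J → b (topRow j) ≡ y ⇧[ n ] j
    b-topRow h = b-index (y∈ h)

    ⇧-level-inj : ∀ j j' → y ⇧[ n ] j ≡ y ⇧[ n ] j' → j ≡ j'
    ⇧-level-inj j j' e = inside-unique (top-inside j refl) (top-inside j' e)

    topRow-inj : ∀ {j j'} → j ≤ J → j' ≤ J → topRow j ≡ topRow j' → j ≡ j'
    topRow-inj {j} {j'} h h' e = ⇧-level-inj j j' (index-inj (y∈ h) (y∈ h') e)

    topRow-< : ∀ {j j'} → j ≤ J → j' ≤ J → topRow j < topRow j' → j' < j
    topRow-< {j} {j'} h h' lt with j' <? j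
    ... | yes p = p
    ... | no p = ⊥-elim (ℤP.<⇒≱ (mono< lt) (subst₂ ℤ._≤_ (sym (b-topRow h)) (sym (b-topRow h')) (⇧-≤ (ℕP.≮⇒≥ p))))
      where ⇧-≤ : j ≤ j' → y ⇧[ n ] j ℤ.≤ y ⇧[ n ] j'
            ⇧-≤ p = linear (_ ∷ _ ∷ []) (y ∷ []) (# 0 ≤ⁿ # 1 ∷ [] ⊢ # 0 ⊕ ↑ # 0 ≤ᶻ # 0 ⊕ ↑ # 1) (ℕP.*-monoˡ-≤ n p)

    topRow-<⁻ : ∀ {j j'} → j ≤ J → j' ≤ J → j' < j → topRow j < topRow j'
    topRow-<⁻ {j} {j'} h h' lt = cmp< {topRow j} {topRow j'} (subst₂ ℤ._<_ (sym (b-topRow h')) (sym (b-topRow h)) ⇧-<)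
      where ⇧-< : y ⇧[ n ] j' ℤ.< y ⇧[ n ] j
            ⇧-< = linear (j' ℕ.* n ∷ _ ∷ _ ∷ []) (y ∷ []) (# 0 ⊕ # 1 ≤ⁿ # 2 ∷ lit 1 ≤ⁿ # 1 ∷ [] ⊢ # 0 ⊕ ↑ # 0 <ᶻ # 0 ⊕ ↑ # 2) (gap-n lt , 1≤n)

    rep-top : ∀ {j} → j ≤ J → Rep τ κ (topRow j , part τ (topRow j))
    rep-top h = rep⇐ (head⇐ _ h (b-topRow h))

    rep-is-top : ∀ {i k} → Rep τ κ (i , k) → ∃ λ j → j ≤ J × b i ≡ y ⇧[ n ] j × (i , k) ≡ (topRow j , part τ (topRow j))
    rep-is-top {i} r with rep⇒ r
    ... | refl , hd with head⇒ hd
    ...   | j , h , e with index-b i e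
    ...     | refl = j , h , e , refl

    components : Count (Rep τ κ) (suc J)
    components = subst (Count (Rep τ κ)) (length-upTo (suc J)) (mapCount (λ j → topRow j , part τ (topRow j)) (upTo (suc J)) (Uniq.upTo⁺ (suc J))
      (λ a a' m m' e → topRow-inj (ℕP.≤-pred (∈-upTo⁻ m)) (ℕP.≤-pred (∈-upTo⁻ m')) (cong proj₁ e))
      (λ a m → rep-top (ℕP.≤-pred (∈-upTo⁻ m)))
      (λ { (i , k) r → let (j , h , _ , e) = rep-is-top r in j , ∈-upTo⁺ (s≤s h) , e }))

    component-rows : ∀ {i k} → Rep τ κ (i , k) → Count (RowsOf τ κ (i , k)) (suc (length inner))
    component-rows {i} {k} r with rep⇒ r
    ... | refl , hd with head⇒ hd
    ...   | j , h , e = mapCount (λ w → index (w ⇧[ n ] j)) ribbon ribbon-unique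
      (λ a a' m m' → level-inj j (ribbon-up j h m) (ribbon-up j h m'))
      (λ w m → rows-inside⇐ j h e (subst (Inside j) (sym (b-index (ribbon-up j h m))) (ribbon-inside j m)))
      (λ i' R → let (w , m , e') = inside-ribbon {i'} j h (rows-inside⇒ j h e R) in w , m , sym (index-b i' e'))

    -- Higher levels lie in earlier rows, so the components below that of level j₀ are those of the
    -- j₀ smaller levels. This is the summand N of the spin.
    components-below : ∀ {j₀} → j₀ ≤ J → Count (λ a → Rep τ κ a × (suc (topRow j₀) < suc (proj₁ a))) j₀
    components-below {j₀} h₀ = subst (Count _) (length-upTo j₀) (mapCount (λ j → topRow j , part τ (topRow j)) (upTo j₀) (Uniq.upTo⁺ j₀)
      (λ a a' m m' e → topRow-inj (ok m) (ok m') (cong proj₁ e))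
      (λ a m → rep-top (ok m) , s≤s (topRow-<⁻ h₀ (ok m) (∈-upTo⁻ m)))
      (λ { (i , k) (r , lt) → let (j , h , _ , e) = rep-is-top r in
             j , ∈-upTo⁺ (topRow-< h₀ h (subst (topRow j₀ <_) (cong proj₁ e) (ℕP.≤-pred lt))) , e }))
      where ok : ∀ {j} → j ∈ upTo j₀ → j ≤ J
            ok m = ℕP.≤-trans (ℕP.<⇒≤ (∈-upTo⁻ m)) h₀

    spinOf : ℕ → ℕ
    spinOf j₀ = suc J ℕ.* length inner ℕ.+ j₀

    marked : ∀ {K} → StrongCover K τ κ → ∀ j₀ → j₀ ≤ J → MarkedCoverSpin K τ (suc (topRow j₀)) κ (spinOf j₀)
    marked S j₀ h = record
      { cover = S ; mark = (topRow j₀ , part τ (topRow j₀)) , rep-top h , refl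
      ; c = suc J ; h = suc (length inner) ; N = j₀
      ; #comp = components ; #rows = λ { (i , k) r → component-rows r } ; #below = components-below h ; spinEq = refl }

    marked⁻ : ∀ {K r s} → MarkedCoverSpin K τ r κ s → ∃ λ j₀ → j₀ ≤ J × r ≡ suc (topRow j₀) × s ≡ spinOf j₀
    marked⁻ M with MarkedCoverSpin.mark M
    ... | (i , k) , rep , refl with rep-is-top rep
    ...   | j₀ , h , _ , refl = j₀ , h , refl , ≡.trans (MarkedCoverSpin.spinEq M) (cong₂ ℕ._+_ (cong₂ ℕ._*_
            (count-unique (MarkedCoverSpin.#comp M) components (λ _ r → r) (λ _ r → r))
            (cong (_∸ 1) (count-unique (MarkedCoverSpin.#rows M _ rep) (component-rows rep) (λ _ r → r) (λ _ r → r))))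
            (count-unique (MarkedCoverSpin.#below M) (components-below h) (λ _ r → r) (λ _ r → r)))

-- The Pieri rule for one box

partition? : ∀ κ → Dec (IsPartition κ)
partition? κ with ℕP.allUpTo? (λ i → part κ (suc i) ≤? part κ i) (length κ) | All.all? (1 ≤?_) κ
... | yes p | yes q = yes ((λ i → dec i) , q)
  where
  dec : ∀ i → part κ (suc i) ≤ part κ i
  dec i with i <? length κ
  ... | yes h = p h
  ... | no h = ℕP.≤-trans (ℕP.≤-reflexive (part-beyond κ (suc i) (ℕP.m≤n⇒m≤1+n (ℕP.≮⇒≥ h)))) z≤n
... | no p | _ = no (λ k → p (λ {i} _ → proj₁ k i))
... | yes _ | no q = no (λ k → q (proj₂ k))

opaque
  core? : ∀ K κ → Dec (IsCore K κ)
  core? K κ with partition? κ | ℕP.allUpTo? row? (length κ)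
    where
    ne? : ∀ i j → Dec (hook κ i j ≢ suc K)
    ne? i j with hook κ i j ≟ suc K
    ... | yes e = no (λ k → k e)
    ... | no e = yes e
    row? : ∀ i → Dec (∀ {j} → j < part κ i → hook κ i j ≢ suc K)
    row? i = ℕP.allUpTo? (ne? i) (part κ i)
  ... | yes p | yes h = yes (p , λ i j lt → h (part-support κ i (ℕP.≤-<-trans z≤n lt)) lt)
  ... | no p | _ = no (p ∘ proj₁)
  ... | yes _ | no h = no (λ k → h (λ {i} _ {j} lt → proj₂ k i j lt))

Entry : Set
Entry = List ℕ × ℕ

wsum : List Entry → (List ℕ → ℕ → ℤ) → ℕ → ℤ
wsum [] F d = 0ℤ
wsum ((τ , s) ∷ xs) F d = shk s (F τ) d ℤ.+ wsum xs F d

shk-add : ∀ k (g h : ℕ → ℤ) d → shk k (λ d → g d ℤ.+ h d) d ≡ shk k g d ℤ.+ shk k h d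
shk-add zero g h d = refl
shk-add (suc k) g h zero = refl
shk-add (suc k) g h (suc d) = shk-add k g h d

shk-sh : ∀ k (g : ℕ → ℤ) d → shk k (sh g) d ≡ shk (suc k) g d
shk-sh zero g d = refl
shk-sh (suc k) g d = sh-cong (shk-sh k g) d

-- The start function is computed from 𝔭 instead of the beads, so that the value makes sense without
-- a proof that the list is a core.
ΦL : (K ℓ : ℕ) → Fn → List ℕ → ℕ → ℤ
ΦL K ℓ f τ = Catalan.Φ ℓ (suc K) f (D-of K (part (pmap K τ)))

D-of-pmap : ∀ K τ (E : ℕ → ℕ) → (∀ i → + part (pmap K τ) i ≡ wt (suc K) E i) → ∀ i → D-of K (part (pmap K τ)) i ≡ E i
D-of-pmap K τ E h i = ≡.trans (cong (_∸ part (pmap K τ) i) (lem (h i))) (ℕP.m+n∸n≡m (E i) (part (pmap K τ) i))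
  where lem : ∀ {u} → + u ≡ + (i ℕ.+ suc K) ℤ.- + E i → i ℕ.+ suc K ≡ E i ℕ.+ u
        lem e = linear (_ ∷ i ∷ K ∷ E i ∷ []) [] (↑ # 0 ≈ᶻ ↑ (# 1 ⊕ 1+ # 2) ⊖ ↑ # 3 ∷ [] ⊢ # 1 ⊕ 1+ # 2 ≈ⁿ # 3 ⊕ # 0) e

module CoreCovers (K : ℕ) (κ : List ℕ) (c : IsCore K κ) where
  n : ℕ
  n = suc K
  B : Beads n
  B = coreBeads c
  1≤n : 1 ≤ n
  1≤n = s≤s z≤n
  module R = Rows 1≤n B
  module Dc = Decide 1≤n B

  record Found (z : ℕ) : Set where
    constructor found
    field
      x : ℤ
      J : ℕ
      X : R.Exchange x (R.b z) J

  module At {z : ℕ} (F : Found z) where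
    open Found F public
    σ : Beads n
    σ = Swap.σ 1≤n B X

    list : List ℕ
    list = FromBeads.list σ

    list-dec : Decreasing (part list)
    list-dec = FromBeads.list-dec σ

    list-core : IsCore K list
    list-core = FromBeads.list-core σ

    list-beads : ∀ i → row-bead (part list) i ≡ Swap.bσ 1≤n B X i
    list-beads = FromBeads.list-beads σ

    list-pmap : ∀ i → + part (pmap K list) i ≡ wt n (Swap.Dσ 1≤n B X) i
    list-pmap = FromBeads.list-pmap σ

    inner : List ℤ
    inner = Ribbon.inner 1≤n B X

    topRow : ℕ → ℕ
    topRow j = RowLists.index 1≤n B (R.b z ⇧[ n ] j)

    b-topRow : ∀ {j} → j ≤ J → R.b (topRow j) ≡ R.b z ⇧[ n ] j
    b-topRow = Ribbon.InLists.b-topRow 1≤n B X list κ list-dec (core-dec c) list-beads (λ _ → refl)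

    row-< : ∀ {r} → x ℤ.< R.b r → r < length κ
    row-< {r} = Ribbon.row-< 1≤n B X {r}

    cover : StrongCover K list κ
    cover = list-core , c , (λ i → lem i (list-beads i) (Swap.bσ-≤ 1≤n B X i)) ,
      Ribbon.size-drop 1≤n B X (≡.trans (sum-part (pmap K κ) (length κ) (ℕP.≤-reflexive (length-pmap K κ))) (Σ<-cong (length κ) (λ i _ → core-pmap c i)))
        (≡.trans (sum-part (pmap K list) (length κ) (ℕP.≤-trans (ℕP.≤-reflexive (length-pmap K list)) (FromBeads.list-length σ))) (Σ<-cong (length κ) (λ i _ → list-pmap i)))
      where
      lem : ∀ i {u v} → + u ℤ.- + i ≡ v → v ℤ.≤ + part κ i ℤ.- + i → u ≤ part κ i
      lem i e h = linear (_ ∷ i ∷ _ ∷ []) (_ ∷ []) (↑ # 0 ⊖ ↑ # 1 ≈ᶻ # 0 ∷ # 0 ≤ᶻ ↑ # 2 ⊖ ↑ # 1 ∷ [] ⊢ # 0 ≤ⁿ # 2) (e , h)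

    steps : ℕ
    steps = suc J ℕ.* length inner

    j₀≤J : ∀ {p} j₀ → R.b p ≡ R.b z ⇧[ n ] j₀ → j₀ ≤ J
    j₀≤J {p} j₀ e with j₀ ≤? J
    ... | yes h = h
    ... | no h = ⊥-elim (R.Exchange.top∉ X (R.mem-le {R.b z} (ℕP.≰⇒> h) (p , e)))

    marked : ∀ j₀ → j₀ ≤ J → MarkedCoverSpin K list (suc (topRow j₀)) κ (steps ℕ.+ j₀)
    marked = Ribbon.InLists.marked 1≤n B X list κ list-dec (core-dec c) list-beads (λ _ → refl) cover

    marked⁻ : ∀ {r s} → MarkedCoverSpin K list r κ s → ∃ λ j₀ → j₀ ≤ J × r ≡ suc (topRow j₀) × s ≡ steps ℕ.+ j₀
    marked⁻ = Ribbon.InLists.marked⁻ 1≤n B X list κ list-dec (core-dec c) list-beads (λ _ → refl)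

    entry-marked : ∀ p j₀ → R.b p ≡ R.b z ⇧[ n ] j₀ → MarkedCoverSpin K list (suc p) κ (steps ℕ.+ j₀)
    entry-marked p j₀ e = subst (λ r → MarkedCoverSpin K list (suc r) κ (steps ℕ.+ j₀)) (RowLists.index-b 1≤n B p e) (marked j₀ (j₀≤J {p} j₀ e))

  entryAt : ∀ z → Dec (Found z) → ℕ → List Entry
  entryAt z (yes F) j₀ = (At.list F , At.steps F ℕ.+ j₀) ∷ []
  entryAt z (no _) j₀ = []

  opaque
    found? : ∀ z → Dec (Found z)
    found? z with Dc.exchange? (R.b z) (z , refl)
    ... | yes (x , J , X) = yes (found x J X)
    ... | no none = no (λ { (found x J X) → none (x , J , X) })

  -- Visits the rows p, D p, D (D p), ..., that is, goes down the runner of the marked bead. Row `z`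
  -- is tried as the row of the lowest exchanged bead y; the mark then sits on level `j₀`, which is
  -- its contribution to the spin.
  path : ℕ → ℕ → ℕ → List Entry
  path zero z j₀ = []
  path (suc m) z j₀ with z <? length κ
  ... | yes _ = entryAt z (found? z) j₀ ++ path m (R.D z) (suc j₀)
  ... | no _ = []

  next-bead : ∀ {p} z j₀ → R.b p ≡ R.b z ⇧[ n ] j₀ → R.b p ≡ R.b (R.D z) ⇧[ n ] suc j₀
  next-bead {p} z j₀ e = lem (R.b p) (R.b z) (R.b (R.D z)) e (R.b-D z)
    where lem : ∀ u v w → u ≡ v ⇧[ n ] j₀ → w ≡ v ℤ.- + n → u ≡ w ⇧[ n ] suc j₀
          lem u v w e e' = linear (j₀ ℕ.* n ∷ K ∷ []) (_ ∷ v ∷ _ ∷ []) (# 0 ≈ᶻ # 1 ⊕ ↑ # 0 ∷ # 2 ≈ᶻ # 1 ⊖ ↑ 1+ # 1 ∷ [] ⊢ # 0 ≈ᶻ # 2 ⊕ ↑ (1+ # 1 ⊕ # 0)) (e , e')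

  entry-sound : ∀ {p e} z F? j₀ → R.b p ≡ R.b z ⇧[ n ] j₀ → e ∈ entryAt z F? j₀ → MarkedCoverSpin K (proj₁ e) (suc p) κ (proj₂ e)
  entry-sound {p} z (yes F) j₀ e (here refl) = At.entry-marked F p j₀ e

  path-sound : ∀ {p e} m z j₀ → R.b p ≡ R.b z ⇧[ n ] j₀ → e ∈ path m z j₀ → MarkedCoverSpin K (proj₁ e) (suc p) κ (proj₂ e)
  path-sound {p} {e} (suc m) z j₀ eq mem with z <? length κ
  ... | yes _ = go (∈-++⁻ (entryAt z (found? z) j₀) mem)
    where
    go : e ∈ entryAt z (found? z) j₀ ⊎ e ∈ path m (R.D z) (suc j₀) → MarkedCoverSpin K (proj₁ e) (suc p) κ (proj₂ e)
    go (inj₁ l) = entry-sound {p} z (found? z) j₀ eq l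
    go (inj₂ r) = path-sound {p} m (R.D z) (suc j₀) (next-bead {p} z j₀ eq) r

  path-origin : ∀ {e} m z j₀ → e ∈ path m z j₀ → ∃ λ z' → ∃ λ i → R.b z ≡ R.b z' ⇧[ n ] i × ∃ λ (F : Found z') → proj₁ e ≡ At.list F
  path-origin {e} (suc m) z j₀ mem with z <? length κ
  ... | yes _ = go (∈-++⁻ (entryAt z (found? z) j₀) mem)
    where
    at : ∀ F? → e ∈ entryAt z F? j₀ → ∃ λ (F : Found z) → proj₁ e ≡ At.list F
    at (yes F) (here refl) = F , refl
    go : e ∈ entryAt z (found? z) j₀ ⊎ e ∈ path m (R.D z) (suc j₀) → ∃ λ z' → ∃ λ i → R.b z ≡ R.b z' ⇧[ n ] i × ∃ λ (F : Found z') → proj₁ e ≡ At.list F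
    go (inj₁ l) = z , 0 , sym (ℤP.+-identityʳ (R.b z)) , at (found? z) l
    go (inj₂ r) = let (z' , i , e' , F , q) = path-origin m (R.D z) (suc j₀) r in
      z' , suc i , lem (R.b z) (R.b (R.D z)) (R.b z') i (R.b-D z) e' , F , q
      where
      lem : ∀ u v w i → v ≡ u ℤ.- + n → v ≡ w ⇧[ n ] i → u ≡ w ⇧[ n ] suc i
      lem u v w i e e' = linear (K ∷ i ℕ.* n ∷ []) (_ ∷ _ ∷ w ∷ []) (# 0 ≈ᶻ # 1 ⊖ ↑ 1+ # 0 ∷ # 0 ≈ᶻ # 2 ⊕ ↑ # 1 ∷ [] ⊢ # 1 ≈ᶻ # 2 ⊕ ↑ (1+ # 0 ⊕ # 1)) (e , e')

  -- A cover found further down the runner has a component starting in a row below every component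
  -- start of the covers found before it.
  path-unique : ∀ m z j₀ → Unique (path m z j₀)
  path-unique zero z j₀ = []
  path-unique (suc m) z j₀ with z <? length κ
  ... | no _ = []
  ... | yes _ = join (found? z)
    where
    rest = path m (R.D z) (suc j₀)
    join : ∀ F? → Unique (entryAt z F? j₀ ++ rest)
    join (no _) = path-unique m (R.D z) (suc j₀)
    join (yes F) = All.tabulate fresh ∷ path-unique m (R.D z) (suc j₀)
      where
      fresh : ∀ {e} → e ∈ rest → (At.list F , At.steps F ℕ.+ j₀) ≢ e
      fresh mem refl = clash (path-origin m (R.D z) (suc j₀) mem)
        where
        clash : (∃ λ z' → ∃ λ i → R.b (R.D z) ≡ R.b z' ⇧[ n ] i × ∃ λ (F' : Found z') → At.list F ≡ At.list F') → ⊥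
        clash (z' , i , e , F' , q) = below (At.marked⁻ F (subst (λ τ → MarkedCoverSpin K τ (suc z') κ (At.steps F' ℕ.+ 0)) (sym q)
            (At.entry-marked F' z' 0 (sym (ℤP.+-identityʳ (R.b z'))))))
          where
          lem : ∀ u v w j → v ≡ u ℤ.- + n → v ≡ w ⇧[ n ] i → w ≡ u ⇧[ n ] j → ⊥
          lem u v w j a c d = linear (K ∷ i ℕ.* n ∷ j ℕ.* n ∷ []) (_ ∷ u ∷ _ ∷ []) (# 0 ≈ᶻ # 1 ⊖ ↑ 1+ # 0 ∷ # 0 ≈ᶻ # 2 ⊕ ↑ # 1 ∷ # 2 ≈ᶻ # 1 ⊕ ↑ # 2 ∷ [] ⊢ absurd) (a , c , d)
          below : (∃ λ j → j ≤ At.J F × suc z' ≡ suc (At.topRow F j) × _) → ⊥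
          below (j , h , e' , _) = lem (R.b z) (R.b (R.D z)) (R.b z') j (R.b-D z) e
            (≡.trans (cong R.b (ℕP.suc-injective e')) (At.b-topRow F h))

  path-hit : ∀ i m z z' j₀ {e} → z < length κ → R.b z' ≡ R.b z ⇧[ n ] i → length κ ≤ z' ℕ.+ m → e ∈ entryAt z (found? z) (j₀ ℕ.+ i) → e ∈ path m z' j₀
  path-hit i m z z' j₀ {e} z< eq fuel mem = go m fuel (z' <? length κ)
    where
    le : z' ≤ z
    le = R.cmp≤ {z'} {z} (lem (R.b z) (R.b z') eq)
      where lem : ∀ u v → v ≡ u ⇧[ n ] i → u ℤ.≤ v
            lem u v h = linear (i ℕ.* n ∷ []) (_ ∷ _ ∷ []) (# 0 ≈ᶻ # 1 ⊕ ↑ # 0 ∷ [] ⊢ # 1 ≤ᶻ # 0) h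
    go : ∀ m → length κ ≤ z' ℕ.+ m → Dec (z' < length κ) → e ∈ path m z' j₀
    go zero fuel _ = ⊥-elim (linear (_ ∷ _ ∷ _ ∷ []) [] (# 0 ≤ⁿ # 1 ⊕ lit 0 ∷ # 1 ≤ⁿ # 2 ∷ # 2 <ⁿ # 0 ∷ [] ⊢ absurd) (fuel , le , z<))
    go (suc m) fuel (no h) = ⊥-elim (h (ℕP.≤-<-trans le z<))
    go (suc m) fuel (yes h) with z' <? length κ
    ... | no h' = ⊥-elim (h' h)
    ... | yes _ = at i eq mem
      where
      at : ∀ i → R.b z' ≡ R.b z ⇧[ n ] i → e ∈ entryAt z (found? z) (j₀ ℕ.+ i) → e ∈ entryAt z' (found? z') j₀ ++ path m (R.D z') (suc j₀)
      at zero eq mem = ∈-++⁺ˡ (subst₂ (λ z j → e ∈ entryAt z (found? z) j) (sym (R.b-inj {z'} {z} (≡.trans eq (ℤP.+-identityʳ (R.b z))))) (ℕP.+-identityʳ j₀) mem)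
      at (suc i) eq mem = ∈-++⁺ʳ (entryAt z' (found? z') j₀) (path-hit i m z (R.D z') (suc j₀) z< (lem (R.b z) (R.b z') (R.b (R.D z')) eq (R.b-D z'))
          (ℕP.≤-trans fuel (ℕP.≤-trans (ℕP.≤-reflexive (ℕP.+-suc z' m)) (ℕP.+-monoˡ-≤ m (R.D-> z')))) (subst (λ j → e ∈ entryAt z (found? z) j) (ℕP.+-suc j₀ i) mem))
        where lem : ∀ u v w → v ≡ u ⇧[ n ] suc i → w ≡ v ℤ.- + n → w ≡ u ⇧[ n ] i
              lem u v w h k = linear (K ∷ i ℕ.* n ∷ []) (_ ∷ u ∷ _ ∷ []) (# 0 ≈ᶻ # 1 ⊕ ↑ (1+ # 0 ⊕ # 1) ∷ # 2 ≈ᶻ # 0 ⊖ ↑ 1+ # 0 ∷ [] ⊢ # 2 ≈ᶻ # 1 ⊕ ↑ # 1) (h , k)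

  module Sub (τ : List ℕ) (t : IsCore K τ) (τ⊆κ : ∀ i → part τ i ≤ part κ i) where
    T : Beads n
    T = coreBeads t

    T⊆ : ∀ i → Beads.b T i ℤ.≤ R.b i
    T⊆ i = lem i (τ⊆κ i)
      where lem : ∀ i {u v} → u ≤ v → + u ℤ.- + i ℤ.≤ + v ℤ.- + i
            lem i h = linear (_ ∷ _ ∷ i ∷ []) [] (# 0 ≤ⁿ # 1 ∷ [] ⊢ ↑ # 0 ⊖ ↑ # 2 ≤ᶻ ↑ # 1 ⊖ ↑ # 2) h

    module Bt = Between 1≤n B T T⊆

    Filled : ∀ {z} → Found z → Set
    Filled {z} (found x J _) = ∀ j → j ≤ J → Bt.PosOn (x ⇧[ n ] j) (R.b z ⇧[ n ] j)

    differ : τ ≢ κ → ∃ λ i → Beads.b T i ℤ.< R.b i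
    differ ne with ℕP.anyUpTo? (λ i → part τ i <? part κ i) (length κ)
    ... | yes (i , _ , h) = i , lem i h
      where lem : ∀ i {u v} → u < v → + u ℤ.- + i ℤ.< + v ℤ.- + i
            lem i h = linear (_ ∷ _ ∷ i ∷ []) [] (# 0 <ⁿ # 1 ∷ [] ⊢ ↑ # 0 ⊖ ↑ # 2 <ᶻ ↑ # 1 ⊖ ↑ # 2) h
    ... | no none = ⊥-elim (ne (part-ext (core-pos t) (core-pos c) (λ i → same i (i <? length κ))))
      where
      same : ∀ i → Dec (i < length κ) → part τ i ≡ part κ i
      same i (yes h) = ℕP.≤-antisym (τ⊆κ i) (ℕP.≮⇒≥ (λ k → none (i , h , k)))
      same i (no h) = ≡.trans (ℕP.n≤0⇒n≡0 (ℕP.≤-trans (τ⊆κ i) (ℕP.≤-reflexive (part-beyond κ i (ℕP.≮⇒≥ h))))) (sym (part-beyond κ i (ℕP.≮⇒≥ h)))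

    filled-cover : τ ≢ κ → ∃ λ z → ∃ λ (F : Found z) → Filled F
    filled-cover ne = let (i , lt) = differ ne in build (Bt.exchange-exists i lt)
      where
      build : Bt.Goal → ∃ λ z → ∃ λ (F : Found z) → Filled F
      build (x , y , J , X , P) = at (R.mem-base {y} J (R.Exchange.top∈ X))
        where
        at : R.mem y → ∃ λ z → ∃ λ (F : Found z) → Filled F
        at (z , refl) = z , found x J X , P

    filled-any : ∀ {z} (F F' : Found z) → Filled F → Filled F'
    filled-any {z} (found x J X) (found x' J' X') P = subst₂ (λ x J → ∀ j → j ≤ J → Bt.PosOn (x ⇧[ n ] j) (R.b z ⇧[ n ] j))
        (proj₁ u) (proj₂ u) P
      where u = Dc.exchange-unique X X'

    below : ∀ {z} (F : Found z) → Filled F → ∀ i → part τ i ≤ part (At.list F) i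
    below {z} F P i = lem i (Bt.below-σ (At.X F) P i) (At.list-beads F i)
      where lem : ∀ i {u v w} → + u ℤ.- + i ℤ.≤ w → + v ℤ.- + i ≡ w → u ≤ v
            lem i h e = linear (_ ∷ i ∷ _ ∷ []) (_ ∷ []) (↑ # 0 ⊖ ↑ # 1 ≤ᶻ # 0 ∷ ↑ # 2 ⊖ ↑ # 1 ≈ᶻ # 0 ∷ [] ⊢ # 0 ≤ⁿ # 2) (h , e)

-- Some exchange of κ still contains τ, and its size is one less than that of κ. Either it is τ, or
-- the argument repeats; `m` bounds the number of repetitions.
size-strict : ∀ {K} m κ τ → sum (pmap K κ) ≤ m → IsCore K κ → IsCore K τ → (∀ i → part τ i ≤ part κ i) → τ ≢ κ → sum (pmap K τ) < sum (pmap K κ)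
size-strict {K} m κ τ bound c t sub ne = go m bound (CoreCovers.Sub.filled-cover K κ c τ t sub ne)
  where
  open CoreCovers K κ c
  open Sub τ t sub
  go : ∀ m → sum (pmap K κ) ≤ m → (∃ λ z → ∃ λ (F : Found z) → Filled F) → sum (pmap K τ) < sum (pmap K κ)
  go m bound (z , F , P) = at m (Data.List.Properties.≡-dec _≟_ τ (At.list F)) bound
    where
    decrement : sum (pmap K (At.list F)) ℕ.+ 1 ≡ sum (pmap K κ)
    decrement = proj₂ (proj₂ (proj₂ (At.cover F)))
    lt : sum (pmap K (At.list F)) < sum (pmap K κ)
    lt = subst (sum (pmap K (At.list F)) <_) decrement (ℕP.≤-reflexive (ℕP.+-comm 1 _))
    at : ∀ m → Dec (τ ≡ At.list F) → sum (pmap K κ) ≤ m → sum (pmap K τ) < sum (pmap K κ)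
    at m (yes e) _ = subst (λ τ → sum (pmap K τ) < sum (pmap K κ)) (sym e) lt
    at zero (no _) bound = ⊥-elim (ℕP.<⇒≱ (ℕP.<-≤-trans lt bound) z≤n)
    at (suc m) (no ne') bound = ℕP.<-trans (size-strict m (At.list F) τ (ℕP.≤-pred (ℕP.≤-trans lt bound)) (At.list-core F) t (below F P) ne') lt

size-equal : ∀ {K κ τ} → IsCore K κ → IsCore K τ → (∀ i → part τ i ≤ part κ i) → sum (pmap K τ) ≡ sum (pmap K κ) → τ ≡ κ
size-equal {K} {κ} {τ} c t sub e with Data.List.Properties.≡-dec _≟_ τ κ
... | yes q = q
... | no ne = ⊥-elim (ℕP.<-irrefl e (size-strict (sum (pmap K κ)) κ τ ℕP.≤-refl c t sub ne))

module _ (K : ℕ) (κ : List ℕ) (c : IsCore K κ) where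
  open CoreCovers K κ c

  -- The smaller core of a strong cover lies inside an exchange of κ of the same size, hence equals
  -- it. The mark is the first row of a component, that is, of some level, and fixes the start of
  -- the walk.
  path-complete : ∀ {τ r s} → MarkedCoverSpin K τ r κ s → ∃ λ p → r ≡ suc p × (τ , s) ∈ path (length κ) p 0
  path-complete {τ} {r} {s} M = go (filled-cover τ≢κ)
    where
    S = MarkedCoverSpin.cover M
    t = proj₁ S
    τ⊆κ = proj₁ (proj₂ (proj₂ S))
    sizes = proj₂ (proj₂ (proj₂ S))
    open Sub τ t τ⊆κ
    τ≢κ : τ ≢ κ
    τ≢κ refl = ℕP.1+n≢n (≡.trans (ℕP.+-comm 1 _) sizes)
    go : (∃ λ z → ∃ λ (F : Found z) → Filled F) → ∃ λ p → r ≡ suc p × (τ , s) ∈ path (length κ) p 0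
    go (z , F , P) = finish (found? z) refl
      where
      finish : ∀ F? → F? ≡ found? z → ∃ λ p → r ≡ suc p × (τ , s) ∈ path (length κ) p 0
      finish (no none) _ = ⊥-elim (none F)
      finish (yes F') eq = at (At.marked⁻ F' (subst (λ τ → MarkedCoverSpin K τ r κ s) τ≡ M))
        where
        τ≡ : τ ≡ At.list F'
        τ≡ = size-equal (At.list-core F') t (below F' (filled-any F F' P))
          (ℕP.+-cancelʳ-≡ 1 _ _ (≡.trans sizes (sym (proj₂ (proj₂ (proj₂ (At.cover F')))))))
        z< : z < length κ
        z< = At.row-< F' {z} (R.Exchange.x<y (At.X F'))
        at : (∃ λ j₀ → j₀ ≤ At.J F' × r ≡ suc (At.topRow F' j₀) × s ≡ At.steps F' ℕ.+ j₀) → ∃ λ p → r ≡ suc p × (τ , s) ∈ path (length κ) p 0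
        at (j₀ , h , e , e') = p , e , path-hit j₀ (length κ) z p 0 z< (At.b-topRow F' h) (ℕP.m≤n+m (length κ) p)
            (subst (λ F? → (τ , s) ∈ entryAt z F? j₀) eq (here (cong₂ _,_ τ≡ e')))
          where p = At.topRow F' j₀

covers : ℕ → List ℕ → ℕ → List Entry
covers K κ p with core? K κ
... | yes c = CoreCovers.path K κ c (length κ) p 0
... | no _ = []

covers-sound : ∀ K κ p {e} → e ∈ covers K κ p → MarkedCoverSpin K (proj₁ e) (suc p) κ (proj₂ e)
covers-sound K κ p m with core? K κ
... | yes c = CoreCovers.path-sound K κ c {p} (length κ) p 0 (sym (ℤP.+-identityʳ _)) m

covers-complete : ∀ K κ {τ r s} → MarkedCoverSpin K τ r κ s → ∃ λ p → r ≡ suc p × (τ , s) ∈ covers K κ p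
covers-complete K κ M with core? K κ
... | yes c = path-complete K κ c M
... | no nc = ⊥-elim (nc (proj₁ (proj₂ (MarkedCoverSpin.cover M))))

covers-unique : ∀ K κ p → Unique (covers K κ p)
covers-unique K κ p with core? K κ
... | yes c = CoreCovers.path-unique K κ c (length κ) p 0
... | no _ = []

descending-roots : ∀ ℓ (E : ℕ → ℕ) → (∀ i → i < E i) → All (Descending ℓ) (Catalan.roots ℓ E)
descending-roots ℓ E h = All.tabulate (λ { {i , j} m → let (a , b , c) = Catalan.∈-roots⁻ ℓ E m in ℕP.<-≤-trans (h i) c , b })

module PathΦ (K : ℕ) (κ : List ℕ) (c : IsCore K κ) (ℓ : ℕ) (len≤ℓ : length κ ≤ ℓ) {p : ℕ} {f : Fn} (C : Class ℓ p f) where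
  open CoreCovers K κ c
  open Catalan ℓ

  γ : Wt
  γ = wt n R.D

  -- From an empty row on the entries sum to 0, so lowering that row makes the tail sum -1.
  empty-row : ∀ z → z < ℓ → length κ ≤ z → ∀ d → H R.D f (sub z γ) d ≡ 0ℤ
  empty-row z z<ℓ le = cat-tail ℓ (roots R.D) (descending-roots ℓ R.D R.D->) (C .vanish) z (sub z γ) (lem (tailSum-sub ℓ z z γ) zero-tail (tailδ-in ℓ z z ℕP.≤-refl z<ℓ))
    where
    zero-tail : tailSum ℓ z γ ≡ 0ℤ
    zero-tail = ≡.trans (Σ<-cong (ℓ ∸ z) (λ i _ → ≡.trans (sym (core-pmap c (z ℕ.+ i))) (cong +_ (part-beyond (pmap K κ) (z ℕ.+ i)
      (ℕP.≤-trans (ℕP.≤-reflexive (length-pmap K κ)) (ℕP.≤-trans le (ℕP.m≤m+n z i))))))) (Σ<-zero (ℓ ∸ z))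
    lem : ∀ {s t u} → s ≡ t ℤ.- u → t ≡ 0ℤ → u ≡ 1ℤ → s ℤ.< 0ℤ
    lem e e' e'' = linear [] (_ ∷ _ ∷ _ ∷ []) (# 0 ≈ᶻ # 1 ⊖ # 2 ∷ # 1 ≈ᶻ lit 0ℤ ∷ # 2 ≈ᶻ lit 1ℤ ∷ [] ⊢ # 0 <ᶻ lit 0ℤ) (e , e' , e'')

  entry-Φ : ∀ z j₀ → R.b p ≡ R.b z ⇧[ n ] j₀ → z < length κ → ∀ F? d →
    shk j₀ (Φ n f (upd R.D z (suc (R.D z)))) d ≡ wsum (entryAt z F? j₀) (ΦL K ℓ f) d
  entry-Φ z j₀ bp z< (yes F) d = ≡.trans (shk-cong j₀ (λ d → ≡.trans (Dc.Φ-exchange ℓ len≤ℓ C z j₀ bp (At.X F) d) (shk-cong (At.steps F) same d)) d)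
    (≡.trans (shk-+ j₀ (At.steps F) _ d) (≡.trans (cong (λ k → shk k (ΦL K ℓ f (At.list F)) d) (ℕP.+-comm j₀ (At.steps F))) (sym (ℤP.+-identityʳ _))))
    where
    same : ∀ d → Φ n f (Swap.Dσ 1≤n B (At.X F)) d ≡ ΦL K ℓ f (At.list F) d
    same d = sym (Φ-cong n (C .ext) _ _ (D-of-pmap K (At.list F) (Swap.Dσ 1≤n B (At.X F)) (At.list-pmap F)) d)
  entry-Φ z j₀ bp z< (no none) d = shk-zero j₀ (Dc.Φ-no-exchange ℓ len≤ℓ C z j₀ bp positive (λ { (x , J , X) → none (found x J X) })) d
    where
    positive : ℤ.- + z ℤ.< R.b z
    positive = lem (part-positive (core-pos c) z z<)
      where lem : ∀ {u} → 1 ≤ u → ℤ.- + z ℤ.< + u ℤ.- + z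
            lem h = linear (_ ∷ z ∷ []) [] (lit 1 ≤ⁿ # 0 ∷ [] ⊢ ⊝ ↑ # 1 <ᶻ ↑ # 0 ⊖ ↑ # 1) h

  -- The walk of `path` is the repeated expansion of first roots: each expansion splits off the
  -- start function increased at `z`, which `entry-Φ` straightens, and continues with the lowered
  -- row `D z` and one more factor t.
  path-Φ : ∀ m z j₀ → R.b p ≡ R.b z ⇧[ n ] j₀ → z < ℓ → length κ ≤ z ℕ.+ m → ∀ d →
    shk j₀ (H R.D f (sub z γ)) d ≡ wsum (path m z j₀) (ΦL K ℓ f) d
  path-Φ zero z j₀ bp z<ℓ fuel d = shk-zero j₀ (empty-row z z<ℓ (subst (length κ ≤_) (ℕP.+-identityʳ z) fuel)) d
  path-Φ (suc m) z j₀ bp z<ℓ fuel d with z <? length κ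
  ... | no h = shk-zero j₀ (empty-row z z<ℓ (ℕP.≮⇒≥ h)) d
  ... | yes h = ≡.trans (expand (R.D z <? ℓ)) (sym (wsum-++ (entryAt z (found? z) j₀) _))
    where
    wsum-++ : ∀ xs ys → wsum (xs ++ ys) (ΦL K ℓ f) d ≡ wsum xs (ΦL K ℓ f) d ℤ.+ wsum ys (ΦL K ℓ f) d
    wsum-++ [] ys = sym (ℤP.+-identityˡ _)
    wsum-++ (x ∷ xs) ys = ≡.trans (cong (λ v → shk (proj₂ x) (ΦL K ℓ f (proj₁ x)) d ℤ.+ v) (wsum-++ xs ys)) (sym (ℤP.+-assoc (shk (proj₂ x) (ΦL K ℓ f (proj₁ x)) d) _ _))
    E' = upd R.D z (suc (R.D z))
    fuel' : length κ ≤ R.D z ℕ.+ m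
    fuel' = ℕP.≤-trans fuel (ℕP.≤-trans (ℕP.≤-reflexive (ℕP.+-suc z m)) (ℕP.+-monoˡ-≤ m (R.D-> z)))
    bp' : R.b p ≡ R.b (R.D z) ⇧[ n ] suc j₀
    bp' = next-bead {p} z j₀ bp
    expand : Dec (R.D z < ℓ) → shk j₀ (H R.D f (sub z γ)) d ≡ wsum (entryAt z (found? z) j₀) (ΦL K ℓ f) d ℤ.+ wsum (path m (R.D z) (suc j₀)) (ΦL K ℓ f) d
    expand (yes lt) = ≡.trans (shk-cong j₀ (lower-row n (C .ext) R.D E' z z<ℓ lt (upd-same R.D z _) (upd-other R.D z _)) d)
      (≡.trans (shk-add j₀ _ _ d) (cong₂ ℤ._+_ (entry-Φ z j₀ bp h (found? z) d)
        (≡.trans (shk-sh j₀ _ d) (path-Φ m (R.D z) (suc j₀) bp' lt fuel' d))))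
    expand (no ge) = ≡.trans (shk-cong j₀ (lower-last-row n (C .ext) R.D E' z (ℕP.≮⇒≥ ge) (upd-same R.D z _) (upd-other R.D z _)) d)
      (≡.trans (entry-Φ z j₀ bp h (found? z) d) (≡.trans (sym (ℤP.+-identityʳ _)) (cong (λ v → wsum (entryAt z (found? z) j₀) (ΦL K ℓ f) d ℤ.+ v) (sym none))))
      where
      none : wsum (path m (R.D z) (suc j₀)) (ΦL K ℓ f) d ≡ 0ℤ
      none = cong (λ xs → wsum xs (ΦL K ℓ f) d) (past m (ℕP.≤-trans len≤ℓ (ℕP.≮⇒≥ ge)))
        where
        past : ∀ m → length κ ≤ R.D z → path m (R.D z) (suc j₀) ≡ []
        past zero _ = refl
        past (suc m) le with R.D z <? length κ
        ... | yes lt = ⊥-elim (ℕP.<⇒≱ lt le)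
        ... | no _ = refl

-- The dual Pieri rule for one box: lowering row p of the weight sums over the strong covers marked in row p.
covers-Φ : ∀ K κ ℓ → IsCore K κ → length κ ≤ ℓ → ∀ {p f} → p < ℓ → Class ℓ p f → ∀ d →
  Catalan.H ℓ (D-of K (part (pmap K κ))) f (sub p (wt (suc K) (D-of K (part (pmap K κ))))) d ≡ wsum (covers K κ p) (ΦL K ℓ f) d
covers-Φ K κ ℓ c len≤ℓ {p} {f} p<ℓ C d with core? K κ
... | no nc = ⊥-elim (nc c)
... | yes c' = ≡.trans (H-cong (C .ext) E R.D (λ i _ → E≡ i) _ d)
    (≡.trans (cat-ext (roots R.D) (C .ext) (λ k → cong (λ e → + (k ℕ.+ suc K) ℤ.- + e ℤ.- δ p k) (E≡ k)) d)
      (PathΦ.path-Φ K κ c' ℓ len≤ℓ C (length κ) p 0 (sym (ℤP.+-identityʳ _)) p<ℓ (ℕP.m≤n+m (length κ) p) d))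
  where
  open CoreCovers K κ c'
  open Catalan ℓ
  E = D-of K (part (pmap K κ))
  E≡ : ∀ i → E i ≡ R.D i
  E≡ = D-of-pmap K κ R.D (core-pmap c')

-- Strong strips and chains

-- A partially built tableau: its innermost core so far, the steps outward from it, and their total spin.
record State : Set where
  constructor state
  field
    core : List ℕ
    steps : List (ℕ × List ℕ)
    spin : ℕ
open State

push : ℕ → State → Entry → State
push p a (τ , s) = state τ ((suc p , core a) ∷ steps a) (s ℕ.+ spin a)

∈-concatMap-split : ∀ {A B : Set} (f : A → List B) xs {y} → y ∈ concatMap f xs → ∃ λ x → x ∈ xs × y ∈ f x
∈-concatMap-split f (x ∷ xs) m with ∈-++⁻ (f x) m
... | inj₁ l = x , here refl , l
... | inj₂ r = let (x' , m' , h) = ∈-concatMap-split f xs r in x' , there m' , h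

∈-concatMap-join : ∀ {A B : Set} (f : A → List B) {xs x y} → x ∈ xs → y ∈ f x → y ∈ concatMap f xs
∈-concatMap-join f (here refl) h = ∈-++⁺ˡ h
∈-concatMap-join f {x' ∷ xs} (there m) h = ∈-++⁺ʳ (f x') (∈-concatMap-join f m h)

concatMap-unique : ∀ {A B : Set} (f : A → List B) {xs} → Unique xs → (∀ x → x ∈ xs → Unique (f x)) →
  (∀ x x' y → x ∈ xs → x' ∈ xs → y ∈ f x → y ∈ f x' → x ≡ x') → Unique (concatMap f xs)
concatMap-unique f [] u d = []
concatMap-unique f {x ∷ xs} (p ∷ q) u d = Uniq.++⁺ (u x (here refl)) (concatMap-unique f q (λ x m → u x (there m)) (λ x x' y m m' → d x x' y (there m) (there m')))
  (λ { {y} (h , h') → let (x' , m' , h'') = ∈-concatMap-split f xs h' in All.lookup p m' (d x x' y (here refl) (there m') h h'') })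

spin-unique : ∀ {K τ r κ s s'} → MarkedCoverSpin K τ r κ s → MarkedCoverSpin K τ r κ s' → s ≡ s'
spin-unique M M' = ≡.trans (M .spinEq) (≡.trans (cong₂ ℕ._+_ (cong₂ ℕ._*_
    (count-unique (M .#comp) (M' .#comp) (λ _ r → r) (λ _ r → r))
    (cong (_∸ 1) (count-unique (M .#rows _ rep) (M' .#rows _ rep) (λ _ r → r) (λ _ r → r))))
    (count-unique (M .#below) (M' .#below) (λ _ r → r) (λ _ r → r))) (sym (M' .spinEq)))
  where
  open MarkedCoverSpin
  rep = proj₁ (proj₂ (M .mark))

contained-length : ∀ {τ κ} → All (1 ≤_) τ → (∀ i → part τ i ≤ part κ i) → length τ ≤ length κ
contained-length {τ} {κ} pos sub = ℕP.≮⇒≥ (λ h → ℕP.<⇒≱ (part-positive pos (length κ) h)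
  (ℕP.≤-trans (sub (length κ)) (ℕP.≤-reflexive (part-beyond κ (length κ) ℕP.≤-refl))))

cover-length : ∀ {K τ r κ s} → MarkedCoverSpin K τ r κ s → length τ ≤ length κ
cover-length {κ = κ} M = let (t , c , sub , _) = MarkedCoverSpin.cover M in contained-length {κ = κ} (core-pos t) sub

mark-row : ∀ {K τ r κ s} → MarkedCoverSpin K τ r κ s → ∃ λ p → p < length κ × r ≡ suc p
mark-row {κ = κ} M with MarkedCoverSpin.mark M
... | (i , j) , ((_ , h) , _) , e = i , part-support κ i (ℕP.≤-<-trans z≤n h) , e

chain-core : ∀ {K τ st κ s} → Chain K τ st κ s → IsCore K τ
chain-core (done c) = c
chain-core (step M _) = proj₁ (MarkedCoverSpin.cover M)

chain-end : ∀ {K τ st κ s} → Chain K τ st κ s → IsCore K κ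
chain-end (done c) = c
chain-end (step _ C) = chain-end C

chain-size : ∀ {K τ st κ s} → Chain K τ st κ s → sum (pmap K τ) ℕ.+ length st ≡ sum (pmap K κ)
chain-size (done _) = ℕP.+-identityʳ _
chain-size {K} {τ} (step {rest = rest} M C) = ≡.trans (≡.trans (sym (ℕP.+-assoc (sum (pmap K τ)) 1 (length rest)))
  (cong (ℕ._+ length rest) (proj₂ (proj₂ (proj₂ (MarkedCoverSpin.cover M)))))) (chain-size C)

blocks-length : ∀ {R : ℕ → ℕ → Set} es rs → Blocks R es rs → length rs ≡ sum es
blocks-length [] rs e = cong length e
blocks-length (e ∷ es) rs (le , _ , B) = ≡.trans (sym (ℕP.m+[n∸m]≡n le)) (cong (e ℕ.+_) (≡.trans (sym (Data.List.Properties.length-drop e rs)) (blocks-length es (drop e rs) B)))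

data Step (K : ℕ) : State → ℕ → State → Set where
  stepped : ∀ {κ τ st r s s'} → MarkedCoverSpin K τ r κ s' → Step K (state κ st s) r (state τ ((r , κ) ∷ st) (s' ℕ.+ s))

data Path (K : ℕ) : List ℕ → State → State → Set where
  [] : ∀ {a} → Path K [] a a
  _∷_ : ∀ {r w a b c} → Step K a r b → Path K w b c → Path K (r ∷ w) a c

marks : State → List ℕ
marks a = map proj₁ (steps a)

-- Paths run from the outer core inwards, tableaux are listed from the inside outwards; hence the
-- reversal.
path-marks : ∀ {K w a c} → Path K w a c → marks c ≡ w ʳ++ marks a
path-marks [] = refl
path-marks (stepped _ ∷ p) = path-marks p

path-snoc : ∀ {K w a b r c} → Path K w a b → Step K b r c → Path K (w ++ r ∷ []) a c
path-snoc [] s = s ∷ []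
path-snoc (x ∷ p) s = x ∷ path-snoc p s

-- The final state stores all intermediate cores and marks, so stripping equally many steps from it
-- leaves the same starting point.
path-determined : ∀ {K w w' a a' c} → length w ≡ length w' → Path K w a c → Path K w' a' c → w ≡ w' × core a ≡ core a' × steps a ≡ steps a'
path-determined e [] [] = refl , refl , refl
path-determined e (stepped m ∷ p) (stepped m' ∷ p') with path-determined (ℕP.suc-injective e) p p'
... | refl , refl , refl = refl , refl , refl

wsumS : List State → (List ℕ → ℕ → ℤ) → ℕ → ℤ
wsumS [] F d = 0ℤ
wsumS (a ∷ as) F d = shk (spin a) (F (core a)) d ℤ.+ wsumS as F d

wsumS-++ : ∀ xs ys F d → wsumS (xs ++ ys) F d ≡ wsumS xs F d ℤ.+ wsumS ys F d
wsumS-++ [] ys F d = sym (ℤP.+-identityˡ _)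
wsumS-++ (x ∷ xs) ys F d = ≡.trans (cong (λ v → shk (spin x) (F (core x)) d ℤ.+ v) (wsumS-++ xs ys F d)) (sym (ℤP.+-assoc (shk (spin x) (F (core x)) d) _ _))

-- The first entry of a weight belongs to the innermost strip, which is peeled last, so its operator
-- is the one closest to the functional.
apply : (ℕ → Fn → Fn) → List ℕ → Fn → Fn
apply G [] f = f
apply G (e ∷ es) f = apply G es (G e f)

apply-iterate : ∀ (G : ℕ → Fn → Fn) es (g : ℕ → Fn) → (∀ v → g (suc v) ≡ G (part es v) (g v)) → apply G es (g 0) ≡ g (length es)
apply-iterate G [] g s = refl
apply-iterate G (e ∷ es) g s = ≡.trans (cong (apply G es) (sym (s 0))) (apply-iterate G es (g ∘ suc) (s ∘ suc))

-- Both kinds of strips: q counts the rows still available, row q is the next of them, and after marking it nxt q are left.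
module Strips (ℓ : ℕ) (row nxt : ℕ → ℕ) (R : ℕ → ℕ → Set)
  (row-< : ∀ {q} → q < ℓ → row q < ℓ) (nxt-≤ : ∀ {q} → q < ℓ → nxt q ≤ ℓ)
  (row-inj : ∀ {q' q} → q' < q → q < ℓ → row q' ≢ row q)
  (row-surj : ∀ {p} → p < ℓ → ∃ λ q → q < ℓ × row q ≡ p)
  (R-row : ∀ {q q'} → q < ℓ → q' < nxt q → R (suc (row q')) (suc (row q)))
  (R-row⁻ : ∀ {q q'} → q < ℓ → q' < ℓ → R (suc (row q')) (suc (row q)) → q' < nxt q) (K : ℕ) where

  strips : ℕ → ℕ → State → List State
  strips q zero a = a ∷ []
  strips zero (suc d) a = []
  strips (suc q) (suc d) a = strips q (suc d) a ++ concatMap (λ e → strips (nxt q) d (push (row q) a e)) (covers K (core a) (row q))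

  -- The marks of one strip read inwards, as a sequence of decisions to pass over the next available
  -- row or to use it. This is the common recursion of `strips`, `es` and `hs`.
  data Word : ℕ → ℕ → List ℕ → Set where
    [] : ∀ {q} → Word q 0 []
    skip : ∀ {q d w} → Word q (suc d) w → Word (suc q) (suc d) w
    mark : ∀ {q d w} → Word (nxt q) d w → Word (suc q) (suc d) (suc (row q) ∷ w)

  word-length : ∀ {q d w} → Word q d w → length w ≡ d
  word-length [] = refl
  word-length (skip W) = word-length W
  word-length (mark W) = cong suc (word-length W)

  word-head : ∀ {q d r w} → Word q d (r ∷ w) → ∃ λ q' → q' < q × r ≡ suc (row q')
  word-head (skip W) = let (q' , h , e) = word-head W in q' , ℕP.m<n⇒m<1+n h , e
  word-head (mark {q} W) = q , ℕP.≤-refl , refl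

  Sound : ℕ → ℕ → State → Set
  Sound q d a = ∀ {c} → c ∈ strips q d a → ∃ λ w → Word q d w × Path K w a c

  sound-step : ∀ q d a → Sound q (suc d) a → (∀ e → Sound (nxt q) d (push (row q) a e)) → Sound (suc q) (suc d) a
  sound-step q d a skipped marked {c} m with ∈-++⁻ (strips q (suc d) a) m
  ... | inj₁ l = let (w , W , p) = skipped l in w , skip W , p
  ... | inj₂ r = let (e , m' , h) = ∈-concatMap-split (λ e → strips (nxt q) d (push (row q) a e)) (covers K (core a) (row q)) r
                     (w , W , p) = marked e h in
      suc (row q) ∷ w , mark W , stepped (covers-sound K (core a) (row q) m') ∷ p

  strips-sound : ∀ q d a → Sound q d a
  strips-sound q zero a (here refl) = [] , [] , []
  strips-sound (suc q) (suc d) a = sound-step q d a (strips-sound q (suc d) a) (λ e → strips-sound (nxt q) d (push (row q) a e))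

  strips-complete : ∀ {q d w a c} → Word q d w → Path K w a c → c ∈ strips q d a
  strips-complete [] [] = here refl
  strips-complete (skip W) p = ∈-++⁺ˡ (strips-complete W p)
  strips-complete {suc q} {suc d} {a = a} (mark W) (stepped {κ = κ} m ∷ p) with covers-complete K κ m
  ... | p' , refl , m' = ∈-++⁺ʳ (strips q (suc d) a) (∈-concatMap-join (λ e → strips (nxt q) d (push (row q) a e)) m' (strips-complete W p))

  strips-unique : ∀ q d a → q ≤ ℓ → Unique (strips q d a)
  strips-unique q zero a h = [] ∷ []
  strips-unique zero (suc d) a h = []
  strips-unique (suc q) (suc d) a h = Uniq.++⁺ (strips-unique q (suc d) a (ℕP.<⇒≤ h))
    (concatMap-unique later (covers-unique K (core a) (row q)) (λ e _ → strips-unique (nxt q) d (push (row q) a e) (nxt-≤ h)) same)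
    (λ { (l , r) → disjoint l r })
    where
    later : Entry → List State
    later e = strips (nxt q) d (push (row q) a e)
    same : ∀ e e' c → e ∈ covers K (core a) (row q) → e' ∈ covers K (core a) (row q) → c ∈ later e → c ∈ later e' → e ≡ e'
    same e e' c m m' h h' with strips-sound (nxt q) d (push (row q) a e) h | strips-sound (nxt q) d (push (row q) a e') h'
    ... | w , W , p | w' , W' , p' with path-determined (≡.trans (word-length W) (sym (word-length W'))) p p'
    ...   | _ , refl , _ = cong (proj₁ e ,_) (spin-unique (covers-sound K (core a) (row q) m) (covers-sound K (core a) (row q) m'))
    disjoint : ∀ {c} → c ∈ strips q (suc d) a → c ∈ concatMap later (covers K (core a) (row q)) → ⊥
    disjoint l r with strips-sound q (suc d) a l | ∈-concatMap-split later (covers K (core a) (row q)) r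
    ... | w , W , p | e , m , h' with strips-sound (nxt q) d (push (row q) a e) h'
    ...   | w' , W' , p' with path-determined (≡.trans (word-length W) (sym (cong suc (word-length W')))) p (stepped (covers-sound K (core a) (row q) m) ∷ p')
    ...     | refl , _ with word-head W
    ...       | q' , q'<q , e' = row-inj q'<q h (sym (ℕP.suc-injective e'))

  head-ok : ℕ → List ℕ → Set
  head-ok q [] = Data.Unit.⊤
  head-ok q (r ∷ _) = ∀ q' → q' < q → R (suc (row q')) r

  word-linked : ∀ {q d w acc} → q ≤ ℓ → Word q d w → Linked R acc → head-ok q acc → Linked R (w ʳ++ acc)
  word-linked h [] L ok = L
  word-linked {acc = []} h (skip W) L ok = word-linked (ℕP.<⇒≤ h) W L tt
  word-linked {acc = r ∷ acc} h (skip W) L ok = word-linked (ℕP.<⇒≤ h) W L (λ q' lt → ok q' (ℕP.m<n⇒m<1+n lt))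
  word-linked {acc = []} h (mark W) L ok = word-linked (nxt-≤ h) W [-] (λ q' lt → R-row h lt)
  word-linked {suc q} {acc = r ∷ acc} h (mark W) L ok = word-linked (nxt-≤ h) W (ok q ℕP.≤-refl ∷ L) (λ q' lt → R-row h lt)

  linked-suffix : ∀ w {acc} → Linked R (w ʳ++ acc) → Linked R acc
  linked-suffix [] L = L
  linked-suffix (x ∷ w) L = Linked.tail (linked-suffix w L)

  InRange : ℕ → Set
  InRange r = ∃ λ q → q < ℓ × r ≡ suc (row q)

  Starts : ℕ → List ℕ → Set
  Starts q w = ∀ r w' → w ≡ r ∷ w' → ∃ λ q' → q' < q × r ≡ suc (row q')

  word-step : ∀ n q r w {acc} → q < ℓ → All InRange w → Linked R (w ʳ++ r ∷ acc) → Starts (suc q) (r ∷ w) →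
    (Starts q (r ∷ w) → Word q (suc n) (r ∷ w)) → (Starts (nxt q) w → Word (nxt q) n w) → Word (suc q) (suc n) (r ∷ w)
  word-step n q r w {acc} h rs L hd skipped marked with hd r w refl
  ... | q' , lt , refl with q' ≟ q
  ...   | no ne = skip (skipped (λ { _ _ refl → q' , ℕP.≤∧≢⇒< (ℕP.≤-pred lt) ne , refl }))
  ...   | yes refl = mark (marked (next rs L))
    where
    next : ∀ {w} → All InRange w → Linked R (w ʳ++ suc (row q) ∷ acc) → Starts (nxt q) w
    next ((q₂ , q₂< , refl) ∷ _) L r w' refl = q₂ , R-row⁻ h q₂< (Linked.head (linked-suffix w' L)) , refl

  to-word : ∀ n q w {acc} → q ≤ ℓ → length w ≡ n → All InRange w → Linked R (w ʳ++ acc) → Starts q w → Word q n w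
  to-word zero q [] h e rs L hd = []
  to-word (suc n) zero (r ∷ w) h e rs L hd with hd r w refl
  ... | q' , () , _
  to-word (suc n) (suc q) (r ∷ w) {acc} h e (r∈ ∷ rs) L hd = word-step n q r w {acc} h rs L hd
    (to-word (suc n) q (r ∷ w) {acc} (ℕP.<⇒≤ h) e (r∈ ∷ rs) L) (to-word n (nxt q) w {r ∷ acc} (nxt-≤ h) (ℕP.suc-injective e) rs L)

  path-range : ∀ {w a c} → length (core a) ≤ ℓ → Path K w a c → All InRange w
  path-range h [] = []
  path-range h (stepped m ∷ p) with mark-row m
  ... | i , lt , refl with row-surj (ℕP.<-≤-trans lt h)
  ...   | q , q< , refl = (q , q< , refl) ∷ path-range (ℕP.≤-trans (cover-length m) h) p

  path-word : ∀ {w a c} → length (core a) ≤ ℓ → Path K w a c → Linked R (w ʳ++ []) → Word ℓ (length w) w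
  path-word {w} h p L = to-word (length w) ℓ w {[]} ℕP.≤-refl refl (path-range h p) L
    (λ { r w' refl → All.lookup (path-range h p) (here refl) })

  chains : List ℕ → State → List State
  chains [] a = a ∷ []
  chains (e ∷ es) a = concatMap (strips ℓ e) (chains es a)

  take-ʳ++ : ∀ (w m : List ℕ) → take (length w) (w ʳ++ m) ≡ w ʳ++ [] × drop (length w) (w ʳ++ m) ≡ m
  take-ʳ++ w m rewrite ʳ++-defn w {m} | ʳ++-defn w {[]} | sym (length-reverse w) | ++-identityʳ (reverse w) = go (reverse w)
    where
    go : ∀ v → take (length v) (v ++ m) ≡ v × drop (length v) (v ++ m) ≡ m
    go [] = refl , refl
    go (x ∷ v) = cong (x ∷_) (proj₁ (go v)) , proj₂ (go v)

  length-ʳ++ : ∀ (w m : List ℕ) → length w ≤ length (w ʳ++ m)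
  length-ʳ++ w m = ℕP.≤-trans (ℕP.m≤m+n (length w) (length m)) (ℕP.≤-reflexive (sym (Data.List.Properties.length-ʳ++ w)))

  path-chain : ∀ {w a c end} → Chain K (core a) (steps a) end (spin a) → Path K w a c → Chain K (core c) (steps c) end (spin c)
  path-chain C [] = C
  path-chain C (stepped m ∷ p) = path-chain (step m C) p

  chains-sound : ∀ es κ → IsCore K κ → ∀ {c} → c ∈ chains es (state κ [] 0) → Chain K (core c) (steps c) κ (spin c) × Blocks R es (marks c)
  chains-sound [] κ k (here refl) = done k , refl
  chains-sound (e ∷ es) κ k m with ∈-concatMap-split (strips ℓ e) (chains es (state κ [] 0)) m
  ... | b , m' , h with strips-sound ℓ e b h | chains-sound es κ k m'
  ...   | w , W , p | C , B with word-length W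
  ...     | refl = path-chain C p , subst (Blocks R (length w ∷ es)) (sym (path-marks p))
            (length-ʳ++ w (marks b) , subst (Linked R) (sym (proj₁ (take-ʳ++ w (marks b)))) (word-linked ℕP.≤-refl W [] tt)
            , subst (Blocks R es) (sym (proj₂ (take-ʳ++ w (marks b)))) B)

  chain-split : ∀ e {τ st end s} → e ≤ length st → Chain K τ st end s →
    ∃ λ b → ∃ λ w → length w ≡ e × Path K w b (state τ st s) × Chain K (core b) (steps b) end (spin b) × marks b ≡ drop e (map proj₁ st)
  chain-split zero h C = _ , [] , refl , [] , C , refl
  chain-split (suc e) (s≤s h) (step {r = r} m C) with chain-split e h C
  ... | b , w , len , p , C' , eq = b , w ++ r ∷ [] , ≡.trans (Data.List.Properties.length-++ w) (≡.trans (ℕP.+-comm (length w) 1) (cong suc len)) , path-snoc p (stepped m) , C' , eq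

  chain-length : ∀ {τ st end s} → Chain K τ st end s → length τ ≤ length end
  chain-length (done _) = ℕP.≤-refl
  chain-length (step m C) = ℕP.≤-trans (cover-length m) (chain-length C)

  chains-complete : ∀ es {κ τ st s} → length κ ≤ ℓ → Chain K τ st κ s → Blocks R es (map proj₁ st) → state τ st s ∈ chains es (state κ [] 0)
  chains-complete [] {st = []} h (done _) B = here refl
  chains-complete (e ∷ es) {κ} {τ} {st} {s} h C (le , L , B) with chain-split e (ℕP.≤-trans le (ℕP.≤-reflexive (length-map proj₁ st))) C
  ... | b , w , refl , p , C' , eq = ∈-concatMap-join (strips ℓ (length w)) (chains-complete es h C' (subst (Blocks R es) (sym eq) B))
    (strips-complete (path-word (ℕP.≤-trans (chain-length C') h) p
      (subst (Linked R) (≡.trans (cong (take (length w)) (path-marks p)) (proj₁ (take-ʳ++ w (marks b)))) L)) p)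

  chain-spin : ∀ {τ st end s s'} → Chain K τ st end s → Chain K τ st end s' → s ≡ s'
  chain-spin (done _) (done _) = refl
  chain-spin (step m C) (step m' C') = cong₂ ℕ._+_ (spin-unique m m') (chain-spin C C')

  chains-unique : ∀ es κ → IsCore K κ → Unique (chains es (state κ [] 0))
  chains-unique [] κ k = [] ∷ []
  chains-unique (e ∷ es) κ k = concatMap-unique (strips ℓ e) (chains-unique es κ k) (λ b _ → strips-unique ℓ e b ℕP.≤-refl) same
    where
    merge : ∀ b b' → b ∈ chains es (state κ [] 0) → b' ∈ chains es (state κ [] 0) → core b ≡ core b' → steps b ≡ steps b' → b ≡ b'
    merge (state τ st s) (state .τ .st s') m m' refl refl = cong (state τ st) (chain-spin (proj₁ (chains-sound es κ k m)) (proj₁ (chains-sound es κ k m')))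
    same : ∀ b b' c → b ∈ chains es (state κ [] 0) → b' ∈ chains es (state κ [] 0) → c ∈ strips ℓ e b → c ∈ strips ℓ e b' → b ≡ b'
    same b b' c m m' h h' = let (w , W , p) = strips-sound ℓ e b h
                                (w' , W' , p') = strips-sound ℓ e b' h'
                                (_ , q , q') = path-determined (≡.trans (word-length W) (sym (word-length W'))) p p' in merge b b' m m' q q'

  chains-Φ : ∀ (G : ℕ → Fn → Fn) → (∀ e {f} → Class ℓ 0 f → Class ℓ 0 (G e f)) →
    (∀ e {f} → Class ℓ 0 f → ∀ a → IsCore K (core a) → length (core a) ≤ ℓ → ∀ t → wsumS (strips ℓ e a) (ΦL K ℓ f) t ≡ shk (spin a) (ΦL K ℓ (G e f) (core a)) t) →
    ∀ es κ → IsCore K κ → length κ ≤ ℓ → ∀ {f} → Class ℓ 0 f → ∀ t → wsumS (chains es (state κ [] 0)) (ΦL K ℓ f) t ≡ ΦL K ℓ (apply G es f) κ t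
  chains-Φ G G-class strip [] κ k len C t = ℤP.+-identityʳ _
  chains-Φ G G-class strip (e ∷ es) κ k len {f} C t = ≡.trans (last-strip (chains es (state κ [] 0)) (λ b m → m)) (chains-Φ G G-class strip es κ k len (G-class e C) t)
    where
    last-strip : ∀ bs → (∀ b → b ∈ bs → b ∈ chains es (state κ [] 0)) → wsumS (concatMap (strips ℓ e) bs) (ΦL K ℓ f) t ≡ wsumS bs (ΦL K ℓ (G e f)) t
    last-strip [] sub = refl
    last-strip (b ∷ bs) sub = ≡.trans (wsumS-++ (strips ℓ e b) _ (ΦL K ℓ f) t)
      (cong₂ ℤ._+_ (strip e C b (chain-core chain) (ℕP.≤-trans (chain-length chain) len) t) (last-strip bs (λ b m → sub b (there m))))
      where chain = proj₁ (chains-sound es κ k (sub b (here refl)))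

  -- Here `g q d` is the adjoint of e_d or h_d in the `q` available rows, and `g-step` distinguishes
  -- whether the next row is used. In `g-class` the excluded swap belongs to the row about to be
  -- lowered, as the Pieri rule for one box permits.
  module Weighted {f : Fn} (g : ℕ → ℕ → Fn) (g-zero : ∀ q → g q 0 ≈ f) (g-none : ∀ d → g 0 (suc d) ≈ zeroFn)
    (g-step : ∀ q d → q < ℓ → ∀ γ t → g (suc q) (suc d) γ t ≡ g q (suc d) γ t ℤ.+ g (nxt q) d (sub (row q) γ) t)
    (g-class : ∀ q d → q < ℓ → Class ℓ (row q) (g (nxt q) d)) where
    open Catalan ℓ

    F : Fn → List ℕ → ℕ → ℤ
    F = ΦL K ℓ

    strips-Φ : ∀ q d a → q ≤ ℓ → IsCore K (core a) → length (core a) ≤ ℓ → ∀ t → wsumS (strips q d a) (F f) t ≡ shk (spin a) (F (g q d) (core a)) t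
    strips-Φ q zero a h k len t = ≡.trans (ℤP.+-identityʳ _) (shk-cong (spin a) (λ t → sym (cat-cong (roots _) (g-zero q) _ t)) t)
    strips-Φ zero (suc d) a h k len t = sym (shk-zero (spin a) (λ t → ≡.trans (cat-cong (roots E) (g-none d) (wt (suc K) E) t) (zeros (roots E) _ t)) t)
      where
      E = D-of K (part (pmap K (core a)))
      zeros : ∀ Ψ γ t → cat Ψ zeroFn γ t ≡ 0ℤ
      zeros [] γ t = refl
      zeros ((i , j) ∷ Ψ) γ t = ≡.trans (inv-cong i j (zeros Ψ) γ t) (go γ t)
        where go : ∀ γ t → inv i j zeroFn γ t ≡ 0ℤ
              go γ zero = refl
              go γ (suc t) = cong (λ x → 0ℤ ℤ.+ x) (go (raise i j γ) t)
    strips-Φ (suc q) (suc d) a h k len t = ≡.trans (wsumS-++ (strips q (suc d) a) _ (F f) t)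
      (≡.trans (cong₂ ℤ._+_ (strips-Φ q (suc d) a (ℕP.<⇒≤ h) k len t) (later (covers K κ (row q)) (λ e m → m)))
      (≡.trans (sym (shk-add (spin a) _ _ t)) (shk-cong (spin a) (λ t → sym (expand t)) t)))
      where
      κ = core a
      E = D-of K (part (pmap K κ))
      γ = wt (suc K) E
      g' = g (nxt q) d
      expand : ∀ t → F (g (suc q) (suc d)) κ t ≡ F (g q (suc d)) κ t ℤ.+ wsum (covers K κ (row q)) (F g') t
      expand t = ≡.trans (cat-cong (roots E) (g-step q d h) γ t) (≡.trans (cat-+ (roots E) (g q (suc d)) (λ γ → g' (sub (row q) γ)) γ t)
        (cong (λ v → F (g q (suc d)) κ t ℤ.+ v) (≡.trans (cat-translate (roots E) (g-class q d h .ext) (λ i → ℤ.- δ (row q) i) γ t)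
          (covers-Φ K κ ℓ k len (row-< h) (g-class q d h) t))))
      later : ∀ es → (∀ e → e ∈ es → e ∈ covers K κ (row q)) → wsumS (concatMap (λ e → strips (nxt q) d (push (row q) a e)) es) (F f) t ≡ shk (spin a) (wsum es (F g')) t
      later [] sub = sym (shk-zero (spin a) (λ _ → refl) t)
      later (e ∷ es) sub = ≡.trans (wsumS-++ (strips (nxt q) d (push (row q) a e)) _ (F f) t)
        (≡.trans (cong₂ ℤ._+_ (≡.trans (strips-Φ (nxt q) d (push (row q) a e) (nxt-≤ h) (proj₁ (MarkedCoverSpin.cover M)) (ℕP.≤-trans (cover-length M) len) t)
            (≡.trans (cong (λ k → shk k (F g' (proj₁ e)) t) (ℕP.+-comm (proj₂ e) (spin a))) (sym (shk-+ (spin a) (proj₂ e) _ t)))) (later es (λ e m → sub e (there m))))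
          (sym (shk-add (spin a) _ _ t)))
        where M = covers-sound K κ (row q) (sub e (here refl))

length-zero : ∀ {xs : List ℕ} → length xs ≡ 0 → xs ≡ []
length-zero {[]} _ = refl

-- Semistandard tableaux

rowAt : List (List ℕ) → ℕ → List ℕ
rowAt [] i = []
rowAt (r ∷ F) zero = r
rowAt (r ∷ F) (suc i) = rowAt F i

entry-rowAt : ∀ F i j → entry F i j ≡ part (rowAt F i) j
entry-rowAt [] i j = refl
entry-rowAt (r ∷ F) zero j = refl
entry-rowAt (r ∷ F) (suc i) j = entry-rowAt F i j

part-lengths : ∀ F i → part (map length F) i ≡ length (rowAt F i)
part-lengths [] i = refl
part-lengths (r ∷ F) zero = refl
part-lengths (r ∷ F) (suc i) = part-lengths F i

rowAt-ext : ∀ {F G} → All (λ r → 1 ≤ length r) F → All (λ r → 1 ≤ length r) G → (∀ i → rowAt F i ≡ rowAt G i) → F ≡ G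
rowAt-ext [] [] h = refl
rowAt-ext [] (p ∷ _) h = ⊥-elim (ℕP.<⇒≱ p (ℕP.≤-reflexive (cong length (sym (h 0)))))
rowAt-ext (p ∷ _) [] h = ⊥-elim (ℕP.<⇒≱ p (ℕP.≤-reflexive (cong length (h 0))))
rowAt-ext (p ∷ ps) (q ∷ qs) h = cong₂ _∷_ (h 0) (rowAt-ext ps qs (h ∘ suc))

fillRows : (ℕ → List ℕ) → ℕ → List (List ℕ)
fillRows r zero = []
fillRows r (suc m) with r 0
... | [] = []
... | x ∷ xs = (x ∷ xs) ∷ fillRows (r ∘ suc) m

fillRows-nonempty : ∀ r m → All (λ r → 1 ≤ length r) (fillRows r m)
fillRows-nonempty r zero = []
fillRows-nonempty r (suc m) with r 0
... | [] = []
... | x ∷ xs = s≤s z≤n ∷ fillRows-nonempty (r ∘ suc) m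

rowAt-fillRows : ∀ r m → (∀ i → length (r (suc i)) ≤ length (r i)) → (∀ i → m ≤ i → r i ≡ []) → ∀ i → rowAt (fillRows r m) i ≡ r i
rowAt-fillRows r zero dec z i = sym (z i z≤n)
rowAt-fillRows r (suc m) dec z i with r 0 in eq
rowAt-fillRows r (suc m) dec z i | [] = sym (empty (r i) (subst (λ v → length (r i) ≤ length v) eq (decreasing-≤ {length ∘ r} dec {0} {i} z≤n)))
  where empty : ∀ (xs : List ℕ) → length xs ≤ 0 → xs ≡ []
        empty [] _ = refl
rowAt-fillRows r (suc m) dec z zero | x ∷ xs = sym eq
rowAt-fillRows r (suc m) dec z (suc i) | x ∷ xs = rowAt-fillRows (r ∘ suc) m (λ i → dec (suc i)) (λ i h → z (suc i) (s≤s h)) i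

ΣN : ℕ → (ℕ → ℕ) → ℕ
ΣN zero h = 0
ΣN (suc m) h = ΣN m h ℕ.+ h m

ΣN-cong : ∀ m {g h : ℕ → ℕ} → (∀ i → i < m → g i ≡ h i) → ΣN m g ≡ ΣN m h
ΣN-cong zero e = refl
ΣN-cong (suc m) e = cong₂ ℕ._+_ (ΣN-cong m (λ i h → e i (ℕP.m<n⇒m<1+n h))) (e m ℕP.≤-refl)

ΣN-zero : ∀ m (h : ℕ → ℕ) → ΣN m h ≡ 0 → ∀ i → i < m → h i ≡ 0
ΣN-zero (suc m) h e i lt with i ≟ m
... | yes refl = ℕP.m+n≡0⇒n≡0 (ΣN m h) e
... | no ne = ΣN-zero m h (ℕP.m+n≡0⇒m≡0 (ΣN m h) e) i (ℕP.≤∧≢⇒< (ℕP.≤-pred lt) ne)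

ΣN-all-zero : ∀ m (h : ℕ → ℕ) → (∀ i → i < m → h i ≡ 0) → ΣN m h ≡ 0
ΣN-all-zero zero h e = refl
ΣN-all-zero (suc m) h e = cong₂ ℕ._+_ (ΣN-all-zero m h (λ i lt → e i (ℕP.m<n⇒m<1+n lt))) (e m ℕP.≤-refl)

ΣN-change : ∀ m p (g h : ℕ → ℕ) k → p < m → (∀ i → i ≢ p → g i ≡ h i) → g p ≡ h p ℕ.+ k → ΣN m g ≡ ΣN m h ℕ.+ k
ΣN-change (suc m) p g h k lt o e with p ≟ m
... | yes refl = linear (_ ∷ _ ∷ _ ∷ h m ∷ k ∷ []) [] (# 0 ≈ⁿ # 1 ∷ # 2 ≈ⁿ # 3 ⊕ # 4 ∷ [] ⊢ # 0 ⊕ # 2 ≈ⁿ # 1 ⊕ # 3 ⊕ # 4) (ΣN-cong m {g} {h} (λ i i< → o i (ℕP.<⇒≢ i<)) , e)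
... | no ne = linear (_ ∷ ΣN m h ∷ k ∷ _ ∷ _ ∷ []) [] (# 0 ≈ⁿ # 1 ⊕ # 2 ∷ # 3 ≈ⁿ # 4 ∷ [] ⊢ # 0 ⊕ # 3 ≈ⁿ # 1 ⊕ # 4 ⊕ # 2) (ΣN-change m p g h k (ℕP.≤∧≢⇒< (ℕP.≤-pred lt) ne) o e , o m (λ q → ne (sym q)))

ΣN-front : ∀ m (g : ℕ → ℕ) → ΣN (suc m) g ≡ g 0 ℕ.+ ΣN m (g ∘ suc)
ΣN-front zero g = sym (ℕP.+-identityʳ (g 0))
ΣN-front (suc m) g = ≡.trans (cong (ℕ._+ g (suc m)) (ΣN-front m g)) (ℕP.+-assoc (g 0) _ _)

ΣN-swap : ∀ m n (g : ℕ → ℕ → ℕ) → ΣN m (λ i → ΣN n (g i)) ≡ ΣN n (λ u → ΣN m (λ i → g i u))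
ΣN-swap zero n g = sym (ΣN-all-zero n _ (λ _ _ → refl))
ΣN-swap (suc m) n g = ≡.trans (cong (ℕ._+ ΣN n (g m)) (ΣN-swap m n g)) (sym (plus n (λ u → ΣN m (λ i → g i u)) (g m)))
  where
  plus : ∀ n (a b : ℕ → ℕ) → ΣN n (λ u → a u ℕ.+ b u) ≡ ΣN n a ℕ.+ ΣN n b
  plus zero a b = refl
  plus (suc n) a b = linear (_ ∷ ΣN n a ∷ ΣN n b ∷ a n ∷ b n ∷ []) [] (# 0 ≈ⁿ # 1 ⊕ # 2 ∷ [] ⊢ # 0 ⊕ (# 3 ⊕ # 4) ≈ⁿ # 1 ⊕ # 3 ⊕ (# 2 ⊕ # 4)) (plus n a b)

sum-rows : ∀ (h : List ℕ → ℕ) → h [] ≡ 0 → ∀ F m → length F ≤ m → sum (map h F) ≡ ΣN m (h ∘ rowAt F)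
sum-rows h h0 [] m le = sym (ΣN-all-zero m _ (λ i _ → h0))
sum-rows h h0 (r ∷ F) (suc m) (s≤s le) = ≡.trans (cong (h r ℕ.+_) (sum-rows h h0 F m le)) (sym (ΣN-front m (h ∘ rowAt (r ∷ F))))

sum-ΣN : ∀ xs m → length xs ≤ m → sum xs ≡ ΣN m (part xs)
sum-ΣN [] m le = sym (ΣN-all-zero m _ (λ i _ → refl))
sum-ΣN (x ∷ xs) (suc m) (s≤s le) = ≡.trans (cong (x ℕ.+_) (sum-ΣN xs m le)) (sym (ΣN-front m (part (x ∷ xs))))

rowAt-All : ∀ {P : List ℕ → Set} {F} → P [] → All P F → ∀ i → P (rowAt F i)
rowAt-All e [] i = e
rowAt-All e (p ∷ ps) zero = p
rowAt-All e (p ∷ ps) (suc i) = rowAt-All e ps i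

rows-All : ∀ {P : List ℕ → Set} F → (∀ i → P (rowAt F i)) → All P F
rows-All [] h = []
rows-All (r ∷ F) h = h 0 ∷ rows-All F (h ∘ suc)

trim-self : ∀ {xs} → All (1 ≤_) xs → trim xs ≡ xs
trim-self [] = refl
trim-self {suc x ∷ xs} (p ∷ ps) = cong (suc x ∷_) (trim-self ps)

trim-positive : ∀ xs → Decreasing (part xs) → All (1 ≤_) (trim xs)
trim-positive [] dec = []
trim-positive (zero ∷ xs) dec = subst (All (1 ≤_)) (sym (trim-zero (zero ∷ xs) (λ i → ℕP.n≤0⇒n≡0 (decreasing-≤ {part (0 ∷ xs)} dec {0} {i} z≤n)))) []
trim-positive (suc x ∷ xs) dec = s≤s z≤n ∷ trim-positive xs (dec ∘ suc)

cnt : ℕ → List ℕ → ℕ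
cnt u r = length (filter (λ x → x ≟ u) r)

cnt-zero : ∀ u r → All (_≢ u) r → cnt u r ≡ 0
cnt-zero u [] [] = refl
cnt-zero u (x ∷ r) (p ∷ ps) = ≡.trans (cong length (filter-reject (λ x → x ≟ u) p)) (cnt-zero u r ps)

cnt-zero⁻ : ∀ u r → cnt u r ≡ 0 → All (_≢ u) r
cnt-zero⁻ u [] e = []
cnt-zero⁻ u (x ∷ r) e with x ≟ u
... | yes q = ⊥-elim (ℕP.1+n≢0 (≡.trans (sym (cong length (filter-accept (λ x → x ≟ u) q))) e))
... | no q = q ∷ cnt-zero⁻ u r (≡.trans (sym (cong length (filter-reject (λ x → x ≟ u) q))) e)

cnt-snoc : ∀ u r x → cnt u (r ++ x ∷ []) ≡ cnt u r ℕ.+ cnt u (x ∷ [])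
cnt-snoc u r x = ≡.trans (cong length (filter-++ (λ x → x ≟ u) r (x ∷ []))) (length-++ (filter (λ x → x ≟ u) r))

cnt-self : ∀ x → cnt x (x ∷ []) ≡ 1
cnt-self x = cong length (filter-accept (λ y → y ≟ x) {x} {[]} refl)

cnt-other : ∀ u x → x ≢ u → cnt u (x ∷ []) ≡ 0
cnt-other u x ne = cong length (filter-reject (λ y → y ≟ u) {x} {[]} ne)

cnt-total : ∀ v r → All (λ x → 1 ≤ x × x ≤ v) r → length r ≡ ΣN v (λ u → cnt (suc u) r)
cnt-total v [] [] = sym (ΣN-all-zero v _ (λ _ _ → refl))
cnt-total v (suc y ∷ r) ((_ , y<v) ∷ ps) = ≡.trans (cong suc (cnt-total v r ps)) (≡.trans (ℕP.+-comm 1 _) (sym (ΣN-change v y _ _ 1 y<v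
  (λ u ne → cong length (filter-reject (λ x → x ≟ suc u) {suc y} {r} (λ e → ne (sym (ℕP.suc-injective e)))))
  (≡.trans (cong length (filter-accept (λ x → x ≟ suc y) {suc y} {r} refl)) (ℕP.+-comm 1 _)))))

part-snoc-old : ∀ r x j → j < length r → part (r ++ x ∷ []) j ≡ part r j
part-snoc-old (y ∷ r) x zero h = refl
part-snoc-old (y ∷ r) x (suc j) (s≤s h) = part-snoc-old r x j h

part-snoc-new : ∀ r x → part (r ++ x ∷ []) (length r) ≡ x
part-snoc-new [] x = refl
part-snoc-new (y ∷ r) x = part-snoc-new r x

part-All : ∀ {P : ℕ → Set} {r} → All P r → ∀ j → j < length r → P (part r j)
part-All (p ∷ ps) zero h = p
part-All (p ∷ ps) (suc j) (s≤s h) = part-All ps j h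

linked-snoc : ∀ {r x} → Linked _≤_ r → All (_≤ x) r → Linked _≤_ (r ++ x ∷ [])
linked-snoc [] [] = [-]
linked-snoc [-] (p ∷ []) = p ∷ [-]
linked-snoc (q ∷ L) (p ∷ ps) = q ∷ linked-snoc L ps

linked-snoc⁻ : ∀ r {x} → Linked _≤_ (r ++ x ∷ []) → Linked _≤_ r
linked-snoc⁻ [] L = []
linked-snoc⁻ (y ∷ []) L = [-]
linked-snoc⁻ (y ∷ y' ∷ r) (q ∷ L) = q ∷ linked-snoc⁻ (y' ∷ r) L

linked-last : ∀ r {x} → Linked _≤_ (r ++ x ∷ []) → All (_≤ x) r
linked-last [] L = []
linked-last (y ∷ []) (q ∷ L) = q ∷ []
linked-last (y ∷ y' ∷ r) (q ∷ L) with linked-last (y' ∷ r) L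
... | p ∷ ps = ℕP.≤-trans q p ∷ p ∷ ps

data Snoc : List ℕ → Set where
  nil : Snoc []
  snoc : ∀ r x → Snoc (r ++ x ∷ [])

snocView : ∀ r → Snoc r
snocView [] = nil
snocView (x ∷ r) with snocView r
... | nil = snoc [] x
... | snoc r' y = snoc (x ∷ r') y

dropLast : List ℕ → List ℕ
dropLast [] = []
dropLast (x ∷ []) = []
dropLast (x ∷ y ∷ r) = x ∷ dropLast (y ∷ r)

dropLast-snoc : ∀ r x → dropLast (r ++ x ∷ []) ≡ r
dropLast-snoc [] x = refl
dropLast-snoc (y ∷ []) x = refl
dropLast-snoc (y ∷ y' ∷ r) x = cong (y ∷_) (dropLast-snoc (y' ∷ r) x)

updRow : (ℕ → List ℕ) → ℕ → List ℕ → ℕ → List ℕ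
updRow r p v i with i ≟ p
... | yes _ = v
... | no _ = r i

updRow-same : ∀ r p v → updRow r p v p ≡ v
updRow-same r p v with p ≟ p
... | yes _ = refl
... | no h = ⊥-elim (h refl)

updRow-other : ∀ r p v i → i ≢ p → updRow r p v i ≡ r i
updRow-other r p v i h with i ≟ p
... | yes e = ⊥-elim (h e)
... | no _ = refl

module Fillings (ℓ : ℕ) (η : List ℕ) where

  addBox dropBox : ℕ → ℕ → List (List ℕ) → List (List ℕ)
  addBox p x F = fillRows (updRow (rowAt F) p (rowAt F p ++ x ∷ [])) ℓ
  dropBox p _ F = fillRows (updRow (rowAt F) p (dropLast (rowAt F p))) ℓ

  Shape : Set
  Shape = ℕ → ℕ

  cut : Shape → ℕ → Shape
  cut ν p = upd ν p (ν p ∸ 1)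

  record Full (v : ℕ) (ν : Shape) (F : List (List ℕ)) : Set where
    field
      nonempty : All (λ r → 1 ≤ length r) F
      shape : ∀ i → length (rowAt F i) ≡ ν i
      bound : ∀ i → All (λ x → 1 ≤ x × x ≤ v) (rowAt F i)
      sorted : ∀ i → Linked _≤_ (rowAt F i)
      columns : ∀ i j → j < ν (suc i) → part (rowAt F i) j < part (rowAt F (suc i)) j
      content : ∀ u → u < v → ΣN ℓ (λ i → cnt (suc u) (rowAt F i)) ≡ part η u

  -- entries up to suc v, with e entries suc v, all of them in the rows from p on
  record Partial (v e p : ℕ) (ν : Shape) (F : List (List ℕ)) : Set where
    field
      nonempty : All (λ r → 1 ≤ length r) F
      shape : ∀ i → length (rowAt F i) ≡ ν i
      bound : ∀ i → All (λ x → 1 ≤ x × x ≤ suc v) (rowAt F i)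
      sorted : ∀ i → Linked _≤_ (rowAt F i)
      columns : ∀ i j → j < ν (suc i) → part (rowAt F i) j < part (rowAt F (suc i)) j
      content : ∀ u → u < v → ΣN ℓ (λ i → cnt (suc u) (rowAt F i)) ≡ part η u
      top : ΣN ℓ (λ i → cnt (suc v) (rowAt F i)) ≡ e
      free : ∀ i → i < p → All (_≢ suc v) (rowAt F i)

  full⇒partial : ∀ {v ν F} → Full (suc v) ν F → Partial v (part η v) 0 ν F
  full⇒partial T = record { nonempty = nonempty ; shape = shape ; bound = bound ; sorted = sorted ; columns = columns
    ; content = λ u h → content u (ℕP.m<n⇒m<1+n h) ; top = content _ ℕP.≤-refl ; free = λ _ () }
    where open Full T

  partial⇒full : ∀ {v ν F} → Partial v (part η v) 0 ν F → Full (suc v) ν F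
  partial⇒full {v} {ν} {F} T = record { nonempty = nonempty ; shape = shape ; bound = bound ; sorted = sorted ; columns = columns ; content = all }
    where
    open Partial T
    all : ∀ u → u < suc v → ΣN ℓ (λ i → cnt (suc u) (rowAt F i)) ≡ part η u
    all u h with u ≟ v
    ... | yes refl = top
    ... | no ne = content u (ℕP.≤∧≢⇒< (ℕP.≤-pred h) ne)

  module _ (ν : Shape) (ν-dec : Decreasing ν) (ν-end : ∀ i → ℓ ≤ i → ν i ≡ 0) where

    row-end : ∀ {F} → (∀ i → length (rowAt F i) ≡ ν i) → ∀ i → ℓ ≤ i → rowAt F i ≡ []
    row-end {F} sh i h = length-zero (≡.trans (sh i) (ν-end i h))

    done⇒full : ∀ {v p F} → Partial v 0 p ν F → Full v ν F
    done⇒full {v} {p} {F} T = record { nonempty = nonempty ; shape = shape ; bound = tight ; sorted = sorted ; columns = columns ; content = content }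
      where
      open Partial T
      absent : ∀ i → All (_≢ suc v) (rowAt F i)
      absent i with i <? ℓ
      ... | yes h = cnt-zero⁻ (suc v) (rowAt F i) (ΣN-zero ℓ _ top i h)
      ... | no h = subst (All (_≢ suc v)) (sym (row-end {F} shape i (ℕP.≮⇒≥ h))) []
      tight : ∀ i → All (λ x → 1 ≤ x × x ≤ v) (rowAt F i)
      tight i = All.zipWith (λ { ((a , c) , ne) → a , ℕP.≤-pred (ℕP.≤∧≢⇒< c ne) }) (bound i , absent i)

    full⇒done : ∀ {v p F} → Full v ν F → Partial v 0 p ν F
    full⇒done {v} {p} {F} T = record { nonempty = nonempty ; shape = shape ; bound = λ i → All.map (λ { (a , c) → a , ℕP.m≤n⇒m≤1+n c }) (bound i)
      ; sorted = sorted ; columns = columns ; content = content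
      ; top = ΣN-all-zero ℓ _ (λ i _ → cnt-zero (suc v) (rowAt F i) (absent i)) ; free = λ i _ → absent i }
      where
      open Full T
      absent : ∀ i → All (_≢ suc v) (rowAt F i)
      absent i = All.map (λ { (a , c) refl → ℕP.<-irrefl refl c }) (bound i)

    stuck : ∀ {v e F} → ¬ Partial v (suc e) ℓ ν F
    stuck {v} {e} {F} T = ℕP.1+n≢0 (≡.trans (sym top) (ΣN-all-zero ℓ _ (λ i h → cnt-zero (suc v) (rowAt F i) (free i h))))
      where open Partial T

    weaken : ∀ {v e p F} → Partial v e (suc p) ν F → Partial v e p ν F
    weaken T = record { nonempty = nonempty ; shape = shape ; bound = bound ; sorted = sorted ; columns = columns ; content = content ; top = top
      ; free = λ i h → free i (ℕP.m<n⇒m<1+n h) }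
      where open Partial T

    module _ (p : ℕ) (p<ℓ : p < ℓ) (corner : ν (suc p) < ν p) where

      cut-dec : Decreasing (cut ν p)
      cut-dec i with suc i ≟ p | i ≟ p
      ... | yes refl | yes e = ⊥-elim (ℕP.1+n≢n (sym e))
      ... | yes refl | no _ = ℕP.≤-trans (ℕP.m∸n≤m _ 1) (ν-dec i)
      ... | no _ | yes refl = ℕP.≤-pred (ℕP.≤-trans corner (ℕP.≤-reflexive (sym (ℕP.m+[n∸m]≡n (ℕP.≤-trans (s≤s z≤n) corner)))))
      ... | no _ | no _ = ν-dec i

      cut-end : ∀ i → ℓ ≤ i → cut ν p i ≡ 0
      cut-end i h with i ≟ p
      ... | yes refl = ⊥-elim (ℕP.<⇒≱ p<ℓ h)
      ... | no _ = ν-end i h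

      cut-same : suc (cut ν p p) ≡ ν p
      cut-same = ≡.trans (cong suc (upd-same ν p _)) (ℕP.m+[n∸m]≡n (ℕP.≤-trans (s≤s z≤n) corner))

      cut-other : ∀ i → i ≢ p → cut ν p i ≡ ν i
      cut-other = upd-other ν p _

      module _ {v e : ℕ} {F : List (List ℕ)} (T : Partial v e p (cut ν p) F) where
        open Partial T
        private
          x = suc v
          new : ℕ → List ℕ
          new = updRow (rowAt F) p (rowAt F p ++ x ∷ [])
          new-p : new p ≡ rowAt F p ++ x ∷ []
          new-p = updRow-same (rowAt F) p _
          new-o : ∀ i → i ≢ p → new i ≡ rowAt F i
          new-o = updRow-other (rowAt F) p _
          new-shape : ∀ i → length (new i) ≡ ν i
          new-shape i with i ≟ p
          ... | yes refl = ≡.trans (length-++ (rowAt F p)) (≡.trans (ℕP.+-comm _ 1) (≡.trans (cong suc (shape p)) cut-same))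
          ... | no ne = ≡.trans (shape i) (cut-other i ne)
          rows : ∀ i → rowAt (addBox p x F) i ≡ new i
          rows = rowAt-fillRows new ℓ (λ i → subst₂ _≤_ (sym (new-shape (suc i))) (sym (new-shape i)) (ν-dec i))
            (λ i h → length-zero (≡.trans (new-shape i) (ν-end i h)))
          by-row : ∀ (P : ℕ → List ℕ → Set) → P p (rowAt F p ++ x ∷ []) → (∀ i → i ≢ p → P i (rowAt F i)) → ∀ i → P i (rowAt (addBox p x F) i)
          by-row P at-p at-o i with i ≟ p
          ... | yes refl = subst (P p) (sym (≡.trans (rows p) new-p)) at-p
          ... | no ne = subst (P i) (sym (≡.trans (rows i) (new-o i ne))) (at-o i ne)
        row-p : rowAt (addBox p x F) p ≡ rowAt F p ++ x ∷ []
        row-p = ≡.trans (rows p) new-p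
        row-o : ∀ i → i ≢ p → rowAt (addBox p x F) i ≡ rowAt F i
        row-o i ne = ≡.trans (rows i) (new-o i ne)
        private
          total : ∀ u → ΣN ℓ (λ i → cnt u (rowAt (addBox p x F) i)) ≡ ΣN ℓ (λ i → cnt u (rowAt F i)) ℕ.+ cnt u (x ∷ [])
          total u = ΣN-change ℓ p _ _ _ p<ℓ (λ i ne → cong (cnt u) (row-o i ne)) (≡.trans (cong (cnt u) row-p) (cnt-snoc u (rowAt F p) x))
          cols : ∀ i j → j < ν (suc i) → part (rowAt (addBox p x F) i) j < part (rowAt (addBox p x F) (suc i)) j
          cols i j h = by-cases (i ≟ p) (suc i ≟ p) (j ≟ length (rowAt F (suc i)))
            where
            by-cases : Dec (i ≡ p) → Dec (suc i ≡ p) → Dec (j ≡ length (rowAt F (suc i))) → part (rowAt (addBox p x F) i) j < part (rowAt (addBox p x F) (suc i)) j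
            by-cases (yes refl) (yes e') _ = ⊥-elim (ℕP.1+n≢n e')
            by-cases (yes refl) (no ne) _ = subst₂ _<_
              (sym (≡.trans (cong (λ r → part r j) row-p) (part-snoc-old (rowAt F p) x j (ℕP.<-≤-trans h (ℕP.≤-pred (ℕP.≤-trans corner (ℕP.≤-reflexive (≡.trans (sym cut-same) (cong suc (sym (shape p)))))))))))
              (cong (λ r → part r j) (sym (row-o (suc p) ne))) (columns p j (subst (j <_) (sym (cut-other (suc p) ne)) h))
            -- The new box itself: the entry above it lies in a row before `p`, which is still free
            -- of `v + 1`.
            by-cases (no ne) (yes refl) (yes refl) = subst₂ _<_ (cong (λ r → part r j) (sym (row-o i ne)))
                (sym (≡.trans (cong (λ r → part r j) row-p) (part-snoc-new (rowAt F (suc i)) x)))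
                (below-x (part-All (bound i) j j<) (part-All (free i ℕP.≤-refl) j j<))
              where
              j< : j < length (rowAt F i)
              j< = ℕP.<-≤-trans h (ℕP.≤-trans (ν-dec i) (ℕP.≤-reflexive (sym (≡.trans (shape i) (cut-other i ne)))))
              below-x : ∀ {y} → 1 ≤ y × y ≤ x → y ≢ x → y < x
              below-x (_ , le) nq = ℕP.≤∧≢⇒< le nq
            by-cases (no ne) (yes refl) (no nj) = subst₂ _<_ (cong (λ r → part r j) (sym (row-o i ne)))
                (sym (≡.trans (cong (λ r → part r j) row-p) (part-snoc-old (rowAt F (suc i)) x j j<)))
                (columns i j (subst (j <_) (shape (suc i)) j<))
              where
              j< : j < length (rowAt F (suc i))
              j< = ℕP.≤∧≢⇒< (ℕP.≤-pred (ℕP.≤-trans h (ℕP.≤-reflexive (≡.trans (sym cut-same) (cong suc (sym (shape (suc i)))))))) nj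
            by-cases (no ne) (no ne') _ = subst₂ _<_ (cong (λ r → part r j) (sym (row-o i ne))) (cong (λ r → part r j) (sym (row-o (suc i) ne')))
              (columns i j (subst (j <_) (sym (cut-other (suc i) ne')) h))

        add-partial : Partial v (suc e) p ν (addBox p x F)
        add-partial = record
          { nonempty = fillRows-nonempty new ℓ
          ; shape = λ i → ≡.trans (cong length (rows i)) (new-shape i)
          ; bound = by-row (λ _ r → All (λ y → 1 ≤ y × y ≤ x) r) (++⁺ (bound p) ((s≤s z≤n , ℕP.≤-refl) ∷ [])) (λ i _ → bound i)
          ; sorted = by-row (λ _ r → Linked _≤_ r) (linked-snoc (sorted p) (All.map proj₂ (bound p))) (λ i _ → sorted i)
          ; columns = cols
          ; content = λ u h → ≡.trans (total (suc u)) (≡.trans (cong₂ ℕ._+_ (content u h) (cnt-other (suc u) x (λ q → ℕP.<-irrefl (sym (ℕP.suc-injective q)) h))) (ℕP.+-identityʳ _))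
          ; top = ≡.trans (total x) (≡.trans (cong₂ ℕ._+_ top (cnt-self x)) (ℕP.+-comm e 1))
          ; free = λ i h → subst (All (_≢ x)) (sym (row-o i (ℕP.<⇒≢ h))) (free i h) }

        drop-add : dropBox p x (addBox p x F) ≡ F
        drop-add = rowAt-ext (fillRows-nonempty _ ℓ) nonempty (λ i → ≡.trans (rowAt-fillRows old ℓ old-dec old-end i) (old-row i))
          where
          old : ℕ → List ℕ
          old = updRow (rowAt (addBox p x F)) p (dropLast (rowAt (addBox p x F) p))
          old-row : ∀ i → old i ≡ rowAt F i
          old-row i with i ≟ p
          ... | yes refl = ≡.trans (cong dropLast row-p) (dropLast-snoc (rowAt F p) x)
          ... | no ne = row-o i ne
          len : ∀ i → length (old i) ≡ cut ν p i
          len i = ≡.trans (cong length (old-row i)) (shape i)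
          old-dec : ∀ i → length (old (suc i)) ≤ length (old i)
          old-dec i = subst₂ _≤_ (sym (len (suc i))) (sym (len i)) (cut-dec i)
          old-end : ∀ i → ℓ ≤ i → old i ≡ []
          old-end i h = length-zero (≡.trans (len i) (cut-end i h))

        add-has : ¬ All (_≢ x) (rowAt (addBox p x F) p)
        add-has a = All.lookup a (subst (x ∈_) (sym row-p) (∈-++⁺ʳ (rowAt F p) (here refl))) refl

      module _ {v e : ℕ} {F : List (List ℕ)} (T : Partial v (suc e) p ν F) (r : List ℕ) (ends : rowAt F p ≡ r ++ suc v ∷ []) where
        open Partial T
        private
          x = suc v
          old : ℕ → List ℕ
          old = updRow (rowAt F) p (dropLast (rowAt F p))
          old-p : old p ≡ r
          old-p = ≡.trans (updRow-same (rowAt F) p _) (≡.trans (cong dropLast ends) (dropLast-snoc r x))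
          old-o : ∀ i → i ≢ p → old i ≡ rowAt F i
          old-o = updRow-other (rowAt F) p _
          len-r : suc (length r) ≡ ν p
          len-r = ≡.trans (≡.trans (ℕP.+-comm 1 (length r)) (sym (length-++ r))) (≡.trans (cong length (sym ends)) (shape p))
          old-shape : ∀ i → length (old i) ≡ cut ν p i
          old-shape i with i ≟ p
          ... | yes refl = ≡.trans (cong length (≡.trans (cong dropLast ends) (dropLast-snoc r x))) (cong (_∸ 1) len-r)
          ... | no ne = shape i
          rows' : ∀ i → rowAt (dropBox p x F) i ≡ old i
          rows' = rowAt-fillRows old ℓ (λ i → subst₂ _≤_ (sym (old-shape (suc i))) (sym (old-shape i)) (cut-dec i))
            (λ i h → length-zero (≡.trans (old-shape i) (cut-end i h)))
          row'-p : rowAt (dropBox p x F) p ≡ r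
          row'-p = ≡.trans (rows' p) old-p
          row'-o : ∀ i → i ≢ p → rowAt (dropBox p x F) i ≡ rowAt F i
          row'-o i ne = ≡.trans (rows' i) (old-o i ne)
          by-row' : ∀ (P : ℕ → List ℕ → Set) → P p r → (∀ i → i ≢ p → P i (rowAt F i)) → ∀ i → P i (rowAt (dropBox p x F) i)
          by-row' P at-p at-o i with i ≟ p
          ... | yes refl = subst (P p) (sym row'-p) at-p
          ... | no ne = subst (P i) (sym (row'-o i ne)) (at-o i ne)
          total' : ∀ u → ΣN ℓ (λ i → cnt u (rowAt F i)) ≡ ΣN ℓ (λ i → cnt u (rowAt (dropBox p x F) i)) ℕ.+ cnt u (x ∷ [])
          total' u = ΣN-change ℓ p _ _ _ p<ℓ (λ i ne → cong (cnt u) (sym (row'-o i ne)))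
            (≡.trans (cong (cnt u) ends) (≡.trans (cnt-snoc u r x) (cong (λ w → cnt u w ℕ.+ cnt u (x ∷ [])) (sym row'-p))))
          cols' : ∀ i j → j < cut ν p (suc i) → part (rowAt (dropBox p x F) i) j < part (rowAt (dropBox p x F) (suc i)) j
          cols' i j h = by-cases (i ≟ p) (suc i ≟ p)
            where
            by-cases : Dec (i ≡ p) → Dec (suc i ≡ p) → part (rowAt (dropBox p x F) i) j < part (rowAt (dropBox p x F) (suc i)) j
            by-cases (yes refl) (yes e') = ⊥-elim (ℕP.1+n≢n e')
            by-cases (yes refl) (no ne) = subst₂ _<_
              (≡.trans (cong (λ w → part w j) ends) (≡.trans (part-snoc-old r x j (ℕP.<-≤-trans j< (ℕP.≤-pred (ℕP.≤-trans corner (ℕP.≤-reflexive (sym len-r)))))) (cong (λ w → part w j) (sym row'-p))))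
              (cong (λ w → part w j) (sym (row'-o (suc p) ne))) (columns p j j<)
              where j< : j < ν (suc p)
                    j< = subst (j <_) (cut-other (suc p) ne) h
            by-cases (no ne) (yes refl) = subst₂ _<_ (cong (λ w → part w j) (sym (row'-o i ne)))
              (≡.trans (cong (λ w → part w j) ends) (≡.trans (part-snoc-old r x j j<) (cong (λ w → part w j) (sym row'-p))))
              (columns i j (ℕP.<-≤-trans j< (ℕP.≤-trans (ℕP.n≤1+n _) (ℕP.≤-reflexive len-r))))
              where j< : j < length r
                    j< = ℕP.<-≤-trans h (ℕP.≤-reflexive (ℕP.suc-injective (≡.trans cut-same (sym len-r))))
            by-cases (no ne) (no ne') = subst₂ _<_ (cong (λ w → part w j) (sym (row'-o i ne))) (cong (λ w → part w j) (sym (row'-o (suc i) ne')))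
              (columns i j (subst (j <_) (cut-other (suc i) ne') h))

        drop-partial : Partial v e p (cut ν p) (dropBox p x F)
        drop-partial = record
          { nonempty = fillRows-nonempty old ℓ
          ; shape = λ i → ≡.trans (cong length (rows' i)) (old-shape i)
          ; bound = by-row' (λ _ w → All (λ y → 1 ≤ y × y ≤ x) w) (++⁻ˡ r (subst (All _) ends (bound p))) (λ i _ → bound i)
          ; sorted = by-row' (λ _ w → Linked _≤_ w) (linked-snoc⁻ r (subst (Linked _≤_) ends (sorted p))) (λ i _ → sorted i)
          ; columns = cols'
          ; content = λ u h → ≡.trans (≡.trans (sym (ℕP.+-identityʳ _)) (cong (ΣN ℓ (λ i → cnt (suc u) (rowAt (dropBox p x F) i)) ℕ.+_)
              (sym (cnt-other (suc u) x (λ q → ℕP.<-irrefl (sym (ℕP.suc-injective q)) h))))) (≡.trans (sym (total' (suc u))) (content u h))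
          ; top = ℕP.suc-injective (≡.trans (≡.trans (ℕP.+-comm 1 _) (cong (ΣN ℓ (λ i → cnt x (rowAt (dropBox p x F) i)) ℕ.+_) (sym (cnt-self x)))) (≡.trans (sym (total' x)) top))
          ; free = λ i h → subst (All (_≢ x)) (sym (row'-o i (ℕP.<⇒≢ h))) (free i h) }

        add-drop : addBox p x (dropBox p x F) ≡ F
        add-drop = rowAt-ext (fillRows-nonempty _ ℓ) nonempty same
          where
          same : ∀ i → rowAt (addBox p x (dropBox p x F)) i ≡ rowAt F i
          same i with i ≟ p
          ... | yes refl = ≡.trans (row-p drop-partial) (≡.trans (cong (λ w → w ++ x ∷ []) row'-p) (sym ends))
          ... | no ne = ≡.trans (row-o drop-partial i ne) (row'-o i ne)

    data Last (v p : ℕ) (F : List (List ℕ)) : Set where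
      absent : All (_≢ suc v) (rowAt F p) → Last v p F
      present : ∀ r → rowAt F p ≡ r ++ suc v ∷ [] → ν (suc p) < ν p → Last v p F

    -- In a sorted row the largest value `v + 1` can only stand at the end. Nothing can stand below
    -- it, as columns increase strictly, so row `p + 1` is shorter.
    last? : ∀ {v e p F} → Partial v e p ν F → Last v p F
    last? {v} {e} {p} {F} T = look (rowAt F p) refl (snocView (rowAt F p))
      where
      open Partial T
      look : ∀ w → rowAt F p ≡ w → Snoc w → Last v p F
      look _ eq nil = absent (subst (All _) (sym eq) [])
      look _ eq (snoc r y) with y ≟ suc v
      ... | no ne = absent (subst (All _) (sym eq) (++⁺ (All.map small (linked-last r (subst (Linked _≤_) eq (sorted p)))) (ne ∷ [])))
        where
        y< : y < suc v
        y< = ℕP.≤∧≢⇒< (proj₂ (All.lookup (subst (All _) eq (bound p)) (∈-++⁺ʳ r (here refl)))) ne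
        small : ∀ {a} → a ≤ y → a ≢ suc v
        small h refl = ℕP.<⇒≱ y< h
      ... | yes refl = present r eq (ℕP.≤∧≢⇒< (ν-dec p) flat)
        where
        flat : ν (suc p) ≢ ν p
        flat q = ℕP.<⇒≱ (columns p (length r) j<) (ℕP.≤-trans (proj₂ (part-All (bound (suc p)) (length r) (ℕP.<-≤-trans j< (ℕP.≤-reflexive (sym (shape (suc p)))))))
            (ℕP.≤-reflexive (sym (≡.trans (cong (λ w → part w (length r)) eq) (part-snoc-new r y)))))
          where
          j< : length r < ν (suc p)
          j< = ℕP.≤-reflexive (≡.trans (≡.trans (ℕP.+-comm 1 (length r)) (sym (length-++ r))) (≡.trans (cong length (sym eq)) (≡.trans (shape p) (sym q))))

  when : ∀ {A : Set} → Dec A → List (List (List ℕ)) → List (List (List ℕ))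
  when (yes _) xs = xs
  when (no _) xs = []

  -- The entries `v + 1` form a horizontal strip and are peeled box by box, rows from top to bottom:
  -- either row `p` has none left, or its last box is one. This is the recursion of `hs p c`, with
  -- `c` the number of rows from `p` on.
  fillings : ℕ → Shape → List (List (List ℕ))
  partials : ℕ → ℕ → ℕ → ℕ → Shape → List (List (List ℕ))
  fillings zero ν = [] ∷ []
  fillings (suc v) ν = partials v (part η v) 0 ℓ ν
  partials v zero p c ν = fillings v ν
  partials v (suc e) p zero ν = []
  partials v (suc e) p (suc c) ν = partials v (suc e) (suc p) c ν ++ when (ν (suc p) <? ν p) (map (addBox p (suc v)) (partials v e p (suc c) (cut ν p)))

  record Good (n : ℕ) (ν : Shape) : Set where
    constructor good
    field
      dec : Decreasing ν
      end : ∀ i → ℓ ≤ i → ν i ≡ 0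
      total : ΣN ℓ ν ≡ n

  good-cut : ∀ {n ν p} → Good (suc n) ν → p < ℓ → ν (suc p) < ν p → Good n (cut ν p)
  good-cut {n} {ν} {p} (good dec end total) h corner = good (cut-dec ν dec end p h corner) (cut-end ν dec end p h corner)
    (ℕP.suc-injective (≡.trans (ℕP.+-comm 1 _) (≡.trans (sym (ΣN-change ℓ p ν (cut ν p) 1 h (λ i ne → sym (upd-other ν p _ i ne))
      (≡.trans (sym (cut-same ν dec end p h corner)) (ℕP.+-comm 1 _)))) total)))

  weight : ℕ → ℕ
  weight v = ΣN v (part η)

  good-zero : ∀ {ν} → Good 0 ν → ∀ i → ν i ≡ 0
  good-zero {ν} (good _ end total) i with i <? ℓ
  ... | yes h = ΣN-zero ℓ ν total i h
  ... | no h = end i (ℕP.≮⇒≥ h)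

  cap : ∀ {p c} → p ℕ.+ suc c ≡ ℓ → p < ℓ × suc p ℕ.+ c ≡ ℓ
  cap {p} {c} e = ℕP.≤-trans (s≤s (ℕP.m≤m+n p c)) (ℕP.≤-reflexive e') , e'
    where e' = ≡.trans (sym (ℕP.+-suc p c)) e

  full-zero : ∀ {ν} → Good 0 ν → Full 0 ν []
  full-zero g = record { nonempty = [] ; shape = λ i → sym (good-zero g i) ; bound = λ _ → [] ; sorted = λ _ → []
    ; columns = λ i j h → ⊥-elim (ℕP.n≮0 (subst (j <_) (good-zero g (suc i)) h)) ; content = λ _ () }

  fillings-sound : ∀ v {ν} → Good (weight v) ν → ∀ {F} → F ∈ fillings v ν → Full v ν F
  partials-sound : ∀ v e p c {ν} → p ℕ.+ c ≡ ℓ → Good (weight v ℕ.+ e) ν → ∀ {F} → F ∈ partials v e p c ν → Partial v e p ν F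
  fillings-sound zero g (here refl) = full-zero g
  fillings-sound (suc v) g m = partial⇒full (partials-sound v (part η v) 0 ℓ refl g m)
  partials-sound v zero p c {ν} eq g@(good dec end total) m = full⇒done ν dec end (fillings-sound v (good dec end (≡.trans total (ℕP.+-identityʳ _))) m)
  partials-sound v (suc e) p (suc c) {ν} eq g@(good dec end _) m with ∈-++⁻ (partials v (suc e) (suc p) c ν) m
  ... | inj₁ l = weaken ν dec end (partials-sound v (suc e) (suc p) c (proj₂ (cap eq)) g l)
  ... | inj₂ r = marked (ν (suc p) <? ν p) r
    where
    g' : Good (suc (weight v ℕ.+ e)) ν
    g' = good dec end (≡.trans (Good.total g) (ℕP.+-suc _ e))
    marked : ∀ {F} (d : Dec (ν (suc p) < ν p)) → F ∈ when d (map (addBox p (suc v)) (partials v e p (suc c) (cut ν p))) → Partial v (suc e) p ν F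
    marked (yes corner) m with ∈-map⁻ (addBox p (suc v)) m
    ... | F' , m' , refl = add-partial ν dec end p (proj₁ (cap eq)) corner (partials-sound v e p (suc c) eq (good-cut g' (proj₁ (cap eq)) corner) m')

  fillings-complete : ∀ v {ν} → Good (weight v) ν → ∀ {F} → Full v ν F → F ∈ fillings v ν
  partials-complete : ∀ v e p c {ν} → p ℕ.+ c ≡ ℓ → Good (weight v ℕ.+ e) ν → ∀ {F} → Partial v e p ν F → F ∈ partials v e p c ν
  fillings-complete zero g {[]} T = here refl
  fillings-complete zero g {r ∷ F} T = ⊥-elim (ℕP.<⇒≱ (All.lookup (Full.nonempty T) (here refl)) (ℕP.≤-reflexive (≡.trans (Full.shape T 0) (good-zero g 0))))
  fillings-complete (suc v) g T = partials-complete v (part η v) 0 ℓ refl g (full⇒partial T)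
  partials-complete v zero p c {ν} eq (good dec end total) T = fillings-complete v (good dec end (≡.trans total (ℕP.+-identityʳ _))) (done⇒full ν dec end T)
  partials-complete v (suc e) p zero {ν} eq (good dec end _) T = ⊥-elim (stuck ν dec end (subst (λ q → Partial v (suc e) q ν _) (≡.trans (sym (ℕP.+-identityʳ p)) eq) T))
  partials-complete v (suc e) p (suc c) {ν} eq g@(good dec end _) {F} T with last? ν dec end T
  ... | absent a = ∈-++⁺ˡ (partials-complete v (suc e) (suc p) c (proj₂ (cap eq)) g (record { Partial T ; free = free' }))
    where
    free' : ∀ i → i < suc p → All (_≢ suc v) (rowAt F i)
    free' i h with i ≟ p
    ... | yes refl = a
    ... | no ne = Partial.free T i (ℕP.≤∧≢⇒< (ℕP.≤-pred h) ne)
  ... | present r ends corner = ∈-++⁺ʳ (partials v (suc e) (suc p) c ν) (subst (λ G → G ∈ _) (add-drop ν dec end p p< corner T r ends) (enter (ν (suc p) <? ν p) (∈-map⁺ (addBox p (suc v))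
      (partials-complete v e p (suc c) eq (good-cut (good dec end (≡.trans (Good.total g) (ℕP.+-suc _ e))) p< corner) (drop-partial ν dec end p p< corner T r ends)))))
    where
    p< = proj₁ (cap eq)
    enter : ∀ {G xs} (d : Dec (ν (suc p) < ν p)) → G ∈ xs → G ∈ when d xs
    enter (yes _) m = m
    enter (no k) m = ⊥-elim (k corner)

  map-unique : ∀ {A B : Set} (f : A → B) {xs} → Unique xs → (∀ x y → x ∈ xs → y ∈ xs → f x ≡ f y → x ≡ y) → Unique (map f xs)
  map-unique f [] inj = []
  map-unique f {x ∷ xs} (n ∷ u) inj = All.tabulate differ ∷ map-unique f u (λ a b m m' → inj a b (there m) (there m'))
    where
    differ : ∀ {y} → y ∈ map f xs → f x ≢ y
    differ m e with ∈-map⁻ f m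
    ... | z , m' , refl = All.lookup n m' (inj x z (here refl) (there m') e)

  fillings-unique : ∀ v {ν} → Good (weight v) ν → Unique (fillings v ν)
  partials-unique : ∀ v e p c {ν} → p ℕ.+ c ≡ ℓ → Good (weight v ℕ.+ e) ν → Unique (partials v e p c ν)
  fillings-unique zero g = [] ∷ []
  fillings-unique (suc v) g = partials-unique v (part η v) 0 ℓ refl g
  partials-unique v zero p c eq (good dec end total) = fillings-unique v (good dec end (≡.trans total (ℕP.+-identityʳ _)))
  partials-unique v (suc e) p zero eq g = []
  partials-unique v (suc e) p (suc c) {ν} eq g@(good dec end total) = Uniq.++⁺ (partials-unique v (suc e) (suc p) c (proj₂ (cap eq)) g) (proj₁ (boxed (ν (suc p) <? ν p)))
    (λ { (l , r) → proj₂ (boxed (ν (suc p) <? ν p)) r (Partial.free (partials-sound v (suc e) (suc p) c (proj₂ (cap eq)) g l) p ℕP.≤-refl) })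
    where
    p< = proj₁ (cap eq)
    xs = partials v e p (suc c) (cut ν p)
    boxed : (d : Dec (ν (suc p) < ν p)) → Unique (when d (map (addBox p (suc v)) xs)) ×
      (∀ {F} → F ∈ when d (map (addBox p (suc v)) xs) → ¬ All (_≢ suc v) (rowAt F p))
    boxed (no _) = [] , λ ()
    boxed (yes corner) = map-unique (addBox p (suc v)) (partials-unique v e p (suc c) eq g')
        (λ F G m m' q → ≡.trans (sym (drop-add ν dec end p p< corner (snd m))) (≡.trans (cong (dropBox p (suc v)) q) (drop-add ν dec end p p< corner (snd m'))))
      , λ m → has m
      where
      g' : Good (weight v ℕ.+ e) (cut ν p)
      g' = good-cut (good dec end (≡.trans total (ℕP.+-suc _ e))) p< corner
      snd : ∀ {F} → F ∈ xs → Partial v e p (cut ν p) F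
      snd m = partials-sound v e p (suc c) eq g' m
      has : ∀ {F} → F ∈ map (addBox p (suc v)) xs → ¬ All (_≢ suc v) (rowAt F p)
      has m with ∈-map⁻ (addBox p (suc v)) m
      ... | F' , m' , refl = add-has ν dec end p p< corner (snd m')

  open Sign ℓ using (unit-functional; unit-class; alternant-zero)

  -- The functional f_η of the overview, for the first `v` entries of η.
  functional : ℕ → Fn
  functional zero = unit-functional
  functional (suc v) = hs 0 ℓ (part η v) (functional v)

  functional-class : ∀ v → Class ℓ 0 (functional v)
  functional-class zero = unit-class
  functional-class (suc v) = hs-full (part η v) (functional-class v)

  -- Row `p` has no box to give. If another row follows, the lowered weight is fixed by the dot
  -- action of the swap at `p`, which `Class ℓ p` allows; if `p` is the last row, it is empty and
  -- its tail sum becomes -1.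
  flat-vanishes : ∀ {p G} {ν : Shape} → Class ℓ p G → p < ℓ → (∀ i → ℓ ≤ i → ν i ≡ 0) → ν (suc p) ≡ ν p → G (sub p (λ i → + ν i)) 0 ≡ 0ℤ
  flat-vanishes {p} {G} {ν} C h end flat with suc p <? ℓ
  ... | no k = C .vanish p _ (ℤP.≤-<-trans (ℤP.≤-reflexive tail) (ℤ.-<+ {0} {0})) 0
    where
    last : suc p ≡ ℓ
    last = ℕP.≤-antisym h (ℕP.≮⇒≥ k)
    zero-p : ν p ≡ 0
    zero-p = ≡.trans (sym flat) (end (suc p) (ℕP.≮⇒≥ k))
    tail : tailSum ℓ p (sub p (λ i → + ν i)) ≡ -[1+ 0 ]
    tail = ≡.trans (cong (λ m → tailSum m p (sub p (λ i → + ν i))) (sym last)) (≡.trans (cong (λ m → Σ< m (λ i → sub p (λ i → + ν i) (p ℕ.+ i))) (ℕP.m+n∸n≡m 1 p))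
      (≡.trans (ℤP.+-identityˡ _) (≡.trans (cong (sub p (λ i → + ν i)) (ℕP.+-identityʳ p)) (cong₂ (λ a b → + a ℤ.- b) zero-p (δ-refl p)))))
  ... | yes k = lemma _ (≡.trans (C .ext fixed 0) (C .anti p k ℕP.1+n≢n (sub p (λ i → + ν i)) 0))
    where
    lemma : ∀ a → a ≡ ℤ.- a → a ≡ 0ℤ
    lemma a e = linear [] (_ ∷ []) (# 0 ≈ᶻ ⊝ # 0 ∷ [] ⊢ # 0 ≈ᶻ lit 0ℤ) e
    fixed : ∀ i → sub p (λ i → + ν i) i ≡ dotSwap p (sub p (λ i → + ν i)) i
    fixed i with place p i
    ... | left = ≡.trans (at-p (+ ν p)) (cong₂ (λ a b → a ℤ.+ b) (sym (≡.trans (cong (sub p (λ i → + ν i)) (sw-l p)) (cong₂ (λ a b → + a ℤ.- b) flat (δ-≢ p (suc p) (λ e → ℕP.1+n≢n (sym e))))))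
        (cong₂ ℤ._-_ (sym (δ-≢ (suc p) p ℕP.1+n≢n)) (sym (δ-refl p))))
      where at-p : ∀ a → a ℤ.- δ p p ≡ a ℤ.- 0ℤ ℤ.+ (0ℤ ℤ.- 1ℤ)
            at-p a = linear [] (_ ∷ a ∷ []) (# 0 ≈ᶻ lit 1ℤ ∷ [] ⊢ # 1 ⊖ # 0 ≈ᶻ # 1 ⊖ lit 0ℤ ⊕ (lit 0ℤ ⊖ lit 1ℤ)) (δ-refl p)
    ... | right = ≡.trans (next-p (+ ν (suc p))) (cong₂ (λ a b → a ℤ.+ b) (sym (≡.trans (cong (sub p (λ i → + ν i)) (sw-r p)) (cong₂ (λ a b → + a ℤ.- b) (sym flat) (δ-refl p))))
        (cong₂ ℤ._-_ (sym (δ-refl (suc p))) (sym (δ-≢ p (suc p) (λ e → ℕP.1+n≢n (sym e))))))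
      where next-p : ∀ a → a ℤ.- δ p (suc p) ≡ a ℤ.- 1ℤ ℤ.+ (1ℤ ℤ.- 0ℤ)
            next-p a = linear [] (_ ∷ a ∷ []) (# 0 ≈ᶻ lit 0ℤ ∷ [] ⊢ # 1 ⊖ # 0 ≈ᶻ # 1 ⊖ lit 1ℤ ⊕ (lit 1ℤ ⊖ lit 0ℤ)) (δ-≢ p (suc p) (λ e → ℕP.1+n≢n (sym e)))
    ... | other a b = sym (≡.trans (cong₂ (λ x y → x ℤ.+ y) (cong (sub p (λ i → + ν i)) (sw-o p i a b)) (cong₂ ℤ._-_ (δ-≢ (suc p) i (λ e → b (sym e))) (δ-≢ p i (λ e → a (sym e)))))
        (ℤP.+-identityʳ _))

  -- The recursions of the lists and of `hs` agree term by term; where no box can be removed, the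
  -- list is empty and `flat-vanishes` gives 0.
  fillings-count : ∀ v {ν} → Good (weight v) ν → + length (fillings v ν) ≡ functional v (λ i → + ν i) 0
  partials-count : ∀ v e p c {ν} → p ℕ.+ c ≡ ℓ → Good (weight v ℕ.+ e) ν → + length (partials v e p c ν) ≡ hs p c e (functional v) (λ i → + ν i) 0
  fillings-count zero g = sym (alternant-zero _ (λ i _ → cong +_ (good-zero g i)))
  fillings-count (suc v) g = partials-count v (part η v) 0 ℓ refl g
  partials-count v zero p c eq (good dec end total) = fillings-count v (good dec end (≡.trans total (ℕP.+-identityʳ _)))
  partials-count v (suc e) p zero eq g = refl
  partials-count v (suc e) p (suc c) {ν} eq g@(good dec end total) = ≡.trans (cong +_ (length-++ (partials v (suc e) (suc p) c ν)))
    (cong₂ ℤ._+_ (partials-count v (suc e) (suc p) c (proj₂ (cap eq)) g) (boxed (ν (suc p) <? ν p) (λ corner → partials-count v e p (suc c) eq (g' corner))))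
    where
    p< = proj₁ (cap eq)
    G = hs p (suc c) e (functional v)
    C : Class ℓ p G
    C = hs-class p (suc c) e eq (functional-class v)
    g' : ν (suc p) < ν p → Good (weight v ℕ.+ e) (cut ν p)
    g' corner = good-cut (good dec end (≡.trans total (ℕP.+-suc _ e))) p< corner
    xs = partials v e p (suc c) (cut ν p)
    boxed : (d : Dec (ν (suc p) < ν p)) → (ν (suc p) < ν p → + length xs ≡ G (λ i → + cut ν p i) 0) →
      + length (when d (map (addBox p (suc v)) xs)) ≡ G (sub p (λ i → + ν i)) 0
    boxed (no k) _ = sym (flat-vanishes {G = G} C p< end (ℕP.≤-antisym (dec p) (ℕP.≮⇒≥ k)))
    boxed (yes corner) ih = ≡.trans (cong +_ (length-map (addBox p (suc v)) xs)) (≡.trans (ih corner) (C .ext cut-sub 0))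
      where
      cut-sub : ∀ i → + cut ν p i ≡ sub p (λ i → + ν i) i
      cut-sub i with i ≟ p
      ... | yes refl rewrite δ-refl p = linear (_ ∷ _ ∷ []) [] (lit 1 ⊕ # 0 ≈ⁿ # 1 ∷ [] ⊢ ↑ # 0 ≈ᶻ ↑ # 1 ⊕ ⊝ ↑ lit 1) (ℕP.m+[n∸m]≡n {1} {ν p} (ℕP.≤-trans (s≤s z≤n) corner))
      ... | no ne rewrite δ-≢ p i (λ e → ne (sym e)) = sym (ℤP.+-identityʳ _)

  full-weight : ∀ {v ν F} → Full v ν F → ΣN ℓ ν ≡ weight v
  full-weight {v} {ν} {F} T = ≡.trans (ΣN-cong ℓ (λ i _ → ≡.trans (sym (shape i)) (cnt-total v (rowAt F i) (bound i))))
    (≡.trans (ΣN-swap ℓ v (λ i u → cnt (suc u) (rowAt F i))) (ΣN-cong v content))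
    where open Full T

  module _ (ν : List ℕ) (dec : Decreasing (part ν)) (end : ∀ i → ℓ ≤ i → part ν i ≡ 0) where

    full⇒ssyt : ∀ {F} → Full (length η) (part ν) F → SSYT ν η F
    full⇒ssyt {F} T = ≡.trans (sym (trim-self lengths)) (trim-ext (map length F) ν (λ i → ≡.trans (part-lengths F i) (shape i)))
      , rows-All F (λ i → All.map proj₁ (bound i)) , rows-All F sorted
      , (λ i j h → subst₂ _<_ (sym (entry-rowAt F i j)) (sym (entry-rowAt F (suc i) j))
          (columns i j (subst (j <_) (≡.trans (part-lengths F (suc i)) (shape (suc i))) h)))
      , (λ u → ≡.trans (sum-rows (cnt (suc u)) refl F ℓ len) (count u))
      where
      open Full T
      lengths : All (1 ≤_) (map length F)
      lengths = mapped F nonempty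
        where
        mapped : ∀ G → All (λ r → 1 ≤ length r) G → All (1 ≤_) (map length G)
        mapped [] [] = []
        mapped (r ∷ G) (p ∷ ps) = p ∷ mapped G ps
      len : length F ≤ ℓ
      len = ℕP.≮⇒≥ (λ h → ℕP.<⇒≱ (part-positive lengths ℓ (subst (ℓ <_) (sym (length-map length F)) h))
        (ℕP.≤-reflexive (≡.trans (part-lengths F ℓ) (≡.trans (shape ℓ) (end ℓ ℕP.≤-refl)))))
      count : ∀ u → ΣN ℓ (λ i → cnt (suc u) (rowAt F i)) ≡ part η u
      count u with u <? length η
      ... | yes h = content u h
      ... | no h = ≡.trans (ΣN-all-zero ℓ _ (λ i _ → cnt-zero (suc u) (rowAt F i) (All.map (λ { (_ , le) refl → h le }) (bound i))))
        (sym (part-beyond η u (ℕP.≮⇒≥ h)))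

    ssyt⇒full : ∀ {F} → SSYT ν η F → Full (length η) (part ν) F
    ssyt⇒full {F} (shapes , pos , weakly , strictly , counts) = record
      { nonempty = unmap F (subst (All (1 ≤_)) (sym shapes) (trim-positive ν dec))
      ; shape = shape
      ; bound = λ i → All.tabulate (λ m → All.lookup (rowAt-All [] pos i) m , small i m)
      ; sorted = rowAt-All [] weakly
      ; columns = λ i j h → subst₂ _<_ (entry-rowAt F i j) (entry-rowAt F (suc i) j)
          (strictly i j (subst (j <_) (sym (≡.trans (part-lengths F (suc i)) (shape (suc i)))) h))
      ; content = λ u _ → count u }
      where
      unmap : ∀ G → All (1 ≤_) (map length G) → All (λ r → 1 ≤ length r) G
      unmap [] [] = []
      unmap (r ∷ G) (p ∷ ps) = p ∷ unmap G ps
      shape : ∀ i → length (rowAt F i) ≡ part ν i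
      shape i = ≡.trans (sym (part-lengths F i)) (≡.trans (cong (λ xs → part xs i) shapes) (part-trim ν i))
      len : length F ≤ ℓ
      len = ℕP.≮⇒≥ (λ h → ℕP.<⇒≱ (part-positive (subst (All (1 ≤_)) (sym shapes) (trim-positive ν dec)) ℓ (subst (ℓ <_) (sym (length-map length F)) h))
        (ℕP.≤-reflexive (≡.trans (part-lengths F ℓ) (≡.trans (shape ℓ) (end ℓ ℕP.≤-refl)))))
      count : ∀ u → ΣN ℓ (λ i → cnt (suc u) (rowAt F i)) ≡ part η u
      count u = ≡.trans (sym (sum-rows (cnt (suc u)) refl F ℓ len)) (counts u)
      -- A value beyond the length of η has prescribed multiplicity 0.
      small : ∀ i {x} → x ∈ rowAt F i → x ≤ length η
      small i {zero} m = z≤n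
      small i {suc u} m with u <? length η
      ... | yes h = h
      ... | no h with i <? ℓ
      ...   | no k = ⊥-elim (none (subst (suc u ∈_) (row-end (part ν) dec end {F} shape i (ℕP.≮⇒≥ k)) m))
        where none : ∀ {y : ℕ} → ¬ (y ∈ [])
              none ()
      ...   | yes k = ⊥-elim (All.lookup (cnt-zero⁻ (suc u) (rowAt F i) (ΣN-zero ℓ _ (≡.trans (count u) (part-beyond η u (ℕP.≮⇒≥ h))) i k)) m refl)

-- Comparison of the two sides

reversed-< : ∀ {ℓ p} → p < ℓ → ℓ ∸ suc p < ℓ
reversed-< {ℓ} {p} h = ℕP.∸-monoʳ-< {ℓ} {suc p} {0} (s≤s z≤n) h

mirrored : ∀ {ℓ p} → p < ℓ → ℓ ∸ suc (ℓ ∸ suc p) ≡ p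
mirrored {ℓ} {p} h = linear (ℓ ∸ suc p ∷ _ ∷ _ ∷ _ ∷ []) [] (# 0 ⊕ 1+ # 1 ≈ⁿ # 2 ∷ # 3 ⊕ 1+ # 0 ≈ⁿ # 2 ∷ [] ⊢ # 3 ≈ⁿ # 1) (ℕP.m∸n+n≡m h , ℕP.m∸n+n≡m {ℓ} {suc (ℓ ∸ suc p)} (reversed-< h))

reversed-≤ : ∀ {ℓ q q'} → q < ℓ → q' < ℓ → ℓ ∸ suc q ≤ ℓ ∸ suc q' → q' ≤ q
reversed-≤ {ℓ} {q} {q'} h h' le = linear (_ ∷ _ ∷ _ ∷ _ ∷ _ ∷ []) [] (# 0 ≤ⁿ # 1 ∷ # 0 ⊕ 1+ # 2 ≈ⁿ # 3 ∷ # 1 ⊕ 1+ # 4 ≈ⁿ # 3 ∷ [] ⊢ # 4 ≤ⁿ # 2) (le , ℕP.m∸n+n≡m h , ℕP.m∸n+n≡m h')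

-- Marks increase strictly outwards, so peeling goes up: once row `q` is used, the `q` rows above it
-- remain.
module Vertical (ℓ K : ℕ) where
  open Strips ℓ (λ q → q) (λ q → q) _<_ (λ h → h) ℕP.<⇒≤ (λ h _ → ℕP.<⇒≢ h) (λ {p} h → p , h , refl) (λ _ h → s≤s h) (λ _ _ h → ℕP.≤-pred h) K public

  strips-es : ∀ e {f} → Class ℓ 0 f → ∀ a → IsCore K (core a) → length (core a) ≤ ℓ → ∀ t →
    wsumS (strips ℓ e a) (ΦL K ℓ f) t ≡ shk (spin a) (ΦL K ℓ (es ℓ e f) (core a)) t
  strips-es e {f} C a k len t = Weighted.strips-Φ {f} (λ q d → es q d f) (λ _ _ _ → refl) (λ _ _ _ → refl) (λ _ _ _ _ _ → refl) (λ q d _ → es-class q d C) ℓ e a ℕP.≤-refl k len t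

  chains-es : ∀ es' κ → IsCore K κ → length κ ≤ ℓ → ∀ {f} → Class ℓ 0 f → ∀ t →
    wsumS (chains es' (state κ [] 0)) (ΦL K ℓ f) t ≡ ΦL K ℓ (apply (es ℓ) es' f) κ t
  chains-es = chains-Φ (es ℓ) (λ e → es-full e) strips-es

-- Marks decrease weakly outwards, so peeling goes down: rows are counted from the bottom, and the
-- row just used remains available.
module Horizontal (ℓ K : ℕ) where
  open Strips ℓ (λ q → ℓ ∸ suc q) suc _≥'_ reversed-< (λ h → h)
    (λ {q'} {q} h h' e → ℕP.<⇒≱ h (reversed-≤ (ℕP.<-trans h h') h' (ℕP.≤-reflexive e)))
    (λ {p} h → ℓ ∸ suc p , reversed-< h , mirrored h)
    (λ {q} {q'} h h' → s≤s (ℕP.∸-monoʳ-≤ ℓ h'))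
    (λ {q} {q'} h h' le → s≤s (reversed-≤ h h' (ℕP.≤-pred le))) K public

  strips-hs : ∀ e {f} → Class ℓ 0 f → ∀ a → IsCore K (core a) → length (core a) ≤ ℓ → ∀ t →
    wsumS (strips ℓ e a) (ΦL K ℓ f) t ≡ shk (spin a) (ΦL K ℓ (hs 0 ℓ e f) (core a)) t
  strips-hs e {f} C a k len t = ≡.trans (Weighted.strips-Φ {f} (λ q d → hs (ℓ ∸ q) q d f) (λ _ _ _ → refl) (λ _ _ _ → refl) row-step
      (λ q d h → hs-class (ℓ ∸ suc q) (suc q) d (ℕP.m∸n+n≡m h) C) ℓ e a ℕP.≤-refl k len t)
    (cong (λ p → shk (spin a) (ΦL K ℓ (hs p ℓ e f) (core a)) t) (ℕP.n∸n≡0 ℓ))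
    where
    row-step : ∀ q d → q < ℓ → ∀ γ t → hs (ℓ ∸ suc q) (suc q) (suc d) f γ t ≡ hs (ℓ ∸ q) q (suc d) f γ t ℤ.+ hs (ℓ ∸ suc q) (suc q) d f (sub (ℓ ∸ suc q) γ) t
    row-step q d h γ t = cong (λ p → hs p q (suc d) f γ t ℤ.+ hs (ℓ ∸ suc q) (suc q) d f (sub (ℓ ∸ suc q) γ) t) (sym (ℕP.+-∸-assoc 1 h))

  chains-hs : ∀ es' κ → IsCore K κ → length κ ≤ ℓ → ∀ {f} → Class ℓ 0 f → ∀ t →
    wsumS (chains es' (state κ [] 0)) (ΦL K ℓ f) t ≡ ΦL K ℓ (apply (hs 0 ℓ) es' f) κ t
  chains-hs = chains-Φ (hs 0 ℓ) (λ e → hs-full e) strips-hs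

shk-point : ∀ s (g : ℕ → ℤ) → (∀ t → g (suc t) ≡ 0ℤ) → shk s g s ≡ g 0 × (∀ d → s ≢ d → shk s g d ≡ 0ℤ)
shk-point zero g h = refl , λ { zero ne → ⊥-elim (ne refl) ; (suc d) _ → h d }
shk-point (suc s) g h = proj₁ (shk-point s g h) , λ { zero _ → refl ; (suc d) ne → proj₂ (shk-point s g h) d (ne ∘ cong suc) }

-- Extracts the coefficient of t^d: the objects `h a` over all states of spin `d`. On the left there
-- is one tableau over each state, on the right its pairings with the semistandard tableaux of the
-- inner shape.
module Enumerate {B : Set} (h : State → List B) (d : ℕ) where
  spin? : (a : State) → Dec (spin a ≡ d)
  spin? a = spin a ≟ d

  elems : List State → List B
  elems as = concatMap h (filter spin? as)

  elems⁻ : ∀ as {y} → y ∈ elems as → ∃ λ a → a ∈ as × spin a ≡ d × y ∈ h a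
  elems⁻ as m = let (a , m' , y∈) = ∈-concatMap-split h (filter spin? as) m
                    (a∈ , e) = ∈-filter⁻ spin? {xs = as} m' in a , a∈ , e , y∈

  elems⁺ : ∀ {as a y} → a ∈ as → spin a ≡ d → y ∈ h a → y ∈ elems as
  elems⁺ a∈ e y∈ = ∈-concatMap-join h (∈-filter⁺ spin? a∈ e) y∈

  elems-unique : ∀ {as} → Unique as → (∀ a → a ∈ as → Unique (h a)) → (∀ a a' y → spin a ≡ spin a' → y ∈ h a → y ∈ h a' → a ≡ a') → Unique (elems as)
  elems-unique {as} u hu apart = concatMap-unique h (Uniq.filter⁺ spin? u) (λ a m → hu a (proj₁ (∈-filter⁻ spin? {xs = as} m)))
    (λ a a' y m m' → apart a a' y (≡.trans (proj₂ (∈-filter⁻ spin? {xs = as} m)) (sym (proj₂ (∈-filter⁻ spin? {xs = as} m')))))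

  elems-size : ∀ as (F : List ℕ → ℕ → ℤ) → (∀ a → a ∈ as → F (core a) 0 ≡ + length (h a)) → (∀ a → a ∈ as → ∀ t → F (core a) (suc t) ≡ 0ℤ) →
    + length (elems as) ≡ wsumS as F d
  elems-size [] F e z = refl
  elems-size (a ∷ as) F e z = ≡.trans (head (spin a ≟ d)) (cong (λ v → shk (spin a) (F (core a)) d ℤ.+ v) (elems-size as F (λ a m → e a (there m)) (λ a m → z a (there m))))
    where
    point = shk-point (spin a) (F (core a)) (z a (here refl))
    head : Dec (spin a ≡ d) → + length (elems (a ∷ as)) ≡ shk (spin a) (F (core a)) d ℤ.+ + length (elems as)
    head (yes refl) = ≡.trans (cong (λ xs → + length (concatMap h xs)) (Data.List.Properties.filter-accept spin? {a} {as} refl))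
      (≡.trans (cong +_ (length-++ (h a))) (cong (λ v → v ℤ.+ + length (elems as)) (sym (≡.trans (proj₁ point) (e a (here refl))))))
    head (no ne) = ≡.trans (cong (λ xs → + length (concatMap h xs)) (Data.List.Properties.filter-reject spin? {a} {as} ne))
      (≡.trans (sym (ℤP.+-identityˡ _)) (cong (λ v → v ℤ.+ + length (elems as)) (sym (proj₂ point d ne))))

module Degree-zero (ℓ : ℕ) (η : List ℕ) where
  open Fillings ℓ η

  hs-degree : ∀ p c e {f : Fn} → (∀ γ t → f γ (suc t) ≡ 0ℤ) → ∀ γ t → hs p c e f γ (suc t) ≡ 0ℤ
  hs-degree p c zero h = h
  hs-degree p zero (suc e) h γ t = refl
  hs-degree p (suc c) (suc e) h γ t = cong₂ ℤ._+_ (hs-degree (suc p) c (suc e) h γ t) (hs-degree p (suc c) e h (sub p γ) t)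

  functional-degree : ∀ v γ t → functional v γ (suc t) ≡ 0ℤ
  functional-degree zero γ t = refl
  functional-degree (suc v) = hs-degree 0 ℓ (part η v) (functional-degree v)

module _ {K : ℕ} {κ : List ℕ} (c : IsCore K κ) where
  open Rows (s≤s z≤n) (coreBeads c) using (D-mono)

  pmap-dec : Decreasing (part (pmap K κ))
  pmap-dec i = falls (core-pmap c i) (core-pmap c (suc i)) (D-mono {i} {suc i} (ℕP.n<1+n i))
    where
    falls : ∀ {n x x' y y'} → + x ≡ + n ℤ.- + y → + x' ≡ + suc n ℤ.- + y' → y < y' → x' ≤ x
    falls {n} e e' h = linear (_ ∷ n ∷ _ ∷ _ ∷ _ ∷ []) [] (↑ # 0 ≈ᶻ ↑ # 1 ⊖ ↑ # 2 ∷ ↑ # 3 ≈ᶻ ↑ 1+ # 1 ⊖ ↑ # 4 ∷ # 2 <ⁿ # 4 ∷ [] ⊢ # 3 ≤ⁿ # 0) (e , e' , h)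

  pmap-end : ∀ {ℓ} → length κ ≤ ℓ → ∀ i → ℓ ≤ i → part (pmap K κ) i ≡ 0
  pmap-end len i h = part-beyond (pmap K κ) i (ℕP.≤-trans (ℕP.≤-reflexive (length-pmap K κ)) (ℕP.≤-trans len h))

ΣN-grow : ∀ {m m'} (h : ℕ → ℕ) → m ≤ m' → ΣN m h ≤ ΣN m' h
ΣN-grow {m} {zero} h z≤n = z≤n
ΣN-grow {m} {suc m'} h le with m ≟ suc m'
... | yes refl = ℕP.≤-refl
... | no ne = ℕP.≤-trans (ΣN-grow h (ℕP.≤-pred (ℕP.≤∧≢⇒< le ne))) (ℕP.m≤m+n (ΣN m' h) (h m'))

ΣN-long : ∀ (ν : ℕ → ℕ) i k → (∀ r → r ≤ i ℕ.+ k → 1 ≤ ν r) → ν i ℕ.+ k ≤ ΣN (suc (i ℕ.+ k)) ν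
ΣN-long ν i zero h rewrite ℕP.+-identityʳ i | ℕP.+-identityʳ (ν i) = ℕP.m≤n+m (ν i) (ΣN i ν)
ΣN-long ν i (suc k) h rewrite ℕP.+-suc i k | ℕP.+-suc (ν i) k =
  ℕP.≤-trans (ℕP.≤-reflexive (ℕP.+-comm 1 _)) (ℕP.+-mono-≤ (ΣN-long ν i k (λ r le → h r (ℕP.m≤n⇒m≤1+n le))) (h (suc (i ℕ.+ k)) ℕP.≤-refl))

module _ {K ℓ : ℕ} {κ : List ℕ} (c : IsCore K κ) (len : length κ ≤ ℓ) (small : sum (pmap K κ) ≤ K) where
  private
    ν = part (pmap K κ)
    E = D-of K ν
    E≡ : ∀ i → E i ≡ coreD c i
    E≡ = D-of-pmap K κ (coreD c) (core-pmap c)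
    E-> : ∀ i → i < E i
    E-> i = subst (i <_) (sym (E≡ i)) (Rows.D-> (s≤s z≤n) (coreBeads c) i)
    γ≡ : ∀ i → wt (suc K) E i ≡ + ν i
    γ≡ i = ≡.trans (cong (λ e → + (i ℕ.+ suc K) ℤ.- + e) (E≡ i)) (sym (core-pmap c i))

  -- A root (i , j) forces row i to be so long that row j, and with it everything below, is empty.
  root-empty : ∀ {i j} → i < j → j < ℓ → E i ≤ j → ν j ≡ 0
  root-empty {i} {j} i<j j<ℓ root with ν j in eq
  ... | zero = refl
  ... | suc x = ⊥-elim (impossible (ℕP.m+[n∸m]≡n (ℕP.<⇒≤ i<j)) long (core-pmap c i) (subst (_≤ j) (E≡ i) root))
    where
    long : ν i ℕ.+ (j ∸ i) ≤ K
    long = ℕP.≤-trans (ΣN-long ν i (j ∸ i) (λ r le → ℕP.≤-trans (ℕP.≤-trans (s≤s z≤n) (ℕP.≤-reflexive (sym eq)))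
        (decreasing-≤ (pmap-dec c) (ℕP.≤-trans le (ℕP.≤-reflexive (ℕP.m+[n∸m]≡n (ℕP.<⇒≤ i<j)))))))
      (ℕP.≤-trans (ΣN-grow ν (ℕP.≤-trans (s≤s (ℕP.≤-reflexive (ℕP.m+[n∸m]≡n (ℕP.<⇒≤ i<j)))) j<ℓ))
      (ℕP.≤-trans (ℕP.≤-reflexive (sym (sum-ΣN (pmap K κ) ℓ (ℕP.≤-trans (ℕP.≤-reflexive (length-pmap K κ)) len)))) small))
    impossible : ∀ {i k j v y} → i ℕ.+ k ≡ j → v ℕ.+ k ≤ K → + v ≡ + (i ℕ.+ suc K) ℤ.- + y → y ≤ j → ⊥
    impossible {i} {k} e h e' h' = linear (i ∷ k ∷ _ ∷ _ ∷ _ ∷ _ ∷ []) [] (# 0 ⊕ # 1 ≈ⁿ # 2 ∷ # 3 ⊕ # 1 ≤ⁿ # 4 ∷ ↑ # 3 ≈ᶻ ↑ (# 0 ⊕ 1+ # 4) ⊖ ↑ # 5 ∷ # 5 ≤ⁿ # 2 ∷ [] ⊢ absurd) (e , h , e' , h')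

  -- By `root-empty` every root ends in an empty row, below which all rows are empty too, so the
  -- tail sum there is 0 and `cat-trivial` applies.
  ΦL-small : ∀ {f} → Ext f → Tail ℓ f → ∀ t → ΦL K ℓ f κ t ≡ f (λ i → + ν i) t
  ΦL-small ef tf t = ≡.trans (cat-trivial ℓ (Catalan.roots ℓ E) (descending-roots ℓ E E->) tf (wt (suc K) E) (All.tabulate flat) t) (ef γ≡ t)
    where
    flat : ∀ {x} → x ∈ Catalan.roots ℓ E → tailSum ℓ (proj₂ x) (wt (suc K) E) ℤ.≤ 0ℤ
    flat {i , j} m = let (_ , j< , r) = Catalan.∈-roots⁻ ℓ E m in ℤP.≤-reflexive (≡.trans (Σ<-cong (ℓ ∸ j) (λ q _ → ≡.trans (γ≡ (j ℕ.+ q))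
      (cong +_ (ℕP.n≤0⇒n≡0 (ℕP.≤-trans (decreasing-≤ (pmap-dec c) (ℕP.m≤m+n j q)) (ℕP.≤-reflexive (root-empty (ℕP.<-≤-trans (E-> i) r) j< r))))))) (Σ<-zero (ℓ ∸ j)))

columns-down : ℕ → ℕ → Wt
columns-down ℓ zero k = 0ℤ
columns-down ℓ (suc m) k = columns-down ℓ m k ℤ.- initial ℓ k

columns-down-in : ∀ ℓ m k → k < ℓ → columns-down ℓ m k ≡ ℤ.- + m
columns-down-in ℓ zero k h = refl
columns-down-in ℓ (suc m) k h = linear (m ∷ []) (_ ∷ _ ∷ []) (# 0 ≈ᶻ ⊝ ↑ # 0 ∷ # 1 ≈ᶻ lit 1ℤ ∷ [] ⊢ # 0 ⊕ ⊝ # 1 ≈ᶻ ⊝ ↑ 1+ # 0) (columns-down-in ℓ m k h , initial-in ℓ k h)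

columns-down-out : ∀ ℓ m k → ℓ ≤ k → columns-down ℓ m k ≡ 0ℤ
columns-down-out ℓ zero k h = refl
columns-down-out ℓ (suc m) k h = linear [] (_ ∷ _ ∷ []) (# 0 ≈ᶻ lit 0ℤ ∷ # 1 ≈ᶻ lit 0ℤ ∷ [] ⊢ # 0 ⊕ ⊝ # 1 ≈ᶻ lit 0ℤ) (columns-down-out ℓ m k h , initial-out ℓ k h)

apply-columns : ∀ ℓ m {f} → Ext f → ∀ γ t → apply (es ℓ) (replicate m ℓ) f γ t ≡ f (γ ⊞ columns-down ℓ m) t
apply-columns ℓ zero ef γ t = ef (λ k → sym (ℤP.+-identityʳ (γ k))) t
apply-columns ℓ (suc m) ef γ t = ≡.trans (apply-columns ℓ m (es-ext ℓ ℓ ef) γ t) (≡.trans (es-top ℓ ef (γ ⊞ columns-down ℓ m) t)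
  (ef (λ k → ℤP.+-assoc (γ k) (columns-down ℓ m k) (ℤ.- initial ℓ k)) t))

wt-D-of : ∀ K (u : ℕ → ℕ) i → u i ≤ K → wt (suc K) (D-of K u) i ≡ + u i
wt-D-of K u i h = lemma (ℕP.m∸n+n≡m {i ℕ.+ suc K} {u i} (ℕP.≤-trans h (ℕP.≤-trans (ℕP.n≤1+n K) (ℕP.m≤n+m (suc K) i))))
  where
  lemma : ∀ {e v n} → e ℕ.+ v ≡ n → + n ℤ.- + e ≡ + v
  lemma {e} h = linear (e ∷ _ ∷ _ ∷ []) [] (# 0 ⊕ # 1 ≈ⁿ # 2 ∷ [] ⊢ ↑ # 2 ⊖ ↑ # 0 ≈ᶻ ↑ # 1) h

-- In rows before ℓ the shift cancels, (i + K + m + 1) - (m + u_i) = i + K + 1 - u_i, so both sides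
-- have the same roots; the m operators of degree ℓ take the m added columns off the weight again.
Φ-columns : ∀ K ℓ m {f} → Ext f → (u u' : ℕ → ℕ) → (∀ i → u i ≤ K) → (∀ i → u' i ≤ K ℕ.+ m) →
  (∀ i → i < ℓ → u' i ≡ m ℕ.+ u i) → (∀ i → ℓ ≤ i → u i ≡ 0) → (∀ i → ℓ ≤ i → u' i ≡ 0) → ∀ t →
  Catalan.Φ ℓ (suc (K ℕ.+ m)) (apply (es ℓ) (replicate m ℓ) f) (D-of (K ℕ.+ m) u') t ≡ Catalan.Φ ℓ (suc K) f (D-of K u) t
Φ-columns K ℓ m {f} ef u u' ub ub' low end end' t = ≡.trans (cat-cong (Catalan.roots ℓ E') (apply-columns ℓ m ef) γ' t)
  (≡.trans (cat-translate (Catalan.roots ℓ E') ef (columns-down ℓ m) γ' t)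
  (≡.trans (cat-ext (Catalan.roots ℓ E') ef weights t) (Catalan.H-cong ℓ ef E' E E≡ (wt (suc K) E) t)))
  where
  E = D-of K u
  E' = D-of (K ℕ.+ m) u'
  γ' = wt (suc (K ℕ.+ m)) E'
  E≡ : ∀ i → i < ℓ → E' i ≡ E i
  E≡ i h = ≡.trans (cong₂ _∸_ (rearrange i) (low i h)) (ℕP.[m+n]∸[m+o]≡n∸o m (i ℕ.+ suc K) (u i))
    where
    rearrange : ∀ i → i ℕ.+ suc (K ℕ.+ m) ≡ m ℕ.+ (i ℕ.+ suc K)
    rearrange i = linear (i ∷ K ∷ m ∷ []) [] ([] ⊢ # 0 ⊕ 1+ (# 1 ⊕ # 2) ≈ⁿ # 2 ⊕ (# 0 ⊕ 1+ # 1)) tt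
  weights : ∀ i → (γ' ⊞ columns-down ℓ m) i ≡ wt (suc K) E i
  weights i with i <? ℓ
  ... | yes h = ≡.trans (cong₂ (λ a b → a ℤ.+ b) (≡.trans (wt-D-of (K ℕ.+ m) u' i (ub' i)) (cong +_ (low i h))) (columns-down-in ℓ m i h)) (≡.trans (cancel m (u i)) (sym (wt-D-of K u i (ub i))))
    where
    cancel : ∀ m v → + (m ℕ.+ v) ℤ.- + m ≡ + v
    cancel m v = linear (m ∷ _ ∷ []) [] ([] ⊢ ↑ (# 0 ⊕ # 1) ⊖ ↑ # 0 ≈ᶻ ↑ # 1) tt
  ... | no h = ≡.trans (cong₂ (λ a b → a ℤ.+ b) (≡.trans (wt-D-of (K ℕ.+ m) u' i (ub' i)) (cong +_ (end' i (ℕP.≮⇒≥ h)))) (columns-down-out ℓ m i (ℕP.≮⇒≥ h)))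
    (sym (≡.trans (wt-D-of K u i (ub i)) (cong +_ (end i (ℕP.≮⇒≥ h)))))

sum-raised : ∀ m xs → sum (map (m ℕ.+_) xs) ≡ sum xs ℕ.+ sum (replicate m (length xs))
sum-raised m xs = ≡.trans (raised xs) (cong (sum xs ℕ.+_) (sym (repeated m (length xs))))
  where
  raised : ∀ xs → sum (map (m ℕ.+_) xs) ≡ sum xs ℕ.+ length xs ℕ.* m
  raised [] = refl
  raised (x ∷ xs) = linear (_ ∷ sum xs ∷ length xs ℕ.* m ∷ m ∷ x ∷ []) [] (# 0 ≈ⁿ # 1 ⊕ # 2 ∷ [] ⊢ # 3 ⊕ # 4 ⊕ # 0 ≈ⁿ # 4 ⊕ # 1 ⊕ (# 3 ⊕ # 2)) (raised xs)
  repeated : ∀ m n → sum (replicate m n) ≡ n ℕ.* m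
  repeated zero n = sym (ℕP.*-zeroʳ n)
  repeated (suc m) n = ≡.trans (cong (n ℕ.+_) (repeated m n)) (sym (ℕP.*-suc n m))

part-map : ∀ m xs i → i < length xs → part (map (m ℕ.+_) xs) i ≡ m ℕ.+ part xs i
part-map m (x ∷ xs) zero h = refl
part-map m (x ∷ xs) (suc i) (s≤s h) = part-map m xs i h

part-bounded : ∀ {K} xs → All (_≤ K) xs → ∀ i → part xs i ≤ K
part-bounded [] [] i = z≤n
part-bounded (x ∷ xs) (p ∷ ps) zero = p
part-bounded (x ∷ xs) (p ∷ ps) (suc i) = part-bounded xs ps i

tableau : State → Tab
tableau a = tab (core a) (steps a)

tableau-injective : ∀ {a a'} → spin a ≡ spin a' → tableau a ≡ tableau a' → a ≡ a'
tableau-injective {state _ _ _} {state _ _ _} refl refl = refl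

-- All tableaux with outer shape `u` end in one and the same core, from which the enumeration starts
-- inwards.
module Target {K ℓ : ℕ} (u : List ℕ) (length-u : length u ≤ ℓ) (u-dec : Decreasing (part u)) (u≤K : ∀ i → part u i ≤ K) where
  u-end : ∀ i → ℓ ≤ i → part u i ≡ 0
  u-end i h = part-beyond u i (ℕP.≤-trans length-u h)

  private module B = FromBounded K ℓ (part u) u-dec u≤K u-end

  opaque
    target : List ℕ
    target = B.list

    target-core : IsCore K target
    target-core = B.list-core

    target-length : length target ≤ ℓ
    target-length = B.list-length

    target-part : ∀ i → part (pmap K target) i ≡ part u i
    target-part = B.list-μ

  target-trim : trim (pmap K target) ≡ trim u
  target-trim = trim-ext (pmap K target) u target-part

  target-sum : sum (pmap K target) ≡ sum u
  target-sum = ≡.trans (sum-ΣN (pmap K target) ℓ (ℕP.≤-trans (ℕP.≤-reflexive (length-pmap K target)) target-length))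
    (≡.trans (ΣN-cong ℓ (λ i _ → target-part i)) (sym (sum-ΣN u ℓ length-u)))

  target-unique : ∀ {κ} → IsCore K κ → trim (pmap K κ) ≡ trim u → κ ≡ target
  target-unique {κ} c e = pmap-injective c target-core (λ i → ≡.trans (trim⇒part {pmap K κ} {u} e i) (sym (target-part i)))

module Equality (k ℓ : ℕ) (μ : List ℕ) (μ-par : ParKL k ℓ μ) (η : List ℕ) (d : ℕ) where
  m K' : ℕ
  m = sum μ ∸ k
  K' = k ℕ.+ m
  μ' : List ℕ
  μ' = map (m ℕ.+_) μ

  μ-length = proj₁ μ-par
  μ-dec = proj₁ (proj₂ μ-par)

  μ≤k : ∀ i → part μ i ≤ k
  μ≤k = part-bounded μ (proj₂ (proj₂ μ-par))

  μ'-length : length μ' ≡ ℓ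
  μ'-length = ≡.trans (length-map (m ℕ.+_) μ) μ-length

  μ'-in : ∀ i → i < ℓ → part μ' i ≡ m ℕ.+ part μ i
  μ'-in i h = part-map m μ i (subst (i <_) (sym μ-length) h)

  μ'-out : ∀ i → ℓ ≤ i → part μ' i ≡ 0
  μ'-out i h = part-beyond μ' i (ℕP.≤-trans (ℕP.≤-reflexive μ'-length) h)

  μ'-dec : Decreasing (part μ')
  μ'-dec i with suc i <? ℓ
  ... | yes h = subst₂ _≤_ (sym (μ'-in (suc i) h)) (sym (μ'-in i (ℕP.<⇒≤ h))) (ℕP.+-monoʳ-≤ m (μ-dec i))
  ... | no h = ℕP.≤-trans (ℕP.≤-reflexive (μ'-out (suc i) (ℕP.≮⇒≥ h))) z≤n

  μ'≤K' : ∀ i → part μ' i ≤ K'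
  μ'≤K' i with i <? ℓ
  ... | yes h = ℕP.≤-trans (ℕP.≤-reflexive (≡.trans (μ'-in i h) (ℕP.+-comm m _))) (ℕP.+-monoˡ-≤ m (μ≤k i))
  ... | no h = ℕP.≤-trans (ℕP.≤-reflexive (μ'-out i (ℕP.≮⇒≥ h))) z≤n

  module T = Target {k} {ℓ} μ (ℕP.≤-reflexive μ-length) μ-dec μ≤k
  module T' = Target {K'} {ℓ} μ' (ℕP.≤-reflexive μ'-length) μ'-dec μ'≤K'
  module S = Horizontal ℓ k
  module V = Vertical ℓ K'
  open Fillings ℓ η
  open Sign ℓ using (unit-functional; unit-class; alternant-zero)

  -- Adding m columns of height ℓ adds mℓ boxes, and m strips of ℓ boxes each remove as many.
  inside-sum : ∀ {τ st s} → Chain K' τ st T'.target s → Blocks _<_ (replicate m ℓ) (map proj₁ st) → sum (pmap K' τ) ≡ sum μ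
  inside-sum {τ} {st} C B = ℕP.+-cancelʳ-≡ (length st) _ _ (≡.trans (chain-size C) (≡.trans T'.target-sum (≡.trans (sum-raised m μ)
    (cong (sum μ ℕ.+_) (≡.trans (cong (λ l → sum (replicate m l)) μ-length) (≡.trans (sym (blocks-length (replicate m ℓ) _ B)) (length-map proj₁ st)))))))

  inside-ΣN : ∀ τ → length τ ≤ ℓ → sum (pmap K' τ) ≡ ΣN ℓ (part (pmap K' τ))
  inside-ΣN τ len = sum-ΣN (pmap K' τ) ℓ (ℕP.≤-trans (ℕP.≤-reflexive (length-pmap K' τ)) len)

  weight-η : weight (length η) ≡ sum η
  weight-η = sym (sum-ΣN η (length η) ℕP.≤-refl)

  smt : List State
  smt = S.chains η (state T.target [] 0)

  vsmt : List State
  vsmt = V.chains (replicate m ℓ) (state T'.target [] 0)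

  fillings-of : State → List (List (List ℕ))
  fillings-of a = fillings (length η) (part (pmap K' (core a)))

  module L = Enumerate (λ a → tableau a ∷ []) d
  module R = Enumerate (λ a → map (tableau a ,_) (fillings-of a)) d

  vsmt-sound : ∀ {a} → a ∈ vsmt → Chain K' (core a) (steps a) T'.target (spin a) × Blocks _<_ (replicate m ℓ) (map proj₁ (steps a))
  vsmt-sound = V.chains-sound (replicate m ℓ) T'.target T'.target-core

  smt-sound : ∀ {a} → a ∈ smt → Chain k (core a) (steps a) T.target (spin a) × Blocks _≥'_ η (map proj₁ (steps a))
  smt-sound = S.chains-sound η T.target T.target-core

  module _ {τ st s} (C : Chain K' τ st T'.target s) (B : Blocks _<_ (replicate m ℓ) (map proj₁ st)) where
    inner-core : IsCore K' τ
    inner-core = chain-core C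

    inner-length : length τ ≤ ℓ
    inner-length = ℕP.≤-trans (V.chain-length C) T'.target-length

    inner-good : sum η ≡ sum μ → Good (weight (length η)) (part (pmap K' τ))
    inner-good e = good (pmap-dec inner-core) (pmap-end inner-core inner-length)
      (≡.trans (sym (inside-ΣN τ inner-length)) (≡.trans (inside-sum C B) (≡.trans (sym e) (sym weight-η))))

    inner-full : ∀ {F} → SSYT (pmap K' τ) η F → Full (length η) (part (pmap K' τ)) F
    inner-full = ssyt⇒full (pmap K' τ) (pmap-dec inner-core) (pmap-end inner-core inner-length)

    inner-ssyt : ∀ {F} → Full (length η) (part (pmap K' τ)) F → SSYT (pmap K' τ) η F
    inner-ssyt = full⇒ssyt (pmap K' τ) (pmap-dec inner-core) (pmap-end inner-core inner-length)

    content-sum : ∀ {F} → SSYT (pmap K' τ) η F → sum η ≡ sum μ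
    content-sum Y = ≡.trans (sym weight-η) (≡.trans (sym (full-weight (inner-full Y))) (≡.trans (sym (inside-ΣN τ inner-length)) (inside-sum C B)))

    -- This is what the choice of `m` is for: it is the least number with |μ| ≤ k + m.
    inner-small : sum (pmap K' τ) ≤ K'
    inner-small = ℕP.≤-trans (ℕP.≤-reflexive (inside-sum C B)) (ℕP.m≤n+m∸n (sum μ) k)

  f : Fn
  f = functional (length η)

  f-class : Class ℓ 0 f
  f-class = functional-class (length η)

  Left : Tab → Set
  Left T = (sum η ≡ sum μ) × SMT k η μ T d

  Right : Tab × List (List ℕ) → Set
  Right TF = VSMT K' (replicate m ℓ) μ' (proj₁ TF) d × SSYT (inside K' (proj₁ TF)) η (proj₂ TF)

  right-sum : ∀ {TF} → Right TF → sum η ≡ sum μ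
  right-sum {tab τ st , F} ((κ , C , B , e) , Y) = ending (T'.target-unique (chain-end C) e) C
    where
    ending : ∀ {κ} → κ ≡ T'.target → Chain K' τ st κ d → sum η ≡ sum μ
    ending refl C = content-sum C B Y

  module _ (η≡μ : sum η ≡ sum μ) where

    left-sound : ∀ {T} → T ∈ L.elems smt → Left T
    left-sound {T} m = from (L.elems⁻ smt m)
      where
      from : (∃ λ a → a ∈ smt × spin a ≡ d × T ∈ tableau a ∷ []) → Left T
      from (a , a∈ , refl , here refl) = let (C , B) = smt-sound a∈ in η≡μ , T.target , C , B , T.target-trim

    left-complete : ∀ T → Left T → T ∈ L.elems smt
    left-complete (tab τ st) (_ , κ , C , B , e) = ending (T.target-unique (chain-end C) e) C
      where
      ending : ∀ {κ} → κ ≡ T.target → Chain k τ st κ d → tab τ st ∈ L.elems smt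
      ending refl C = L.elems⁺ (S.chains-complete η T.target-length C B) refl (here refl)

    left-unique : Unique (L.elems smt)
    left-unique = L.elems-unique (S.chains-unique η T.target T.target-core) (λ _ _ → [] ∷ [])
      (λ { a a' _ e (here refl) (here e') → tableau-injective e e' })

    right-sound : ∀ {TF} → TF ∈ R.elems vsmt → Right TF
    right-sound {TF} m = from (R.elems⁻ vsmt m)
      where
      filled : ∀ a → a ∈ vsmt → spin a ≡ d → (∃ λ F → F ∈ fillings-of a × TF ≡ (tableau a , F)) → Right TF
      filled a a∈ refl (F , F∈ , refl) = let (C , B) = vsmt-sound a∈ in
        (T'.target , C , B , T'.target-trim) , inner-ssyt C B (fillings-sound (length η) (inner-good C B η≡μ) F∈)
      from : (∃ λ a → a ∈ vsmt × spin a ≡ d × TF ∈ map (tableau a ,_) (fillings-of a)) → Right TF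
      from (a , a∈ , e , m') = filled a a∈ e (∈-map⁻ (tableau a ,_) m')

    right-complete : ∀ TF → Right TF → TF ∈ R.elems vsmt
    right-complete (tab τ st , F) ((κ , C , B , e) , Y) = ending (T'.target-unique (chain-end C) e) C
      where
      ending : ∀ {κ} → κ ≡ T'.target → Chain K' τ st κ d → (tab τ st , F) ∈ R.elems vsmt
      ending refl C = R.elems⁺ (V.chains-complete (replicate m ℓ) T'.target-length C B) refl
        (∈-map⁺ (tab τ st ,_) (fillings-complete (length η) (inner-good C B η≡μ) (inner-full C B Y)))

    right-unique : Unique (R.elems vsmt)
    right-unique = R.elems-unique (V.chains-unique (replicate m ℓ) T'.target T'.target-core)
      (λ a a∈ → let (C , B) = vsmt-sound a∈ in Uniq.map⁺ (cong proj₂) (fillings-unique (length η) (inner-good C B η≡μ))) apart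
      where
      apart : ∀ a a' TF → spin a ≡ spin a' → TF ∈ map (tableau a ,_) (fillings-of a) → TF ∈ map (tableau a' ,_) (fillings-of a') → a ≡ a'
      apart a a' TF e m m' = let (_ , _ , e₁) = ∈-map⁻ (tableau a ,_) m
                                 (_ , _ , e₂) = ∈-map⁻ (tableau a' ,_) m' in tableau-injective e (cong proj₁ (≡.trans (sym e₁) e₂))

    -- As |η| = |μ|, every chain reaches the empty core, where the unit functional is 1 in degree 0.
    -- Applying h for each entry of η in turn builds up `functional`.
    left-size : + length (L.elems smt) ≡ ΦL k ℓ f T.target d
    left-size = ≡.trans (L.elems-size smt (ΦL k ℓ unit-functional) (λ a a∈ → ≡.trans (at a∈ 0) (alternant-zero _ (λ i i<ℓ → cong +_ (empty a∈ i i<ℓ)))) (λ a a∈ t → at a∈ (suc t)))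
      (≡.trans (S.chains-hs η T.target T.target-core T.target-length unit-class d)
        (cong (λ g → ΦL k ℓ g T.target d) (apply-iterate (hs 0 ℓ) η functional (λ _ → refl))))
      where
      none : ∀ {a} → a ∈ smt → sum (pmap k (core a)) ≡ 0
      none {a} a∈ = let (C , B) = smt-sound a∈ in ℕP.+-cancelʳ-≡ (length (steps a)) _ 0 (≡.trans (chain-size C) (≡.trans T.target-sum (≡.trans (sym η≡μ)
        (≡.trans (sym (blocks-length η _ B)) (length-map proj₁ (steps a))))))
      len : ∀ {a} → a ∈ smt → length (core a) ≤ ℓ
      len a∈ = ℕP.≤-trans (S.chain-length (proj₁ (smt-sound a∈))) T.target-length
      at : ∀ {a} → a ∈ smt → ∀ t → ΦL k ℓ unit-functional (core a) t ≡ unit-functional (λ i → + part (pmap k (core a)) i) t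
      at a∈ = ΦL-small (chain-core (proj₁ (smt-sound a∈))) (len a∈) (ℕP.≤-trans (ℕP.≤-reflexive (none a∈)) z≤n) (unit-class .ext) (unit-class .vanish)
      empty : ∀ {a} → a ∈ smt → ∀ i → i < ℓ → part (pmap k (core a)) i ≡ 0
      empty {a} a∈ = ΣN-zero ℓ _ (≡.trans (sym (sum-ΣN (pmap k (core a)) ℓ (ℕP.≤-trans (ℕP.≤-reflexive (length-pmap k (core a))) (len a∈)))) (none a∈))

    right-size : + length (R.elems vsmt) ≡ ΦL K' ℓ (apply (es ℓ) (replicate m ℓ) f) T'.target d
    right-size = ≡.trans (R.elems-size vsmt (ΦL K' ℓ f)
        (λ a a∈ → ≡.trans (at a∈ 0) (≡.trans (sym (fillings-count (length η) (let (C , B) = vsmt-sound a∈ in inner-good C B η≡μ))) (cong +_ (sym (length-map (tableau a ,_) (fillings-of a))))))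
        (λ a a∈ t → ≡.trans (at a∈ (suc t)) (Degree-zero.functional-degree ℓ η (length η) _ t)))
      (V.chains-es (replicate m ℓ) T'.target T'.target-core T'.target-length f-class d)
      where
      at : ∀ {a} → a ∈ vsmt → ∀ t → ΦL K' ℓ f (core a) t ≡ f (λ i → + part (pmap K' (core a)) i) t
      at a∈ = let (C , B) = vsmt-sound a∈ in ΦL-small (inner-core C B) (inner-length C B) (inner-small C B) (f-class .ext) (f-class .vanish)

    -- Both lengths are the t^d-coefficient of the value of f_η at μ with the roots of its core; the
    -- right-hand one is first rewritten by taking off the m columns.
    same-size : length (R.elems vsmt) ≡ length (L.elems smt)
    same-size = ℤP.+-injective (≡.trans right-size (≡.trans (Φ-columns k ℓ m (f-class .ext) (part (pmap k T.target)) (part (pmap K' T'.target))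
        (λ i → ℕP.≤-trans (ℕP.≤-reflexive (T.target-part i)) (μ≤k i)) (λ i → ℕP.≤-trans (ℕP.≤-reflexive (T'.target-part i)) (μ'≤K' i))
        (λ i h → ≡.trans (T'.target-part i) (≡.trans (μ'-in i h) (cong (m ℕ.+_) (sym (T.target-part i)))))
        (λ i h → ≡.trans (T.target-part i) (T.u-end i h)) (λ i h → ≡.trans (T'.target-part i) (μ'-out i h)) d)
      (sym left-size)))

  coefficients : Dec (sum η ≡ sum μ) → ∃ λ n → Count Left n × Count Right n
  coefficients (yes e) = length (L.elems smt)
    , record { elems = L.elems smt ; sound = All.tabulate (left-sound e) ; complete = left-complete e ; unique = left-unique e ; size = refl }
    , record { elems = R.elems vsmt ; sound = All.tabulate (right-sound e) ; complete = right-complete e ; unique = right-unique e ; size = same-size e }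
  -- Both sides are then empty: on the right, content and size of a tableau over an inner shape of
  -- size |μ| would have to agree.
  coefficients (no ne) = 0
    , record { elems = [] ; sound = [] ; complete = λ _ l → ⊥-elim (ne (proj₁ l)) ; unique = [] ; size = refl }
    , record { elems = [] ; sound = [] ; complete = λ TF r → ⊥-elim (ne (right-sum {TF} r)) ; unique = [] ; size = refl }

theorem2p7 : (k ℓ : ℕ) → 1 ≤ k → 1 ≤ ℓ → (μ : List ℕ) → ParKL k ℓ μ →
    (η : List ℕ) (d : ℕ) →
    ∃ λ n →
      Count (λ T → (sum η ≡ sum μ) × SMT k η μ T d) n ×
      Count (λ TF → VSMT (k ℕ.+ (sum μ ∸ k)) (replicate (sum μ ∸ k) ℓ)
                         (map ((sum μ ∸ k) ℕ.+_) μ) (proj₁ TF) d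
                    × SSYT (inside (k ℕ.+ (sum μ ∸ k)) (proj₁ TF)) η (proj₂ TF)) n
theorem2p7 k ℓ _ _ μ μ-par η d = Equality.coefficients k ℓ μ μ-par η d (sum η ≟ sum μ)
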